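{- Let $P_1,P_2\in\mathbb{Z}[y]$ be two linearly independent polynomials satisfying $P_1(0)=P_2(0)=0$. There exists a constant $c_{P_1,P_2}>0$ depending only on $P_1$ and $P_2$ such that if $\mathbb{F}_q$ is a finite field of characteristic at least $c_{P_1,P_2}$ and $A,B,C\subset\mathbb{F}_q$, then \[ \#\{(x,y)\in\mathbb{F}_q^2:(x,\,x+P_1(y),\,x+P_2(y))\in A\times B\times C\}=\frac{|A||B||C|}{q}+E, \] where $|E|\le C_{P_1,P_2}\,(|A||B||C|)^{1/2}q^{1/2-1/16}$ for a constant $C_{P_1,P_2}>0$ depending only on $P_1$ and $P_2$.
   Context: Polynomials in $\mathbb{Z}[y]$ are evaluated in $\mathbb{F}_q$ by reducing coefficients modulo the characteristic. -}

module Defs where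

open import Level using (0ℓ)
open import Data.Nat as ℕ using (ℕ; zero; suc; _<_; _≤_)
open import Data.Integer as ℤ using (ℤ; +_; -[1+_])
open import Data.Bool using (Bool; true; false; if_then_else_; _∧_)
open import Data.Fin using (Fin)
open import Data.List using (List; []; _∷_; map)
open import Data.List.Relation.Unary.All using (All)
open import Data.Product using (Σ; ∃; _×_)
open import Relation.Binary.PropositionalEquality using (_≡_)
open import Relation.Nullary using (¬_)
open import Function.Bundles using (_↔_)

-- Polynomials in ℤ[y] as coefficient lists (constant term first).

Polyℤ : Set
Polyℤ = List ℤ

_·P_ : ℤ → Polyℤ → Polyℤ
a ·P P = map (a ℤ.*_) P

_+P_ : Polyℤ → Polyℤ → Polyℤ
[] +P Q = Q
(a ∷ P) +P [] = a ∷ P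
(a ∷ P) +P (b ∷ Q) = (a ℤ.+ b) ∷ (P +P Q)

IsZeroPoly : Polyℤ → Set
IsZeroPoly P = All (_≡ ℤ.0ℤ) P

LinIndep : Polyℤ → Polyℤ → Set
LinIndep P₁ P₂ =
  ∀ (a b : ℤ) → IsZeroPoly ((a ·P P₁) +P (b ·P P₂)) → (a ≡ ℤ.0ℤ) × (b ≡ ℤ.0ℤ)

evalℤ : Polyℤ → ℤ → ℤ
evalℤ [] y = ℤ.0ℤ
evalℤ (a ∷ P) y = a ℤ.+ y ℤ.* evalℤ P y

open import Algebra.Structures using (IsCommutativeRing)

record FiniteField : Set₁ where
  field
    F    : Set
    _+_  : F → F → F
    _*_  : F → F → F
    -_   : F → F
    0#   : F
    1#   : F
    isCommutativeRing : IsCommutativeRing _≡_ _+_ _*_ -_ 0# 1#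
    0≢1  : ¬ (0# ≡ 1#)
    inverse : ∀ x → ¬ (x ≡ 0#) → ∃ λ y → x * y ≡ 1#
    q    : ℕ
    enum : Fin q ↔ F

  infixl 6 _+_
  infixl 7 _*_

  natF : ℕ → F
  natF zero = 0#
  natF (suc n) = 1# + natF n

  intF : ℤ → F
  intF (+ n) = natF n
  intF -[1+ n ] = - natF (suc n)

  evalF : Polyℤ → F → F
  evalF [] y = 0#
  evalF (a ∷ P) y = intF a + y * evalF P y

  IsCharacteristic : ℕ → Set
  IsCharacteristic p =
    (0 < p) × (natF p ≡ 0#) × (∀ n → 0 < n → n < p → ¬ (natF n ≡ 0#))

  element : Fin q → F
  element = Function.Bundles.Inverse.to enum

  Subset : Set
  Subset = F → Bool

  private
    count : ∀ {n} → (Fin n → ℕ) → ℕ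
    count {zero} f = 0
    count {suc n} f = f Fin.zero ℕ.+ count (λ i → f (Fin.suc i))
      where import Data.Fin as Fin

  sumF : (F → ℕ) → ℕ
  sumF f = count (λ i → f (element i))

  ind : Bool → ℕ
  ind b = if b then 1 else 0

  ∣_∣ₛ : Subset → ℕ
  ∣ A ∣ₛ = sumF (λ x → ind (A x))

  patternCount : Polyℤ → Polyℤ → Subset → Subset → Subset → ℕ
  patternCount P₁ P₂ A B C =
    sumF (λ x → sumF (λ y →
      ind (A x ∧ B (x + evalF P₁ y) ∧ C (x + evalF P₂ y))))

{-# OPTIONS --safe #-}
module Submission where

-- Write N(f,g,h) = Σ_{x,y} f(x) g(x + P₁y) h(x + P₂y).  After subtracting means it suffices to bound N for
-- mean-zero weights.  No Fourier analysis is used: Cauchy-Schwarz replaces each weight in turn by a dual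
-- function, and the norms of the dual functions are controlled by energies Σ_u c_f(u)², where
-- c_f(u) = Σ_x f(x) f(x + u).  Three arithmetic inputs close the resulting system of inequalities:
--  (1) square-root cancellation: for f = aP₁ + bP₂ ≠ 0 the representation function of f(y) - f(z) has
--      L¹-distance O(q^{3/2}) from its mean.  The substitution x = 1/(y - z), v = z/(y - z) turns f(y) - f(z) = c
--      into a curve v^s = κ x^{s+1} + (terms of lower weight), and Stepanov's method bounds its points;
--  (2) nonsingular fibres of the maps involved have boundedly many points: on the curve cut out by all but one
--      equation, the last one t and the coordinate y satisfy a polynomial relation by pigeonhole, and at a
--      simple zero of t its lowest coefficient in t vanishes at y;
--  (3) the resulting count of quadruples, with the singular locus handled by a Wronskian.

open import Defs
open import Level as Universe using (0ℓ)
open import Algebra.Bundles using (CommutativeRing)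
open import Data.Nat as N using (ℕ; zero; suc; z≤n; s≤s)
import Data.Nat.Properties as NP
open NP using (*-cancelʳ-≤; *-cancelˡ-<; *-cancelˡ-≡; *-cancelˡ-≤; *-distribˡ-+; *-mono-<; *-mono-≤; *-monoʳ-<; *-monoʳ-≤; *-monoˡ-≤; *-suc; *-zeroʳ; +-cancelʳ-≡; +-cancelʳ-≤; +-cancelˡ-≤; +-mono-<-≤; +-mono-≤; +-monoʳ-<; +-monoʳ-≤; +-monoˡ-<; +-monoˡ-≤; +-suc; <-cmp; <-irrefl; <-trans; <-≤-trans; <⇒≢; <⇒≤; <⇒≤pred; <⇒≱; ^-monoʳ-<; ^-monoʳ-≤; ^-monoˡ-≤; m+[n∸m]≡n; m<n⇒m<1+n; m^n≢0; m∸n≤m; m≤m*n; m≤m+n; m≤n*m; m≤n+m; m≤n⇒m≤1+n; m≤n⇒∃[o]m+o≡n; n<1+n; n∸n≡0; n≤1+n; pred-mono-≤; pred[n]≤n; suc-injective; ≤-<-trans; ≤-antisym; ≤-pred; ≤-total; ≤′⇒≤; ≤⇒≤′; ≤∧≢⇒<; ≮⇒≥; ≰⇒>; ≰⇒≥) renaming (≤-trans to ≤∙; ≤-reflexive to ≡⇒≤)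
open import Data.Nat.Tactic.RingSolver using (solve-∀)
open import Data.Integer as ℤ using (ℤ)
import Data.Integer.Properties as ℤₚ
open import Data.Bool using (Bool; true; false; _∧_)
open import Data.Fin as Fin using (Fin; toℕ; fromℕ<; combine; remQuot)
import Data.Fin.Properties as Finₚ
open import Data.List using (List; []; _∷_; _++_; map; length; tabulate; filter; cartesianProduct)
import Data.List.Properties as Listₚ
open import Data.List.Relation.Unary.All as All using (All; []; _∷_)
import Data.List.Relation.Unary.All.Properties as Allₚ
open import Data.List.Relation.Unary.AllPairs as AllPairs using (AllPairs; []; _∷_)
open import Data.List.Relation.Unary.Any as Any using (Any; here; there)
open import Data.List.Relation.Unary.Unique.Propositional using (Unique)
import Data.List.Relation.Unary.Unique.Propositional.Properties as Uniqueₚ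
open import Data.Product using (_×_; _,_; proj₁; proj₂; ∃; ∃₂)
open import Data.Sum using (_⊎_; inj₁; inj₂)
open import Data.Empty using (⊥-elim)
open import Data.Unit using (⊤; tt)
open import Function.Bundles using (Inverse)
import Relation.Binary.PropositionalEquality as ≡
open ≡ using (_≡_)
open import Relation.Binary.Definitions using (tri<; tri≈; tri>)
open import Relation.Nullary using (Dec; yes; no; ¬_; ¬?; _×-dec_; _⊎-dec_)

-- No division is ever performed: the mean-zero part of a weight is multiplied by q, and the bound
-- on the error term is read as an inequality between 16th powers, multiplied through by q^16; hence
-- the exponent 23 = 16 + 7, where 7/16 = 1/2 - 1/16. Four dual functions h₁, f₁, g₁, h₂ are formed
-- in turn, the norm of each being controlled by the next. Such a chain never ends by itself. It
-- closes because the quartic sum Σ_u c(u)^4 of the last function h₂ is estimated twice: from below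
-- by expanding the norm of h₂ with three Cauchy-Schwarz steps, which produces the quadruples, and
-- from above by positivity of autocorrelations. The upper bound has two terms; if one dominates the
-- saving is q^(1/12), if the other does it is q^(3/44), and both exceed q^(1/16). The point count
-- for f(y) - f(z) = c is only one-sided, q + O(√q). Since the counts over all c sum to exactly q²,
-- an upper bound already controls the L¹ distance to the mean, but summing over q values of c loses
-- √q compared with a bound for a single exponential sum. The exponents above have room for this
-- loss.

module RingZ where
 import Algebra.Solver.Ring as RS
 open import Algebra.Solver.Ring.AlmostCommutativeRing
 open import Data.Integer using (+_; -[1+_]; _⊖_)
 open import Data.Maybe using (Maybe; just; nothing)

 module IntegerCoefficients {a ℓ} (R : CommutativeRing a ℓ) where
  open CommutativeRing R
  open import Algebra.Properties.Ring ring
  open import Relation.Binary.Reasoning.Setoid setoid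

  natR : ℕ -> Carrier
  natR zero = 0#
  natR (suc n) = 1# + natR n

  intR : ℤ -> Carrier
  intR (+ n) = natR n
  intR -[1+ n ] = - natR (suc n)

  natR-+ : ∀ m n -> natR (m N.+ n) ≈ natR m + natR n
  natR-+ zero n = sym (+-identityˡ _)
  natR-+ (suc m) n = trans (+-congˡ (natR-+ m n)) (sym (+-assoc _ _ _))

  natR-* : ∀ m n -> natR (m N.* n) ≈ natR m * natR n
  natR-* zero n = sym (zeroˡ _)
  natR-* (suc m) n = begin
   natR (n N.+ m N.* n) ≈⟨ natR-+ n (m N.* n) ⟩
   natR n + natR (m N.* n) ≈⟨ +-cong (sym (*-identityˡ _)) (natR-* m n) ⟩
   1# * natR n + natR m * natR n ≈⟨ distribʳ _ _ _ ⟨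
   (1# + natR m) * natR n ∎

  intR-⊖ : ∀ m n -> intR (m ⊖ n) ≈ natR m - natR n
  intR-⊖ zero zero = sym (-‿inverseʳ 0#)
  intR-⊖ zero (suc n) = sym (+-identityˡ _)
  intR-⊖ (suc m) zero = sym (trans (+-congˡ -0#≈0#) (+-identityʳ _))
  intR-⊖ (suc m) (suc n) = begin
   intR (suc m ⊖ suc n) ≡⟨ ≡.cong intR (ℤₚ.[1+m]⊖[1+n]≡m⊖n m n) ⟩
   intR (m ⊖ n) ≈⟨ intR-⊖ m n ⟩
   natR m - natR n ≈⟨ +-congʳ (+-identityʳ _) ⟨
   (natR m + 0#) - natR n ≈⟨ +-congʳ (+-congˡ (-‿inverseʳ 1#)) ⟨
   (natR m + (1# - 1#)) - natR n ≈⟨ +-congʳ (+-assoc _ _ _) ⟨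
   ((natR m + 1#) - 1#) - natR n ≈⟨ +-congʳ (+-congʳ (+-comm _ _)) ⟩
   ((1# + natR m) - 1#) - natR n ≈⟨ +-assoc _ _ _ ⟩
   (1# + natR m) + (- 1# + - natR n) ≈⟨ +-congˡ (-‿+-comm 1# (natR n)) ⟩
   (1# + natR m) - (1# + natR n) ∎

  intR-neg : ∀ i -> intR (ℤ.- i) ≈ - intR i
  intR-neg (+ zero) = sym -0#≈0#
  intR-neg (+ suc n) = refl
  intR-neg -[1+ n ] = sym (-‿involutive _)

  intR-+ : ∀ i j -> intR (i ℤ.+ j) ≈ intR i + intR j
  intR-+ (+ m) (+ n) = natR-+ m n
  intR-+ (+ m) -[1+ n ] = intR-⊖ m (suc n)
  intR-+ -[1+ m ] (+ n) = trans (intR-⊖ n (suc m)) (+-comm _ _)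
  intR-+ -[1+ m ] -[1+ n ] = begin
   - natR (suc (suc (m N.+ n))) ≡⟨ ≡.cong (\ k -> - natR (suc k)) (+-suc m n) ⟨
   - natR (suc m N.+ suc n) ≈⟨ -‿cong (natR-+ (suc m) (suc n)) ⟩
   - (natR (suc m) + natR (suc n)) ≈⟨ -‿+-comm _ _ ⟨
   - natR (suc m) + - natR (suc n) ∎

  intR-* : ∀ i j -> intR (i ℤ.* j) ≈ intR i * intR j
  intR-* (+ m) (+ n) = trans (reflexive (≡.cong intR (≡.sym (ℤₚ.pos-* m n)))) (natR-* m n)
  intR-* (+ m) -[1+ n ] = begin
   intR (+ m ℤ.* -[1+ n ]) ≡⟨ ≡.cong intR (≡.sym (ℤₚ.neg-distribʳ-* (+ m) (+ suc n))) ⟩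
   intR (ℤ.- (+ m ℤ.* + suc n)) ≈⟨ intR-neg (+ m ℤ.* + suc n) ⟩
   - intR (+ m ℤ.* + suc n) ≈⟨ -‿cong (intR-* (+ m) (+ suc n)) ⟩
   - (natR m * natR (suc n)) ≈⟨ -‿distribʳ-* _ _ ⟩
   natR m * - natR (suc n) ∎
  intR-* -[1+ m ] (+ n) = begin
   intR (-[1+ m ] ℤ.* + n) ≡⟨ ≡.cong intR (≡.sym (ℤₚ.neg-distribˡ-* (+ suc m) (+ n))) ⟩
   intR (ℤ.- (+ suc m ℤ.* + n)) ≈⟨ intR-neg (+ suc m ℤ.* + n) ⟩
   - intR (+ suc m ℤ.* + n) ≈⟨ -‿cong (intR-* (+ suc m) (+ n)) ⟩
   - (natR (suc m) * natR n) ≈⟨ -‿distribˡ-* _ _ ⟩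
   - natR (suc m) * natR n ∎
  intR-* -[1+ m ] -[1+ n ] = begin
   natR (suc m N.* suc n) ≈⟨ natR-* (suc m) (suc n) ⟩
   natR (suc m) * natR (suc n) ≈⟨ -‿involutive _ ⟨
   - - (natR (suc m) * natR (suc n)) ≈⟨ -‿cong (-‿distribʳ-* _ _) ⟩
   - (natR (suc m) * - natR (suc n)) ≈⟨ -‿distribˡ-* _ _ ⟩
   - natR (suc m) * - natR (suc n) ∎

  private
   dec : ∀ i j -> Maybe (intR i ≈ intR j)
   dec i j with i ℤ.≟ j
   ... | yes ≡.refl = just refl
   ... | no _ = nothing

   morphism : ℤ.+-*-rawRing -Raw-AlmostCommutative⟶ fromCommutativeRing R
   morphism = record
    { ⟦_⟧ = intR
    ; +-homo = intR-+
    ; *-homo = intR-*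
    ; -‿homo = intR-neg
    ; 0-homo = refl
    ; 1-homo = +-identityʳ 1#
    }

  open RS ℤ.+-*-rawRing (fromCommutativeRing R) morphism dec public
   using (solve; _:=_; _:+_; _:*_; _:-_; :-_; _:^_; con; var; Polynomial)

-- Explicit constants depending only on degrees.

module StepConst where

 -- Here s + 1 is the degree of the polynomial and K bounds the weight `κ` that each further Taylor
 -- coefficient costs. `slack` is the surplus of q-th power monomials that makes the unknowns
 -- outnumber the equations in Stepanov's construction; `radius` says how large √q must be for this.
 slack radius : ℕ -> ℕ -> ℕ
 slack s K = suc (4 N.* (s N.+ s N.* s N.* K N.+ 1))
 radius s K = s N.* slack s K N.+ s N.* (2 N.* suc s N.+ 1) N.+ 4 N.* s N.+ 1

 -- `weight s` majorises `κ` on the curves of degree s + 1: 1 + s (s + 2) bounds the total length of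
 -- the rows, one factor s + 1 is the weight of v, the other the number of coefficients in v, and
 -- the doubling comes from the scaling of the local parameter by η². `excess s` is the coefficient
 -- of q / r in the final point count.
 weight excess : ℕ -> ℕ
 weight s = suc s N.* suc (s N.* suc (suc s)) N.* suc s N.+ suc s N.* suc (s N.* suc (suc s)) N.* suc s
 excess s = slack s (weight s) N.+ 2 N.* suc s N.+ 1

 -- `size E` bounds the rank of the function spaces used for fibres and the weight of the last
 -- equation t on them. With M = `size E`, `cap E` is the least a with M (1 + a + M (M + 1)) < a (M
 -- + 1), the inequality that forces a polynomial relation between y and t.
 size cap : ℕ -> ℕ
 size E = E N.* E N.* E N.+ E N.* E N.+ E
 cap E = suc (size E N.* suc (size E N.* suc (size E)))

 -- `badConst E` times q² bounds the singular quadruples: five loci where a derivative vanishes, one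
 -- controlled by a Wronskian, and one with isolated solutions. `quadConst` adds the contributions
 -- of nonsingular and singular quadruples to the number of colliding pairs, in units of q³.
 badConst quadConst : ℕ -> ℕ
 badConst E = 5 N.* (E N.* E) N.+ (suc (E N.+ E) N.+ suc (E N.+ (E N.+ E))) N.* E N.+ cap E N.* E
 quadConst E = (cap E N.* (E N.* (E N.* E))) N.* E N.+ badConst E N.* (E N.* (E N.* E))

-- Elimination of the norms of the dual functions.

module NumChain where
 open import Data.Nat
 open NP
 open ≡ hiding (J)
 open import Algebra.Solver.CommutativeMonoid *-1-commutativeMonoid using (solve; _⊕_; id; _⊜_; Expr)

 infixl 9 _⋆_
 _⋆_ : ∀ {n} -> Expr n -> ℕ -> Expr n
 e ⋆ zero = id
 e ⋆ suc n = e ⊕ (e ⋆ n)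

 ^-cancel-≤ : ∀ k .{{_ : NonZero k}} {x y} -> x ^ k ≤ y ^ k -> x ≤ y
 ^-cancel-≤ k {x} {y} h with x ≤? y
 ... | yes p = p
 ... | no ¬p = ⊥-elim (<⇒≱ (^-monoˡ-< k (≰⇒> ¬p)) h)

 -- Raise x² ≤ y z to the n-th power, insert the bound on z^n and cancel x^a. Each use eliminates
 -- the newest norm z in favour of the older norms x and y.
 climb : ∀ {x y z} T b a n .{{_ : NonZero x}} -> b + a ≡ n + n -> x * x ≤ y * z -> z ^ n ≤ T * x ^ a -> x ^ b ≤ T * y ^ n
 climb {x} {y} {z} T b a n eq sq h = *-cancelʳ-≤ (x ^ b) (T * y ^ n) (x ^ a) {{m^n≢0 x a}} (begin
  x ^ b * x ^ a ≡⟨ sym (^-distribˡ-+-* x b a) ⟩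
  x ^ (b + a) ≡⟨ cong (x ^_) eq ⟩
  x ^ (n + n) ≡⟨ trans (^-distribˡ-+-* x n n) (sym (power-* x x n)) ⟩
  (x * x) ^ n ≤⟨ ^-monoˡ-≤ n sq ⟩
  (y * z) ^ n ≡⟨ power-* y z n ⟩
  y ^ n * z ^ n ≤⟨ *-monoʳ-≤ (y ^ n) h ⟩
  y ^ n * (T * x ^ a) ≡⟨ solve 3 (\ y T x -> y ⊕ (T ⊕ x) ⊜ (T ⊕ y) ⊕ x) refl (y ^ n) T (x ^ a) ⟩
  T * y ^ n * x ^ a ∎)
  where
  open ≤-Reasoning
  power-* : ∀ x y n -> (x * y) ^ n ≡ x ^ n * y ^ n
  power-* x y zero = refl
  power-* x y (suc n) = trans (cong (x * y *_) (power-* x y n)) (solve 4 (\ x y a b -> (x ⊕ y) ⊕ (a ⊕ b) ⊜ (x ⊕ a) ⊕ (y ⊕ b)) refl x y (x ^ n) (y ^ n))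

 -- Dictionary: `a0`, `b0`, `co` are the squared norms of f, g, h; `c1`, `a1`, `b1`, `c2` those of
 -- h₁, f₁, g₁, h₂; `e` is the quartic correlation sum of h₂; `X` and `Y` are sums of absolute
 -- products of correlations. The norms are eliminated in the order `c2`, `b1`, `a1`, `c1`.
 module Chain (D q N a0 b0 co a1 b1 c1 c2 e X Y Λ : ℕ) .{{_ : NonZero q}} .{{_ : NonZero N}} .{{_ : NonZero a1}} .{{_ : NonZero b1}} .{{_ : NonZero c1}} .{{_ : NonZero c2}} .{{_ : NonZero e}}
  (h1 : (q * N) * (q * N) ≤ co * c1) (h2 : c1 * c1 ≤ a0 * a1) (h3 : a1 * a1 ≤ b0 * b1) (h4 : b1 * b1 ≤ c1 * c2)
  (hv : c2 ^ 8 ≤ D * q ^ 11 * a1 ^ 4 * b1 ^ 4 * e) where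
  open ≤-Reasoning

  private
   via : ∀ {x y z} -> y ≡ z -> x ≤ y -> x ≤ z
   via refl h = h

   times-e : ∀ {s} -> e ≤ s -> c2 ^ 8 ≤ D * q ^ 11 * a1 ^ 4 * b1 ^ 4 * s
   times-e he = ≤-trans hv (*-monoʳ-≤ (D * q ^ 11 * a1 ^ 4 * b1 ^ 4) he)

   instance
    qN≢0 : NonZero (q * N)
    qN≢0 = m*n≢0 q N

  -- The case in which degenerate pairs (y, z) dominate the upper bound on `e`.
  module _ (k : ℕ) (he : e ≤ k * q ^ 6 * a1 ^ 2 * c1 * c2 ^ 3) where
   private
    K : ℕ
    K = D * k

    sA : c2 ^ 5 ≤ (K * q ^ 17 * a1 ^ 6 * c1) * b1 ^ 4
    sA = *-cancelʳ-≤ (c2 ^ 5) _ (c2 ^ 3) {{m^n≢0 c2 3}} (≤-trans (≤-reflexive (solve 1 (\ c -> (c ⋆ 5) ⊕ (c ⋆ 3) ⊜ c ⋆ 8) refl c2)) (via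
     (solve 7 (\ D q a b k c x -> (((D ⊕ (q ⋆ 11)) ⊕ (a ⋆ 4)) ⊕ (b ⋆ 4)) ⊕ ((((k ⊕ (q ⋆ 6)) ⊕ (a ⋆ 2)) ⊕ c) ⊕ (x ⋆ 3)) ⊜ (((((D ⊕ k) ⊕ (q ⋆ 17)) ⊕ (a ⋆ 6)) ⊕ c) ⊕ (b ⋆ 4)) ⊕ (x ⋆ 3)) refl D q a1 b1 k c1 c2) (times-e he)))

    sB : b1 ^ 6 ≤ (K * q ^ 17 * c1 ^ 6) * a1 ^ 6
    sB = via (solve 4 (\ K q a c -> (((K ⊕ (q ⋆ 17)) ⊕ (a ⋆ 6)) ⊕ c) ⊕ (c ⋆ 5) ⊜ ((K ⊕ (q ⋆ 17)) ⊕ (c ⋆ 6)) ⊕ (a ⋆ 6)) refl K q a1 c1) (climb {b1} {c1} {c2} (K * q ^ 17 * a1 ^ 6 * c1) 6 4 5 refl h4 sA)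

    sC : a1 ^ 6 ≤ (K * q ^ 17 * b0 ^ 6) * c1 ^ 6
    sC = via (solve 4 (\ K q b c -> ((K ⊕ (q ⋆ 17)) ⊕ (c ⋆ 6)) ⊕ (b ⋆ 6) ⊜ ((K ⊕ (q ⋆ 17)) ⊕ (b ⋆ 6)) ⊕ (c ⋆ 6)) refl K q b0 c1) (climb {a1} {b0} {b1} (K * q ^ 17 * c1 ^ 6) 6 6 6 refl h3 sB)

    sD : c1 ^ 6 ≤ (K * q ^ 17 * b0 ^ 6 * a0 ^ 6) * (q * N) ^ 0
    sD = via (sym (*-identityʳ _)) (climb {c1} {a0} {a1} (K * q ^ 17 * b0 ^ 6) 6 6 6 refl h2 sC)

   case1 : N ^ 12 ≤ K * q ^ 5 * (a0 * b0 * co) ^ 6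
   case1 = *-cancelʳ-≤ (N ^ 12) _ (q ^ 12) {{m^n≢0 q 12}} (≤-trans (≤-reflexive (solve 2 (\ n q -> (n ⋆ 12) ⊕ (q ⋆ 12) ⊜ (q ⊕ n) ⋆ 12) refl N q)) (via
     (solve 5 (\ K q a b c -> (((K ⊕ (q ⋆ 17)) ⊕ (b ⋆ 6)) ⊕ (a ⋆ 6)) ⊕ (c ⋆ 6) ⊜ ((K ⊕ (q ⋆ 5)) ⊕ (((a ⊕ b) ⊕ c) ⋆ 6)) ⊕ (q ⋆ 12)) refl K q a0 b0 co) (climb {q * N} {co} {c1} (K * q ^ 17 * b0 ^ 6 * a0 ^ 6) 12 0 6 refl h1 sD)))

  -- The case in which generic pairs dominate. Here `e` also enters its own upper bound, through
  -- `Y`.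
  module _ (k : ℕ) (he : e ≤ k * q ^ 5 * a1 * (X * Y)) (hX : X * X ≤ (q ^ 2 * Λ * b0 * c1 * a1) * (q ^ 2 * Λ * a0 * b0 * c1)) (hY : Y * Y ≤ (q ^ 2 * Λ * a1 * b1 * c2) * e) where
   private
    J L K : ℕ
    J = k * k
    L = Λ ^ 3
    K = D * J

    -- Squaring `he` makes `hX` and `hY` applicable; `Y`² contributes one factor `e`, which cancels
    -- against `e`².
    sE : e ≤ J * q ^ 16 * L * a0 * b0 ^ 2 * b1 * a1 ^ 4 * c1 ^ 2 * c2
    sE = *-cancelʳ-≤ e _ e (begin
     e * e ≤⟨ *-mono-≤ he he ⟩
     (k * q ^ 5 * a1 * (X * Y)) * (k * q ^ 5 * a1 * (X * Y)) ≡⟨ solve 5 (\ k q a x y -> (((k ⊕ (q ⋆ 5)) ⊕ a) ⊕ (x ⊕ y)) ⊕ (((k ⊕ (q ⋆ 5)) ⊕ a) ⊕ (x ⊕ y)) ⊜ (((k ⊕ k) ⊕ (q ⋆ 10)) ⊕ (a ⋆ 2)) ⊕ ((x ⊕ x) ⊕ (y ⊕ y))) refl k q a1 X Y ⟩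
     J * q ^ 10 * a1 ^ 2 * ((X * X) * (Y * Y)) ≤⟨ *-monoʳ-≤ (J * q ^ 10 * a1 ^ 2) (*-mono-≤ hX hY) ⟩
     J * q ^ 10 * a1 ^ 2 * (((q ^ 2 * Λ * b0 * c1 * a1) * (q ^ 2 * Λ * a0 * b0 * c1)) * ((q ^ 2 * Λ * a1 * b1 * c2) * e))
      ≡⟨ solve 10 (\ J q l a0 b0 b a c x e -> ((J ⊕ (q ⋆ 10)) ⊕ (a ⋆ 2)) ⊕ (((((((q ⋆ 2) ⊕ l) ⊕ b0) ⊕ c) ⊕ a) ⊕ (((((q ⋆ 2) ⊕ l) ⊕ a0) ⊕ b0) ⊕ c)) ⊕ ((((((q ⋆ 2) ⊕ l) ⊕ a) ⊕ b) ⊕ x) ⊕ e))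
         ⊜ ((((((((J ⊕ (q ⋆ 16)) ⊕ (l ⋆ 3)) ⊕ a0) ⊕ (b0 ⋆ 2)) ⊕ b) ⊕ (a ⋆ 4)) ⊕ (c ⋆ 2)) ⊕ x) ⊕ e) refl J q Λ a0 b0 b1 a1 c1 c2 e ⟩
     J * q ^ 16 * L * a0 * b0 ^ 2 * b1 * a1 ^ 4 * c1 ^ 2 * c2 * e ∎)

    sA : c2 ^ 7 ≤ (K * q ^ 27 * L * a0 * b0 ^ 2 * a1 ^ 8 * c1 ^ 2) * b1 ^ 5
    sA = *-cancelʳ-≤ (c2 ^ 7) _ c2 (≤-trans (≤-reflexive (solve 1 (\ c -> (c ⋆ 7) ⊕ c ⊜ c ⋆ 8) refl c2)) (via
     (solve 10 (\ D J q L a0 b0 b a c x -> (((D ⊕ (q ⋆ 11)) ⊕ (a ⋆ 4)) ⊕ (b ⋆ 4)) ⊕ ((((((((J ⊕ (q ⋆ 16)) ⊕ L) ⊕ a0) ⊕ (b0 ⋆ 2)) ⊕ b) ⊕ (a ⋆ 4)) ⊕ (c ⋆ 2)) ⊕ x)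
         ⊜ ((((((((D ⊕ J) ⊕ (q ⋆ 27)) ⊕ L) ⊕ a0) ⊕ (b0 ⋆ 2)) ⊕ (a ⋆ 8)) ⊕ (c ⋆ 2)) ⊕ (b ⋆ 5)) ⊕ x) refl D J q L a0 b0 b1 a1 c1 c2) (times-e sE)))

    sB : b1 ^ 9 ≤ (K * q ^ 27 * L * a0 * b0 ^ 2 * c1 ^ 9) * a1 ^ 8
    sB = via (solve 7 (\ K q L a0 b0 a c -> ((((((K ⊕ (q ⋆ 27)) ⊕ L) ⊕ a0) ⊕ (b0 ⋆ 2)) ⊕ (a ⋆ 8)) ⊕ (c ⋆ 2)) ⊕ (c ⋆ 7) ⊜ (((((K ⊕ (q ⋆ 27)) ⊕ L) ⊕ a0) ⊕ (b0 ⋆ 2)) ⊕ (c ⋆ 9)) ⊕ (a ⋆ 8)) refl K q L a0 b0 a1 c1) (climb {b1} {c1} {c2} (K * q ^ 27 * L * a0 * b0 ^ 2 * a1 ^ 8 * c1 ^ 2) 9 5 7 refl h4 sA)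

    sC : a1 ^ 10 ≤ (K * q ^ 27 * L * a0 * b0 ^ 11) * c1 ^ 9
    sC = via (solve 6 (\ K q L a b c -> (((((K ⊕ (q ⋆ 27)) ⊕ L) ⊕ a) ⊕ (b ⋆ 2)) ⊕ (c ⋆ 9)) ⊕ (b ⋆ 9) ⊜ ((((K ⊕ (q ⋆ 27)) ⊕ L) ⊕ a) ⊕ (b ⋆ 11)) ⊕ (c ⋆ 9)) refl K q L a0 b0 c1) (climb {a1} {b0} {b1} (K * q ^ 27 * L * a0 * b0 ^ 2 * c1 ^ 9) 10 8 9 refl h3 sB)

    sD : c1 ^ 11 ≤ (K * q ^ 27 * L * a0 * b0 ^ 11 * a0 ^ 10) * (q * N) ^ 0
    sD = via (sym (*-identityʳ _)) (climb {c1} {a0} {a1} (K * q ^ 27 * L * a0 * b0 ^ 11) 11 9 10 refl h2 sC)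

   case2 : N ^ 22 ≤ (D * (k * k)) * q ^ 5 * Λ ^ 3 * (a0 * b0 * co) ^ 11
   case2 = *-cancelʳ-≤ (N ^ 22) _ (q ^ 22) {{m^n≢0 q 22}} (≤-trans (≤-reflexive (solve 2 (\ n q -> (n ⋆ 22) ⊕ (q ⋆ 22) ⊜ (q ⊕ n) ⋆ 22) refl N q)) (via
     (solve 6 (\ K q L a b c -> (((((K ⊕ (q ⋆ 27)) ⊕ L) ⊕ a) ⊕ (b ⋆ 11)) ⊕ (a ⋆ 10)) ⊕ (c ⋆ 11) ⊜ (((K ⊕ (q ⋆ 5)) ⊕ L) ⊕ (((a ⊕ b) ⊕ c) ⋆ 11)) ⊕ (q ⋆ 22)) refl K q L a0 b0 co) (climb {q * N} {co} {c1} (K * q ^ 27 * L * a0 * b0 ^ 11 * a0 ^ 10) 22 0 11 refl h1 sD)))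

 -- The exponents 12 : 5 : 6 and 44 : 19 : 22 both beat 16 : 7 : 8.
 finish1 : ∀ K q N M .{{_ : NonZero q}} .{{_ : NonZero K}} -> N ^ 12 ≤ K * q ^ 5 * M ^ 6 -> N ^ 16 ≤ K ^ 2 * q ^ 7 * M ^ 8
 finish1 K q N M h = ^-cancel-≤ 3 (begin
  (N ^ 16) ^ 3 ≡⟨ solve 1 (\ n -> (n ⋆ 16) ⋆ 3 ⊜ (n ⋆ 12) ⋆ 4) refl N ⟩
  (N ^ 12) ^ 4 ≤⟨ ^-monoˡ-≤ 4 h ⟩
  (K * q ^ 5 * M ^ 6) ^ 4 ≡⟨ solve 3 (\ k q m -> ((k ⊕ (q ⋆ 5)) ⊕ (m ⋆ 6)) ⋆ 4 ⊜ ((k ⋆ 4) ⊕ (q ⋆ 20)) ⊕ (m ⋆ 24)) refl K q M ⟩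
  K ^ 4 * q ^ 20 * M ^ 24 ≤⟨ *-monoˡ-≤ (M ^ 24) (*-mono-≤ (^-monoʳ-≤ K (s≤s (s≤s (s≤s (s≤s (z≤n {2})))))) (^-monoʳ-≤ q (n≤1+n 20))) ⟩
  K ^ 6 * q ^ 21 * M ^ 24 ≡⟨ solve 3 (\ k q m -> ((k ⋆ 6) ⊕ (q ⋆ 21)) ⊕ (m ⋆ 24) ⊜ (((k ⋆ 2) ⊕ (q ⋆ 7)) ⊕ (m ⋆ 8)) ⋆ 3) refl K q M ⟩
  (K ^ 2 * q ^ 7 * M ^ 8) ^ 3 ∎)
  where open ≤-Reasoning

 finish2 : ∀ K D q N M Λ .{{_ : NonZero q}} .{{_ : NonZero K}} -> D ≤ K -> Λ * Λ ≤ D * q ^ 3 -> N ^ 22 ≤ K * q ^ 5 * Λ ^ 3 * M ^ 11 -> N ^ 16 ≤ K ^ 2 * q ^ 7 * M ^ 8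
 finish2 K D q N M Λ D≤K hΛ h = ^-cancel-≤ 11 (begin
  (N ^ 16) ^ 11 ≡⟨ solve 1 (\ n -> (n ⋆ 16) ⋆ 11 ⊜ (n ⋆ 22) ⋆ 8) refl N ⟩
  (N ^ 22) ^ 8 ≤⟨ ^-monoˡ-≤ 8 h ⟩
  (K * q ^ 5 * Λ ^ 3 * M ^ 11) ^ 8 ≡⟨ solve 4 (\ k q l m -> (((k ⊕ (q ⋆ 5)) ⊕ (l ⋆ 3)) ⊕ (m ⋆ 11)) ⋆ 8 ⊜ (((k ⋆ 8) ⊕ (q ⋆ 40)) ⊕ (m ⋆ 88)) ⊕ ((l ⊕ l) ⋆ 12)) refl K q Λ M ⟩
  -- Only `Λ`² is known to be O(q³); the 8th power turns the odd `Λ`³ into (`Λ`²)^12, and 40 + 36 =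
  -- 76 still fits below 77.
  K ^ 8 * q ^ 40 * M ^ 88 * (Λ * Λ) ^ 12 ≤⟨ *-monoʳ-≤ (K ^ 8 * q ^ 40 * M ^ 88) (^-monoˡ-≤ 12 (≤-trans hΛ (*-monoˡ-≤ (q ^ 3) D≤K))) ⟩
  K ^ 8 * q ^ 40 * M ^ 88 * (K * q ^ 3) ^ 12 ≡⟨ solve 3 (\ k q m -> (((k ⋆ 8) ⊕ (q ⋆ 40)) ⊕ (m ⋆ 88)) ⊕ ((k ⊕ (q ⋆ 3)) ⋆ 12) ⊜ ((k ⋆ 20) ⊕ (q ⋆ 76)) ⊕ (m ⋆ 88)) refl K q M ⟩
  K ^ 20 * q ^ 76 * M ^ 88 ≤⟨ *-monoˡ-≤ (M ^ 88) (*-mono-≤ (^-monoʳ-≤ K (m≤n+m 20 2)) (^-monoʳ-≤ q (n≤1+n 76))) ⟩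
  K ^ 22 * q ^ 77 * M ^ 88 ≡⟨ solve 3 (\ k q m -> ((k ⋆ 22) ⊕ (q ⋆ 77)) ⊕ (m ⋆ 88) ⊜ (((k ⋆ 2) ⊕ (q ⋆ 7)) ⊕ (m ⋆ 8)) ⋆ 11) refl K q M ⟩
  (K ^ 2 * q ^ 7 * M ^ 8) ^ 11 ∎)
  where open ≤-Reasoning

 -- The two cases run with k = 2 D and yield the constants D · 2D and D · (2D)²; this is the larger
 -- one.
 constant : ℕ -> ℕ
 constant D = D * ((2 * D) * (2 * D))

 private
  pos-factor : ∀ {x y z} .{{_ : NonZero x}} -> x * x ≤ y * z -> NonZero z
  pos-factor {x} {y} {zero} h with () ← ≤-trans (>-nonZero⁻¹ (x * x) {{m*n≢0 x x}}) (≤-trans h (≤-reflexive (*-zeroʳ y)))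
  pos-factor {z = suc z} h = _

 elimination : ∀ D q N a0 b0 co a1 b1 c1 c2 e X Y Λ .{{_ : NonZero D}} .{{_ : NonZero q}} ->
  (q * N) * (q * N) ≤ co * c1 -> c1 * c1 ≤ a0 * a1 -> a1 * a1 ≤ b0 * b1 -> b1 * b1 ≤ c1 * c2 ->
  c2 ^ 8 ≤ D * q ^ 11 * a1 ^ 4 * b1 ^ 4 * e -> e ≤ D * q ^ 5 * a1 * (X * Y + q * a1 * c1 * c2 ^ 3) ->
  X * X ≤ (q ^ 2 * Λ * b0 * c1 * a1) * (q ^ 2 * Λ * a0 * b0 * c1) -> Y * Y ≤ (q ^ 2 * Λ * a1 * b1 * c2) * e -> Λ * Λ ≤ D * q ^ 3 ->
  N ^ 16 ≤ constant D ^ 2 * q ^ 7 * (a0 * b0 * co) ^ 8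
 elimination D q zero a0 b0 co a1 b1 c1 c2 e X Y Λ h1 h2 h3 h4 hv he hX hY hΛ = z≤n
 -- If the count is nonzero, every norm in the chain is forced to be nonzero by the inequality that
 -- bounds its predecessor, so all of them may be cancelled.
 elimination D q N@(suc _) a0 b0 co a1 b1 c1 c2 e X Y Λ h1 h2 h3 h4 hv he hX hY hΛ = go
  where
  instance
   qN : NonZero (q * N)
   qN = m*n≢0 q N
   c1≢0 : NonZero c1
   c1≢0 = pos-factor {q * N} {co} h1
   a1≢0 : NonZero a1
   a1≢0 = pos-factor {c1} {a0} h2
   b1≢0 : NonZero b1
   b1≢0 = pos-factor {a1} {b0} h3
   c2≢0 : NonZero c2
   c2≢0 = pos-factor {b1} {c1} h4
   e≢0 : NonZero e
   e≢0 = pos (D * q ^ 11 * a1 ^ 4 * b1 ^ 4) e hv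
    where
    pos : ∀ k e -> c2 ^ 8 ≤ k * e -> NonZero e
    pos k zero h with () ← ≤-trans (m^n>0 c2 8) (≤-trans h (≤-reflexive (*-zeroʳ k)))
    pos k (suc e) h = _
   2D≢0 : NonZero (2 * D)
   2D≢0 = m*n≢0 2 D
   4DD≢0 : NonZero (2 * D * (2 * D))
   4DD≢0 = m*n≢0 (2 * D) (2 * D)
   K≢0 : NonZero (constant D)
   K≢0 = m*n≢0 D (2 * D * (2 * D))
  open Chain D q N a0 b0 co a1 b1 c1 c2 e X Y Λ h1 h2 h3 h4 hv
  double : ∀ {x y z} -> x ≤ z -> y ≤ z -> x + y ≤ 2 * z
  double {z = z} p r = ≤-trans (+-mono-≤ p r) (≤-reflexive (cong (z +_) (sym (+-identityʳ z))))
  go : N ^ 16 ≤ constant D ^ 2 * q ^ 7 * (a0 * b0 * co) ^ 8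
  go with ≤-total (X * Y) (q * a1 * c1 * c2 ^ 3)
  ... | inj₁ small = finish1 (constant D) q N (a0 * b0 * co) (≤-trans (case1 (2 * D) (≤-trans (≤-trans he (*-monoʳ-≤ (D * q ^ 5 * a1) (double small ≤-refl)))
    (≤-reflexive (solve 6 (\ t D q a c x -> ((D ⊕ (q ⋆ 5)) ⊕ a) ⊕ (t ⊕ (((q ⊕ a) ⊕ c) ⊕ (x ⋆ 3))) ⊜ ((((t ⊕ D) ⊕ (q ⋆ 6)) ⊕ (a ⋆ 2)) ⊕ c) ⊕ (x ⋆ 3)) refl 2 D q a1 c1 c2))))
    (*-monoˡ-≤ ((a0 * b0 * co) ^ 6) (*-monoˡ-≤ (q ^ 5) (*-monoʳ-≤ D (m≤m*n (2 * D) (2 * D))))))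
  ... | inj₂ big = finish2 (constant D) D q N (a0 * b0 * co) Λ (m≤m*n D (2 * D * (2 * D))) hΛ (case2 (2 * D) (≤-trans (≤-trans he (*-monoʳ-≤ (D * q ^ 5 * a1) (double ≤-refl big)))
    (≤-reflexive (solve 6 (\ t D q a x y -> ((D ⊕ (q ⋆ 5)) ⊕ a) ⊕ (t ⊕ (x ⊕ y)) ⊜ (((t ⊕ D) ⊕ (q ⋆ 5)) ⊕ a) ⊕ (x ⊕ y)) refl 2 D q a1 X Y))) hX hY)

-- Integer square roots and the global constant.

module Numbers where
 open import Data.Nat
 open NP
 open import Data.Nat.DivMod using (_/_; m/n*n≤m)
 open ≡
 open StepConst
 open NumChain using (constant)

 isqrt : ∀ q -> ∃ \ r -> r * r ≤ q × q < suc r * suc r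
 isqrt zero = 0 , z≤n , s≤s z≤n
 isqrt (suc q) with isqrt q
 ... | r , lo , hi with suc r * suc r ≤? suc q
 ... | yes le = suc r , le , ≤-<-trans hi (*-mono-< (n<1+n (suc r)) (n<1+n (suc r)))
 ... | no ¬le = r , m≤n⇒m≤1+n lo , ≰⇒> ¬le

 -- Serves as a majorant of all values of g up to the given index, so that one constant covers all
 -- degrees at once without any monotonicity of g.
 sumUpTo : (ℕ -> ℕ) -> ℕ -> ℕ
 sumUpTo g zero = g 0
 sumUpTo g (suc n) = g (suc n) + sumUpTo g n

 sumUpTo-≥ : ∀ g {s n} -> s ≤ n -> g s ≤ sumUpTo g n
 sumUpTo-≥ g {s} {zero} z≤n = ≤-refl
 sumUpTo-≥ g {s} {suc n} h with s ≟ suc n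
 ... | yes refl = m≤m+n _ _
 ... | no ne = ≤-trans (sumUpTo-≥ g (≤-pred (≤∧≢⇒< h ne))) (m≤n+m _ (g (suc n)))

 maxExcess maxRadius slope : ℕ -> ℕ
 maxExcess E = sumUpTo excess E
 maxRadius E = sumUpTo (\ s -> radius s (weight s)) E
 slope E = 2 * (E + maxExcess E + suc E)

 -- Majorises, in the order of the summands, `Λ`² / q³, the fibre bound times the generic
 -- multiplicity, the fibre bound times the density of degenerate pairs, and the quadruple constant.
 bigD : ℕ -> ℕ
 bigD E = suc (4 * (slope E * slope E) + E * (cap E * E) + E * (3 * E) + quadConst E)

 -- With r the integer square root of q, every summand of Λ times r is O(q²), so Λ r ≤ `slope E` ·
 -- q²; then q ≤ 4 r² converts the factor r² in (Λ r)² into q.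
 Λ²-bound : ∀ E q r .{{_ : NonZero r}} .{{_ : NonZero q}} -> r * r ≤ q -> q < suc r * suc r ->
  (2 * ((E * q + q * (q * maxExcess E / r)) + q * suc E)) * (2 * ((E * q + q * (q * maxExcess E / r)) + q * suc E)) ≤ (4 * (slope E * slope E)) * q ^ 3
 Λ²-bound E q r lo hi = *-cancelʳ-≤ (Λ * Λ) _ q (begin
  Λ * Λ * q ≤⟨ *-monoʳ-≤ (Λ * Λ) q≤ ⟩
  Λ * Λ * (4 * (r * r)) ≡⟨ e1 Λ r ⟩
  4 * ((Λ * r) * (Λ * r)) ≤⟨ *-monoʳ-≤ 4 (*-mono-≤ Λr Λr) ⟩
  4 * ((k * (q * q)) * (k * (q * q))) ≡⟨ e2 k q ⟩
  (4 * (k * k)) * (q * (q * (q * 1))) * q ∎)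
  where
  open ≤-Reasoning
  C k t Λ : ℕ
  C = maxExcess E
  k = slope E
  t = q * C / r
  Λ = 2 * ((E * q + q * t) + q * suc E)
  r≤q : r ≤ q
  r≤q = ≤-trans (m≤m*n r r) lo
  q≤ : q ≤ 4 * (r * r)
  q≤ = ≤-trans (<⇒≤ hi) (≤-trans (*-mono-≤ 1+r≤ 1+r≤) (≤-reflexive (e3 r)))
   where
   1+r≤ : suc r ≤ r + r
   1+r≤ = +-monoˡ-≤ r (>-nonZero⁻¹ r)
   e3 : ∀ r -> (r + r) * (r + r) ≡ 4 * (r * r)
   e3 = solve-∀
  e1 : ∀ L r -> L * L * (4 * (r * r)) ≡ 4 * ((L * r) * (L * r))
  e1 = solve-∀
  e2 : ∀ k q -> 4 * ((k * (q * q)) * (k * (q * q))) ≡ (4 * (k * k)) * (q * (q * (q * 1))) * q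
  e2 = solve-∀
  e4 : ∀ E q t r -> (2 * ((E * q + q * t) + q * suc E)) * r ≡ 2 * ((E * (q * r) + q * (t * r)) + suc E * (q * r))
  e4 = solve-∀
  e5 : ∀ E C q -> 2 * ((E * (q * q) + q * (q * C)) + suc E * (q * q)) ≡ 2 * (E + C + suc E) * (q * q)
  e5 = solve-∀
  Λr : Λ * r ≤ k * (q * q)
  Λr = begin
   Λ * r ≡⟨ e4 E q t r ⟩
   2 * ((E * (q * r) + q * (t * r)) + suc E * (q * r))
    ≤⟨ *-monoʳ-≤ 2 (+-mono-≤ (+-mono-≤ (*-monoʳ-≤ E (*-monoʳ-≤ q r≤q)) (*-monoʳ-≤ q (m/n*n≤m (q * C) r))) (*-monoʳ-≤ (suc E) (*-monoʳ-≤ q r≤q))) ⟩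
   2 * ((E * (q * q) + q * (q * C)) + suc E * (q * q)) ≡⟨ e5 E C q ⟩
   k * (q * q) ∎

 bigD-≥1 : ∀ E -> 4 * (slope E * slope E) ≤ bigD E
 bigD-≥1 E = ≤-trans (≤-trans (m≤m+n (4 * (slope E * slope E)) (E * (cap E * E))) (≤-trans (m≤m+n (4 * (slope E * slope E) + E * (cap E * E)) (E * (3 * E))) (m≤m+n (4 * (slope E * slope E) + E * (cap E * E) + E * (3 * E)) (quadConst E)))) (n≤1+n _)

 bigD-≥2 : ∀ E -> E * (cap E * E) ≤ bigD E
 bigD-≥2 E = ≤-trans (≤-trans (m≤n+m (E * (cap E * E)) (4 * (slope E * slope E))) (≤-trans (m≤m+n (4 * (slope E * slope E) + E * (cap E * E)) (E * (3 * E))) (m≤m+n (4 * (slope E * slope E) + E * (cap E * E) + E * (3 * E)) (quadConst E)))) (n≤1+n _)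

 bigD-≥3 : ∀ E -> E * (3 * E) ≤ bigD E
 bigD-≥3 E = ≤-trans (≤-trans (m≤n+m (E * (3 * E)) (4 * (slope E * slope E) + E * (cap E * E))) (m≤m+n (4 * (slope E * slope E) + E * (cap E * E) + E * (3 * E)) (quadConst E))) (n≤1+n _)

 bigD-≥4 : ∀ E -> quadConst E ≤ bigD E
 bigD-≥4 E = ≤-trans (m≤n+m (quadConst E) (4 * (slope E * slope E) + E * (cap E * E) + E * (3 * E))) (n≤1+n _)

 D⁴≤ : ∀ D .{{_ : NonZero D}} -> D ^ 4 ≤ constant D ^ 2
 D⁴≤ D = ≤-trans (≤-reflexive (eq D)) (^-monoˡ-≤ 2 (*-monoʳ-≤ D (≤-trans (m≤n*m D 2) (m≤m*n (2 * D) (2 * D) {{m*n≢0 2 D}}))))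
  where
  eq : ∀ D -> D * (D * (D * (D * 1))) ≡ D * D * (D * D * 1)
  eq = solve-∀

 constant-nonzero : ∀ D .{{_ : NonZero D}} -> NonZero (constant D)
 constant-nonzero D = m*n≢0 D (2 * D * (2 * D)) {{it}} {{m*n≢0 (2 * D) (2 * D) {{m*n≢0 2 D}} {{m*n≢0 2 D}}}}
  where
  it : NonZero D
  it = >-nonZero (>-nonZero⁻¹ D)

-- Finite sums and Cauchy-Schwarz in an ordered ring.

module Sums where
 open import Algebra.Structures using (IsCommutativeRing)
 open ≡
 open RingZ

 -- The interface through which all counting arguments see the integers. `halve`, `*-cancel-≤` and
 -- `sq-cancel-≤` take the place of division and square roots.
 record OrderedRing : Set1 where
  infixl 6 _+_
  infixl 7 _*_
  infix 8 -_
  infix 4 _≤_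
  field
   Z : Set
   _+_ _*_ : Z -> Z -> Z
   -_ : Z -> Z
   0z 1z : Z
   isCommutativeRing : IsCommutativeRing _≡_ _+_ _*_ -_ 0z 1z
   _≤_ : Z -> Z -> Set
   ≤-refl : ∀ {a} -> a ≤ a
   ≤-trans : ∀ {a b c} -> a ≤ b -> b ≤ c -> a ≤ c
   diff-≥0 : ∀ {a b} -> a ≤ b -> 0z ≤ b + - a
   ≥0-diff : ∀ {a b} -> 0z ≤ b + - a -> a ≤ b
   +-nonneg : ∀ {a b} -> 0z ≤ a -> 0z ≤ b -> 0z ≤ a + b
   *-nonneg : ∀ {a b} -> 0z ≤ a -> 0z ≤ b -> 0z ≤ a * b
   sq-nonneg : ∀ a -> 0z ≤ a * a
   halve : ∀ {a} -> 0z ≤ a + a -> 0z ≤ a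
   0≤1 : 0z ≤ 1z
   ∣_∣ : Z -> Z
   abs-≥0 : ∀ a -> 0z ≤ ∣ a ∣
   abs-≥ : ∀ a -> a ≤ ∣ a ∣
   abs-sq : ∀ a -> ∣ a ∣ * ∣ a ∣ ≡ a * a
   abs-* : ∀ a b -> ∣ a * b ∣ ≡ ∣ a ∣ * ∣ b ∣
   abs-≤ : ∀ {a b} -> a ≤ b -> - a ≤ b -> ∣ a ∣ ≤ b
   *-cancel-≤ : ∀ {k a b} -> 1z ≤ k -> k * a ≤ k * b -> a ≤ b
   sq-cancel-≤ : ∀ {a b} -> 0z ≤ b -> a * a ≤ b * b -> a ≤ b

  commutativeRing : CommutativeRing 0ℓ 0ℓ
  commutativeRing = record { isCommutativeRing = isCommutativeRing }

 module Summation (𝕆 : OrderedRing) where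
  open OrderedRing 𝕆 public
  open CommutativeRing commutativeRing public using (+-assoc; +-comm; +-identityˡ; +-identityʳ; *-assoc; *-comm;
   *-identityˡ; *-identityʳ; distribˡ; distribʳ; zeroˡ; zeroʳ; -‿inverseʳ; -‿inverseˡ; _-_)
  open IntegerCoefficients commutativeRing public using (solve; _:=_; _:+_; _:*_; _:-_; :-_; con)

  -0z≡0z : 0z ≡ - 0z
  -0z≡0z = solve 0 (con (ℤ.+ 0) := :- con (ℤ.+ 0)) refl

  ≤-by : ∀ {a b} e -> b - a ≡ e -> 0z ≤ e -> a ≤ b
  ≤-by e eq h = ≥0-diff (subst (0z ≤_) (sym eq) h)

  +-mono : ∀ {a b c d} -> a ≤ b -> c ≤ d -> a + c ≤ b + d
  +-mono {a} {b} {c} {d} p r = ≤-by ((b - a) + (d - c))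
   (solve 4 (\ a b c d -> (b :+ d) :- (a :+ c) := (b :- a) :+ (d :- c)) refl a b c d)
   (+-nonneg (diff-≥0 p) (diff-≥0 r))

  *-monoˡ : ∀ {k a b} -> 0z ≤ k -> a ≤ b -> k * a ≤ k * b
  *-monoˡ {k} {a} {b} 0≤k p = ≤-by (k * (b - a))
   (solve 3 (\ k a b -> k :* b :- k :* a := k :* (b :- a)) refl k a b) (*-nonneg 0≤k (diff-≥0 p))

  *-monoʳ : ∀ {k a b} -> 0z ≤ k -> a ≤ b -> a * k ≤ b * k
  *-monoʳ {k} {a} {b} 0≤k p = subst₂ _≤_ (*-comm k a) (*-comm k b) (*-monoˡ 0≤k p)

  *-mono : ∀ {a b c d} -> 0z ≤ a -> 0z ≤ d -> a ≤ b -> c ≤ d -> a * c ≤ b * d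
  *-mono {a} {b} {c} {d} 0≤a 0≤d p r = ≤-trans (*-monoˡ 0≤a r) (*-monoʳ 0≤d p)

  sq-mono : ∀ {a b} -> 0z ≤ a -> a ≤ b -> a * a ≤ b * b
  sq-mono 0≤a p = *-mono 0≤a (≤-trans 0≤a p) p p

  ≤-reflexive : ∀ {a b} -> a ≡ b -> a ≤ b
  ≤-reflexive refl = ≤-refl

  nat : ℕ -> Z
  nat zero = 0z
  nat (suc n) = 1z + nat n

  nat-nonneg : ∀ n -> 0z ≤ nat n
  nat-nonneg zero = ≤-refl
  nat-nonneg (suc n) = +-nonneg 0≤1 (nat-nonneg n)

  module _ {I : Set} where

   Σ : List I -> (I -> Z) -> Z
   Σ [] f = 0z
   Σ (x ∷ xs) f = f x + Σ xs f

   Σ-cong : ∀ xs {f g : I -> Z} -> (∀ x -> f x ≡ g x) -> Σ xs f ≡ Σ xs g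
   Σ-cong [] e = refl
   Σ-cong (x ∷ xs) e = cong₂ _+_ (e x) (Σ-cong xs e)

   Σ-+ : ∀ xs (f g : I -> Z) -> Σ xs (\ x -> f x + g x) ≡ Σ xs f + Σ xs g
   Σ-+ [] f g = sym (+-identityʳ _)
   Σ-+ (x ∷ xs) f g = trans (cong (f x + g x +_) (Σ-+ xs f g))
    (solve 4 (\ a b c d -> a :+ b :+ (c :+ d) := (a :+ c) :+ (b :+ d)) refl (f x) (g x) (Σ xs f) (Σ xs g))

   Σ-*ˡ : ∀ xs k (f : I -> Z) -> Σ xs (\ x -> k * f x) ≡ k * Σ xs f
   Σ-*ˡ [] k f = sym (zeroʳ k)
   Σ-*ˡ (x ∷ xs) k f = trans (cong (k * f x +_) (Σ-*ˡ xs k f)) (sym (distribˡ k (f x) _))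

   Σ-*ʳ : ∀ xs k (f : I -> Z) -> Σ xs (\ x -> f x * k) ≡ Σ xs f * k
   Σ-*ʳ [] k f = sym (zeroˡ k)
   Σ-*ʳ (x ∷ xs) k f = trans (cong (f x * k +_) (Σ-*ʳ xs k f)) (sym (distribʳ k (f x) _))

   Σ-neg : ∀ xs (f : I -> Z) -> Σ xs (\ x -> - f x) ≡ - Σ xs f
   Σ-neg [] f = -0z≡0z
   Σ-neg (x ∷ xs) f = trans (cong (- f x +_) (Σ-neg xs f))
    (solve 2 (\ a b -> :- a :+ :- b := :- (a :+ b)) refl (f x) (Σ xs f))

   Σ-sub : ∀ xs (f g : I -> Z) -> Σ xs (\ x -> f x - g x) ≡ Σ xs f - Σ xs g
   Σ-sub xs f g = trans (Σ-+ xs f (\ x -> - g x)) (cong (Σ xs f +_) (Σ-neg xs g))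

   Σ-zero : ∀ xs -> Σ xs (\ _ -> 0z) ≡ 0z
   Σ-zero [] = refl
   Σ-zero (x ∷ xs) = trans (+-identityˡ _) (Σ-zero xs)

   Σ-const : ∀ xs k -> Σ xs (\ _ -> k) ≡ nat (length xs) * k
   Σ-const [] k = sym (zeroˡ k)
   Σ-const (x ∷ xs) k = trans (cong (k +_) (Σ-const xs k))
    (trans (cong₂ _+_ (sym (*-identityˡ k)) refl) (sym (distribʳ k _ _)))

   Σ-mono : ∀ xs {f g : I -> Z} -> (∀ x -> f x ≤ g x) -> Σ xs f ≤ Σ xs g
   Σ-mono [] le = ≤-refl
   Σ-mono (x ∷ xs) le = +-mono (le x) (Σ-mono xs le)

   Σ-nonneg : ∀ xs {f : I -> Z} -> (∀ x -> 0z ≤ f x) -> 0z ≤ Σ xs f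
   Σ-nonneg [] le = ≤-refl
   Σ-nonneg (x ∷ xs) le = +-nonneg (le x) (Σ-nonneg xs le)

  Σ-swap : ∀ {I J : Set} (xs : List I) (ys : List J) (f : I -> J -> Z) ->
       Σ xs (\ x -> Σ ys (f x)) ≡ Σ ys (\ y -> Σ xs (\ x -> f x y))
  Σ-swap [] ys f = sym (Σ-zero ys)
  Σ-swap (x ∷ xs) ys f = trans (cong (Σ ys (f x) +_) (Σ-swap xs ys f)) (sym (Σ-+ ys (f x) _))

  Σ-mul : ∀ {I J : Set} (xs : List I) (ys : List J) (f : I -> Z) (g : J -> Z) ->
      Σ xs (\ x -> Σ ys (\ y -> f x * g y)) ≡ Σ xs f * Σ ys g
  Σ-mul xs ys f g = trans (Σ-cong xs (\ x -> Σ-*ˡ ys (f x) g)) (Σ-*ʳ xs (Σ ys g) f)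

  Σ-++ : ∀ {I : Set} (xs ys : List I) (f : I -> Z) -> Σ (xs ++ ys) f ≡ Σ xs f + Σ ys f
  Σ-++ [] ys f = sym (+-identityˡ _)
  Σ-++ (x ∷ xs) ys f = trans (cong (f x +_) (Σ-++ xs ys f)) (sym (+-assoc _ _ _))

  Σ-map : ∀ {I J : Set} (xs : List I) (e : I -> J) (f : J -> Z) -> Σ (map e xs) f ≡ Σ xs (\ x -> f (e x))
  Σ-map [] e f = refl
  Σ-map (x ∷ xs) e f = cong (f (e x) +_) (Σ-map xs e f)

  Σ-× : ∀ {I J : Set} (xs : List I) (ys : List J) (f : I × J -> Z) ->
     Σ (cartesianProduct xs ys) f ≡ Σ xs (\ x -> Σ ys (\ y -> f (x , y)))
  Σ-× [] ys f = refl
  Σ-× (x ∷ xs) ys f = trans (Σ-++ (map (x ,_) ys) (cartesianProduct xs ys) f)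
   (cong₂ _+_ (Σ-map ys (x ,_) f) (Σ-× xs ys f))

  -- Lagrange's identity: the double sum of (f(x) g(y) - f(y) g(x))² is nonnegative and equals twice
  -- the difference of the two sides.
  cauchy-schwarz : ∀ {I : Set} (xs : List I) (f g : I -> Z) ->
   Σ xs (\ x -> f x * g x) * Σ xs (\ x -> f x * g x) ≤ Σ xs (\ x -> f x * f x) * Σ xs (\ x -> g x * g x)
  cauchy-schwarz {I} xs f g = ≥0-diff (halve (subst (0z ≤_) lagrange
    (Σ-nonneg xs (\ x -> Σ-nonneg xs (\ y -> sq-nonneg (D x y))))))
   where
   A B C : Z
   A = Σ xs (\ x -> f x * f x)
   B = Σ xs (\ x -> g x * g x)
   C = Σ xs (\ x -> f x * g x)
   D : I -> I -> Z
   D x y = f x * g y - f y * g x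
   pt : ∀ x y -> D x y * D x y ≡
      (f x * f x) * (g y * g y) + (- ((f x * g x) * (f y * g y) + (f x * g x) * (f y * g y)) + (g x * g x) * (f y * f y))
   pt x y = solve 4 (\ a b c d -> (a :* d :- c :* b) :* (a :* d :- c :* b) :=
     (a :* a) :* (d :* d) :+ (:- ((a :* b) :* (c :* d) :+ (a :* b) :* (c :* d)) :+ (b :* b) :* (c :* c)))
     refl (f x) (g x) (f y) (g y)
   lagrange : Σ xs (\ x -> Σ xs (\ y -> D x y * D x y)) ≡ (A * B - C * C) + (A * B - C * C)
   lagrange =
    trans (Σ-cong xs \ x -> trans (Σ-cong xs (pt x)) (trans (Σ-+ xs _ _) (cong₂ _+_ refl
     (trans (Σ-+ xs _ _) (cong₂ _+_ (trans (Σ-neg xs _) (cong -_ (Σ-+ xs _ _))) refl)))))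
    (trans (Σ-+ xs _ _) (trans (cong₂ _+_ (Σ-mul xs xs _ _) (trans (Σ-+ xs _ _)
     (cong₂ _+_ (trans (Σ-neg xs _) (cong -_ (trans (Σ-+ xs _ _) (cong₂ _+_ (Σ-mul xs xs _ _) (Σ-mul xs xs _ _)))))
           (Σ-mul xs xs _ _))))
    (solve 3 (\ A B C -> A :* B :+ (:- (C :* C :+ C :* C) :+ B :* A) := (A :* B :- C :* C) :+ (A :* B :- C :* C))
      refl A B C)))

  ind : ∀ {P : Set} -> Dec P -> Z
  ind (yes _) = 1z
  ind (no _) = 0z

  ind-nonneg : ∀ {P : Set} (d : Dec P) -> 0z ≤ ind d
  ind-nonneg (yes _) = 0≤1
  ind-nonneg (no _) = ≤-refl

  ind-≤1 : ∀ {P : Set} (d : Dec P) -> ind d ≤ 1z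
  ind-≤1 (yes _) = ≤-refl
  ind-≤1 (no _) = 0≤1

  ind-yes : ∀ {P : Set} (d : Dec P) -> P -> ind d ≡ 1z
  ind-yes (yes _) p = refl
  ind-yes (no ¬p) p with () ← ¬p p

  ind-no : ∀ {P : Set} (d : Dec P) -> ¬ P -> ind d ≡ 0z
  ind-no (no _) ¬p = refl
  ind-no (yes p) ¬p with () ← ¬p p

  ind-mono : ∀ {P Q : Set} (d : Dec P) (e : Dec Q) -> (P -> Q) -> ind d ≤ ind e
  ind-mono (yes p) e f = ≤-reflexive (sym (ind-yes e (f p)))
  ind-mono (no _) e f = ind-nonneg e

  ind-cong : ∀ {P Q : Set} (d : Dec P) (e : Dec Q) -> (P -> Q) -> (Q -> P) -> ind d ≡ ind e
  ind-cong (yes p) e f g = sym (ind-yes e (f p))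
  ind-cong (no ¬p) e f g = sym (ind-no e (\ q -> ¬p (g q)))

  ind-∧ : ∀ {P Q R : Set} (r : Dec R) (p : Dec P) (q : Dec Q) -> (R -> P) -> (R -> Q) -> (P -> Q -> R) -> ind r ≡ ind p * ind q
  ind-∧ r (yes p) (yes q) f g h = trans (ind-yes r (h p q)) (sym (*-identityˡ _))
  ind-∧ r (no ¬p) q f g h = trans (ind-no r (\ x -> ¬p (f x))) (sym (zeroˡ _))
  ind-∧ r (yes p) (no ¬q) f g h = trans (ind-no r (\ x -> ¬q (g x))) (sym (zeroʳ _))

open Sums using (OrderedRing; module Summation)

-- The integers as an ordered ring, and passage to natural numbers.

module IntRing where
 open import Data.Integer using (+_; -[1+_]; ∣_∣; +≤+; -≤+; -≤-; _⊖_; 0ℤ; 1ℤ)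
 open ≡
 open Sums

 private
  0≤+ : ∀ {n} -> 0ℤ ℤ.≤ + n
  0≤+ = +≤+ z≤n

  plus : ∀ {a b} -> 0ℤ ℤ.≤ a -> 0ℤ ℤ.≤ b -> 0ℤ ℤ.≤ a ℤ.+ b
  plus {+ m} {+ n} _ _ = 0≤+

  times : ∀ {a b} -> 0ℤ ℤ.≤ a -> 0ℤ ℤ.≤ b -> 0ℤ ℤ.≤ a ℤ.* b
  times {+ m} {+ n} _ _ = subst (0ℤ ℤ.≤_) (ℤₚ.pos-* m n) 0≤+

  square : ∀ a -> a ℤ.* a ≡ + (∣ a ∣ N.* ∣ a ∣)
  square (+ n) = sym (ℤₚ.pos-* n n)
  square -[1+ n ] = refl

  half : ∀ {a} -> 0ℤ ℤ.≤ a ℤ.+ a -> 0ℤ ℤ.≤ a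
  half {+ n} _ = 0≤+

  upper : ∀ a -> a ℤ.≤ + ∣ a ∣
  upper (+ n) = ℤₚ.≤-refl
  upper -[1+ n ] = -≤+

  abs-upper : ∀ {a b} -> a ℤ.≤ b -> ℤ.- a ℤ.≤ b -> + ∣ a ∣ ℤ.≤ b
  abs-upper {+ n} p r = p
  abs-upper { -[1+ n ]} p r = r

  cancel : ∀ {k a b} -> 1ℤ ℤ.≤ k -> k ℤ.* a ℤ.≤ k ℤ.* b -> a ℤ.≤ b
  cancel {+ suc k} {a} {b} (+≤+ _) h = ℤₚ.*-cancelˡ-≤-pos a b (+ suc k) h

  sq-cancel : ∀ {a b} -> 0ℤ ℤ.≤ b -> a ℤ.* a ℤ.≤ b ℤ.* b -> a ℤ.≤ b
  sq-cancel {a} {+ n} _ h = ℤₚ.≤-trans (upper a) (+≤+ (root (ℤₚ.drop‿+≤+ (subst₂ ℤ._≤_ (square a) (square (+ n)) h))))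
   where
   root : ∣ a ∣ N.* ∣ a ∣ N.≤ n N.* n -> ∣ a ∣ N.≤ n
   root h with ∣ a ∣ N.≤? n
   ... | yes p = p
   ... | no ¬p = ⊥-elim (<⇒≱ (*-mono-< (≰⇒> ¬p) (≰⇒> ¬p)) h)

 integers : OrderedRing
 integers = record
  { Z = ℤ ; _+_ = ℤ._+_ ; _*_ = ℤ._*_ ; -_ = ℤ.-_ ; 0z = 0ℤ ; 1z = 1ℤ
  ; isCommutativeRing = CommutativeRing.isCommutativeRing ℤₚ.+-*-commutativeRing
  ; _≤_ = ℤ._≤_ ; ≤-refl = ℤₚ.≤-refl ; ≤-trans = ℤₚ.≤-trans ; diff-≥0 = ℤₚ.i≤j⇒0≤j-i ; ≥0-diff = ℤₚ.0≤i-j⇒j≤i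
  ; +-nonneg = plus ; *-nonneg = times ; sq-nonneg = \ a -> subst (0ℤ ℤ.≤_) (sym (square a)) 0≤+
  ; halve = \ {a} -> half {a} ; 0≤1 = 0≤+ ; ∣_∣ = \ a -> + ∣ a ∣ ; abs-≥0 = \ _ -> 0≤+ ; abs-≥ = upper
  ; abs-sq = \ a -> trans (sym (ℤₚ.pos-* ∣ a ∣ ∣ a ∣)) (sym (square a))
  ; abs-* = \ a b -> trans (cong +_ (ℤₚ.abs-* a b)) (ℤₚ.pos-* ∣ a ∣ ∣ b ∣)
  ; abs-≤ = abs-upper ; *-cancel-≤ = \ {k} {a} {b} -> cancel {k} {a} {b} ; sq-cancel-≤ = sq-cancel }

 open Summation integers using (nat)

 nat≡+ : ∀ n -> nat n ≡ + n
 nat≡+ zero = refl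
 nat≡+ (suc n) = cong (\ t -> 1ℤ ℤ.+ t) (nat≡+ n)

 ∣nat∣ : ∀ n -> ∣ nat n ∣ ≡ n
 ∣nat∣ n = cong ∣_∣ (nat≡+ n)

 ∣∣-mono : ∀ {i j} -> 0ℤ ℤ.≤ i -> i ℤ.≤ j -> ∣ i ∣ N.≤ ∣ j ∣
 ∣∣-mono {+ m} _ (+≤+ h) = h

 ∣∣-≤ : ∀ {i m} -> 0ℤ ℤ.≤ i -> i ℤ.≤ nat m -> ∣ i ∣ N.≤ m
 ∣∣-≤ {i} {m} p h = subst (∣ i ∣ N.≤_) (∣nat∣ m) (∣∣-mono p h)

 ∣∣-+ : ∀ {i j} -> 0ℤ ℤ.≤ i -> 0ℤ ℤ.≤ j -> ∣ i ℤ.+ j ∣ ≡ ∣ i ∣ N.+ ∣ j ∣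
 ∣∣-+ {+ m} {+ n} _ _ = refl

 ∣∣-sq-mono : ∀ {i j} -> i ℤ.* i ℤ.≤ j -> ∣ i ∣ N.* ∣ i ∣ N.≤ ∣ j ∣
 ∣∣-sq-mono {i} {j} h = subst (N._≤ ∣ j ∣) (ℤₚ.abs-* i i) (∣∣-mono (subst (0ℤ ℤ.≤_) (sym (square i)) 0≤+) h)

-- Arithmetic of the finite field.

module Fld (𝔽 : FiniteField) where
 open ≡
 open RingZ

 open FiniteField 𝔽 public
  using (F; _+_; _*_; -_; 0#; 1#; natF; intF; evalF; IsCharacteristic; q; element; sumF; isCommutativeRing; 0≢1)

 FR : CommutativeRing 0ℓ 0ℓ
 FR = record { isCommutativeRing = isCommutativeRing }

 open CommutativeRing FR public using (+-assoc; +-comm; +-identityˡ; +-identityʳ; *-assoc; *-comm;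
   *-identityˡ; *-identityʳ; distribˡ; distribʳ; zeroˡ; zeroʳ; -‿inverseʳ; -‿inverseˡ; _-_)
 open IntegerCoefficients FR public using (solve; _:=_; _:+_; _:*_; _:-_; :-_; con; Polynomial; intR; natR; intR-+; intR-*; intR-neg; natR-+; natR-*)

 index : F -> Fin q
 index = Inverse.from (FiniteField.enum 𝔽)

 element-index : ∀ x -> element (index x) ≡ x
 element-index = Inverse.strictlyInverseˡ (FiniteField.enum 𝔽)

 index-element : ∀ i -> index (element i) ≡ i
 index-element = Inverse.strictlyInverseʳ (FiniteField.enum 𝔽)

 infix 4 _≟_
 _≟_ : (x y : F) -> Dec (x ≡ y)
 x ≟ y with index x Fin.≟ index y
 ... | yes e = yes (trans (sym (element-index x)) (trans (cong element e) (element-index y)))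
 ... | no ¬e = no (\ e -> ¬e (cong index e))

 els : List F
 els = tabulate element

 length-els : length els ≡ q
 length-els = Listₚ.length-tabulate element

 -- Made total by giving 0 the inverse 0, so that expressions in 1 / (y - z) can be written down
 -- without a proof that y and z differ.
 inv : F -> F
 inv x with x ≟ 0#
 ... | yes _ = 0#
 ... | no ne = proj₁ (FiniteField.inverse 𝔽 x ne)

 inv-r : ∀ {x} -> ¬ x ≡ 0# -> x * inv x ≡ 1#
 inv-r {x} ne with x ≟ 0#
 ... | yes e = ⊥-elim (ne e)
 ... | no ne' = proj₂ (FiniteField.inverse 𝔽 x ne')

 inv-l : ∀ {x} -> ¬ x ≡ 0# -> inv x * x ≡ 1#
 inv-l {x} ne = trans (*-comm _ _) (inv-r ne)

 *-cancelˡ-0 : ∀ {x y} -> ¬ x ≡ 0# -> x * y ≡ 0# -> y ≡ 0#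
 *-cancelˡ-0 {x} {y} ne e = trans (sym (*-identityˡ y)) (trans (cong (_* y) (sym (inv-l ne)))
  (trans (*-assoc _ _ _) (trans (cong (inv x *_) e) (zeroʳ _))))

 *-≢0 : ∀ {x y} -> ¬ x ≡ 0# -> ¬ y ≡ 0# -> ¬ x * y ≡ 0#
 *-≢0 nx ny e = ny (*-cancelˡ-0 nx e)

 sub-≡ : ∀ {x y} -> x - y ≡ 0# -> x ≡ y
 sub-≡ {x} {y} e = trans (solve 2 (\ x y -> x := (x :- y) :+ y) refl x y) (trans (cong (_+ y) e) (+-identityˡ y))

 ≡-sub : ∀ {x y} -> x ≡ y -> x - y ≡ 0#
 ≡-sub {x} refl = -‿inverseʳ x

 neg-≢0 : ∀ {x} -> ¬ x ≡ 0# -> ¬ - x ≡ 0#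
 neg-≢0 {x} ne e = ne (trans (solve 1 (\ x -> x := :- (:- x)) refl x) (trans (cong -_ e) (solve 0 (:- con (ℤ.+ 0) := con (ℤ.+ 0)) refl)))

 natF≡natR : ∀ n -> natF n ≡ natR n
 natF≡natR zero = refl
 natF≡natR (suc n) = cong (1# +_) (natF≡natR n)

 intF≡intR : ∀ i -> intF i ≡ intR i
 intF≡intR (ℤ.+ n) = natF≡natR n
 intF≡intR (ℤ.-[1+ n ]) = cong -_ (natF≡natR (suc n))

-- Polynomials over F and their evaluation in algebras.

module PolyEval (𝔽 : FiniteField) where
 open ≡ using (_≡_)
 open RingZ
 private module K = Fld 𝔽
 open K using (F)

 Pol : Set
 Pol = List F

 coef : Pol -> ℕ -> F
 coef [] n = K.0#
 coef (a ∷ p) zero = a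
 coef (a ∷ p) (suc n) = coef p n

 infixl 6 _⊞_
 infixl 7 _⊠_

 _⊞_ : Pol -> Pol -> Pol
 [] ⊞ r = r
 (a ∷ p) ⊞ [] = a ∷ p
 (a ∷ p) ⊞ (b ∷ r) = (a K.+ b) ∷ (p ⊞ r)

 scale : F -> Pol -> Pol
 scale k = map (k K.*_)

 _⊠_ : Pol -> Pol -> Pol
 [] ⊠ r = []
 (a ∷ p) ⊠ r = scale a r ⊞ (K.0# ∷ (p ⊠ r))

 deriv : Pol -> Pol
 deriv [] = []
 deriv (a ∷ p) = p ⊞ (K.0# ∷ deriv p)

 -- The same polynomial identities are used in F, in power series over F and in families of power
 -- series; each is an instance.
 record FAlgebra : Set1 where
  field
   alg : CommutativeRing 0ℓ 0ℓ
  open CommutativeRing alg public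
  field
   ι : F -> Carrier
   ι-+ : ∀ x y -> ι (x K.+ y) ≈ ι x + ι y
   ι-* : ∀ x y -> ι (x K.* y) ≈ ι x * ι y
   ι-0 : ι K.0# ≈ 0#
   ι-neg : ∀ x -> ι (K.- x) ≈ - ι x
   ι-1 : ι K.1# ≈ 1#

 module Eval (A : FAlgebra) where
  open FAlgebra A renaming (Carrier to C)
  open IntegerCoefficients alg
  open import Relation.Binary.Reasoning.Setoid setoid

  hev : Pol -> C -> C
  hev [] x = 0#
  hev (a ∷ p) x = ι a + x * hev p x

  der : Pol -> C -> C
  der [] x = 0#
  der (a ∷ p) x = hev p x + x * der p x

  -- The second-order Taylor remainder: p(x + v) = p(x) + v p'(x) + v² `tay p x v`. The recursive
  -- definition involves no factorials and makes sense in every characteristic.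
  tay : Pol -> C -> C -> C
  tay [] x v = 0#
  tay (a ∷ p) x v = der p x + (x + v) * tay p x v

  hev-cong : ∀ p {x y} -> x ≈ y -> hev p x ≈ hev p y
  hev-cong [] e = refl
  hev-cong (a ∷ p) e = +-congˡ (*-cong e (hev-cong p e))

  taylor : ∀ p x v -> hev p (x + v) ≈ (hev p x + v * der p x) + (v * v) * tay p x v
  taylor [] x v = solve 1 (\ v -> con (ℤ.+ 0) := (con (ℤ.+ 0) :+ v :* con (ℤ.+ 0)) :+ v :* v :* con (ℤ.+ 0)) refl v
  taylor (a ∷ p) x v = begin
   ι a + (x + v) * hev p (x + v) ≈⟨ +-congˡ (*-congˡ (taylor p x v)) ⟩
   ι a + (x + v) * ((hev p x + v * der p x) + (v * v) * tay p x v)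
    ≈⟨ solve 6 (\ a x v h d t -> a :+ (x :+ v) :* ((h :+ v :* d) :+ v :* v :* t) :=
       ((a :+ x :* h) :+ v :* (h :+ x :* d)) :+ v :* v :* (d :+ (x :+ v) :* t)) refl (ι a) x v (hev p x) (der p x) (tay p x v) ⟩
   ((ι a + x * hev p x) + v * (hev p x + x * der p x)) + (v * v) * (der p x + (x + v) * tay p x v) ∎

  hev-⊞ : ∀ p r x -> hev (p ⊞ r) x ≈ hev p x + hev r x
  hev-⊞ [] r x = sym (+-identityˡ _)
  hev-⊞ (a ∷ p) [] x = sym (+-identityʳ _)
  hev-⊞ (a ∷ p) (b ∷ r) x = begin
   ι (a K.+ b) + x * hev (p ⊞ r) x ≈⟨ +-cong (ι-+ a b) (*-congˡ (hev-⊞ p r x)) ⟩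
   (ι a + ι b) + x * (hev p x + hev r x) ≈⟨ solve 5 (\ a b x h k -> (a :+ b) :+ x :* (h :+ k) := (a :+ x :* h) :+ (b :+ x :* k)) refl (ι a) (ι b) x (hev p x) (hev r x) ⟩
   (ι a + x * hev p x) + (ι b + x * hev r x) ∎

  hev-scale : ∀ k p x -> hev (scale k p) x ≈ ι k * hev p x
  hev-scale k [] x = sym (zeroʳ _)
  hev-scale k (a ∷ p) x = begin
   ι (k K.* a) + x * hev (scale k p) x ≈⟨ +-cong (ι-* k a) (*-congˡ (hev-scale k p x)) ⟩
   ι k * ι a + x * (ι k * hev p x) ≈⟨ solve 4 (\ k a x h -> k :* a :+ x :* (k :* h) := k :* (a :+ x :* h)) refl (ι k) (ι a) x (hev p x) ⟩
   ι k * (ι a + x * hev p x) ∎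

  hev-shift : ∀ p x -> hev (K.0# ∷ p) x ≈ x * hev p x
  hev-shift p x = trans (+-congʳ ι-0) (+-identityˡ _)

  hev-⊠ : ∀ p r x -> hev (p ⊠ r) x ≈ hev p x * hev r x
  hev-⊠ [] r x = sym (zeroˡ _)
  hev-⊠ (a ∷ p) r x = begin
   hev (scale a r ⊞ (K.0# ∷ (p ⊠ r))) x ≈⟨ hev-⊞ (scale a r) _ x ⟩
   hev (scale a r) x + hev (K.0# ∷ (p ⊠ r)) x ≈⟨ +-cong (hev-scale a r x) (trans (hev-shift (p ⊠ r) x) (*-congˡ (hev-⊠ p r x))) ⟩
   ι a * hev r x + x * (hev p x * hev r x) ≈⟨ solve 4 (\ a r x h -> a :* r :+ x :* (h :* r) := (a :+ x :* h) :* r) refl (ι a) (hev r x) x (hev p x) ⟩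
   (ι a + x * hev p x) * hev r x ∎

  hev-zero : ∀ p x -> (∀ k -> coef p k ≡ K.0#) -> hev p x ≈ 0#
  hev-zero [] x e = refl
  hev-zero (a ∷ p) x e = trans (+-cong (trans (reflexive (≡.cong ι (e 0))) ι-0) (trans (*-congˡ (hev-zero p x (\ k -> e (suc k)))) (zeroʳ x))) (+-identityʳ _)

  hev-deriv : ∀ p x -> hev (deriv p) x ≈ der p x
  hev-deriv [] x = refl
  hev-deriv (a ∷ p) x = trans (hev-⊞ p (K.0# ∷ deriv p) x) (+-congˡ (trans (hev-shift (deriv p) x) (*-congˡ (hev-deriv p x))))

-- Formal power series in a parameter u.

module Ser (𝔽 : FiniteField) where
 open ≡
 open RingZ
 open Fld 𝔽

 Ser : Set
 Ser = ℕ -> F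

 infix 4 _≈_
 _≈_ : Ser -> Ser -> Set
 a ≈ b = ∀ n -> a n ≡ b n

 tl : Ser -> Ser
 tl a n = a (suc n)

 infixl 6 _+ˢ_
 infixl 7 _*ˢ_

 _+ˢ_ _*ˢ_ : Ser -> Ser -> Ser
 (a +ˢ b) n = a n + b n
 (a *ˢ b) zero = a 0 * b 0
 (a *ˢ b) (suc n) = a 0 * b (suc n) + (tl a *ˢ b) n

 -ˢ_ : Ser -> Ser
 (-ˢ a) n = - a n

 const : F -> Ser
 const x zero = x
 const x (suc n) = 0#

 *ˢ-cong : ∀ {a b c d} -> a ≈ b -> c ≈ d -> a *ˢ c ≈ b *ˢ d
 *ˢ-cong p r zero = cong₂ _*_ (p 0) (r 0)
 *ˢ-cong p r (suc n) = cong₂ _+_ (cong₂ _*_ (p 0) (r (suc n))) (*ˢ-cong (\ k -> p (suc k)) r n)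

 *ˢ-distribʳ : ∀ c a b -> (a +ˢ b) *ˢ c ≈ (a *ˢ c) +ˢ (b *ˢ c)
 *ˢ-distribʳ c a b zero = distribʳ _ _ _
 *ˢ-distribʳ c a b (suc n) = trans (cong₂ _+_ (distribʳ _ _ _) (*ˢ-distribʳ c (tl a) (tl b) n))
  (solve 4 (\ a b e f -> (a :+ b) :+ (e :+ f) := (a :+ e) :+ (b :+ f)) refl _ _ _ _)

 *ˢ-scale : ∀ x a b -> (\ n -> x * a n) *ˢ b ≈ (\ n -> x * (a *ˢ b) n)
 *ˢ-scale x a b zero = *-assoc _ _ _
 *ˢ-scale x a b (suc n) = trans (cong₂ _+_ (*-assoc _ _ _) (*ˢ-scale x (tl a) b n)) (sym (distribˡ _ _ _))

 *ˢ-zeroˡ : ∀ a b -> (∀ n -> a n ≡ 0#) -> a *ˢ b ≈ const 0#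
 *ˢ-zeroˡ a b e zero = trans (cong (_* b 0) (e 0)) (zeroˡ _)
 *ˢ-zeroˡ a b e (suc n) = trans (cong₂ _+_ (trans (cong (_* b (suc n)) (e 0)) (zeroˡ _)) (trans (*ˢ-zeroˡ (tl a) b (\ k -> e (suc k)) n) (const0 n))) (+-identityʳ 0#)
  where
  const0 : ∀ n -> const 0# n ≡ 0#
  const0 zero = refl
  const0 (suc n) = refl

 *ˢ-sucʳ : ∀ a b n -> (a *ˢ b) (suc n) ≡ a (suc n) * b 0 + (a *ˢ tl b) n
 *ˢ-sucʳ a b zero = +-comm _ _
 *ˢ-sucʳ a b (suc n) = trans (cong (a 0 * b (suc (suc n)) +_) (*ˢ-sucʳ (tl a) b n))
  (solve 3 (\ x y z -> x :+ (y :+ z) := y :+ (x :+ z)) refl _ _ _)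

 *ˢ-comm : ∀ a b -> a *ˢ b ≈ b *ˢ a
 *ˢ-comm a b zero = *-comm _ _
 *ˢ-comm a b (suc n) = trans (cong₂ _+_ (*-comm _ _) (*ˢ-comm (tl a) b n)) (sym (*ˢ-sucʳ b a n))

 *ˢ-assoc : ∀ a b c -> (a *ˢ b) *ˢ c ≈ a *ˢ (b *ˢ c)
 *ˢ-assoc a b c zero = *-assoc _ _ _
 *ˢ-assoc a b c (suc n) = trans (cong (a 0 * b 0 * c (suc n) +_) (trans (*ˢ-distribʳ c (\ k -> a 0 * b (suc k)) (tl a *ˢ b) n)
   (cong₂ _+_ (*ˢ-scale (a 0) (tl b) c n) (*ˢ-assoc (tl a) b c n))))
  (solve 5 (\ x y z m w -> x :* y :* z :+ (x :* m :+ w) := x :* (y :* z :+ m) :+ w) refl (a 0) (b 0) (c (suc n)) _ _)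

 *ˢ-identityˡ : ∀ a -> const 1# *ˢ a ≈ a
 *ˢ-identityˡ a zero = *-identityˡ _
 *ˢ-identityˡ a (suc n) = trans (cong₂ _+_ (*-identityˡ _) (trans (*ˢ-zeroˡ (tl (const 1#)) a (\ _ -> refl) n) (c0 n))) (+-identityʳ _)
  where
  c0 : ∀ n -> const 0# n ≡ 0#
  c0 zero = refl
  c0 (suc n) = refl

 const0≡0 : ∀ n -> const 0# n ≡ 0#
 const0≡0 zero = refl
 const0≡0 (suc n) = refl

 SR : CommutativeRing 0ℓ 0ℓ
 SR = record
  { Carrier = Ser ; _≈_ = _≈_ ; _+_ = _+ˢ_ ; _*_ = _*ˢ_ ; -_ = -ˢ_ ; 0# = const 0# ; 1# = const 1#
  ; isCommutativeRing = record
   { isRing = record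
    { +-isAbelianGroup = record
     { isGroup = record
      { isMonoid = record
       { isSemigroup = record
        { isMagma = record
         { isEquivalence = record { refl = \ n -> refl ; sym = \ e n -> sym (e n) ; trans = \ e f n -> trans (e n) (f n) }
         ; ∙-cong = \ e f n -> cong₂ _+_ (e n) (f n) }
        ; assoc = \ a b c n -> +-assoc _ _ _ }
       ; identity = (\ a n -> trans (cong (_+ a n) (const0≡0 n)) (+-identityˡ _)) , (\ a n -> trans (cong (a n +_) (const0≡0 n)) (+-identityʳ _)) }
      ; inverse = (\ a n -> trans (-‿inverseˡ _) (sym (const0≡0 n))) , (\ a n -> trans (-‿inverseʳ _) (sym (const0≡0 n)))
      ; ⁻¹-cong = \ e n -> cong -_ (e n) }
     ; comm = \ a b n -> +-comm _ _ }
    ; *-cong = *ˢ-cong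
    ; *-assoc = *ˢ-assoc
    ; *-identity = *ˢ-identityˡ , (\ a n -> trans (*ˢ-comm a (const 1#) n) (*ˢ-identityˡ a n))
    ; distrib = (\ a b c n -> trans (*ˢ-comm a (b +ˢ c) n) (trans (*ˢ-distribʳ a b c n) (cong₂ _+_ (*ˢ-comm b a n) (*ˢ-comm c a n)))) , *ˢ-distribʳ }
   ; *-comm = *ˢ-comm } }

 module R = CommutativeRing SR
 module Sol = IntegerCoefficients SR

 const-+ : ∀ x y -> const (x + y) ≈ const x +ˢ const y
 const-+ x y zero = refl
 const-+ x y (suc n) = sym (+-identityʳ 0#)

 const-*ˡ : ∀ x a -> const x *ˢ a ≈ (\ n -> x * a n)
 const-*ˡ x a zero = refl
 const-*ˡ x a (suc n) = trans (cong (x * a (suc n) +_) (trans (*ˢ-zeroˡ (tl (const x)) a (\ _ -> refl) n) (const0≡0 n))) (+-identityʳ _)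

 const-* : ∀ x y -> const (x * y) ≈ const x *ˢ const y
 const-* x y n = sym (trans (const-*ˡ x (const y) n) (h n))
  where
  h : ∀ n -> x * const y n ≡ const (x * y) n
  h zero = refl
  h (suc n) = zeroʳ x

 const-neg : ∀ x -> const (- x) ≈ -ˢ const x
 const-neg x zero = refl
 const-neg x (suc n) = sym (solve 0 (:- con (ℤ.+ 0) := con (ℤ.+ 0)) refl)

 uˢ : Ser
 uˢ 0 = 0#
 uˢ 1 = 1#
 uˢ (suc (suc n)) = 0#

 u*-zero : ∀ a -> (uˢ *ˢ a) 0 ≡ 0#
 u*-zero a = zeroˡ _

 u*-suc : ∀ a n -> (uˢ *ˢ a) (suc n) ≡ a n
 u*-suc a n = trans (cong₂ _+_ (zeroˡ _) (trans (*ˢ-cong {tl uˢ} {const 1#} {a} {a} (\ { zero -> refl ; (suc k) -> refl }) (\ _ -> refl) n) (*ˢ-identityˡ a n))) (+-identityˡ _)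

 infix 4 _≡[_]_
 _≡[_]_ : Ser -> ℕ -> Ser -> Set
 a ≡[ n ] b = ∀ {k} -> k N.< n -> a k ≡ b k

 ≡[]-+ : ∀ {n a b c d} -> a ≡[ n ] b -> c ≡[ n ] d -> a +ˢ c ≡[ n ] b +ˢ d
 ≡[]-+ p r k<n = cong₂ _+_ (p k<n) (r k<n)

 ≡[]-neg : ∀ {n a b} -> a ≡[ n ] b -> -ˢ a ≡[ n ] -ˢ b
 ≡[]-neg p k<n = cong -_ (p k<n)

 ≡[]-* : ∀ {n a b c d} -> a ≡[ n ] b -> c ≡[ n ] d -> a *ˢ c ≡[ n ] b *ˢ d
 ≡[]-* {a = a} {b} {c} {d} p r {zero} k<n = cong₂ _*_ (p k<n) (r k<n)
 ≡[]-* {suc n} {a} {b} {c} {d} p r {suc k} (s≤s k<n) = cong₂ _+_ (cong₂ _*_ (p (s≤s z≤n)) (r (s≤s k<n)))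
  (≡[]-* {n} {tl a} {tl b} {c} {d} (\ l<n -> p (s≤s l<n)) (\ l<n -> r (m<n⇒m<1+n l<n)) k<n)

 ≡[]-u* : ∀ {n a b} -> a ≡[ n ] b -> uˢ *ˢ a ≡[ suc n ] uˢ *ˢ b
 ≡[]-u* {a = a} {b} p {zero} _ = trans (u*-zero a) (sym (u*-zero b))
 ≡[]-u* {a = a} {b} p {suc k} (s≤s k<n) = trans (u*-suc a k) (trans (p k<n) (sym (u*-suc b k)))

 -- Because Φ preserves congruence modulo u^n, the map a ↦ A + u Φ(a) improves agreement by one
 -- coefficient. The k-th coefficient is therefore final at the k-th iterate, which is where `fix`
 -- reads it off.
 module Fixpoint (A : Ser) (Φ : Ser -> Ser) (causal : ∀ {n a b} -> a ≡[ n ] b -> Φ a ≡[ n ] Φ b) where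
  iter : ℕ -> Ser
  iter zero = A
  iter (suc m) = A +ˢ uˢ *ˢ Φ (iter m)

  iter-step : ∀ m -> iter m ≡[ suc m ] iter (suc m)
  iter-step zero {zero} _ = sym (trans (cong (A 0 +_) (u*-zero (Φ A))) (+-identityʳ _))
  iter-step zero {suc k} (s≤s ())
  iter-step (suc m) = ≡[]-+ {a = A} {A} (\ _ -> refl) (≡[]-u* (causal (iter-step m)))

  iter-mono : ∀ {m l} -> m N.≤′ l -> iter m ≡[ suc m ] iter l
  iter-mono N.≤′-refl _ = refl
  iter-mono {m} {suc l} (N.≤′-step h) k<m = trans (iter-mono h k<m) (iter-step l (≤∙ k<m (s≤s (≤′⇒≤ h))))

  fix : Ser
  fix k = iter k k

  fix-iter : ∀ m -> fix ≡[ suc m ] iter m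
  fix-iter m {k} (s≤s k≤m) = iter-mono (≤⇒≤′ k≤m) (n<1+n k)

  fix-eq : fix ≈ A +ˢ uˢ *ˢ Φ fix
  fix-eq zero = sym (trans (cong (A 0 +_) (u*-zero (Φ fix))) (+-identityʳ _))
  fix-eq (suc k) = cong (A (suc k) +_) (trans (u*-suc (Φ (iter k)) k)
   (trans (sym (causal (fix-iter k) (n<1+n k))) (sym (u*-suc (Φ fix) k))))

 unit-cancel : ∀ a b -> ¬ a 0 ≡ 0# -> (∀ n -> (a *ˢ b) n ≡ 0#) -> ∀ n -> b n ≡ 0#
 unit-cancel a b ne e n = go n {n} (n<1+n n)
  where
  go : ∀ m {k} -> k N.< suc m -> b k ≡ 0#
  step : ∀ m -> (∀ {k} -> k N.< m -> b k ≡ 0#) -> b m ≡ 0#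
  step m h = *-cancelˡ-0 ne (trans (sym (trans (shape m) (trans (cong (a 0 * b m +_) (rest m h)) (+-identityʳ _)))) (e m))
   where
   low : ℕ -> F
   low zero = 0#
   low (suc m) = (tl a *ˢ b) m
   shape : ∀ m -> (a *ˢ b) m ≡ a 0 * b m + low m
   shape zero = sym (+-identityʳ _)
   shape (suc m) = refl
   rest : ∀ m -> (∀ {k} -> k N.< m -> b k ≡ 0#) -> low m ≡ 0#
   rest zero h = refl
   rest (suc m) h = trans (≡[]-* {suc m} {tl a} {tl a} {b} {const 0#} (\ _ -> refl) (\ {k} k<m -> trans (h k<m) (sym (const0≡0 k))) (n<1+n m))
     (trans (*ˢ-comm (tl a) (const 0#) m) (trans (*ˢ-zeroˡ (const 0#) (tl a) const0≡0 m) (const0≡0 m)))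
  go zero {zero} _ = step 0 (\ ())
  go zero {suc k} (s≤s ())
  go (suc m) {k} k<m with k N.≟ suc m
  ... | yes refl = step (suc m) (go m)
  ... | no ne' = go m (≤∧≢⇒< (≤-pred k<m) ne')

 -- A series with a simple zero is u times the unit `tl t`, hence not a zero divisor.
 simple-zero-cancel : ∀ t b -> t 0 ≡ 0# -> ¬ t 1 ≡ 0# -> (∀ n -> (t *ˢ b) n ≡ 0#) -> ∀ n -> b n ≡ 0#
 simple-zero-cancel t b t0 t1 e = unit-cancel (tl t) b t1 (\ n -> trans (sym (trans (cong (_+ (tl t *ˢ b) n) (trans (cong (_* b (suc n)) t0) (zeroˡ _))) (+-identityˡ _))) (e (suc n)))

 conv-vanish : ∀ a b n -> (∀ i k -> i N.+ k ≡ n -> a i ≡ 0# ⊎ b k ≡ 0#) -> (a *ˢ b) n ≡ 0#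
 prod0 : ∀ {x y} -> x ≡ 0# ⊎ y ≡ 0# -> x * y ≡ 0#
 prod0 {x} {y} (inj₁ e) = trans (cong (_* y) e) (zeroˡ y)
 prod0 {x} {y} (inj₂ e) = trans (cong (x *_) e) (zeroʳ x)
 conv-vanish a b zero h = prod0 (h 0 0 refl)
 conv-vanish a b (suc n) h = trans (cong₂ _+_ (prod0 (h 0 (suc n) refl)) (conv-vanish (tl a) b n (\ i k e -> h (suc i) k (cong suc e)))) (+-identityʳ 0#)

 -- The tool for leading coefficients: every term of the convolution except the one at (i, k)
 -- contains a vanishing factor.
 conv-top : ∀ a b i k -> (∀ i' k' -> i' N.+ k' ≡ i N.+ k -> ¬ i' ≡ i -> a i' ≡ 0# ⊎ b k' ≡ 0#) -> (a *ˢ b) (i N.+ k) ≡ a i * b k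
 conv-top a b zero zero h = refl
 conv-top a b zero (suc k) h = trans (cong (a 0 * b (suc k) +_) (conv-vanish (tl a) b k (\ i' k' e -> h (suc i') k' (cong suc e) (\ ())))) (+-identityʳ _)
 conv-top a b (suc i) k h = trans (cong₂ _+_ (prod0 (h 0 (suc i N.+ k) refl (\ ()))) (conv-top (tl a) b i k (\ i' k' e ne -> h (suc i') k' (cong suc e) (\ { refl -> ne refl })))) (+-identityˡ _)

-- Coefficients, division and roots of polynomials.

module Poly (𝔽 : FiniteField) where
 open ≡
 open RingZ
 open Fld 𝔽
 open Ser 𝔽
 open PolyEval 𝔽 public

 coef-⊞ : ∀ p r -> coef (p ⊞ r) ≈ coef p +ˢ coef r
 coef-⊞ [] r n = sym (+-identityˡ _)
 coef-⊞ (a ∷ p) [] n = sym (+-identityʳ _)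
 coef-⊞ (a ∷ p) (b ∷ r) zero = refl
 coef-⊞ (a ∷ p) (b ∷ r) (suc n) = coef-⊞ p r n

 coef-scale : ∀ k p n -> coef (scale k p) n ≡ k * coef p n
 coef-scale k [] n = sym (zeroʳ k)
 coef-scale k (a ∷ p) zero = refl
 coef-scale k (a ∷ p) (suc n) = coef-scale k p n

 coef-⊠ : ∀ p r -> coef (p ⊠ r) ≈ coef p *ˢ coef r
 coef-⊠ [] r n = sym (trans (*ˢ-zeroˡ (coef []) (coef r) (\ _ -> refl) n) (const0≡0 n))
 coef-⊠ (a ∷ p) r zero = trans (coef-⊞ (scale a r) _ 0) (trans (+-identityʳ _) (coef-scale a r 0))
 coef-⊠ (a ∷ p) r (suc n) = trans (coef-⊞ (scale a r) _ (suc n)) (cong₂ _+_ (coef-scale a r (suc n)) (coef-⊠ p r n))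

 coef-deriv : ∀ p n -> coef (deriv p) n ≡ natF (suc n) * coef p (suc n)
 coef-deriv [] n = sym (zeroʳ _)
 coef-deriv (a ∷ p) zero = trans (coef-⊞ p (0# ∷ deriv p) 0) (trans (+-identityʳ _) (sym (trans (cong (_* coef p 0) (+-identityʳ 1#)) (*-identityˡ _))))
 coef-deriv (a ∷ p) (suc n) = trans (coef-⊞ p (0# ∷ deriv p) (suc n)) (trans (cong (coef p (suc n) +_) (coef-deriv p n))
  (solve 3 (\ o m x -> x :+ m :* x := (con (ℤ.+ 1) :+ m) :* x) refl 1# (natF (suc n)) (coef p (suc n)) ∙ cong (\ t -> (t + natF (suc n)) * coef p (suc n)) (+-identityʳ 1#)))
  where
  _∙_ : ∀ {x y z : F} -> x ≡ y -> y ≡ z -> x ≡ z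
  _∙_ = trans

 coef-≥length : ∀ p n -> length p N.≤ n -> coef p n ≡ 0#
 coef-≥length [] n _ = refl
 coef-≥length (a ∷ p) (suc n) (s≤s h) = coef-≥length p n h

 length-⊞ : ∀ {m} p r -> length p N.≤ m -> length r N.≤ m -> length (p ⊞ r) N.≤ m
 length-⊞ [] r _ h = h
 length-⊞ (a ∷ p) [] h _ = h
 length-⊞ (a ∷ p) (b ∷ r) (s≤s h) (s≤s k) = s≤s (length-⊞ p r h k)

 selfAlgebra : FAlgebra
 selfAlgebra = record { alg = FR ; ι = \ x -> x ; ι-+ = \ _ _ -> refl ; ι-* = \ _ _ -> refl ; ι-0 = refl ; ι-neg = \ _ -> refl ; ι-1 = refl }

 seriesAlgebra : FAlgebra
 seriesAlgebra = record { alg = SR ; ι = const ; ι-+ = const-+ ; ι-* = const-* ; ι-0 = \ _ -> refl ; ι-neg = const-neg ; ι-1 = \ _ -> refl }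

 module Ev = Eval selfAlgebra
 module Es = Eval seriesAlgebra

 ev : Pol -> F -> F
 ev = Ev.hev

 evalF≡ev : ∀ P x -> evalF P x ≡ ev (map intF P) x
 evalF≡ev [] x = refl
 evalF≡ev (a ∷ P) x = cong (\ t -> intF a + x * t) (evalF≡ev P x)

 NonzeroPol : Pol -> Set
 NonzeroPol p = ∃ \ k -> ¬ coef p k ≡ 0#

 -- Synthetic division by x - r: the coefficients are the successive Horner values at r.
 quotient : F -> Pol -> Pol
 quotient r [] = []
 quotient r (a ∷ []) = []
 quotient r (a ∷ b ∷ p) = ev (b ∷ p) r ∷ quotient r (b ∷ p)

 length-quotient : ∀ r p -> length (quotient r p) ≡ N.pred (length p)
 length-quotient r [] = refl
 length-quotient r (a ∷ []) = refl
 length-quotient r (a ∷ b ∷ p) = cong suc (length-quotient r (b ∷ p))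

 quotient-ev : ∀ r p x -> ev p x ≡ ev p r + (x - r) * ev (quotient r p) x
 quotient-ev r [] x = sym (trans (+-identityˡ _) (zeroʳ _))
 quotient-ev r (a ∷ []) x = solve 3 (\ a x r -> a :+ x :* con (ℤ.+ 0) := (a :+ r :* con (ℤ.+ 0)) :+ (x :- r) :* con (ℤ.+ 0)) refl a x r
 quotient-ev r (a ∷ b ∷ p) x = trans (cong (\ t -> a + x * t) (quotient-ev r (b ∷ p) x))
  (solve 5 (\ a x r e g -> a :+ x :* (e :+ (x :- r) :* g) := (a :+ r :* e) :+ (x :- r) :* (e :+ x :* g)) refl a x r (ev (b ∷ p) r) (ev (quotient r (b ∷ p)) x))

 quotient-zero : ∀ r p -> (∀ k -> coef (quotient r p) k ≡ 0#) -> ∀ k -> coef p (suc k) ≡ 0#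
 quotient-zero r [] e k = refl
 quotient-zero r (a ∷ []) e k = refl
 quotient-zero r (a ∷ b ∷ p) e (suc k) = quotient-zero r (b ∷ p) (\ k -> e (suc k)) k
 quotient-zero r (a ∷ b ∷ p) e zero = trans (sym (trans (cong (b +_) (trans (cong (r *_) (Ev.hev-zero p r (quotient-zero r (b ∷ p) (\ k -> e (suc k))))) (zeroʳ r))) (+-identityʳ b))) (e 0)

 all-zero? : ∀ p -> (∀ k -> coef p k ≡ 0#) ⊎ NonzeroPol p
 all-zero? [] = inj₁ (\ _ -> refl)
 all-zero? (a ∷ p) with a ≟ 0# | all-zero? p
 ... | no ne | _ = inj₂ (0 , ne)
 ... | yes e | inj₁ z = inj₁ (\ { zero -> e ; (suc k) -> z k })
 ... | yes e | inj₂ (k , n) = inj₂ (suc k , n)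

 -- Divide by x - r; the other listed roots are roots of the quotient because x - r is nonzero
 -- there. A vanishing quotient would leave a constant polynomial with root r, that is, zero.
 roots-bound : ∀ p -> NonzeroPol p -> ∀ xs -> Unique xs -> All (\ x -> ev p x ≡ 0#) xs -> length xs N.< length p
 roots-bound p nz xs = go (length p) p refl nz xs
  where
  go : ∀ n p -> length p ≡ n -> NonzeroPol p -> ∀ xs -> Unique xs -> All (\ x -> ev p x ≡ 0#) xs -> length xs N.< n
  go zero [] _ (k , ne) xs u a = ⊥-elim (ne refl)
  go (suc n) p l nz [] u a = s≤s z≤n
  go (suc n) p l nz (r ∷ xs) (u ∷ us) (e ∷ a) with all-zero? (quotient r p)
  ... | inj₁ z = ⊥-elim (proj₂ nz (zero-all (proj₁ nz)))
   where
   zero-all : ∀ k -> coef p k ≡ 0#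
   zero-all (suc k) = quotient-zero r p z k
   zero-all zero = const-term p (quotient-zero r p z) e
    where
    const-term : ∀ p -> (∀ k -> coef p (suc k) ≡ 0#) -> ev p r ≡ 0# -> coef p 0 ≡ 0#
    const-term [] z e = refl
    const-term (a ∷ p) z e = trans (sym (trans (cong (a +_) (trans (cong (r *_) (Ev.hev-zero p r z)) (zeroʳ r))) (+-identityʳ a))) e
  ... | inj₂ nz' = s≤s (go n (quotient r p) (trans (length-quotient r p) (cong N.pred l)) nz' xs us (roots u a))
   where
   roots : ∀ {ys} -> All (\ y -> ¬ r ≡ y) ys -> All (\ x -> ev p x ≡ 0#) ys -> All (\ x -> ev (quotient r p) x ≡ 0#) ys
   roots [] [] = []
   roots (ne ∷ u) (e' ∷ a) = *-cancelˡ-0 (\ d -> ne (sym (sub-≡ d)))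
     (trans (sym (trans (cong₂ _+_ e refl) (+-identityˡ _))) (trans (sym (quotient-ev r p _)) e')) ∷ roots u a

 lst : ℕ -> (ℕ -> F) -> Pol
 lst zero f = []
 lst (suc n) f = f 0 ∷ lst n (\ i -> f (suc i))

 length-lst : ∀ n f -> length (lst n f) ≡ n
 length-lst zero f = refl
 length-lst (suc n) f = cong suc (length-lst n _)

 coef-lst : ∀ n f i -> i N.< n -> coef (lst n f) i ≡ f i
 coef-lst (suc n) f zero _ = refl
 coef-lst (suc n) f (suc i) (s≤s h) = coef-lst n _ i h

 coef-lst-≥ : ∀ n f i -> n N.≤ i -> coef (lst n f) i ≡ 0#
 coef-lst-≥ n f i h = coef-≥length (lst n f) i (≤∙ (≡⇒≤ (length-lst n f)) h)

 length-deriv : ∀ p -> length (deriv p) N.≤ length p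
 length-deriv [] = z≤n
 length-deriv (a ∷ p) = length-⊞ p (0# ∷ deriv p) (n≤1+n _) (s≤s (length-deriv p))

-- Sums over the field and changes of variable.

module FSum (𝔽 : FiniteField) (𝕆 : OrderedRing) where
 open import Data.Fin.Permutation using (Permutation; permutation)
 open ≡
 import Algebra.Properties.CommutativeMonoid.Sum as CMS
 open Summation 𝕆 public
 private module K = Fld 𝔽
 open K public using (F; q; els; element; index; _≟_) renaming (_+_ to _⊕_; _*_ to _⊗_; -_ to ⊖_; 0# to 𝟘; 1# to 𝟙; _-_ to _⊝_)

 open CMS (CommutativeRing.+-commutativeMonoid commutativeRing) using (sum; sum-permute; sum-cong-≗)

 S : (F -> Z) -> Z
 S = Σ els

 private
  Σ-tabulate : ∀ {n} (e : Fin n -> F) (f : F -> Z) -> Σ (tabulate e) f ≡ sum (\ i -> f (e i))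
  Σ-tabulate {zero} e f = refl
  Σ-tabulate {suc n} e f = cong (f (e Fin.zero) +_) (Σ-tabulate (\ i -> e (Fin.suc i)) f)

  sum-δ : ∀ {n} (j : Fin n) (g : Fin n -> Z) -> sum (\ i -> ind (j Fin.≟ i) * g i) ≡ g j
  sum-0 : ∀ {n} (g : Fin n -> Z) -> (∀ i -> g i ≡ 0z) -> sum g ≡ 0z
  sum-0 {zero} g e = refl
  sum-0 {suc n} g e = trans (cong₂ _+_ (e Fin.zero) (sum-0 _ (\ i -> e (Fin.suc i)))) (+-identityʳ _)
  sum-δ {suc n} Fin.zero g = trans (cong₂ _+_ (*-identityˡ _) (sum-0 {n} _ (\ i -> zeroˡ (g (Fin.suc i))))) (+-identityʳ _)
  sum-δ {suc n} (Fin.suc j) g = trans (cong₂ _+_ (zeroˡ _) (trans (sum-cong-≗ {n} (\ i -> cong (_* g (Fin.suc i))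
    (ind-cong (Fin.suc j Fin.≟ Fin.suc i) (j Fin.≟ i) (\ { refl -> refl }) (cong Fin.suc)))) (sum-δ j (\ i -> g (Fin.suc i))))) (+-identityˡ _)

 S-perm : (σ τ : F -> F) -> (∀ x -> σ (τ x) ≡ x) -> (∀ x -> τ (σ x) ≡ x) -> ∀ f -> S (\ x -> f (σ x)) ≡ S f
 S-perm σ τ στ τσ f = trans (Σ-tabulate element (\ x -> f (σ x))) (trans
   (sum-cong-≗ {q} (\ i -> cong f (sym (K.element-index (σ (element i))))))
   (trans (sym (sum-permute (\ i -> f (element i)) π)) (sym (Σ-tabulate element f))))
  where
  π : Permutation q q
  π = permutation (\ i -> index (σ (element i))) (\ i -> index (τ (element i)))
   (\ i -> trans (cong (\ z -> index (σ z)) (K.element-index _)) (trans (cong index (στ _)) (K.index-element i)))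
   (\ i -> trans (cong (\ z -> index (τ z)) (K.element-index _)) (trans (cong index (τσ _)) (K.index-element i)))

 S-shift : ∀ a f -> S (\ x -> f (x ⊕ a)) ≡ S f
 S-shift a = S-perm (_⊕ a) (_⊕ (⊖ a)) (\ x -> K.solve 2 (\ x a -> (x K.:+ K.:- a) K.:+ a K.:= x) refl x a)
                    (\ x -> K.solve 2 (\ x a -> (x K.:+ a) K.:+ K.:- a K.:= x) refl x a)

 S-shiftˡ : ∀ a f -> S (\ x -> f (a ⊕ x)) ≡ S f
 S-shiftˡ a f = trans (Σ-cong els (\ x -> cong f (K.+-comm a x))) (S-shift a f)

 S-δ : ∀ a f -> S (\ x -> ind (a ≟ x) * f x) ≡ f a
 S-δ a f = trans (Σ-tabulate element _) (trans (sum-cong-≗ {q} (\ i -> cong (_* f (element i))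
   (ind-cong (a ≟ element i) (index a Fin.≟ i) (\ { refl -> K.index-element i })
    (\ { refl -> sym (K.element-index a) })))) (trans (sum-δ (index a) (\ i -> f (element i))) (cong f (K.element-index a))))

 S-const : ∀ k -> S (\ _ -> k) ≡ nat q * k
 S-const k = trans (Σ-const els k) (cong (\ n -> nat n * k) K.length-els)

-- Autocorrelations, dual functions and positive definiteness.

module Analysis (𝔽 : FiniteField) (𝕆 : OrderedRing) where
 open ≡
 open FSum 𝔽 𝕆
 private module K = Fld 𝔽

 n : (F -> Z) -> Z
 n f = S (\ x -> f x * f x)

 c : (F -> Z) -> F -> Z
 c f u = S (\ x -> f x * f (x ⊕ u))

 D : (F -> F) -> F -> F -> F
 D P y z = P z ⊝ P y

 n-nonneg : ∀ f -> 0z ≤ n f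
 n-nonneg f = Σ-nonneg els (\ x -> sq-nonneg (f x))

 c-𝟘 : ∀ f -> c f 𝟘 ≡ n f
 c-𝟘 f = Σ-cong els (\ x -> cong (\ y -> f x * f y) (K.+-identityʳ x))

 c-cong : ∀ {f g : F -> Z} -> (∀ x -> f x ≡ g x) -> ∀ u -> c f u ≡ c g u
 c-cong e u = Σ-cong els (\ x -> cong₂ _*_ (e x) (e (x ⊕ u)))

 c-abs : ∀ f u -> ∣ c f u ∣ ≤ n f
 c-abs f u = abs-≤ (sq-cancel-≤ (n-nonneg f) cs) (sq-cancel-≤ (n-nonneg f)
   (subst (_≤ n f * n f) (solve 1 (\ a -> a :* a := (:- a) :* (:- a)) refl (c f u)) cs))
  where
  cs : c f u * c f u ≤ n f * n f
  cs = subst (\ t -> c f u * c f u ≤ n f * t) (S-shift u (\ x -> f x * f x)) (cauchy-schwarz els f (\ x -> f (x ⊕ u)))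

 sq-S : ∀ a -> S a * S a ≡ S (c a)
 sq-S a = trans (sym (Σ-*ʳ els (S a) a)) (trans (Σ-cong els (\ x ->
   trans (cong (a x *_) (sym (S-shiftˡ x a))) (sym (Σ-*ˡ els (a x) _)))) (Σ-swap els els _))

 cs1 : ∀ a -> S a * S a ≤ nat q * S (\ x -> a x * a x)
 cs1 a = subst₂ _≤_ (cong₂ _*_ e e) (cong₂ _*_ (trans (S-const (1z * 1z)) (trans (cong (nat q *_) (*-identityˡ 1z)) (*-identityʳ _))) refl)
   (cauchy-schwarz els (\ _ -> 1z) a)
  where
  e : S (\ x -> 1z * a x) ≡ S a
  e = Σ-cong els (\ x -> *-identityˡ (a x))

 -- Summing over the translation v decouples d from φ. All product formulas for correlations below
 -- come from this one.
 mix : ∀ d φ u -> S (\ v -> c (\ w -> d w * φ (w ⊕ v)) u) ≡ c d u * c φ u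
 mix d φ u = trans (Σ-swap els els _) (trans (Σ-cong els inner) (Σ-*ʳ els (c φ u) _))
  where
  inner : ∀ w -> S (\ v -> (d w * φ (w ⊕ v)) * (d (w ⊕ u) * φ ((w ⊕ u) ⊕ v))) ≡ (d w * d (w ⊕ u)) * c φ u
  inner w = trans (Σ-cong els (\ v -> trans
    (solve 4 (\ a b e f -> (a :* b) :* (e :* f) := (a :* e) :* (b :* f)) refl (d w) (φ (w ⊕ v)) (d (w ⊕ u)) (φ ((w ⊕ u) ⊕ v)))
    (cong (\ t -> (d w * d (w ⊕ u)) * (φ (w ⊕ v) * φ t)) (K.solve 3 (\ w u v -> (w K.:+ u) K.:+ v K.:= (w K.:+ v) K.:+ u) refl w u v))))
   (trans (Σ-*ˡ els _ _) (cong ((d w * d (w ⊕ u)) *_) (S-shiftˡ w (\ x -> φ x * φ (x ⊕ u)))))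

 -- The substitute for Plancherel: a pairing of two autocorrelations is a sum of squares, just as it
 -- would be the pairing of two nonnegative Fourier transforms.
 corr2 : ∀ d φ -> S (\ v -> S (\ w -> d w * φ (w ⊕ v)) * S (\ w -> d w * φ (w ⊕ v))) ≡ S (\ u -> c d u * c φ u)
 corr2 d φ = trans (Σ-cong els (\ v -> sq-S (\ w -> d w * φ (w ⊕ v)))) (trans (Σ-swap els els _) (Σ-cong els (mix d φ)))

 c-shift : ∀ φ a b -> S (\ x -> φ (x ⊕ a) * φ (x ⊕ b)) ≡ c φ (b ⊝ a)
 c-shift φ a b = trans (Σ-cong els (\ x -> cong (\ t -> φ (x ⊕ a) * φ t)
   (K.solve 3 (\ x a b -> x K.:+ b K.:= (x K.:+ a) K.:+ (b K.:- a)) refl x a b)))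
  (S-shift a (\ x -> φ x * φ (x ⊕ (b ⊝ a))))

 -- N P R f g h counts configurations (x, x + P y, x + R y) with weights f, g, h, and
 -- dual P R f g represents N P R f g as a linear form in the third weight.

 N : (P R : F -> F) (f g h : F -> Z) -> Z
 N P R f g h = S (\ x -> S (\ y -> f x * g (x ⊕ P y) * h (x ⊕ R y)))

 dual : (P R : F -> F) (f g : F -> Z) -> F -> Z
 dual P R f g w = S (\ y -> f (w ⊝ R y) * g ((w ⊝ R y) ⊕ P y))

 -- The projection to mean zero, multiplied by q in order to stay in the ring.
 proj : (F -> Z) -> F -> Z
 proj φ x = nat q * φ x - S φ

 pdual : (P R : F -> F) (f g : F -> Z) -> F -> Z
 pdual P R f g = proj (dual P R f g)

 dual-N : ∀ P R f g h -> S (\ w -> dual P R f g w * h w) ≡ N P R f g h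
 dual-N P R f g h = trans (Σ-cong els (\ w -> sym (Σ-*ʳ els (h w) _))) (trans (Σ-swap els els _)
  (trans (Σ-cong els (\ y -> trans (sym (S-shift (R y) (\ w -> f (w ⊝ R y) * g ((w ⊝ R y) ⊕ P y) * h w))) (Σ-cong els (\ x -> cong (\ s -> f s * g (s ⊕ P y) * h (x ⊕ R y)) (e x y)))))
  (Σ-swap els els _)))
  where
  e : ∀ x y -> (x ⊕ R y) ⊝ R y ≡ x
  e x y = K.solve 2 (\ x r -> (x K.:+ r) K.:- r K.:= x) refl x (R y)

 S-proj : ∀ φ -> S (proj φ) ≡ 0z
 S-proj φ = trans (Σ-sub els _ _) (trans (cong₂ _-_ (Σ-*ˡ els (nat q) φ) (S-const (S φ))) (-‿inverseʳ _))

 proj-pair : ∀ φ h -> S (\ x -> proj φ x * h x) ≡ nat q * S (\ x -> φ x * h x) - S φ * S h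
 proj-pair φ h = trans (Σ-cong els (\ x -> solve 4 (\ a b s t -> (a :* b :- s) :* t := a :* (b :* t) :- s :* t) refl (nat q) (φ x) (S φ) (h x)))
  (trans (Σ-sub els _ _) (cong₂ _-_ (Σ-*ˡ els (nat q) _) (Σ-*ˡ els (S φ) h)))

 n-proj : ∀ φ -> n (proj φ) ≤ nat q * nat q * n φ
 n-proj φ = ≤-by (nat q * (S φ * S φ)) (trans (cong (\ t -> nat q * nat q * n φ - t) eq)
    (solve 3 (\ a m s -> a :* a :* m :- (a :* (a :* m :- s :* s)) := a :* (s :* s)) refl (nat q) (n φ) (S φ)))
   (*-nonneg (nat-nonneg q) (sq-nonneg (S φ)))
  where
  eq : n (proj φ) ≡ nat q * (nat q * n φ - S φ * S φ)
  eq = trans (proj-pair φ (proj φ)) (trans (cong₂ _-_ (cong (nat q *_) (trans (Σ-cong els (\ x -> *-comm (φ x) (proj φ x))) (proj-pair φ φ)))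
     (trans (cong (S φ *_) (S-proj φ)) (zeroʳ _)))
    (solve 3 (\ a m s -> a :* (a :* m :- s) :- con (ℤ.+ 0) := a :* (a :* m :- s)) refl (nat q) (n φ) (S φ * S φ)))

 pdual-N : ∀ P R f g h -> S h ≡ 0z -> S (\ w -> pdual P R f g w * h w) ≡ nat q * N P R f g h
 pdual-N P R f g h Sh = trans (proj-pair (dual P R f g) h) (trans (cong₂ _-_ (cong (nat q *_) (dual-N P R f g h))
   (trans (cong (S (dual P R f g) *_) Sh) (zeroʳ _)))
  (solve 1 (\ a -> a :- con (ℤ.+ 0) := a) refl (nat q * N P R f g h)))

 -- Test the projected dual function against itself: since it has mean zero, the projection may be
 -- dropped in one factor, which turns the norm into another count to which the next duality step
 -- applies.
 n-pdual : ∀ P R f g -> n (pdual P R f g) ≡ nat q * N P R f g (pdual P R f g)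
 n-pdual P R f g = pdual-N P R f g (pdual P R f g) (S-proj _)

 N-pdual : ∀ P R f g h -> S h ≡ 0z ->
  (nat q * N P R f g h) * (nat q * N P R f g h) ≤ n (pdual P R f g) * n h
 N-pdual P R f g h Sh = subst (\ t -> t * t ≤ n (pdual P R f g) * n h) (pdual-N P R f g h Sh)
  (cauchy-schwarz els (pdual P R f g) h)

 N-swap : ∀ P R f g h -> N P R f g h ≡ N R P f h g
 N-swap P R f g h = Σ-cong els (\ x -> Σ-cong els (\ y ->
  solve 3 (\ a b e -> a :* b :* e := a :* e :* b) refl (f x) (g (x ⊕ P y)) (h (x ⊕ R y))))

 -- Translating x by -P(y) makes the second point the base point, so that each of the three weights
 -- can be moved to the place that is dualised.
 N-rotate : ∀ P R f g h -> N P R f g h ≡ N (\ y -> R y ⊝ P y) (\ y -> ⊖ P y) g h f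
 N-rotate P R f g h = trans (Σ-swap els els _) (trans (Σ-cong els (\ y -> trans (sym (S-shift (⊖ P y) _)) (Σ-cong els (\ x -> step x y))))
  (Σ-swap els els _))
  where
  step : ∀ x y -> f (x ⊕ (⊖ P y)) * g ((x ⊕ (⊖ P y)) ⊕ P y) * h ((x ⊕ (⊖ P y)) ⊕ R y) ≡ g x * h (x ⊕ (R y ⊝ P y)) * f (x ⊕ (⊖ P y))
  step x y = trans (cong₂ (\ s t -> f (x ⊕ (⊖ P y)) * g s * h t)
     (K.solve 2 (\ x p -> (x K.:+ K.:- p) K.:+ p K.:= x) refl x (P y))
     (K.solve 3 (\ x p r -> (x K.:+ K.:- p) K.:+ r K.:= x K.:+ (r K.:- p)) refl x (P y) (R y)))
    (solve 3 (\ a b e -> a :* b :* e := b :* e :* a) refl (f (x ⊕ (⊖ P y))) (g x) (h (x ⊕ (R y ⊝ P y))))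

 -- The cone generated by autocorrelations. It stands for the functions with nonnegative Fourier
 -- transform.
 data PD : (F -> Z) -> Set where
  corr : ∀ φ {ω} -> (∀ u -> ω u ≡ c φ u) -> PD ω
  sums : ∀ {ω : F -> F -> Z} {ω'} -> (∀ s -> PD (ω s)) -> (∀ u -> ω' u ≡ S (\ s -> ω s u)) -> PD ω'

 -- Both sides are additive in ω, so an inequality tested on autocorrelations extends to the cone
 -- they generate.
 PD-dominate : ∀ (m₁ m2 : F -> Z) -> (∀ φ -> S (\ u -> m₁ u * c φ u) ≤ S (\ u -> m2 u * c φ u)) ->
  ∀ {ω} -> PD ω -> S (\ u -> m₁ u * ω u) ≤ S (\ u -> m2 u * ω u)
 PD-dominate m₁ m2 h (corr φ e) = subst₂ _≤_ (Σ-cong els (\ u -> cong (m₁ u *_) (sym (e u)))) (Σ-cong els (\ u -> cong (m2 u *_) (sym (e u)))) (h φ)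
 PD-dominate m₁ m2 h (sums {ω} {ω'} p e) = subst₂ _≤_ (sym (eq m₁)) (sym (eq m2)) (Σ-mono els (\ s -> PD-dominate m₁ m2 h (p s)))
  where
  eq : ∀ m -> S (\ u -> m u * ω' u) ≡ S (\ s -> S (\ u -> m u * ω s u))
  eq m = trans (Σ-cong els (\ u -> trans (cong (m u *_) (e u)) (sym (Σ-*ˡ els (m u) _)))) (Σ-swap els els _)

 -- The analogue of the Schur product theorem: by `mix`, a product of two autocorrelations is a sum
 -- of autocorrelations.
 PD-mul : ∀ {ω} φ -> PD ω -> PD (\ u -> ω u * c φ u)
 PD-mul φ (corr ψ e) = sums {ω = \ v -> c (\ w -> ψ w * φ (w ⊕ v))} (\ v -> corr _ (\ u -> refl))
   (\ u -> trans (cong (_* c φ u) (e u)) (sym (mix ψ φ u)))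
 PD-mul φ (sums {ω} p e) = sums {ω = \ s u -> ω s u * c φ u} (\ s -> PD-mul φ (p s)) (\ u -> trans (cong (_* c φ u) (e u)) (sym (Σ-*ʳ els (c φ u) _)))

 L : (P R : F -> F) (α ω : F -> Z) -> Z
 L P R α ω = S (\ y -> S (\ z -> α (D P y z) * ω (D R y z)))

 -- The function that represents `L P R α ω` as a linear form in α: it transports ω from differences
 -- of R to differences of P.
 κ : (P R : F -> F) (ω : F -> Z) -> F -> Z
 κ P R ω u = S (\ y -> S (\ z -> ind (D P y z ≟ u) * ω (D R y z)))

 L-κ : ∀ P R α ω -> S (\ u -> α u * κ P R ω u) ≡ L P R α ω
 L-κ P R α ω = trans (Σ-cong els (\ u -> trans (sym (Σ-*ˡ els (α u) _)) (Σ-cong els (\ y -> sym (Σ-*ˡ els (α u) _)))))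
  (trans (Σ-swap els els _) (Σ-cong els (\ y -> trans (Σ-swap els els _) (Σ-cong els (\ z ->
   trans (Σ-cong els (\ u -> solve 3 (\ a i w -> a :* (i :* w) := i :* (a :* w)) refl (α u) (ind (D P y z ≟ u)) (ω (D R y z))))
    (S-δ (D P y z) (\ u -> α u * ω (D R y z))))))))

 -- For ω = c_φ the transported function is the sum over x of the autocorrelations of s ↦ Σ φ(x +
 -- R(y)), taken over the y with P(y) = s.
 PD-κ : ∀ P R {ω} -> PD ω -> PD (κ P R ω)
 PD-κ P R (sums {ω} {ω'} p e) = sums {ω = \ s -> κ P R (ω s)} (\ s -> PD-κ P R (p s))
  (\ u -> trans (Σ-cong els (\ y -> trans (Σ-cong els (\ z -> trans (cong (ind (D P y z ≟ u) *_) (e _)) (sym (Σ-*ˡ els _ _)))) (Σ-swap els els _))) (Σ-swap els els _))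
 PD-κ P R {ω} (corr φ e) = sums {ω = \ x -> c (χ x)} (\ x -> corr _ (\ u -> refl)) main
  where
  χ : F -> F -> Z
  χ x s = S (\ y -> ind (P y ≟ s) * φ (x ⊕ R y))
  χχ : ∀ x u -> c (χ x) u ≡ S (\ y -> S (\ z -> ind (D P y z ≟ u) * (φ (x ⊕ R y) * φ (x ⊕ R z))))
  χχ x u = trans (Σ-cong els (\ s -> trans (sym (Σ-*ʳ els (χ x (s ⊕ u)) _)) (Σ-cong els (\ y -> *-assoc _ _ _))))
   (trans (Σ-swap els els _) (Σ-cong els (\ y -> trans (S-δ (P y) (\ s -> φ (x ⊕ R y) * χ x (s ⊕ u)))
    (trans (sym (Σ-*ˡ els (φ (x ⊕ R y)) _)) (Σ-cong els (\ z -> trans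
     (solve 3 (\ a i b -> a :* (i :* b) := i :* (a :* b)) refl (φ (x ⊕ R y)) (ind (P z ≟ P y ⊕ u)) (φ (x ⊕ R z)))
     (cong (_* (φ (x ⊕ R y) * φ (x ⊕ R z))) (ind-cong (P z ≟ P y ⊕ u) (D P y z ≟ u)
      (\ eq -> trans (cong (_⊝ P y) eq) (K.solve 2 (\ p u -> (p K.:+ u) K.:- p K.:= u) refl (P y) u))
      (\ eq -> trans (K.solve 2 (\ p r -> r K.:= p K.:+ (r K.:- p)) refl (P y) (P z)) (cong (P y ⊕_) eq))))))))))
  main : ∀ u -> κ P R ω u ≡ S (\ x -> c (χ x) u)
  main u = sym (trans (Σ-cong els (\ x -> χχ x u)) (trans (Σ-swap els els _) (Σ-cong els (\ y -> trans (Σ-swap els els _) (Σ-cong els (\ z ->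
    trans (Σ-*ˡ els _ _) (cong (ind (D P y z ≟ u) *_) (trans (c-shift φ (R y) (R z)) (sym (e _))))))))))

 sq-L : ∀ P R g φ -> S (\ x -> S (\ x' -> S (\ y -> g (x ⊕ P y) * φ (x' ⊕ R y)) * S (\ y -> g (x ⊕ P y) * φ (x' ⊕ R y)))) ≡ L P R (c g) (c φ)
 sq-L P R g φ = trans (Σ-cong els (\ x -> Σ-cong els (\ x' -> sym (Σ-mul els els _ _))))
  (trans (Σ-cong els (\ x -> trans (Σ-swap els els _) (Σ-cong els (\ y -> Σ-swap els els _))))
  (trans (Σ-swap els els _) (Σ-cong els (\ y -> trans (Σ-swap els els _) (Σ-cong els (\ z ->
   trans (Σ-cong els (\ x -> trans (Σ-cong els (\ x' -> solve 4 (\ a b e f -> (a :* b) :* (e :* f) := (a :* e) :* (b :* f)) refl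
     (g (x ⊕ P y)) (φ (x' ⊕ R y)) (g (x ⊕ P z)) (φ (x' ⊕ R z)))) (Σ-*ˡ els _ _)))
    (trans (Σ-*ʳ els _ _) (cong₂ _*_ (c-shift g (P y) (P z)) (c-shift φ (R y) (R z))))))))))

 module _ (P R : F -> F) (f g : F -> Z) where

  private
   Q² : Z
   Q² = nat q * nat q
   ψ : (F -> Z) -> F -> Z
   ψ φ v = S (\ w -> dual P R f g w * φ (w ⊕ v))

   proj-ψ : ∀ φ v -> S (\ w -> pdual P R f g w * φ (w ⊕ v)) ≡ proj (ψ φ) v
   proj-ψ φ v = trans (proj-pair (dual P R f g) (\ w -> φ (w ⊕ v))) (cong (\ t -> nat q * ψ φ v - t) (sym
     (trans (Σ-swap els els _) (trans (Σ-cong els (\ w -> trans (Σ-*ˡ els _ _) (cong (dual P R f g w *_) (trans (S-shiftˡ w φ) (sym (S-shift v φ))))))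
      (Σ-*ʳ els _ _)))))

   reduce : ∀ φ -> S (\ u -> c (pdual P R f g) u * c φ u) ≤ Q² * n (ψ φ)
   reduce φ = subst (_≤ Q² * n (ψ φ)) (trans (Σ-cong els (\ v -> cong₂ _*_ (sym (proj-ψ φ v)) (sym (proj-ψ φ v)))) (corr2 (pdual P R f g) φ)) (n-proj (ψ φ))

   ψ-N : ∀ φ v -> ψ φ v ≡ S (\ x -> S (\ y -> f x * g (x ⊕ P y) * φ ((x ⊕ R y) ⊕ v)))
   ψ-N φ v = dual-N P R f g (\ w -> φ (w ⊕ v))

   T : (F -> Z) -> F -> F -> Z
   T φ x x' = S (\ y -> g (x ⊕ P y) * φ (x' ⊕ R y))

   ψ-T : ∀ φ v -> ψ φ v ≡ S (\ x -> f x * T φ x (x ⊕ v))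
   ψ-T φ v = trans (ψ-N φ v) (Σ-cong els (\ x -> trans (Σ-cong els (\ y -> trans (*-assoc _ _ _) (cong (\ t -> f x * (g (x ⊕ P y) * φ t))
     (K.solve 3 (\ x r v -> (x K.:+ r) K.:+ v K.:= (x K.:+ v) K.:+ r) refl x (R y) v)))) (Σ-*ˡ els _ _)))

  -- For ω = c_φ the left side is the squared norm of a projection of `ψ φ`. Dropping the projection
  -- costs q², and since `ψ φ v` is Σ_x f(x) T(x, x + v), Cauchy-Schwarz removes f and leaves a form
  -- in g and φ alone.
  dual-L : ∀ {ω} -> PD ω -> S (\ u -> c (pdual P R f g) u * ω u) ≤ Q² * n f * L P R (c g) ω
  dual-L {ω} pd = subst (S (\ u -> c (pdual P R f g) u * ω u) ≤_) (eq ω) (PD-dominate _ (\ u -> Q² * n f * κ R P (c g) u)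
     (\ φ -> ≤-trans (reduce φ) (subst (Q² * n (ψ φ) ≤_) (sym (eq (c φ))) (subst (Q² * n (ψ φ) ≤_) (sym (*-assoc _ _ _)) (*-monoˡ (*-nonneg (nat-nonneg q) (nat-nonneg q)) (bound φ))))) pd)
   where
   eq : ∀ ω -> S (\ u -> Q² * n f * κ R P (c g) u * ω u) ≡ Q² * n f * L P R (c g) ω
   eq ω = trans (Σ-cong els (\ u -> trans (*-assoc _ _ _) (cong (Q² * n f *_) (*-comm _ _)))) (trans (Σ-*ˡ els _ _) (cong (Q² * n f *_)
    (trans (L-κ R P ω (c g)) (Σ-cong els (\ y -> Σ-cong els (\ z -> *-comm _ _))))))
   bound : ∀ φ -> n (ψ φ) ≤ n f * L P R (c g) (c φ)
   bound φ = ≤-trans (Σ-mono els (\ v -> subst (\ t -> t * t ≤ n f * S (\ x -> T φ x (x ⊕ v) * T φ x (x ⊕ v))) (sym (ψ-T φ v)) (cauchy-schwarz els f (\ x -> T φ x (x ⊕ v)))))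
    (≤-reflexive (trans (Σ-*ˡ els _ _) (cong (n f *_) (trans (Σ-swap els els _) (trans (Σ-cong els (\ x -> S-shiftˡ x (\ x' -> T φ x x' * T φ x x'))) (sq-L P R g φ))))))

  -- The companion of `dual-L` with Cauchy-Schwarz taken over y instead. Summing over v makes the
  -- shift by R(y) disappear, and the fibre bound for P lets the values P(y) be replaced by a free
  -- variable s; the correlations of f and of g both survive.
  dual-fibre : ∀ d -> 0z ≤ d -> (∀ s -> S (\ y -> ind (P y ≟ s)) ≤ d) -> ∀ {ω} -> PD ω ->
   S (\ u -> c (pdual P R f g) u * ω u) ≤ S (\ u -> Q² * (nat q * d) * (c f u * c g u) * ω u)
  dual-fibre d 0≤d fib = PD-dominate _ _ (\ φ -> ≤-trans (reduce φ) (subst (Q² * n (ψ φ) ≤_) (sym (eq φ)) (*-monoˡ (*-nonneg (nat-nonneg q) (nat-nonneg q)) (bound φ))))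
   where
   M : (F -> Z) -> Z
   M φ = S (\ u -> c f u * c g u * c φ u)
   eq : ∀ φ -> S (\ u -> Q² * (nat q * d) * (c f u * c g u) * c φ u) ≡ Q² * (nat q * (d * M φ))
   eq φ = trans (Σ-cong els (\ u -> *-assoc _ _ _)) (trans (Σ-*ˡ els _ _) (solve 4 (\ a b e m -> a :* (b :* e) :* m := a :* (b :* (e :* m))) refl Q² (nat q) d (M φ)))
   k : (F -> Z) -> F -> F -> Z
   k φ s v = S (\ x -> (f x * g (x ⊕ s)) * φ (x ⊕ v))
   ψ-k : ∀ φ v -> ψ φ v ≡ S (\ y -> k φ (P y) (R y ⊕ v))
   ψ-k φ v = trans (ψ-N φ v) (trans (Σ-swap els els _) (Σ-cong els (\ y -> Σ-cong els (\ x -> cong (\ t -> f x * g (x ⊕ P y) * φ t) (K.+-assoc x (R y) v)))))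
   k² : (F -> Z) -> F -> Z
   k² φ s = S (\ v -> k φ s v * k φ s v)
   sum-k² : ∀ φ -> S (k² φ) ≡ M φ
   sum-k² φ = trans (Σ-cong els (\ s -> corr2 (\ x -> f x * g (x ⊕ s)) φ)) (trans (Σ-swap els els _) (Σ-cong els (\ u -> trans (Σ-*ʳ els (c φ u) _) (cong (_* c φ u) (mix f g u)))))
   fibre : ∀ (h : F -> Z) -> (∀ s -> 0z ≤ h s) -> S (\ y -> h (P y)) ≤ d * S h
   fibre h 0≤h = subst₂ _≤_ (sym (trans (Σ-cong els (\ y -> sym (S-δ (P y) h))) (Σ-swap els els _))) (Σ-*ˡ els d h)
    (Σ-mono els (\ s -> subst (_≤ d * h s) (sym (Σ-*ʳ els (h s) _)) (*-monoʳ (0≤h s) (fib s))))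
   bound : ∀ φ -> n (ψ φ) ≤ nat q * (d * M φ)
   bound φ = ≤-trans (Σ-mono els (\ v -> subst (\ t -> t * t ≤ nat q * S (\ y -> k φ (P y) (R y ⊕ v) * k φ (P y) (R y ⊕ v))) (sym (ψ-k φ v)) (cs1 _)))
    (≤-trans (≤-reflexive (trans (Σ-*ˡ els _ _) (cong (nat q *_) (trans (Σ-swap els els _) (Σ-cong els (\ y -> S-shiftˡ (R y) (\ v -> k φ (P y) v * k φ (P y) v)))))))
     (*-monoˡ (nat-nonneg q) (subst (\ t -> S (\ y -> k² φ (P y)) ≤ d * t) (sum-k² φ) (fibre (k² φ) (\ s -> Σ-nonneg els (\ v -> sq-nonneg _))))))

-- Correlation sums along polynomial maps.

module Analysis2 (𝔽 : FiniteField) (𝕆 : OrderedRing) where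
 open import Data.Product.Properties using (≡-dec)
 open ≡ hiding (J)
 open FSum 𝔽 𝕆
 open Analysis 𝔽 𝕆
 private module K = Fld 𝔽

 1≤nat : ∀ {m} -> Fin m -> 1z ≤ nat m
 1≤nat {suc m} _ = ≤-by (nat m) (solve 2 (\ a b -> (a :+ b) :- a := b) refl 1z (nat m)) (nat-nonneg m)

 1≤q : 1z ≤ nat q
 1≤q = 1≤nat (index 𝟘)

 -- The left side is Σ_x (Σ_y ψ(x + f(y)))². In terms of additive characters, Λ corresponds to a
 -- bound for the squared exponential sum of f at every nontrivial character; the trivial value is
 -- q².
 LinBound : (F -> F) -> Z -> Set
 LinBound f Λ = ∀ ψ -> S ψ ≡ 0z -> S (\ y -> S (\ z -> c ψ (D f y z))) ≤ Λ * n ψ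

 -- For e ≠ 0 the points a + b e run through all of F, and the correlations of a mean-zero g sum to
 -- (Σ g)² = 0.
 S-line : ∀ g -> S g ≡ 0z -> ∀ a e -> S (\ b -> c g (a ⊕ b ⊗ e)) ≡ ind (e ≟ 𝟘) * (nat q * c g a)
 S-line g Sg a e with e ≟ 𝟘
 ... | yes refl = trans (Σ-cong els (\ b -> cong (c g) (trans (cong (a ⊕_) (K.zeroʳ b)) (K.+-identityʳ a)))) (trans (S-const _) (sym (*-identityˡ _)))
 ... | no ne = trans (S-perm (\ b -> a ⊕ b ⊗ e) (\ x -> (x ⊝ a) ⊗ K.inv e)
    (\ x -> trans (cong (a ⊕_) (trans (K.*-assoc _ _ _) (trans (cong ((x ⊝ a) ⊗_) (K.inv-l ne)) (K.*-identityʳ _)))) (K.solve 2 (\ a x -> a K.:+ (x K.:- a) K.:= x) refl a x))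
    (\ b -> trans (cong (_⊗ K.inv e) (K.solve 2 (\ a x -> (a K.:+ x) K.:- a K.:= x) refl a (b ⊗ e))) (trans (K.*-assoc _ _ _) (trans (cong (b ⊗_) (K.inv-r ne)) (K.*-identityʳ b)))) (c g))
   (trans (sym (sq-S g)) (trans (cong₂ _*_ Sg Sg) (trans (zeroˡ 0z) (sym (zeroˡ _)))))

 module _ (P R : F -> F) (Λ : Z) (0≤Λ : 0z ≤ Λ) (lin : ∀ b -> LinBound (\ y -> P y ⊕ b ⊗ R y) Λ)
      (g φ : F -> Z) (Sg : S g ≡ 0z) where
  private
   Φ : F -> F -> Z
   Φ b s = S (\ β -> g (s ⊝ b ⊗ β) * φ β)

   SΦ : ∀ b -> S (Φ b) ≡ 0z
   SΦ b = trans (Σ-swap els els _) (trans (Σ-cong els (\ β -> trans (Σ-*ʳ els (φ β) _) (trans (cong (_* φ β) (trans (S-shift (⊖ (b ⊗ β)) g) Sg)) (zeroˡ _)))) (Σ-zero els))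

   cΦ : ∀ b u -> c (Φ b) u ≡ S (\ δ -> c φ δ * c g (u ⊝ b ⊗ δ))
   cΦ b u = trans (Σ-cong els (\ s -> trans (sym (Σ-*ʳ els (Φ b (s ⊕ u)) _)) (Σ-cong els (\ β -> trans (cong (g (s ⊝ b ⊗ β) * φ β *_) (sym (S-shiftˡ β _))) (sym (Σ-*ˡ els _ _))))))
    (trans (Σ-swap els els _) (trans (Σ-cong els (\ β -> trans (Σ-swap els els _) (Σ-cong els (\ δ -> inner β δ)))) (trans (Σ-swap els els _) (Σ-cong els (\ δ -> Σ-*ʳ els _ _)))))
    where
    inner : ∀ β δ -> S (\ s -> g (s ⊝ b ⊗ β) * φ β * (g ((s ⊕ u) ⊝ b ⊗ (β ⊕ δ)) * φ (β ⊕ δ))) ≡ φ β * φ (β ⊕ δ) * c g (u ⊝ b ⊗ δ)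
    inner β δ = trans (Σ-cong els (\ s -> trans
      (solve 4 (\ a x e y -> a :* x :* (e :* y) := (x :* y) :* (a :* e)) refl (g (s ⊝ b ⊗ β)) (φ β) (g ((s ⊕ u) ⊝ b ⊗ (β ⊕ δ))) (φ (β ⊕ δ)))
      (cong (\ t -> φ β * φ (β ⊕ δ) * (g (s ⊝ b ⊗ β) * g t)) (K.solve 4 (\ s u x y -> (s K.:+ u) K.:- x K.:= s K.:+ (u K.:- x)) refl s u (b ⊗ (β ⊕ δ)) 𝟘))))
     (trans (Σ-*ˡ els _ _) (cong (φ β * φ (β ⊕ δ) *_) (trans (c-shift g (⊖ (b ⊗ β)) (u ⊝ b ⊗ (β ⊕ δ)))
      (cong (c g) (K.solve 4 (\ u b x y -> (u K.:- b K.:* (x K.:+ y)) K.:- (K.:- (b K.:* x)) K.:= u K.:- b K.:* y) refl u b β δ)))))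

   line' : ∀ a x -> S (\ b -> S (\ δ -> c φ δ * c g ((a ⊕ b ⊗ x) ⊝ b ⊗ δ))) ≡ nat q * (c g a * c φ x)
   line' a x = trans (Σ-swap els els _) (trans (Σ-cong els (\ δ -> trans (Σ-*ˡ els _ _) (trans (cong (c φ δ *_) (trans
     (Σ-cong els (\ b -> cong (c g) (K.solve 4 (\ a b x d -> (a K.:+ b K.:* x) K.:- b K.:* d K.:= a K.:+ b K.:* (x K.:- d)) refl a b x δ)))
     (trans (S-line g Sg a (x ⊝ δ)) (cong (_* (nat q * c g a)) (ind-cong (x ⊝ δ ≟ 𝟘) (x ≟ δ) K.sub-≡ K.≡-sub)))))
     (solve 3 (\ e i m -> e :* (i :* m) := i :* (e :* m)) refl (c φ δ) (ind (x ≟ δ)) (nat q * c g a)))))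
    (trans (S-δ x (\ δ -> c φ δ * (nat q * c g a))) (solve 3 (\ e a m -> e :* (a :* m) := a :* (m :* e)) refl (c φ x) (nat q) (c g a))))

   norms : S (\ b -> n (Φ b)) ≡ nat q * (n g * n φ)
   norms = trans (Σ-cong els (\ b -> trans (sym (c-𝟘 (Φ b))) (trans (cΦ b 𝟘) (Σ-cong els (\ δ -> cong (\ t -> c φ δ * c g (t ⊝ b ⊗ δ))
      (K.solve 1 (\ b -> con0 K.:= con0 K.:+ b K.:* con0) refl b))))))
     (trans (line' 𝟘 𝟘) (cong (nat q *_) (cong₂ _*_ (c-𝟘 g) (c-𝟘 φ))))
    where
    con0 : ∀ {m} -> K.Polynomial m
    con0 = K.con (ℤ.+ 0)

   total : S (\ b -> S (\ y -> S (\ z -> c (Φ b) (D (\ y -> P y ⊕ b ⊗ R y) y z)))) ≡ nat q * L P R (c g) (c φ)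
   total = trans (Σ-swap els els _) (trans (Σ-cong els (\ y -> trans (Σ-swap els els _) (trans (Σ-cong els (\ z ->
     trans (Σ-cong els (\ b -> trans (cΦ b _) (Σ-cong els (\ δ -> cong (\ t -> c φ δ * c g (t ⊝ b ⊗ δ))
       (K.solve 5 (\ p p' b r r' -> (p' K.:+ b K.:* r') K.:- (p K.:+ b K.:* r) K.:= (p' K.:- p) K.:+ b K.:* (r' K.:- r)) refl (P y) (P z) b (R y) (R z))))))
      (line' (D P y z) (D R y z)))) (Σ-*ˡ els _ _)))) (Σ-*ˡ els _ _))

  -- `Φ b` combines g and φ along the lines of slope b. Summed over all slopes, the correlations of
  -- `Φ b` at a + b x collapse by `S-line` to q c_g(a) c_φ(x). Thus q times the two-variable form is
  -- a sum of one-variable forms, one for each P + b R, and the norms of the `Φ b` sum to q times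
  -- the product of norms.
  L-bound : L P R (c g) (c φ) ≤ Λ * (n g * n φ)
  L-bound = *-cancel-≤ 1≤q (subst₂ _≤_ total (trans (Σ-*ˡ els Λ _) (trans (cong (Λ *_) norms)
     (solve 3 (\ l a m -> l :* (a :* m) := a :* (l :* m)) refl Λ (nat q) (n g * n φ)))) (Σ-mono els (\ b -> lin b (Φ b) (SΦ b))))

 repr : (F -> F) -> F -> Z
 repr f u = S (\ y -> S (\ z -> ind (D f y z ≟ u)))

 repr-sum : ∀ f -> S (repr f) ≡ nat q * nat q
 repr-sum f = trans (Σ-swap els els _) (trans (Σ-cong els (\ y -> trans (Σ-swap els els _) (trans (Σ-cong els (\ z ->
    trans (Σ-cong els (\ u -> sym (*-identityʳ _))) (S-δ (D f y z) (\ _ -> 1z)))) (trans (S-const 1z) (*-identityʳ _))))) (S-const (nat q)))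

 repr-pair : ∀ f ω -> S (\ y -> S (\ z -> ω (D f y z))) ≡ S (\ u -> repr f u * ω u)
 repr-pair f ω = sym (trans (Σ-cong els (\ u -> trans (sym (Σ-*ʳ els (ω u) _)) (Σ-cong els (\ y -> sym (Σ-*ʳ els (ω u) _)))))
   (trans (Σ-swap els els _) (Σ-cong els (\ y -> trans (Σ-swap els els _) (Σ-cong els (\ z -> S-δ (D f y z) ω))))))

 -- The exact average of the representation function turns a one-sided bound into an L¹ bound.
 linBound : ∀ f (t : F -> Z) -> (∀ u -> 0z ≤ t u) -> (∀ u -> repr f u ≤ nat q + t u) -> LinBound f (S t + S t)
 linBound f t 0≤t up ψ Sψ = ≤-trans (≤-reflexive eq) (≤-trans (Σ-mono els step) (≤-reflexive (trans (Σ-*ʳ els (n ψ) _) (cong (_* n ψ) fin))))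
  where
  x : F -> Z
  x u = repr f u - nat q
  eq : S (\ y -> S (\ z -> c ψ (D f y z))) ≡ S (\ u -> x u * c ψ u)
  eq = trans (repr-pair f (c ψ)) (sym (trans (Σ-cong els (\ u -> solve 3 (\ r a e -> (r :- a) :* e := r :* e :- a :* e) refl (repr f u) (nat q) (c ψ u)))
    (trans (Σ-sub els _ _) (trans (cong (\ t -> S (\ u -> repr f u * c ψ u) - t) (trans (Σ-*ˡ els _ _) (trans (cong (nat q *_) (trans (sym (sq-S ψ)) (trans (cong₂ _*_ Sψ Sψ) (zeroˡ _)))) (zeroʳ _))))
     (solve 1 (\ a -> a :- con (ℤ.+ 0) := a) refl _)))))
  b : F -> Z
  b u = (t u + t u) - x u
  x≤t : ∀ u -> 0z ≤ t u - x u
  x≤t u = subst (0z ≤_) (solve 3 (\ a t r -> (a :+ t) :- r := t :- (r :- a)) refl (nat q) (t u) (repr f u)) (diff-≥0 (up u))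
  absx : ∀ u -> ∣ x u ∣ ≤ b u
  absx u = abs-≤ (≤-by ((t u - x u) + (t u - x u)) (solve 2 (\ t x -> ((t :+ t) :- x) :- x := (t :- x) :+ (t :- x)) refl (t u) (x u)) (+-nonneg (x≤t u) (x≤t u)))
   (≤-by (t u + t u) (solve 2 (\ t x -> ((t :+ t) :- x) :- (:- x) := t :+ t) refl (t u) (x u)) (+-nonneg (0≤t u) (0≤t u)))
  step : ∀ u -> x u * c ψ u ≤ b u * n ψ
  step u = ≤-trans (abs-≥ _) (subst (_≤ b u * n ψ) (sym (abs-* (x u) (c ψ u))) (*-mono (abs-≥0 _) (n-nonneg ψ) (absx u) (c-abs ψ u)))
  fin : S b ≡ S t + S t
  fin = trans (Σ-sub els _ _) (trans (cong₂ _-_ (Σ-+ els t t) (trans (Σ-sub els _ _) (cong₂ _-_ (repr-sum f) (S-const (nat q)))))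
    (solve 2 (\ s a -> (s :+ s) :- (a :- a) := s :+ s) refl (S t) (nat q * nat q)))

 N-linear : ∀ P Λ -> 0z ≤ Λ -> LinBound P Λ -> ∀ f g -> S g ≡ 0z ->
  S (\ x -> S (\ y -> f x * g (x ⊕ P y))) * S (\ x -> S (\ y -> f x * g (x ⊕ P y))) ≤ n f * (Λ * n g)
 N-linear P Λ 0≤Λ lin f g Sg = ≤-trans (subst (\ t -> t * t ≤ n f * S (\ x -> T x * T x)) (Σ-cong els (\ x -> sym (Σ-*ˡ els (f x) _))) (cauchy-schwarz els f T))
   (*-monoˡ (n-nonneg f) (≤-trans (≤-reflexive eq) (lin g Sg)))
  where
  T : F -> Z
  T x = S (\ y -> g (x ⊕ P y))
  eq : S (\ x -> T x * T x) ≡ S (\ y -> S (\ z -> c g (D P y z)))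
  eq = trans (Σ-cong els (\ x -> sym (Σ-mul els els _ _))) (trans (Σ-swap els els _) (Σ-cong els (\ y -> trans (Σ-swap els els _) (Σ-cong els (\ z -> c-shift g (P y) (P z))))))

 -- Points outside Bad are finite-to-one over (P z - P y , R z - R y).
 L-good : ∀ P R {B : F -> F -> Set} (bad? : ∀ y z -> Dec (B y z)) (C0 C1 : Z) -> 0z ≤ C0 ->
  (∀ a b -> S (\ y -> S (\ z -> (1z - ind (bad? y z)) * (ind (D P y z ≟ a) * ind (D R y z ≟ b)))) ≤ C0) ->
  S (\ y -> S (\ z -> ind (bad? y z))) ≤ C1 ->
  ∀ (X Y : F -> Z) (X̄ Ȳ : Z) -> (∀ u -> 0z ≤ X u) -> (∀ u -> 0z ≤ Y u) -> (∀ u -> X u ≤ X̄) -> (∀ u -> Y u ≤ Ȳ) ->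
  L P R X Y ≤ C0 * (S X * S Y) + C1 * (X̄ * Ȳ)
 L-good P R bad? C0 C1 0≤C0 good few X Y X̄ Ȳ 0≤X 0≤Y X≤ Y≤ = ≤-trans (≤-reflexive split) (+-mono goodPart badPart)
  where
  i : F -> F -> Z
  i y z = ind (bad? y z)
  XY : F -> F -> Z
  XY y z = X (D P y z) * Y (D R y z)
  split : L P R X Y ≡ S (\ y -> S (\ z -> (1z - i y z) * XY y z)) + S (\ y -> S (\ z -> i y z * XY y z))
  split = trans (Σ-cong els (\ y -> trans (Σ-cong els (\ z -> trans (sym (*-identityˡ _)) (solve 3 (\ o i m -> o :* m := (o :- i) :* m :+ i :* m) refl 1z (i y z) (XY y z)))) (Σ-+ els _ _))) (Σ-+ els _ _)
  0≤X̄ : 0z ≤ X̄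
  0≤X̄ = ≤-trans (0≤X 𝟘) (X≤ 𝟘)
  0≤Ȳ : 0z ≤ Ȳ
  0≤Ȳ = ≤-trans (0≤Y 𝟘) (Y≤ 𝟘)
  badPart : S (\ y -> S (\ z -> i y z * XY y z)) ≤ C1 * (X̄ * Ȳ)
  badPart = ≤-trans (Σ-mono els (\ y -> Σ-mono els (\ z -> *-monoˡ (ind-nonneg (bad? y z)) (*-mono (0≤X _) 0≤Ȳ (X≤ _) (Y≤ _)))))
   (≤-trans (≤-reflexive (trans (Σ-cong els (\ y -> Σ-*ʳ els _ _)) (Σ-*ʳ els _ _))) (*-monoʳ (*-nonneg 0≤X̄ 0≤Ȳ) few))
  m : F -> F -> Z
  m a b = S (\ y -> S (\ z -> (1z - i y z) * (ind (D P y z ≟ a) * ind (D R y z ≟ b))))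
  expand : S (\ y -> S (\ z -> (1z - i y z) * XY y z)) ≡ S (\ a -> S (\ b -> m a b * (X a * Y b)))
  expand = sym (trans (Σ-cong els (\ a -> trans (Σ-cong els (\ b -> trans (sym (Σ-*ʳ els _ _)) (Σ-cong els (\ y -> sym (Σ-*ʳ els _ _)))))
     (trans (Σ-swap els els _) (Σ-cong els (\ y -> Σ-swap els els _)))))
    (trans (Σ-swap els els _) (Σ-cong els (\ y -> trans (Σ-swap els els _) (Σ-cong els (\ z ->
     trans (Σ-cong els (\ a -> trans (Σ-cong els (\ b -> solve 5 (\ o p r x t -> o :* (p :* r) :* (x :* t) := r :* (o :* p :* x :* t)) refl
       (1z - i y z) (ind (D P y z ≟ a)) (ind (D R y z ≟ b)) (X a) (Y b))) (trans (S-δ (D R y z) (\ b -> (1z - i y z) * ind (D P y z ≟ a) * X a * Y b))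
        (solve 4 (\ o p x t -> o :* p :* x :* t := p :* (o :* (x :* t))) refl (1z - i y z) (ind (D P y z ≟ a)) (X a) (Y (D R y z))))))
      (S-δ (D P y z) (\ a -> (1z - i y z) * (X a * Y (D R y z))))))))))
  goodPart : S (\ y -> S (\ z -> (1z - i y z) * XY y z)) ≤ C0 * (S X * S Y)
  goodPart = ≤-trans (≤-reflexive expand) (≤-trans (Σ-mono els (\ a -> Σ-mono els (\ b -> *-monoʳ (*-nonneg (0≤X a) (0≤Y b)) (good a b))))
   (≤-reflexive (trans (Σ-cong els (\ a -> Σ-*ˡ els _ _)) (trans (Σ-*ˡ els _ _) (cong (C0 *_) (Σ-mul els els X Y))))))

 els² : List (F × F)
 els² = cartesianProduct els els

 els³ : List (F × F × F)
 els³ = cartesianProduct els els²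

 els⁴ : List ((F × F) × (F × F))
 els⁴ = cartesianProduct els² els²

 infix 4 _≟³_
 _≟³_ : (k l : F × F × F) -> Dec (k ≡ l)
 _≟³_ = ≡-dec _≟_ (≡-dec _≟_ _≟_)

 S³-δ : ∀ k (X : F × F × F -> Z) -> Σ els³ (\ l -> ind (k ≟³ l) * X l) ≡ X k
 S³-δ (k1 , k2 , k3) X = trans (Σ-× els els² _) (trans (Σ-cong els (\ a -> trans (Σ-× els els _) (trans (Σ-cong els (\ b ->
    trans (Σ-cong els (\ e -> trans (cong (_* X (a , b , e)) (split a b e)) (solve 4 (\ i j l m -> i :* j :* l :* m := l :* (i :* j :* m)) refl (ind (k1 ≟ a)) (ind (k2 ≟ b)) (ind (k3 ≟ e)) (X (a , b , e)))))
    (trans (S-δ k3 (\ e -> ind (k1 ≟ a) * ind (k2 ≟ b) * X (a , b , e))) (solve 3 (\ i j m -> i :* j :* m := j :* (i :* m)) refl (ind (k1 ≟ a)) (ind (k2 ≟ b)) (X (a , b , k3))))))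
    (S-δ k2 (\ b -> ind (k1 ≟ a) * X (a , b , k3)))))) (S-δ k1 (\ a -> X (a , k2 , k3))))
  where
  split : ∀ a b e -> ind ((k1 , k2 , k3) ≟³ (a , b , e)) ≡ ind (k1 ≟ a) * ind (k2 ≟ b) * ind (k3 ≟ e)
  split a b e = trans (ind-∧ ((k1 , k2 , k3) ≟³ (a , b , e)) (k1 ≟ a) (≡-dec _≟_ _≟_ (k2 , k3) (b , e)) (cong proj₁) (cong proj₂) (cong₂ _,_))
   (trans (cong (ind (k1 ≟ a) *_) (ind-∧ (≡-dec _≟_ _≟_ (k2 , k3) (b , e)) (k2 ≟ b) (k3 ≟ e) (cong proj₁) (cong proj₂) (cong₂ _,_))) (sym (*-assoc _ _ _)))

 collisions : ∀ {I : Set} (pts : List I) (w : I -> Z) (key : I -> F × F × F) -> Z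
 collisions pts w key = Σ pts (\ p -> Σ pts (\ p' -> w p * w p' * ind (key p' ≟³ key p)))

 -- Group the sum by the value of the key and apply Cauchy-Schwarz over keys; the weighted
 -- multiplicities have squares summing to the number of colliding pairs.
 collision-bound : ∀ {I : Set} (pts : List I) (w : I -> Z) (key : I -> F × F × F) (X : F × F × F -> Z) ->
  Σ pts (\ p -> w p * X (key p)) * Σ pts (\ p -> w p * X (key p)) ≤ collisions pts w key * Σ els³ (\ k -> X k * X k)
 collision-bound pts w key X = subst₂ _≤_ (cong₂ _*_ (sym W) (sym W)) (cong (_* Σ els³ (\ k -> X k * X k)) R²) (cauchy-schwarz els³ R X)
  where
  R : F × F × F -> Z
  R k = Σ pts (\ p -> w p * ind (key p ≟³ k))
  W : Σ pts (\ p -> w p * X (key p)) ≡ Σ els³ (\ k -> R k * X k)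
  W = sym (trans (Σ-cong els³ (\ k -> sym (Σ-*ʳ pts (X k) _))) (trans (Σ-swap els³ pts _) (Σ-cong pts (\ p ->
    trans (Σ-cong els³ (\ k -> solve 3 (\ a i x -> a :* i :* x := i :* (a :* x)) refl (w p) (ind (key p ≟³ k)) (X k))) (S³-δ (key p) (\ k -> w p * X k))))))
  R² : Σ els³ (\ k -> R k * R k) ≡ collisions pts w key
  R² = trans (Σ-cong els³ (\ k -> sym (Σ-mul pts pts _ _))) (trans (Σ-swap els³ pts _) (Σ-cong pts (\ p -> trans (Σ-swap els³ pts _) (Σ-cong pts (\ p' ->
    trans (Σ-cong els³ (\ k -> solve 4 (\ a i b j -> a :* i :* (b :* j) := i :* (a :* b :* j)) refl (w p) (ind (key p ≟³ k)) (w p') (ind (key p' ≟³ k))))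
     (S³-δ (key p) (\ k -> w p * w p' * ind (key p' ≟³ k))))))))

 -- Squaring twice removes f and then g and leaves products of four values of h indexed by (y, z),
 -- (y', z') with P₁(y) - P₁(z) = P₁(y') - P₁(z'). After a translation such a product depends on the
 -- quadruple only through the three shifts in `key`. There are about q³ quadruples and q³ keys, so
 -- O(q³) collisions is the expected order.
 module Quadruples (P1 P2 : F -> F) where
  Q : F -> F
  Q y = P2 y ⊝ P1 y

  on? : (p : (F × F) × (F × F)) -> Dec (D P1 (proj₂ (proj₂ p)) (proj₁ (proj₂ p)) ≡ D P1 (proj₂ (proj₁ p)) (proj₁ (proj₁ p)))
  on? ((y , z) , (y' , z')) = D P1 z' y' ≟ D P1 z y

  key : (F × F) × (F × F) -> F × F × F
  key ((y , z) , (y' , z')) = D Q z z' , D P2 z y , D Q y y'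

  quadruples : Z
  quadruples = collisions els⁴ (\ p -> ind (on? p)) key

  module _ (f g h : F -> Z) where
   private
    T : F -> Z
    T x = S (\ y -> g (x ⊕ P1 y) * h (x ⊕ P2 y))
    -- The total h-weight attached to g(u) g(u + α) once f has been removed; the second
    -- Cauchy-Schwarz runs over the pairs (u, α).
    J : F -> F -> Z
    J α u = Σ els² (\ { (y , z) -> ind (D P1 z y ≟ α) * (h (u ⊕ Q z) * h ((u ⊕ α) ⊕ Q y)) })
    X : F × F × F -> Z
    X (a , b , e) = S (\ u -> h u * h (u ⊕ a) * h (u ⊕ b) * h ((u ⊕ b) ⊕ e))

   S2 W : Z
   S2 = S (\ x -> T x * T x)
   W = Σ els⁴ (\ p -> ind (on? p) * X (key p))

   N²≤S2 : N P1 P2 f g h * N P1 P2 f g h ≤ n f * S2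
   N²≤S2 = subst (\ t -> t * t ≤ n f * S2) (Σ-cong els (\ x -> trans (sym (Σ-*ˡ els (f x) _)) (Σ-cong els (\ y -> sym (*-assoc _ _ _))))) (cauchy-schwarz els f T)

   private
    S2-J : S2 ≡ Σ els² (\ { (u , α) -> g u * g (u ⊕ α) * J α u })
    S2-J = trans (Σ-cong els (\ x -> sym (Σ-mul els els _ _))) (trans (Σ-swap els els _) (trans (Σ-cong els (\ y -> trans (Σ-swap els els _) (Σ-cong els (\ z ->
      trans (sym (S-shift (⊖ P1 z) _)) (Σ-cong els (\ u -> move y z u))))))
     (sym (trans (Σ-× els els _) (trans (Σ-cong els (\ u -> trans (Σ-cong els (\ α -> trans (cong (g u * g (u ⊕ α) *_) (Σ-× els els _)) (trans (sym (Σ-*ˡ els _ _)) (Σ-cong els (\ y -> sym (Σ-*ˡ els _ _))))))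
       (trans (Σ-swap els els _) (Σ-cong els (\ y -> trans (Σ-swap els els _) (Σ-cong els (\ z -> pick y z u)))))))
      (trans (Σ-swap els els _) (Σ-cong els (\ y -> Σ-swap els els _))))))))
     where
     G : F -> F -> F -> Z
     G y z u = g u * g (u ⊕ D P1 z y) * (h (u ⊕ Q z) * h ((u ⊕ D P1 z y) ⊕ Q y))
     pick : ∀ y z u -> S (\ α -> g u * g (u ⊕ α) * (ind (D P1 z y ≟ α) * (h (u ⊕ Q z) * h ((u ⊕ α) ⊕ Q y)))) ≡ G y z u
     pick y z u = trans (Σ-cong els (\ α -> solve 3 (\ a i m -> a :* (i :* m) := i :* (a :* m)) refl (g u * g (u ⊕ α)) (ind (D P1 z y ≟ α)) _)) (S-δ (D P1 z y) (\ α -> g u * g (u ⊕ α) * (h (u ⊕ Q z) * h ((u ⊕ α) ⊕ Q y))))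
     move : ∀ y z u -> g ((u ⊕ (⊖ P1 z)) ⊕ P1 y) * h ((u ⊕ (⊖ P1 z)) ⊕ P2 y) * (g ((u ⊕ (⊖ P1 z)) ⊕ P1 z) * h ((u ⊕ (⊖ P1 z)) ⊕ P2 z)) ≡ G y z u
     move y z u = trans (cong₂ _*_ (cong₂ (\ s t -> g s * h t)
        (K.solve 3 (\ u p r -> (u K.:+ K.:- p) K.:+ r K.:= u K.:+ (r K.:- p)) refl u (P1 z) (P1 y))
        (K.solve 4 (\ u p r s -> (u K.:+ K.:- p) K.:+ s K.:= (u K.:+ (r K.:- p)) K.:+ (s K.:- r)) refl u (P1 z) (P1 y) (P2 y)))
       (cong₂ (\ s t -> g s * h t) (K.solve 2 (\ u p -> (u K.:+ K.:- p) K.:+ p K.:= u) refl u (P1 z))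
        (K.solve 3 (\ u p r -> (u K.:+ K.:- p) K.:+ r K.:= u K.:+ (r K.:- p)) refl u (P1 z) (P2 z))))
      (solve 4 (\ a b e f -> a :* b :* (e :* f) := e :* a :* (f :* b)) refl (g (u ⊕ D P1 z y)) (h ((u ⊕ D P1 z y) ⊕ Q y)) (g u) (h (u ⊕ Q z)))

    gg : Σ els² (\ { (u , α) -> g u * g (u ⊕ α) * (g u * g (u ⊕ α)) }) ≡ n g * n g
    gg = trans (Σ-× els els _) (trans (Σ-cong els (\ u -> trans (Σ-cong els (\ α -> solve 2 (\ a b -> a :* b :* (a :* b) := (a :* a) :* (b :* b)) refl (g u) (g (u ⊕ α))))
       (trans (Σ-*ˡ els _ _) (cong (g u * g u *_) (S-shiftˡ u (\ x -> g x * g x)))))) (Σ-*ʳ els _ _))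

    JJ : Σ els² (\ { (u , α) -> J α u * J α u }) ≡ W
    JJ = trans (Σ-× els els _) (trans (Σ-cong els (\ u -> trans (Σ-cong els (\ α -> sym (Σ-mul els² els² _ _)))
       (trans (Σ-swap els els² _) (Σ-cong els² (\ v -> trans (Σ-swap els els² _) (Σ-cong els² (\ v' -> pick u v v')))))))
      (trans (Σ-swap els els² _) (trans (Σ-cong els² (\ v -> trans (Σ-swap els els² _) (Σ-cong els² (\ v' -> trans (Σ-*ˡ els _ _) (cong (ind (on? (v , v')) *_) (toX v v'))))))
       (sym (Σ-× els² els² _)))))
     where
     A : F -> F -> F × F -> Z
     A α u (y , z) = h (u ⊕ Q z) * h ((u ⊕ α) ⊕ Q y)
     Dv : F × F -> F
     Dv (y , z) = D P1 z y
     pick : ∀ u v v' -> S (\ α -> ind (Dv v ≟ α) * A α u v * (ind (Dv v' ≟ α) * A α u v')) ≡ ind (on? (v , v')) * (A (Dv v) u v * A (Dv v) u v')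
     pick u v v' = trans (Σ-cong els (\ α -> solve 4 (\ i a j b -> i :* a :* (j :* b) := i :* (j :* (a :* b))) refl (ind (Dv v ≟ α)) (A α u v) (ind (Dv v' ≟ α)) (A α u v')))
      (S-δ (Dv v) (\ α -> ind (Dv v' ≟ α) * (A α u v * A α u v')))
     toX : ∀ v v' -> S (\ u -> A (Dv v) u v * A (Dv v) u v') ≡ X (key (v , v'))
     toX (y , z) (y' , z') = trans (sym (S-shift (⊖ Q z) _)) (Σ-cong els (\ u -> trans (cong₂ _*_
       (cong₂ (\ s t -> h s * h t) (K.solve 2 (\ u p -> (u K.:+ K.:- p) K.:+ p K.:= u) refl u (Q z))
         (K.solve 5 (\ u a b e f -> ((u K.:+ K.:- (f K.:- b)) K.:+ (a K.:- b)) K.:+ (e K.:- a) K.:= u K.:+ (e K.:- f)) refl u (P1 y) (P1 z) (P2 y) (P2 z)))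
       (cong₂ (\ s t -> h s * h t) (K.solve 3 (\ u p r -> (u K.:+ K.:- p) K.:+ r K.:= u K.:+ (r K.:- p)) refl u (Q z) (Q z'))
         (K.solve 6 (\ u a b e f r -> ((u K.:+ K.:- (f K.:- b)) K.:+ (a K.:- b)) K.:+ r K.:= (u K.:+ (e K.:- f)) K.:+ (r K.:- (e K.:- a))) refl u (P1 y) (P1 z) (P2 y) (P2 z) (Q y'))))
      (solve 4 (\ a b e f -> a :* b :* (e :* f) := a :* e :* b :* f) refl (h u) (h (u ⊕ D P2 z y)) (h (u ⊕ D Q z z')) (h ((u ⊕ D P2 z y) ⊕ D Q y y')))))

    -- Squaring X gives a sum over a displacement v; summing over each of the three shifts by `mix`
    -- splits off one factor c_h(v), and the remaining weight h(u) gives the fourth.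
    XX : Σ els³ (\ k -> X k * X k) ≡ S (\ u -> c h u * c h u * c h u * c h u)
    XX = trans (Σ-× els els² _) (trans (Σ-cong els (\ a -> trans (Σ-× els els _) (trans (Σ-cong els (\ b -> trans (Σ-cong els (\ e -> sq-S _))
       (trans (Σ-swap els els _) (Σ-cong els (\ v -> inner a b v))))) (trans (Σ-swap els els _) (Σ-cong els (\ v -> trans (Σ-*ʳ els _ _) (cong (_* c h v) (mix (\ u -> h u * h (u ⊕ a)) h v))))))))
      (trans (Σ-swap els els _) (Σ-cong els (\ v -> trans (Σ-*ʳ els _ _) (cong (_* c h v) (trans (Σ-*ʳ els _ _) (cong (_* c h v) (mix h h v))))))))
     where
     inner : ∀ a b v -> S (\ e -> c (\ u -> h u * h (u ⊕ a) * h (u ⊕ b) * h ((u ⊕ b) ⊕ e)) v) ≡ c (\ u -> h u * h (u ⊕ a) * h (u ⊕ b)) v * c h v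
     inner a b v = trans (Σ-cong els (\ e -> c-cong (\ u -> cong (\ t -> h u * h (u ⊕ a) * h (u ⊕ b) * h t) (K.+-assoc u b e)) v))
      (trans (S-shiftˡ b (\ t -> c (\ u -> h u * h (u ⊕ a) * h (u ⊕ b) * h (u ⊕ t)) v)) (mix (\ u -> h u * h (u ⊕ a) * h (u ⊕ b)) h v))

   S2²≤W : S2 * S2 ≤ n g * n g * W
   S2²≤W = subst₂ _≤_ (cong₂ _*_ (sym S2-J) (sym S2-J)) (cong₂ _*_ gg JJ) (cauchy-schwarz els² (\ { (u , α) -> g u * g (u ⊕ α) }) (\ { (u , α) -> J α u }))

   W²≤ : W * W ≤ quadruples * S (\ u -> c h u * c h u * c h u * c h u)
   W²≤ = subst (\ t -> W * W ≤ quadruples * t) XX (collision-bound els⁴ (\ p -> ind (on? p)) key X)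

-- The chain of four dual functions.

module Energy (𝔽 : FiniteField) (𝕆 : OrderedRing) where
 open ≡ hiding (J)
 open FSum 𝔽 𝕆
 open Analysis 𝔽 𝕆
 open Analysis2 𝔽 𝕆

 energy : (F -> Z) -> Z
 energy f = S (\ u -> c f u * c f u)

 energy4 : (F -> Z) -> Z
 energy4 f = S (\ u -> c f u * c f u * c f u * c f u)

 energy-nonneg : ∀ f -> 0z ≤ energy f
 energy-nonneg f = Σ-nonneg els (\ u -> sq-nonneg (c f u))

 energy4-nonneg : ∀ f -> 0z ≤ energy4 f
 energy4-nonneg f = Σ-nonneg els (\ u -> subst (0z ≤_) (sym (*-assoc _ _ _)) (sq-nonneg (c f u * c f u)))

 module Chain (P1 P2 : F -> F) (Λ : Z) (0≤Λ : 0z ≤ Λ)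
  (lin1 : ∀ b -> LinBound (\ y -> P1 y ⊕ b ⊗ P2 y) Λ) (lin2 : ∀ b -> LinBound (\ y -> (P2 y ⊝ P1 y) ⊕ b ⊗ (⊖ P1 y)) Λ)
  (d : Z) (0≤d : 0z ≤ d) (fib : ∀ s -> S (\ y -> ind (P2 y ≟ s)) ≤ d)
  {B : F -> F -> Set} (bad? : ∀ y z -> Dec (B y z)) (C0 C1 : Z) (0≤C0 : 0z ≤ C0)
  (good : ∀ a b -> S (\ y -> S (\ z -> (1z - ind (bad? y z)) * (ind (D P1 y z ≟ a) * ind (D P2 y z ≟ b)))) ≤ C0)
  (few : S (\ y -> S (\ z -> ind (bad? y z))) ≤ C1)
  (f0 g0 h0 : F -> Z) (Sf : S f0 ≡ 0z) (Sg : S g0 ≡ 0z) (Sh : S h0 ≡ 0z) where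

  Q P1⁻ : F -> F
  Q y = P2 y ⊝ P1 y
  P1⁻ y = ⊖ P1 y

  -- Each function is dual to the latest functions in the other two positions. With this order,
  -- opening h₂ and then g₁ in the quartic sum leaves only correlations of f₁, h₁ and h₂, and `s1`
  -- to `s3` bound exactly these three energies.
  h1 f1 g1 h2 : F -> Z
  h1 = pdual P1 P2 f0 g0
  f1 = pdual Q P1⁻ g0 h1
  g1 = pdual P2 P1 f1 h1
  h2 = pdual P1 P2 f1 g1

  private
   qq : Z
   qq = nat q * nat q

   0≤qq : 0z ≤ qq
   0≤qq = *-nonneg (nat-nonneg q) (nat-nonneg q)

  i1 : (nat q * N P1 P2 f0 g0 h0) * (nat q * N P1 P2 f0 g0 h0) ≤ n h1 * n h0
  i1 = N-pdual P1 P2 f0 g0 h0 Sh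

  -- The norm of h₁ is q times the count with weights f, g, h₁. Rotating that count puts f in the
  -- dualised position, so the next dual function f₁ appears; `i3` and `i4` repeat the step with g
  -- and with h₁.
  i2 : n h1 * n h1 ≤ n f1 * n f0
  i2 = subst (\ t -> t * t ≤ n f1 * n f0) (sym (trans (n-pdual P1 P2 f0 g0) (cong (nat q *_) (N-rotate P1 P2 f0 g0 h1)))) (N-pdual Q P1⁻ g0 h1 f0 Sf)

  i3 : n f1 * n f1 ≤ n g1 * n g0
  i3 = subst (\ t -> t * t ≤ n g1 * n g0) (sym (trans (n-pdual Q P1⁻ g0 h1) (cong (nat q *_) (trans (sym (N-rotate P1 P2 f1 g0 h1)) (N-swap P1 P2 f1 g0 h1))))) (N-pdual P2 P1 f1 h1 g0 Sg)

  i4 : n g1 * n g1 ≤ n h2 * n h1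
  i4 = subst (\ t -> t * t ≤ n h2 * n h1) (sym (trans (n-pdual P2 P1 f1 h1) (cong (nat q *_) (N-swap P2 P1 f1 h1 g1)))) (N-pdual P1 P2 f1 g1 h1 (S-proj _))

  private
   energy-pdual : ∀ P R f g -> S g ≡ 0z -> (∀ b -> LinBound (\ y -> P y ⊕ b ⊗ R y) Λ) -> energy (pdual P R f g) ≤ qq * n f * (Λ * (n g * n (pdual P R f g)))
   energy-pdual P R f g Sg' lin = ≤-trans (dual-L P R f g (corr (pdual P R f g) (\ _ -> refl))) (*-monoˡ (*-nonneg 0≤qq (n-nonneg f)) (L-bound P R Λ 0≤Λ lin g (pdual P R f g) Sg'))

  s1 : energy h1 ≤ qq * n f0 * (Λ * (n g0 * n h1))
  s1 = energy-pdual P1 P2 f0 g0 Sg lin1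

  s2 : energy f1 ≤ qq * n g0 * (Λ * (n h1 * n f1))
  s2 = energy-pdual Q P1⁻ g0 h1 (S-proj _) lin2

  s3 : energy h2 ≤ qq * n f1 * (Λ * (n g1 * n h2))
  s3 = energy-pdual P1 P2 f1 g1 (S-proj _) lin1

  X Y : F -> Z
  X u = ∣ c f1 u ∣ * ∣ c h1 u ∣
  Y u = ∣ c h2 u ∣ * (∣ c h2 u ∣ * ∣ c h2 u ∣)

  X-nonneg : ∀ u -> 0z ≤ X u
  X-nonneg u = *-nonneg (abs-≥0 _) (abs-≥0 _)

  Y-nonneg : ∀ u -> 0z ≤ Y u
  Y-nonneg u = *-nonneg (abs-≥0 _) (*-nonneg (abs-≥0 _) (abs-≥0 _))

  X² : S X * S X ≤ energy f1 * energy h1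
  X² = ≤-trans (cauchy-schwarz els (\ u -> ∣ c f1 u ∣) (\ u -> ∣ c h1 u ∣)) (≤-reflexive (cong₂ _*_ (Σ-cong els (\ u -> abs-sq (c f1 u))) (Σ-cong els (\ u -> abs-sq (c h1 u)))))

  Y² : S Y * S Y ≤ energy h2 * energy4 h2
  Y² = ≤-trans (cauchy-schwarz els (\ u -> ∣ c h2 u ∣) (\ u -> ∣ c h2 u ∣ * ∣ c h2 u ∣)) (≤-reflexive (cong₂ _*_ (Σ-cong els (\ u -> abs-sq (c h2 u)))
   (Σ-cong els (\ u -> trans (cong₂ _*_ (abs-sq (c h2 u)) (abs-sq (c h2 u))) (sym (*-assoc _ _ _))))))

  -- Write c^4 = c · c³ with c³ positive definite. Opening the single factor with `dual-L` leaves
  -- the correlation of g₁ against the transport of c³, which is again positive definite, so g₁ can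
  -- be opened too, this time with `dual-fibre` so that the correlations of f₁ and h₁ both survive.
  -- What remains is a sum over pairs (y, z) to which finiteness of generic fibres applies.
  e4 : energy4 h2 ≤ qq * n f1 * (qq * (nat q * d) * (C0 * (S X * S Y) + C1 * ((n f1 * n h1) * (n h2 * (n h2 * n h2)))))
  e4 = ≤-trans (≤-reflexive (Σ-cong els (\ u -> *-comm _ _))) (≤-trans (dual-L P1 P2 f1 g1 pdω) (*-monoˡ (*-nonneg 0≤qq (n-nonneg f1))
    (≤-trans (≤-reflexive (sym (L-κ P1 P2 (c g1) ω))) (≤-trans (dual-fibre P2 P1 f1 h1 d 0≤d fib (PD-κ P1 P2 pdω))
     (≤-trans (≤-reflexive (trans (Σ-cong els (\ u -> *-assoc _ _ _)) (trans (Σ-*ˡ els _ _) (cong (qq * (nat q * d) *_) (L-κ P1 P2 (\ u -> c f1 u * c h1 u) ω)))))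
      (*-monoˡ (*-nonneg 0≤qq (*-nonneg (nat-nonneg q) 0≤d)) (≤-trans toXY
       (L-good P1 P2 bad? C0 C1 0≤C0 good few X Y (n f1 * n h1) (n h2 * (n h2 * n h2)) X-nonneg Y-nonneg
        (\ u -> *-mono (abs-≥0 _) (n-nonneg h1) (c-abs f1 u) (c-abs h1 u))
        (\ u -> *-mono (abs-≥0 _) (*-nonneg (n-nonneg h2) (n-nonneg h2)) (c-abs h2 u) (sq-mono (abs-≥0 _) (c-abs h2 u)))))))))))
   where
   ω : F -> Z
   ω u = c h2 u * c h2 u * c h2 u
   pdω : PD ω
   pdω = PD-mul h2 (PD-mul h2 (corr h2 (\ _ -> refl)))
   toXY : L P1 P2 (\ u -> c f1 u * c h1 u) ω ≤ L P1 P2 X Y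
   toXY = Σ-mono els (\ y -> Σ-mono els (\ z -> ≤-trans (abs-≥ _) (≤-reflexive (trans (abs-* _ _) (cong₂ _*_ (abs-* _ _) (trans (abs-* _ _) (trans (cong (_* ∣ c h2 (D P2 y z) ∣) (abs-* _ _)) (*-assoc _ _ _))))))))

  module V = Quadruples P1 P2
  N2 S2 W : Z
  N2 = N P1 P2 f1 g1 h2
  S2 = V.S2 f1 g1 h2
  W = V.W f1 g1 h2

  -- Start of the estimate in the other direction: the norm of h₂ is q times a count, and three
  -- Cauchy-Schwarz steps lead from that count to the quartic sum.
  vo : n h2 ≡ nat q * N2
  vo = n-pdual P1 P2 f1 g1

  v1 : N2 * N2 ≤ n f1 * S2
  v1 = V.N²≤S2 f1 g1 h2

  v2 : S2 * S2 ≤ n g1 * n g1 * W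
  v2 = V.S2²≤W f1 g1 h2

  v3 : W * W ≤ V.quadruples * energy4 h2
  v3 = V.W²≤ f1 g1 h2

-- The estimate for mean-zero weights in natural numbers.

module Core (𝔽 : FiniteField) where
 open import Data.Nat using (_^_)
 open import Data.Integer using (∣_∣)
 open ≡ hiding (J)
 open import Algebra.Solver.CommutativeMonoid NP.*-1-commutativeMonoid using (_⊕_; _⊜_) renaming (solve to solveM)
 open IntRing
 open NumChain hiding (module Chain)
 open FSum 𝔽 integers hiding (∣_∣; _⊕_)
 private module FS = FSum 𝔽 integers
 open Analysis 𝔽 integers
 open Analysis2 𝔽 integers
 open Energy 𝔽 integers

 private
  abs² : ∀ (i j : ℤ) -> ∣ i ℤ.* j ∣ ≡ ∣ i ∣ N.* ∣ j ∣
  abs² = ℤₚ.abs-*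

 module _ (P1 P2 : F -> F) (Λ d C0 C1 Cq D' : ℕ) .{{_ : N.NonZero q}} .{{_ : N.NonZero D'}}
  (lin1 : ∀ b -> LinBound (\ y -> P1 y FS.⊕ b ⊗ P2 y) (nat Λ)) (lin2 : ∀ b -> LinBound (\ y -> (P2 y ⊝ P1 y) FS.⊕ b ⊗ (⊖ P1 y)) (nat Λ))
  (fib : ∀ s -> S (\ y -> ind (P2 y ≟ s)) ≤ nat d)
  {B : F -> F -> Set} (bad? : ∀ y z -> Dec (B y z))
  (good : ∀ a b -> S (\ y -> S (\ z -> (1z - ind (bad? y z)) * (ind (D P1 y z ≟ a) * ind (D P2 y z ≟ b)))) ≤ nat C0)
  (few : S (\ y -> S (\ z -> ind (bad? y z))) ≤ nat (q N.* C1))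
  (quad : Quadruples.quadruples P1 P2 ≤ nat (q N.* q N.* q N.* Cq))
  (D1 : d N.* C0 N.≤ D') (D2 : d N.* C1 N.≤ D') (D3 : Cq N.≤ D') (Λ² : Λ N.* Λ N.≤ D' N.* q ^ 3)
  (f g h : F -> ℤ) (Sf : S f ≡ 0z) (Sg : S g ≡ 0z) (Sh : S h ≡ 0z) where

  private
   module C = Chain P1 P2 (nat Λ) (nat-nonneg Λ) lin1 lin2 (nat d) (nat-nonneg d) fib bad? (nat C0) (nat (q N.* C1)) (nat-nonneg C0) good few f g h Sf Sg Sh
   a0 b0 co a1 b1 c1 c2 e X Y M : ℕ
   a0 = ∣ n f ∣
   b0 = ∣ n g ∣
   co = ∣ n h ∣
   a1 = ∣ n C.f1 ∣
   b1 = ∣ n C.g1 ∣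
   c1 = ∣ n C.h1 ∣
   c2 = ∣ n C.h2 ∣
   e = ∣ energy4 C.h2 ∣
   X = ∣ S C.X ∣
   Y = ∣ S C.Y ∣
   M = ∣ N P1 P2 f g h ∣

   sq : ∀ {x y z} -> x ℤ.* x ℤ.≤ y ℤ.* z -> ∣ x ∣ N.* ∣ x ∣ N.≤ ∣ y ∣ N.* ∣ z ∣
   sq {x} {y} {z} p = subst (∣ x ∣ N.* ∣ x ∣ N.≤_) (abs² y z) (∣∣-sq-mono {x} {y ℤ.* z} p)

   flip : ∀ {x y z} -> x N.≤ y N.* z -> x N.≤ z N.* y
   flip {x} {y} {z} = subst (x N.≤_) (NP.*-comm y z)

   qN : ∀ x -> ∣ nat q ℤ.* x ∣ ≡ q N.* ∣ x ∣
   qN x = trans (abs² (nat q) x) (cong (N._* ∣ x ∣) (∣nat∣ q))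

   eng : ∀ φ (x y z : F -> ℤ) -> energy φ ℤ.≤ nat q ℤ.* nat q ℤ.* n x ℤ.* (nat Λ ℤ.* (n y ℤ.* n z)) -> ∣ energy φ ∣ N.≤ q N.* q N.* ∣ n x ∣ N.* (Λ N.* (∣ n y ∣ N.* ∣ n z ∣))
   eng φ x y z p = subst (∣ energy φ ∣ N.≤_) (trans (abs² (nat q ℤ.* nat q ℤ.* n x) _) (cong₂ N._*_ (trans (abs² (nat q ℤ.* nat q) (n x)) (cong (N._* ∣ n x ∣) (trans (qN (nat q)) (cong (q N.*_) (∣nat∣ q)))))
     (trans (abs² (nat Λ) _) (cong₂ N._*_ (∣nat∣ Λ) (abs² (n y) (n z)))))) (∣∣-mono (energy-nonneg φ) p)

   h1 : (q N.* M) N.* (q N.* M) N.≤ co N.* c1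
   h1 = flip {(q N.* M) N.* (q N.* M)} {c1} {co} (subst (\ t -> t N.* t N.≤ c1 N.* co) (qN (N P1 P2 f g h)) (sq {nat q ℤ.* N P1 P2 f g h} {n C.h1} {n h} C.i1))

   h2 : c1 N.* c1 N.≤ a0 N.* a1
   h2 = flip {c1 N.* c1} {a1} {a0} (sq {n C.h1} {n C.f1} {n f} C.i2)

   h3 : a1 N.* a1 N.≤ b0 N.* b1
   h3 = flip {a1 N.* a1} {b1} {b0} (sq {n C.f1} {n C.g1} {n g} C.i3)

   h4 : b1 N.* b1 N.≤ c1 N.* c2
   h4 = flip {b1 N.* b1} {c2} {c1} (sq {n C.g1} {n C.h2} {n C.h1} C.i4)

   hX : X N.* X N.≤ (q ^ 2 N.* Λ N.* b0 N.* c1 N.* a1) N.* (q ^ 2 N.* Λ N.* a0 N.* b0 N.* c1)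
   hX = ≤∙ (sq {S C.X} {energy C.f1} {energy C.h1} C.X²) (≤∙ (*-mono-≤ (eng C.f1 g C.h1 C.f1 C.s2) (eng C.h1 f g C.h1 C.s1))
    (≡⇒≤ (solveM 6 (\ q l a b c x -> (((q ⊕ q) ⊕ b) ⊕ (l ⊕ (c ⊕ x))) ⊕ (((q ⊕ q) ⊕ a) ⊕ (l ⊕ (b ⊕ c))) ⊜ (((((q ⋆ 2) ⊕ l) ⊕ b) ⊕ c) ⊕ x) ⊕ (((((q ⋆ 2) ⊕ l) ⊕ a) ⊕ b) ⊕ c)) refl q Λ a0 b0 c1 a1)))

   hY : Y N.* Y N.≤ (q ^ 2 N.* Λ N.* a1 N.* b1 N.* c2) N.* e
   hY = ≤∙ (sq {S C.Y} {energy C.h2} {energy4 C.h2} C.Y²) (*-monoˡ-≤ e (≤∙ (eng C.h2 C.f1 C.g1 C.h2 C.s3)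
    (≡⇒≤ (solveM 5 (\ q l a b x -> ((q ⊕ q) ⊕ a) ⊕ (l ⊕ (b ⊕ x)) ⊜ ((((q ⋆ 2) ⊕ l) ⊕ a) ⊕ b) ⊕ x) refl q Λ a1 b1 c2))))

   he : e N.≤ D' N.* q ^ 5 N.* a1 N.* (X N.* Y N.+ q N.* a1 N.* c1 N.* c2 ^ 3)
   he = begin
    e ≤⟨ ∣∣-mono (energy4-nonneg C.h2) C.e4 ⟩
    ∣ nat q ℤ.* nat q ℤ.* n C.f1 ℤ.* (nat q ℤ.* nat q ℤ.* (nat q ℤ.* nat d) ℤ.* (nat C0 ℤ.* (S C.X ℤ.* S C.Y) ℤ.+ nat (q N.* C1) ℤ.* ((n C.f1 ℤ.* n C.h1) ℤ.* (n C.h2 ℤ.* (n C.h2 ℤ.* n C.h2))))) ∣ ≡⟨ conv ⟩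
    q N.* q N.* a1 N.* (q N.* q N.* (q N.* d) N.* (C0 N.* (X N.* Y) N.+ (q N.* C1) N.* ((a1 N.* c1) N.* (c2 N.* (c2 N.* c2)))))
     ≡⟨ cong (\ t -> q N.* q N.* a1 N.* t) (*-distribˡ-+ (q N.* q N.* (q N.* d)) _ _) ⟩
    q N.* q N.* a1 N.* (q N.* q N.* (q N.* d) N.* (C0 N.* (X N.* Y)) N.+ q N.* q N.* (q N.* d) N.* ((q N.* C1) N.* ((a1 N.* c1) N.* (c2 N.* (c2 N.* c2)))))
     ≡⟨ cong (\ t -> q N.* q N.* a1 N.* t) (cong₂ N._+_ (solveM 5 (\ q d C x y -> ((q ⊕ q) ⊕ (q ⊕ d)) ⊕ (C ⊕ (x ⊕ y)) ⊜ (d ⊕ C) ⊕ ((q ⋆ 3) ⊕ (x ⊕ y))) refl q d C0 X Y)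
        (solveM 6 (\ q d C a c x -> ((q ⊕ q) ⊕ (q ⊕ d)) ⊕ ((q ⊕ C) ⊕ ((a ⊕ c) ⊕ (x ⊕ (x ⊕ x)))) ⊜ (d ⊕ C) ⊕ ((q ⋆ 3) ⊕ (((q ⊕ a) ⊕ c) ⊕ (x ⋆ 3)))) refl q d C1 a1 c1 c2)) ⟩
    q N.* q N.* a1 N.* ((d N.* C0) N.* (q ^ 3 N.* (X N.* Y)) N.+ (d N.* C1) N.* (q ^ 3 N.* (q N.* a1 N.* c1 N.* c2 ^ 3)))
     ≤⟨ *-monoʳ-≤ (q N.* q N.* a1) (+-mono-≤ (*-monoˡ-≤ (q ^ 3 N.* (X N.* Y)) D1) (*-monoˡ-≤ (q ^ 3 N.* (q N.* a1 N.* c1 N.* c2 ^ 3)) D2)) ⟩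
    q N.* q N.* a1 N.* (D' N.* (q ^ 3 N.* (X N.* Y)) N.+ D' N.* (q ^ 3 N.* (q N.* a1 N.* c1 N.* c2 ^ 3)))
     ≡⟨ cong (\ t -> q N.* q N.* a1 N.* t) (trans (sym (*-distribˡ-+ D' (q ^ 3 N.* (X N.* Y)) _)) (cong (D' N.*_) (sym (*-distribˡ-+ (q ^ 3) (X N.* Y) _)))) ⟩
    q N.* q N.* a1 N.* (D' N.* (q ^ 3 N.* (X N.* Y N.+ q N.* a1 N.* c1 N.* c2 ^ 3)))
     ≡⟨ solveM 4 (\ q a D t -> ((q ⊕ q) ⊕ a) ⊕ (D ⊕ ((q ⋆ 3) ⊕ t)) ⊜ ((D ⊕ (q ⋆ 5)) ⊕ a) ⊕ t) refl q a1 D' (X N.* Y N.+ q N.* a1 N.* c1 N.* c2 ^ 3) ⟩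
    D' N.* q ^ 5 N.* a1 N.* (X N.* Y N.+ q N.* a1 N.* c1 N.* c2 ^ 3) ∎
    where
    open NP.≤-Reasoning
    SX≥0 : 0z ≤ S C.X
    SX≥0 = Σ-nonneg els C.X-nonneg
    SY≥0 : 0z ≤ S C.Y
    SY≥0 = Σ-nonneg els C.Y-nonneg
    t₁ t2 : ℤ
    t₁ = nat C0 ℤ.* (S C.X ℤ.* S C.Y)
    t2 = nat (q N.* C1) ℤ.* ((n C.f1 ℤ.* n C.h1) ℤ.* (n C.h2 ℤ.* (n C.h2 ℤ.* n C.h2)))
    nn = n-nonneg
    conv : ∣ nat q ℤ.* nat q ℤ.* n C.f1 ℤ.* (nat q ℤ.* nat q ℤ.* (nat q ℤ.* nat d) ℤ.* (t₁ ℤ.+ t2)) ∣ ≡ q N.* q N.* a1 N.* (q N.* q N.* (q N.* d) N.* (C0 N.* (X N.* Y) N.+ (q N.* C1) N.* ((a1 N.* c1) N.* (c2 N.* (c2 N.* c2)))))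
    conv = trans (abs² (nat q ℤ.* nat q ℤ.* n C.f1) _) (cong₂ N._*_ (trans (abs² (nat q ℤ.* nat q) (n C.f1)) (cong (N._* a1) (trans (qN (nat q)) (cong (q N.*_) (∣nat∣ q)))))
     (trans (abs² (nat q ℤ.* nat q ℤ.* (nat q ℤ.* nat d)) (t₁ ℤ.+ t2)) (cong₂ N._*_ (trans (abs² (nat q ℤ.* nat q) (nat q ℤ.* nat d)) (cong₂ N._*_ (trans (qN (nat q)) (cong (q N.*_) (∣nat∣ q))) (trans (qN (nat d)) (cong (q N.*_) (∣nat∣ d)))))
      (trans (∣∣-+ {t₁} {t2} (*-nonneg (nat-nonneg C0) (*-nonneg SX≥0 SY≥0)) (*-nonneg (nat-nonneg (q N.* C1)) (*-nonneg (*-nonneg (nn C.f1) (nn C.h1)) (*-nonneg (nn C.h2) (*-nonneg (nn C.h2) (nn C.h2))))))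
       (cong₂ N._+_ (trans (abs² (nat C0) _) (cong₂ N._*_ (∣nat∣ C0) (abs² (S C.X) (S C.Y))))
        (trans (abs² (nat (q N.* C1)) _) (cong₂ N._*_ (∣nat∣ (q N.* C1)) (trans (abs² (n C.f1 ℤ.* n C.h1) _) (cong₂ N._*_ (abs² (n C.f1) (n C.h1)) (trans (abs² (n C.h2) _) (cong (c2 N.*_) (abs² (n C.h2) (n C.h2)))))))))))))

   -- Each of the three Cauchy-Schwarz steps doubles the exponent, hence the 8th power; q^11 is q^8
   -- from the relation between norm and count times q³ from the quadruples.
   hv : c2 ^ 8 N.≤ D' N.* q ^ 11 N.* a1 ^ 4 N.* b1 ^ 4 N.* e
   hv = begin
    c2 ^ 8 ≡⟨ cong (_^ 8) (trans (cong ∣_∣ C.vo) (qN C.N2)) ⟩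
    (q N.* m) ^ 8 ≡⟨ solveM 2 (\ q m -> (q ⊕ m) ⋆ 8 ⊜ (q ⋆ 8) ⊕ ((m ⊕ m) ⋆ 4)) refl q m ⟩
    q ^ 8 N.* (m N.* m) ^ 4 ≤⟨ *-monoʳ-≤ (q ^ 8) (^-monoˡ-≤ 4 (sq {C.N2} {n C.f1} {C.S2} C.v1)) ⟩
    q ^ 8 N.* (a1 N.* s) ^ 4 ≡⟨ solveM 3 (\ q a s -> (q ⋆ 8) ⊕ ((a ⊕ s) ⋆ 4) ⊜ ((q ⋆ 8) ⊕ (a ⋆ 4)) ⊕ ((s ⊕ s) ⋆ 2)) refl q a1 s ⟩
    q ^ 8 N.* a1 ^ 4 N.* (s N.* s) ^ 2 ≤⟨ *-monoʳ-≤ (q ^ 8 N.* a1 ^ 4) (^-monoˡ-≤ 2 (≤∙ (sq {C.S2} {n C.g1 ℤ.* n C.g1} {C.W} C.v2) (≡⇒≤ (cong (N._* w) (abs² (n C.g1) (n C.g1)))))) ⟩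
    q ^ 8 N.* a1 ^ 4 N.* (b1 N.* b1 N.* w) ^ 2 ≡⟨ solveM 4 (\ q a b w -> ((q ⋆ 8) ⊕ (a ⋆ 4)) ⊕ (((b ⊕ b) ⊕ w) ⋆ 2) ⊜ (((q ⋆ 8) ⊕ (a ⋆ 4)) ⊕ (b ⋆ 4)) ⊕ (w ⊕ w)) refl q a1 b1 w ⟩
    q ^ 8 N.* a1 ^ 4 N.* b1 ^ 4 N.* (w N.* w) ≤⟨ *-monoʳ-≤ (q ^ 8 N.* a1 ^ 4 N.* b1 ^ 4) (≤∙ (sq {C.W} {C.V.quadruples} {energy4 C.h2} C.v3) (*-monoˡ-≤ e quadℕ)) ⟩
    q ^ 8 N.* a1 ^ 4 N.* b1 ^ 4 N.* ((q N.* q N.* q N.* D') N.* e) ≡⟨ solveM 5 (\ q a b D e -> (((q ⋆ 8) ⊕ (a ⋆ 4)) ⊕ (b ⋆ 4)) ⊕ ((((q ⊕ q) ⊕ q) ⊕ D) ⊕ e) ⊜ (((D ⊕ (q ⋆ 11)) ⊕ (a ⋆ 4)) ⊕ (b ⋆ 4)) ⊕ e) refl q a1 b1 D' e ⟩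
    D' N.* q ^ 11 N.* a1 ^ 4 N.* b1 ^ 4 N.* e ∎
    where
    open NP.≤-Reasoning
    m s w : ℕ
    m = ∣ C.N2 ∣
    s = ∣ C.S2 ∣
    w = ∣ C.W ∣
    quad≥0 : 0z ≤ C.V.quadruples
    quad≥0 = Σ-nonneg els⁴ (\ p -> Σ-nonneg els⁴ (\ p' -> *-nonneg (*-nonneg (ind-nonneg (C.V.on? p)) (ind-nonneg (C.V.on? p'))) (ind-nonneg (C.V.key p' ≟³ C.V.key p))))
    quadℕ : ∣ C.V.quadruples ∣ N.≤ q N.* q N.* q N.* D'
    quadℕ = ≤∙ (∣∣-≤ quad≥0 quad) (*-monoʳ-≤ (q N.* q N.* q) D3)

  mean-zero-bound : M ^ 16 N.≤ constant D' ^ 2 N.* q ^ 7 N.* (a0 N.* b0 N.* co) ^ 8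
  mean-zero-bound = elimination D' q M a0 b0 co a1 b1 c1 c2 e X Y Λ h1 h2 h3 h4 hv he hX hY Λ²

-- The Frobenius map on F and on power series.

module Frob (𝔽 : FiniteField) where
 open import Data.Fin.Permutation using (Permutation; permutation)
 open import Data.Vec.Functional using (removeAt)
 open ≡
 import Algebra.Properties.CommutativeMonoid.Sum as CMS
 open Fld 𝔽
 open Ser 𝔽
 open Poly 𝔽
 open CMS (CommutativeRing.*-commutativeMonoid FR) using ()
  renaming (sum to prod; sum-permute to prod-permute; sum-cong-≗ to prod-cong; ∑-distrib-+ to prod-*; sum-remove to prod-remove; sum-replicate-zero to prod-1)

 infixr 8 _^F_ _^ˢ_
 _^F_ : F -> ℕ -> F
 x ^F zero = 1#
 x ^F suc n = x * x ^F n

 _^ˢ_ : Ser -> ℕ -> Ser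
 x ^ˢ zero = const 1#
 x ^ˢ suc n = x *ˢ x ^ˢ n

 q>0 : 0 N.< q
 q>0 = pos (index 0#)
  where
  pos : ∀ {n} -> Fin n -> 0 N.< n
  pos {suc n} _ = s≤s z≤n

 ^F-zero : ∀ {n} -> 0 N.< n -> 0# ^F n ≡ 0#
 ^F-zero {suc n} _ = zeroˡ _

 els-unique : Unique els
 els-unique = Uniqueₚ.tabulate⁺ (\ {i} {j} e -> trans (sym (index-element i)) (trans (cong index e) (index-element j)))

 prod-const : ∀ n x -> prod {n} (\ _ -> x) ≡ x ^F n
 prod-const zero x = refl
 prod-const (suc n) x = cong (x *_) (prod-const n x)

 prod-single : ∀ {n} (t : Fin n -> F) j -> (∀ i -> ¬ i ≡ j -> t i ≡ 1#) -> prod t ≡ t j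
 prod-single {suc n} t j e = trans (prod-remove {i = j} t) (trans (cong (t j *_)
   (trans (prod-cong {n} (\ k -> e (Fin.punchIn j k) (\ h -> Finₚ.punchInᵢ≢i j k h))) (prod-1 n))) (*-identityʳ _))

 prod-≢0 : ∀ {n} (t : Fin n -> F) -> (∀ i -> ¬ t i ≡ 0#) -> ¬ prod t ≡ 0#
 prod-≢0 {zero} t h e = 0≢1 (sym e)
 prod-≢0 {suc n} t h = *-≢0 (h Fin.zero) (prod-≢0 (\ i -> t (Fin.suc i)) (\ i -> h (Fin.suc i)))

 nz : F -> F -> F
 nz x a with a ≟ 0#
 ... | yes _ = 1#
 ... | no _ = x

 frobenius : ∀ x -> x ^F q ≡ x
 frobenius x with x ≟ 0#
 ... | yes refl = ^F-zero q>0
 ... | no ne = trans (sym whole) (trans (cong (_* x) k≡1) (*-identityˡ x))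
  where
  -- `w` replaces 0 by 1, so that its product over F is nonzero. Multiplication by x permutes F and
  -- multiplies this product by `k`, which is x at every nonzero element. `l` supplies the one
  -- factor x missing at 0, so that the full product has exactly q factors.
  w k l : F -> F
  w a = nz a a
  k a = nz x a
  l a with a ≟ 0#
  ... | yes _ = x
  ... | no _ = 1#
  w-≢0 : ∀ a -> ¬ w a ≡ 0#
  w-≢0 a with a ≟ 0#
  ... | yes _ = \ e -> 0≢1 (sym e)
  ... | no n = n
  wx : ∀ a -> w (x * a) ≡ k a * w a
  wx a with a ≟ 0# | x * a ≟ 0#
  ... | yes refl | yes _ = sym (*-identityˡ _)
  ... | yes refl | no n = ⊥-elim (n (zeroʳ x))
  ... | no n | yes e = ⊥-elim (*-≢0 ne n e)
  ... | no n | no _ = refl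
  kl : ∀ a -> k a * l a ≡ x
  kl a with a ≟ 0#
  ... | yes _ = *-identityˡ x
  ... | no _ = *-identityʳ x
  l1 : ∀ a -> ¬ a ≡ 0# -> l a ≡ 1#
  l1 a n with a ≟ 0#
  ... | yes e = ⊥-elim (n e)
  ... | no _ = refl
  l0 : l 0# ≡ x
  l0 with 0# ≟ 0#
  ... | yes _ = refl
  ... | no n = ⊥-elim (n refl)
  Π : (F -> F) -> F
  Π f = prod {q} (\ i -> f (element i))
  π : Permutation q q
  π = permutation (\ i -> index (x * element i)) (\ i -> index (inv x * element i))
   (\ i -> trans (cong (\ z -> index (x * z)) (element-index _)) (trans (cong index (trans (sym (*-assoc _ _ _)) (trans (cong (_* element i) (inv-r ne)) (*-identityˡ _)))) (index-element i)))
   (\ i -> trans (cong (\ z -> index (inv x * z)) (element-index _)) (trans (cong index (trans (sym (*-assoc _ _ _)) (trans (cong (_* element i) (inv-l ne)) (*-identityˡ _)))) (index-element i)))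
  perm : Π w ≡ Π k * Π w
  perm = trans (prod-permute (\ i -> w (element i)) π) (trans (prod-cong {q} (\ i -> trans (cong w (element-index _)) (wx (element i)))) (prod-* {q} _ _))
  k≡1 : Π k ≡ 1#
  k≡1 = sub-≡ (*-cancelˡ-0 (prod-≢0 _ (\ i -> w-≢0 (element i))) (trans (solve 3 (\ w k o -> w :* (k :- o) := k :* w :- o :* w) refl (Π w) (Π k) 1#) (≡-sub (trans (sym perm) (sym (*-identityˡ _))))))
  Πl : Π l ≡ x
  Πl = trans (prod-single (\ i -> l (element i)) (index 0#) (\ i n -> l1 _ (\ e -> n (trans (sym (index-element i)) (cong index e))))) (trans (cong l (element-index 0#)) l0)
  whole : Π k * x ≡ x ^F q
  whole = trans (cong (Π k *_) (sym Πl)) (trans (sym (prod-* {q} _ _)) (trans (prod-cong {q} (\ i -> kl (element i))) (prod-const q x)))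

 monomial : ℕ -> F -> Pol
 monomial zero c = c ∷ []
 monomial (suc n) c = 0# ∷ monomial n c

 -- (Y + c)^n - Y^n
 powdiff : F -> ℕ -> Pol
 powdiff c zero = []
 powdiff c (suc n) = (scale c (powdiff c n) ⊞ (0# ∷ powdiff c n)) ⊞ monomial n c

 length-monomial : ∀ n c -> length (monomial n c) ≡ suc n
 length-monomial zero c = refl
 length-monomial (suc n) c = cong suc (length-monomial n c)

 length-powdiff : ∀ c n -> length (powdiff c n) N.≤ n
 length-powdiff c zero = z≤n
 length-powdiff c (suc n) = length-⊞ (scale c (powdiff c n) ⊞ (0# ∷ powdiff c n)) (monomial n c)
  (length-⊞ (scale c (powdiff c n)) _ (subst (N._≤ suc n) (sym (Listₚ.length-map (c *_) (powdiff c n))) (m≤n⇒m≤1+n (length-powdiff c n))) (s≤s (length-powdiff c n)))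
  (≡⇒≤ (length-monomial n c))

 module PowEval (A : FAlgebra) where
  open FAlgebra A renaming (Carrier to C; 0# to 0A; 1# to 1A; _+_ to _⊹_; _*_ to _·_; _≈_ to _~_; refl to ~refl; sym to ~sym; trans to ~trans; reflexive to ~reflexive; *-identityʳ to ·-identityʳ) 
   hiding (+-identityˡ; +-identityʳ; *-identityˡ; zeroˡ; zeroʳ; *-assoc; +-assoc; *-comm; +-comm; distribˡ; distribʳ; -_; _-_; -‿inverseˡ; -‿inverseʳ; isCommutativeRing)
  open Eval A
  open RingZ
  module IC = IntegerCoefficients alg
  pow : C -> ℕ -> C
  pow x zero = 1A
  pow x (suc n) = x · pow x n

  hev-monomial : ∀ n c x -> hev (monomial n c) x ~ ι c · pow x n
  hev-monomial zero c x = ~trans (IC.solve 2 (\ a x -> a IC.:+ x IC.:* IC.con (ℤ.+ 0) IC.:= a) ~refl (ι c) x) (~sym (·-identityʳ _))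
  hev-monomial (suc n) c x = ~trans (hev-shift (monomial n c) x) (~trans (*-congˡ (hev-monomial n c x))
   (IC.solve 3 (\ a x p -> x IC.:* (a IC.:* p) IC.:= a IC.:* (x IC.:* p)) ~refl (ι c) x (pow x n)))

  hev-powdiff : ∀ c n x -> hev (powdiff c n) x ⊹ pow x n ~ pow (x ⊹ ι c) n
  hev-powdiff c zero x = FAlgebra.+-identityˡ A 1A
  hev-powdiff c (suc n) x = ~trans (+-congʳ (~trans (hev-⊞ (scale c (powdiff c n) ⊞ (K0 ∷ powdiff c n)) (monomial n c) x)
     (+-cong (~trans (hev-⊞ (scale c (powdiff c n)) (K0 ∷ powdiff c n) x) (+-cong (hev-scale c (powdiff c n) x) (hev-shift (powdiff c n) x))) (hev-monomial n c x))))
   (~trans (IC.solve 4 (\ a x h p -> ((a IC.:* h IC.:+ x IC.:* h) IC.:+ a IC.:* p) IC.:+ x IC.:* p IC.:= (x IC.:+ a) IC.:* (h IC.:+ p)) ~refl (ι c) x (hev (powdiff c n) x) (pow x n))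
    (*-congˡ (hev-powdiff c n x)))
   where
   K0 : F
   K0 = 0#

 module PF = PowEval selfAlgebra
 module PS = PowEval seriesAlgebra

 ^F≡pow : ∀ x n -> x ^F n ≡ PF.pow x n
 ^F≡pow x zero = refl
 ^F≡pow x (suc n) = cong (x *_) (^F≡pow x n)

 ^ˢ≈pow : ∀ x n -> x ^ˢ n ≈ PS.pow x n
 ^ˢ≈pow x zero = \ _ -> refl
 ^ˢ≈pow x (suc n) = *ˢ-cong {x} {x} (\ _ -> refl) (^ˢ≈pow x n)

 private
  frobPol : F -> Pol
  frobPol c = powdiff c q ⊞ ((- c) ∷ [])

  frobPol-ev : ∀ c x -> ev (frobPol c) x ≡ 0#
  frobPol-ev c x = trans (Ev.hev-⊞ (powdiff c q) _ x) (trans (cong (_+ ev ((- c) ∷ []) x) h)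
    (solve 3 (\ x c z -> ((x :+ c) :- x) :+ (:- c :+ x :* con (ℤ.+ 0)) := con (ℤ.+ 0)) refl x c 0#))
   where
   h : ev (powdiff c q) x ≡ (x + c) - x
   h = trans (solve 2 (\ a b -> a := (a :+ b) :- b) refl (ev (powdiff c q) x) x) (cong (_- x) (trans (cong (ev (powdiff c q) x +_) (trans (sym (frobenius x)) (^F≡pow x q)))
     (trans (PF.hev-powdiff c q x) (trans (sym (^F≡pow (x + c) q)) (frobenius (x + c))))))

  frobPol-zero : ∀ c k -> coef (frobPol c) k ≡ 0#
  frobPol-zero c with all-zero? (frobPol c)
  ... | inj₁ z = z
  ... | inj₂ nonz = ⊥-elim (<⇒≱ (roots-bound (frobPol c) nonz els els-unique (All.universal (frobPol-ev c) els))
    (subst (length (frobPol c) N.≤_) (sym length-els) (length-⊞ (powdiff c q) ((- c) ∷ []) (length-powdiff c q) q>0)))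

 -- The polynomial (Y + c)^q - Y^q - c has at most q coefficients and vanishes at all q elements of
 -- F, so it is zero as a polynomial and may be evaluated at a power series.
 frobenius-series : ∀ X c -> (X +ˢ const c) ^ˢ q ≈ X ^ˢ q +ˢ const c
 frobenius-series X c = R.trans (^ˢ≈pow (X +ˢ const c) q) (R.trans (R.sym (PS.hev-powdiff c q X))
   (R.trans (R.+-cong h (R.sym (^ˢ≈pow X q))) (R.+-comm (const c) (X ^ˢ q))))
  where
  h : Es.hev (powdiff c q) X ≈ const c
  h = R.trans (Sol.solve 2 (\ a b -> a Sol.:= (a Sol.:+ Sol.:- b) Sol.:+ b) R.refl (Es.hev (powdiff c q) X) (const c))
    (R.trans (R.+-congʳ (R.trans (R.+-congˡ (R.sym t)) (R.trans (R.sym (Es.hev-⊞ (powdiff c q) ((- c) ∷ []) X)) (Es.hev-zero (frobPol c) X (frobPol-zero c))))) (R.+-identityˡ (const c)))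
   where
   t : Es.hev ((- c) ∷ []) X ≈ -ˢ const c
   t = R.trans (R.+-congˡ (R.zeroʳ X)) (R.trans (R.+-identityʳ _) (const-neg c))

-- Counting roots and fibres by indicator sums.

module Count (𝔽 : FiniteField) (𝕆 : OrderedRing) where
 open ≡
 open import Relation.Unary using (Decidable; Pred)
 open FSum 𝔽 𝕆
 open Analysis2 𝔽 𝕆 using (els²)
 open Frob 𝔽 using (els-unique)
 open Poly 𝔽
 private module K = Fld 𝔽

 nat-mono : ∀ {m n} -> m N.≤ n -> nat m ≤ nat n
 nat-mono {n = n} z≤n = nat-nonneg n
 nat-mono (s≤s h) = +-mono ≤-refl (nat-mono h)

 nat-+ : ∀ m n -> nat (m N.+ n) ≡ nat m + nat n
 nat-+ zero n = sym (+-identityˡ _)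
 nat-+ (suc m) n = trans (cong (1z +_) (nat-+ m n)) (sym (+-assoc _ _ _))

 nat-* : ∀ m n -> nat (m N.* n) ≡ nat m * nat n
 nat-* zero n = sym (zeroˡ _)
 nat-* (suc m) n = trans (nat-+ n (m N.* n)) (trans (cong₂ _+_ (sym (*-identityˡ _)) (nat-* m n)) (sym (distribʳ _ _ _)))

 els²-unique : Unique els²
 els²-unique = Uniqueₚ.cartesianProduct⁺ els-unique els-unique

 module _ {I : Set} {P : Pred I 0ℓ} (P? : Decidable P) where

  count-filter : ∀ xs -> Σ xs (\ x -> ind (P? x)) ≡ nat (length (filter P? xs))
  count-filter [] = refl
  count-filter (x ∷ xs) with P? x
  ... | yes _ = cong (1z +_) (count-filter xs)
  ... | no _ = trans (+-identityˡ _) (count-filter xs)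

  count-≤ : ∀ xs -> Unique xs -> ∀ B -> (∀ ys -> Unique ys -> All P ys -> length ys N.≤ B) -> Σ xs (\ x -> ind (P? x)) ≤ nat B
  count-≤ xs u B h = ≤-trans (≤-reflexive (count-filter xs)) (nat-mono (h (filter P? xs) (Uniqueₚ.filter⁺ P? u) (Allₚ.all-filter P? xs)))

 roots-≤ : ∀ p -> NonzeroPol p -> S (\ x -> ind (ev p x ≟ 𝟘)) ≤ nat (N.pred (length p))
 roots-≤ p nz = count-≤ (\ x -> ev p x ≟ 𝟘) els els-unique _ (\ ys u a -> <⇒≤pred (roots-bound p nz ys u a))

 fibre-≤ : ∀ p -> (∃ \ k -> ¬ coef p (suc k) ≡ 𝟘) -> ∀ a -> S (\ x -> ind (ev p x ≟ a)) ≤ nat (N.pred (length p))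
 fibre-≤ [] (k , ne) a with () ← ne refl
 fibre-≤ (b ∷ p) (k , ne) a = ≤-trans (≤-reflexive (Σ-cong els (\ x -> ind-cong (ev (b ∷ p) x ≟ a) (ev ((b ⊝ a) ∷ p) x ≟ 𝟘)
   (\ e -> trans (re x) (K.≡-sub e)) (\ e -> K.sub-≡ (trans (sym (re x)) e))))) (roots-≤ ((b ⊝ a) ∷ p) (suc k , ne))
  where
  re : ∀ x -> ev ((b ⊝ a) ∷ p) x ≡ ev (b ∷ p) x ⊝ a
  re x = K.solve 3 (\ b a m -> (b K.:- a) K.:+ m K.:= (b K.:+ m) K.:- a) refl b a (x ⊗ ev p x)

-- Polynomials with coefficients in the ring itself.

module CEval {a ℓ} (R : CommutativeRing a ℓ) where
 open RingZ
 open CommutativeRing R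
 open IntegerCoefficients R
 open import Relation.Binary.Reasoning.Setoid setoid

 cev cder : List Carrier -> Carrier -> Carrier
 cev [] v = 0#
 cev (c ∷ cs) v = c + v * cev cs v

 cder [] v = 0#
 cder (c ∷ cs) v = cev cs v + v * cder cs v

 ctay : List Carrier -> Carrier -> Carrier -> Carrier
 ctay [] v ν = 0#
 ctay (c ∷ cs) v ν = cder cs v + (v + ν) * ctay cs v ν

 ctaylor : ∀ cs v ν -> cev cs (v + ν) ≈ (cev cs v + ν * cder cs v) + (ν * ν) * ctay cs v ν
 ctaylor [] v ν = solve 1 (\ v -> con (ℤ.+ 0) := (con (ℤ.+ 0) :+ v :* con (ℤ.+ 0)) :+ v :* v :* con (ℤ.+ 0)) refl ν
 ctaylor (c ∷ cs) v ν = begin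
  c + (v + ν) * cev cs (v + ν) ≈⟨ +-congˡ (*-congˡ (ctaylor cs v ν)) ⟩
  c + (v + ν) * ((cev cs v + ν * cder cs v) + (ν * ν) * ctay cs v ν)
   ≈⟨ solve 6 (\ a x v h d t -> a :+ (x :+ v) :* ((h :+ v :* d) :+ v :* v :* t) :=
      ((a :+ x :* h) :+ v :* (h :+ x :* d)) :+ v :* v :* (d :+ (x :+ v) :* t)) refl c v ν (cev cs v) (cder cs v) (ctay cs v ν) ⟩
  ((c + v * cev cs v) + ν * (cev cs v + v * cder cs v)) + (ν * ν) * (cder cs v + (v + ν) * ctay cs v ν) ∎

 module _ {b} {I : Set b} where

  cev-map-cong : ∀ {f g : I -> Carrier} -> (∀ r -> f r ≈ g r) -> ∀ L {v w} -> v ≈ w -> cev (map f L) v ≈ cev (map g L) w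
  cev-map-cong e [] p = refl
  cev-map-cong e (r ∷ L) p = +-cong (e r) (*-cong p (cev-map-cong e L p))

  cder-map-cong : ∀ {f g : I -> Carrier} -> (∀ r -> f r ≈ g r) -> ∀ L {v w} -> v ≈ w -> cder (map f L) v ≈ cder (map g L) w
  cder-map-cong e [] p = refl
  cder-map-cong e (r ∷ L) p = +-cong (cev-map-cong e L p) (*-cong p (cder-map-cong e L p))

  cev-linear : ∀ (f g : I -> Carrier) w L v -> cev (map (\ r -> f r + w * g r) L) v ≈ cev (map f L) v + w * cev (map g L) v
  cev-linear f g w [] v = solve 1 (\ w -> con (ℤ.+ 0) := con (ℤ.+ 0) :+ w :* con (ℤ.+ 0)) refl w
  cev-linear f g w (r ∷ L) v = trans (+-congˡ (*-congˡ (cev-linear f g w L v)))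
   (solve 6 (\ a b w v x y -> (a :+ w :* b) :+ v :* (x :+ w :* y) := (a :+ v :* x) :+ w :* (b :+ v :* y)) refl (f r) (g r) w v _ _)

  cder-linear : ∀ (f g : I -> Carrier) w L v -> cder (map (\ r -> f r + w * g r) L) v ≈ cder (map f L) v + w * cder (map g L) v
  cder-linear f g w [] v = solve 1 (\ w -> con (ℤ.+ 0) := con (ℤ.+ 0) :+ w :* con (ℤ.+ 0)) refl w
  cder-linear f g w (r ∷ L) v = trans (+-cong (cev-linear f g w L v) (*-congˡ (cder-linear f g w L v)))
   (solve 6 (\ a b w v x y -> (a :+ w :* b) :+ v :* (x :+ w :* y) := (a :+ v :* x) :+ w :* (b :+ v :* y)) refl (cev (map f L) v) (cev (map g L) v) w v _ _)

-- Expansion of a plane curve at a smooth point.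

module Expand (𝔽 : FiniteField) where
 open ≡
 open Fld 𝔽
 open Ser 𝔽
 open Poly 𝔽
 open CEval FR using () renaming (cev to cevF; cder to cderF)
 open CEval SR

 const-cong : ∀ {x y} -> x ≡ y -> const x ≈ const y
 const-cong refl n = refl

 hev-const : ∀ p x -> Es.hev p (const x) ≈ const (ev p x)
 hev-const [] x n = refl
 hev-const (a ∷ p) x = R.trans (R.+-congˡ {x = const a} (R.trans (R.*-congˡ {x = const x} (hev-const p x)) (R.sym (const-* x (ev p x))))) (R.sym (const-+ a (x * ev p x)))

 module _ {I : Set} (f : I -> F) where
  cev-const : ∀ L v -> cev (map (\ r -> const (f r)) L) (const v) ≈ const (cevF (map f L) v)
  cev-const [] v n = refl
  cev-const (r ∷ L) v = R.trans (R.+-congˡ {x = const (f r)} (R.trans (R.*-congˡ {x = const v} (cev-const L v)) (R.sym (const-* v _)))) (R.sym (const-+ (f r) _))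

  cder-const : ∀ L v -> cder (map (\ r -> const (f r)) L) (const v) ≈ const (cderF (map f L) v)
  cder-const [] v n = refl
  cder-const (r ∷ L) v = R.trans (R.+-cong (cev-const L v) (R.trans (R.*-congˡ {x = const v} (cder-const L v)) (R.sym (const-* v _)))) (R.sym (const-+ _ _))

 ctay-causal : ∀ {n} cs v {ν ν'} -> ν ≡[ n ] ν' -> ctay cs v ν ≡[ n ] ctay cs v ν'
 ctay-causal [] v p = \ _ -> refl
 ctay-causal (c ∷ cs) v {ν} {ν'} p = ≡[]-+ {a = cder cs v} {cder cs v} (\ _ -> refl)
  (≡[]-* {a = v +ˢ ν} {v +ˢ ν'} {ctay cs v ν} {ctay cs v ν'} (≡[]-+ {a = v} {v} (\ _ -> refl) p) (ctay-causal cs v p))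

 -- Expansion of the curve Σ_j H_j(x) v^j = 0 at a point (x0, vo) where η = H_v(x0, vo):
 -- x = x0 + η² u and v = vo + η u ψ, with ψ free of denominators.
 module Local (H : List Pol) (x0 vo : F) where
  η : F
  η = cderF (map (\ r -> ev r x0) H) vo

  X0 V0 ω x̂ : Ser
  X0 = const x0
  V0 = const vo
  ω = uˢ *ˢ const (η * η)
  x̂ = X0 +ˢ ω

  Dr ĉ : Pol -> Ser
  Dr r = Es.der r X0 +ˢ ω *ˢ Es.tay r X0 ω
  ĉ r = Es.hev r X0 +ˢ ω *ˢ Dr r

  U U' : Ser
  U = cev (map Dr H) V0
  U' = cder (map Dr H) V0

  ν : Ser -> Ser
  ν ψ = uˢ *ˢ (const η *ˢ ψ)

  T : Ser -> Ser
  T ψ = ctay (map ĉ H) V0 (ν ψ)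

  Φ : Ser -> Ser
  Φ ψ = -ˢ ((const η *ˢ ψ) *ˢ U' +ˢ (ψ *ˢ ψ) *ˢ T ψ)

  ν-causal : ∀ {n a b} -> a ≡[ n ] b -> ν a ≡[ n ] ν b
  ν-causal {n} {a} {b} p = ≡[]-* {n} {uˢ} {uˢ} {const η *ˢ a} {const η *ˢ b} (\ _ -> refl) (≡[]-* {n} {const η} {const η} {a} {b} (\ _ -> refl) p)

  Φ-causal : ∀ {n a b} -> a ≡[ n ] b -> Φ a ≡[ n ] Φ b
  Φ-causal {n} {a} {b} p = ≡[]-neg {n} {(const η *ˢ a) *ˢ U' +ˢ (a *ˢ a) *ˢ T a} {(const η *ˢ b) *ˢ U' +ˢ (b *ˢ b) *ˢ T b}
   (≡[]-+ {n} {(const η *ˢ a) *ˢ U'} {(const η *ˢ b) *ˢ U'} {(a *ˢ a) *ˢ T a} {(b *ˢ b) *ˢ T b}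
    (≡[]-* {n} {const η *ˢ a} {const η *ˢ b} {U'} {U'} (≡[]-* {n} {const η} {const η} {a} {b} (\ _ -> refl) p) (\ _ -> refl))
    (≡[]-* {n} {a *ˢ a} {b *ˢ b} {T a} {T b} (≡[]-* {n} {a} {b} {a} {b} p p) (ctay-causal (map ĉ H) V0 (ν-causal {n} {a} {b} p))))

  open Fixpoint (-ˢ U) Φ (\ {n} {a} {b} -> Φ-causal {n} {a} {b}) public using (iter; fix; fix-eq)

  ψ v̂ : Ser
  ψ = fix
  v̂ = V0 +ˢ ν ψ

  x̂-0 : x̂ 0 ≡ x0
  x̂-0 = trans (cong (x0 +_) (u*-zero (const (η * η)))) (+-identityʳ x0)

  v̂-0 : v̂ 0 ≡ vo
  v̂-0 = trans (cong (vo +_) (u*-zero (const η *ˢ ψ))) (+-identityʳ vo)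

  hev-x̂ : ∀ r -> Es.hev r x̂ ≈ ĉ r
  hev-x̂ r = R.trans (Es.taylor r X0 ω) (Sol.solve 4 (\ h w d t -> (h Sol.:+ w Sol.:* d) Sol.:+ w Sol.:* w Sol.:* t Sol.:= h Sol.:+ w Sol.:* (d Sol.:+ w Sol.:* t)) R.refl
    (Es.hev r X0) ω (Es.der r X0) (Es.tay r X0 ω))

  module _ (on : cevF (map (\ r -> ev r x0) H) vo ≡ 0#) where
   private
    co : Pol -> Ser
    co r = Es.hev r X0
    H0 : cev (map co H) V0 ≈ const 0#
    H0 = R.trans (cev-map-cong {f = co} {\ r -> const (ev r x0)} (\ r -> hev-const r x0) H R.refl) (R.trans (cev-const (\ r -> ev r x0) H vo) (const-cong on))
    Hη : cder (map co H) V0 ≈ const η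
    Hη = R.trans (cder-map-cong {f = co} {\ r -> const (ev r x0)} (\ r -> hev-const r x0) H R.refl) (cder-const (\ r -> ev r x0) H vo)

   -- Taylor expansion in x and v, with the value at the point zero and the v-derivative equal to
   -- `η`, leaves a multiple of u `η`². The cofactor is `U` + ψ + u (...), and this is precisely the
   -- equation that defines ψ as a fixed point.
   on-curve : cev (map (\ r -> Es.hev r x̂) H) v̂ ≈ const 0#
   on-curve = R.trans (cev-map-cong {f = \ r -> Es.hev r x̂} {ĉ} hev-x̂ H R.refl) (R.trans (ctaylor (map ĉ H) V0 (ν ψ))
    (R.trans (R.+-congʳ (R.+-cong (R.trans (cev-linear co Dr ω H V0) (R.+-congʳ H0)) (R.*-congˡ {x = ν ψ} (R.trans (cder-linear co Dr ω H V0) (R.+-congʳ Hη)))))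
    (R.trans (R.+-congʳ (R.+-cong (R.+-congˡ {x = const 0#} (R.*-congʳ {x = U} ω≈)) (R.*-congˡ {x = ν ψ} (R.+-congˡ {x = const η} (R.*-congʳ {x = U'} ω≈)))))
    (R.trans (Sol.solve 6 (\ u e U U' p t -> (con0 Sol.:+ (u Sol.:* (e Sol.:* e)) Sol.:* U Sol.:+ (u Sol.:* (e Sol.:* p)) Sol.:* (e Sol.:+ (u Sol.:* (e Sol.:* e)) Sol.:* U')) Sol.:+ ((u Sol.:* (e Sol.:* p)) Sol.:* (u Sol.:* (e Sol.:* p))) Sol.:* t
       Sol.:= (u Sol.:* (e Sol.:* e)) Sol.:* ((U Sol.:+ p) Sol.:+ u Sol.:* ((e Sol.:* p) Sol.:* U' Sol.:+ (p Sol.:* p) Sol.:* t))) R.refl uˢ (const η) U U' ψ (T ψ))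
    (R.trans (R.*-congˡ {x = uˢ *ˢ (const η *ˢ const η)} bracket) (R.zeroʳ _))))))
    where
    con0 : ∀ {m} -> Sol.Polynomial m
    con0 = Sol.con (ℤ.+ 0)
    ω≈ : ω ≈ uˢ *ˢ (const η *ˢ const η)
    ω≈ = R.*-congˡ {x = uˢ} (const-* η η)
    inner : Ser
    inner = (const η *ˢ ψ) *ˢ U' +ˢ (ψ *ˢ ψ) *ˢ T ψ
    bracket : (U +ˢ ψ) +ˢ uˢ *ˢ inner ≈ const 0#
    bracket = R.trans (R.+-congʳ (R.+-congˡ {x = U} fix-eq))
     (Sol.solve 3 (\ U u m -> (U Sol.:+ (Sol.:- U Sol.:+ u Sol.:* Sol.:- m)) Sol.:+ u Sol.:* m Sol.:= con0) R.refl U uˢ inner)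

-- Lifting simple roots to power series.

module Hensel (𝔽 : FiniteField) where
 open ≡
 open Fld 𝔽
 open Ser 𝔽
 open Poly 𝔽
 open Expand 𝔽 using (hev-const)

 coef0-hev : ∀ p (w : Ser) -> Es.hev p w 0 ≡ ev p (w 0)
 coef0-hev [] w = refl
 coef0-hev (a ∷ p) w = cong (\ t -> a + w 0 * t) (coef0-hev p w)

 coef1-hev : ∀ p (w : Ser) -> Es.hev p w 1 ≡ Ev.der p (w 0) * w 1
 coef1-hev [] w = sym (zeroˡ _)
 coef1-hev (a ∷ p) w = trans (+-identityˡ _) (trans (cong₂ (\ s t -> w 0 * s + w 1 * t) (coef1-hev p w) (coef0-hev p w))
  (solve 4 (\ x d y h -> x :* (d :* y) :+ y :* h := (h :+ x :* d) :* y) refl (w 0) (Ev.der p (w 0)) (w 1) (ev p (w 0))))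

 tay-causal : ∀ {n} p v {ν ν'} -> ν ≡[ n ] ν' -> Es.tay p v ν ≡[ n ] Es.tay p v ν'
 tay-causal [] v e = \ _ -> refl
 tay-causal (a ∷ p) v {ν} {ν'} e = ≡[]-+ {a = Es.der p v} {Es.der p v} (\ _ -> refl)
  (≡[]-* {a = v +ˢ ν} {v +ˢ ν'} {Es.tay p v ν} {Es.tay p v ν'} (≡[]-+ {a = v} {v} (\ _ -> refl) e) (tay-causal p v e))

 der-const : ∀ p x -> Es.der p (const x) ≈ const (Ev.der p x)
 der-const [] x n = refl
 der-const (a ∷ p) x = R.trans (R.+-cong {Es.hev p (const x)} {const (ev p x)} (hev-const p x) (R.trans (R.*-congˡ {x = const x} (der-const p x)) (R.sym (const-* x (Ev.der p x))))) (R.sym (const-+ (ev p x) (x * Ev.der p x)))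

 split-head : ∀ H -> H ≈ const (H 0) +ˢ uˢ *ˢ tl H
 split-head H zero = sym (trans (cong (H 0 +_) (u*-zero (tl H))) (+-identityʳ _))
 split-head H (suc n) = sym (trans (+-identityˡ _) (u*-suc (tl H) n))

 abstract
  -- With w = w₀ + u ω the equation divided by u reads g'(w₀) ω + u ω² R = `tl H`; solved for ω it
  -- is a fixed-point equation with an extra factor u. The coefficient of u records the implicit
  -- derivative, which decides later whether t has a simple zero.
  hensel : ∀ g (H : Ser) wo -> ev g wo ≡ H 0 -> ¬ Ev.der g wo ≡ 0# ->
   ∃ \ w -> (w 0 ≡ wo) × (Es.hev g w ≈ H) × (Ev.der g wo * w 1 ≡ H 1)
  hensel g H wo e ne = w , w0≡ , w-root , trans (cong (\ t -> Ev.der g t * w 1) (sym w0≡)) (trans (sym (coef1-hev g w)) (w-root 1))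
   where
   i : F
   i = inv (Ev.der g wo)
   W0 : Ser
   W0 = const wo
   Φ : Ser -> Ser
   Φ ω = -ˢ (const i *ˢ ((ω *ˢ ω) *ˢ Es.tay g W0 (uˢ *ˢ ω)))
   causal : ∀ {n a b} -> a ≡[ n ] b -> Φ a ≡[ n ] Φ b
   causal {n} {a} {b} p = ≡[]-neg {n} {const i *ˢ ((a *ˢ a) *ˢ Es.tay g W0 (uˢ *ˢ a))} {const i *ˢ ((b *ˢ b) *ˢ Es.tay g W0 (uˢ *ˢ b))}
    (≡[]-* {n} {const i} {const i} {(a *ˢ a) *ˢ Es.tay g W0 (uˢ *ˢ a)} {(b *ˢ b) *ˢ Es.tay g W0 (uˢ *ˢ b)} (\ _ -> refl)
     (≡[]-* {n} {a *ˢ a} {b *ˢ b} {Es.tay g W0 (uˢ *ˢ a)} {Es.tay g W0 (uˢ *ˢ b)} (≡[]-* {n} {a} {b} {a} {b} p p)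
      (tay-causal {n} g W0 {uˢ *ˢ a} {uˢ *ˢ b} (≡[]-* {n} {uˢ} {uˢ} {a} {b} (\ _ -> refl) p))))
   open Fixpoint (const i *ˢ tl H) Φ (\ {n} {a} {b} -> causal {n} {a} {b}) using (fix; fix-eq)
   ω w : Ser
   ω = fix
   w = W0 +ˢ uˢ *ˢ ω
   w0≡ : w 0 ≡ wo
   w0≡ = trans (cong (wo +_) (u*-zero ω)) (+-identityʳ _)
   δ : F
   δ = Ev.der g wo
   R : Ser
   R = Es.tay g W0 (uˢ *ˢ ω)
   unit : const i *ˢ const δ ≈ const 1#
   unit = R.trans (R.sym (const-* i δ)) (\ n -> cong (\ t -> const t n) (inv-l ne))
   eqω : ω *ˢ const δ +ˢ uˢ *ˢ ((ω *ˢ ω) *ˢ R) ≈ tl H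
   eqω = R.trans (R.+-congʳ {x = uˢ *ˢ ((ω *ˢ ω) *ˢ R)} (R.*-congʳ {x = const δ} fix-eq)) (R.trans
    (Sol.solve 6 (\ i h u x d r -> (i Sol.:* h Sol.:+ u Sol.:* (Sol.:- (i Sol.:* (x Sol.:* r)))) Sol.:* d Sol.:+ u Sol.:* (x Sol.:* r) Sol.:= (i Sol.:* d) Sol.:* (h Sol.:- u Sol.:* (x Sol.:* r)) Sol.:+ u Sol.:* (x Sol.:* r)) (\ _ -> refl) (const i) (tl H) uˢ (ω *ˢ ω) (const δ) R)
    (R.trans (R.+-congʳ {x = uˢ *ˢ ((ω *ˢ ω) *ˢ R)} (R.trans (R.*-congʳ {x = tl H +ˢ (-ˢ (uˢ *ˢ ((ω *ˢ ω) *ˢ R)))} unit) (R.*-identityˡ (tl H +ˢ (-ˢ (uˢ *ˢ ((ω *ˢ ω) *ˢ R)))))))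
     (Sol.solve 2 (\ h x -> (h Sol.:- x) Sol.:+ x Sol.:= h) (\ _ -> refl) (tl H) (uˢ *ˢ ((ω *ˢ ω) *ˢ R)))))
   w-root : Es.hev g w ≈ H
   w-root = R.trans (Es.taylor g W0 (uˢ *ˢ ω)) (R.trans (R.+-congʳ {x = ((uˢ *ˢ ω) *ˢ (uˢ *ˢ ω)) *ˢ R} (R.+-cong {Es.hev g W0} {const (H 0)} (R.trans (hev-const g wo) (\ n -> cong (\ t -> const t n) e)) (R.*-congˡ {x = uˢ *ˢ ω} (der-const g wo))))
    (R.trans (Sol.solve 5 (\ h u o d r -> (h Sol.:+ (u Sol.:* o) Sol.:* d) Sol.:+ ((u Sol.:* o) Sol.:* (u Sol.:* o)) Sol.:* r Sol.:= h Sol.:+ u Sol.:* (o Sol.:* d Sol.:+ u Sol.:* ((o Sol.:* o) Sol.:* r))) (\ _ -> refl) (const (H 0)) uˢ ω (const δ) R)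
     (R.trans (R.+-congˡ {x = const (H 0)} (R.*-congˡ {x = uˢ} eqω)) (R.sym (split-head H)))))

 hensel-chain : ∀ p (v : Ser) vo k wo -> v 0 ≡ vo -> ev p wo ≡ ev p vo + k -> ¬ Ev.der p wo ≡ 0# ->
  ∃ \ w -> (w 0 ≡ wo) × (Es.hev p w ≈ Es.hev p v +ˢ const k) × (Ev.der p wo * w 1 ≡ Ev.der p vo * v 1)
 hensel-chain p v vo k wo v0 e s = proj₁ h , proj₁ (proj₂ h) , proj₁ (proj₂ (proj₂ h)) ,
   trans (proj₂ (proj₂ (proj₂ h))) (trans (+-identityʳ _) (trans (coef1-hev p v) (cong (\ t -> Ev.der p t * v 1) v0)))
  where
  h : ∃ \ w -> (w 0 ≡ wo) × (Es.hev p w ≈ Es.hev p v +ˢ const k) × (Ev.der p wo * w 1 ≡ (Es.hev p v +ˢ const k) 1)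
  h = hensel p (Es.hev p v +ˢ const k) wo (trans e (cong (_+ k) (sym (trans (coef0-hev p v) (cong (ev p) v0))))) s

-- The pigeonhole principle in the role of linear algebra.

module Pigeon (𝔽 : FiniteField) where
 open import Data.Fin using (finToFun; funToFin)
 open ≡
 open Fld 𝔽

 q≥2 : 2 N.≤ q
 q≥2 = go (index 0#) (index 1#) (\ e -> 0≢1 (trans (sym (element-index 0#)) (trans (cong element e) (element-index 1#))))
  where
  go : ∀ {n} (i j : Fin n) -> ¬ i ≡ j -> 2 N.≤ n
  go {suc zero} Fin.zero Fin.zero ne = ⊥-elim (ne refl)
  go {suc (suc n)} _ _ _ = s≤s (s≤s z≤n)

 private
  q>1 : 1 N.< q
  q>1 = q≥2

  code : ∀ {N} -> (Fin N -> F) -> Fin (q N.^ N)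
  code f = funToFin (\ i -> index (f i))

  decode : ∀ {N} -> Fin (q N.^ N) -> Fin N -> F
  decode k i = element (finToFun k i)

  decode-code : ∀ {N} (f : Fin N -> F) i -> decode (code f) i ≡ f i
  decode-code f i = trans (cong element (Finₚ.finToFun-funToFin (\ i -> index (f i)) i)) (element-index _)

 -- There are q^N inputs and only q^M outputs. For a map compatible with differences, α - β is then
 -- a nonzero solution of M homogeneous equations in N unknowns.
 collision : ∀ {N M} -> M N.< N -> (T : (Fin N -> F) -> Fin M -> F) ->
  ∃₂ \ (α β : Fin N -> F) -> (∃ \ i -> ¬ α i ≡ β i) × (∀ j -> T α j ≡ T β j)
 collision {N} {M} M<N T with Finₚ.pigeonhole (^-monoʳ-< q q>1 M<N) (\ k -> code (T (decode k)))
 ... | k , l , k<l , e = decode k , decode l , differ , \ j -> trans (sym (decode-code (T (decode k)) j)) (trans (cong (\ t -> decode t j) e) (decode-code (T (decode l)) j))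
  where
  differ : ∃ \ i -> ¬ decode k i ≡ decode l i
  differ with Finₚ.any? (\ i -> ¬? (decode {N} k i ≟ decode l i))
  ... | yes d = d
  ... | no nd = ⊥-elim (<⇒≢ k<l (cong toℕ (trans (sym (Finₚ.funToFin-finToFin {N} {q} k)) (trans (cong-fun eq) (Finₚ.funToFin-finToFin {N} {q} l)))))
   where
   same : ∀ i -> decode {N} k i ≡ decode l i
   same i with decode {N} k i ≟ decode l i
   ... | yes e = e
   ... | no ne = ⊥-elim (nd (i , ne))
   eq : ∀ i -> finToFun {q} {N} k i ≡ finToFun l i
   eq i = trans (sym (index-element _)) (trans (cong index (same i)) (index-element _))
   cong-fun : ∀ {f g : Fin N -> Fin q} -> (∀ i -> f i ≡ g i) -> funToFin f ≡ funToFin g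
   cong-fun {f} {g} = ext N f g
    where
    ext : ∀ N (f g : Fin N -> Fin q) -> (∀ i -> f i ≡ g i) -> funToFin f ≡ funToFin g
    ext zero f g e = refl
    ext (suc N) f g e = cong₂ combine (e Fin.zero) (ext N _ _ (\ i -> e (Fin.suc i)))

 injection-≤ : ∀ {N M} (T : (Fin N -> F) -> Fin M -> F) -> (∀ α β -> (∀ j -> T α j ≡ T β j) -> ∀ i -> α i ≡ β i) -> N N.≤ M
 injection-≤ {N} {M} T inj with N N.≤? M
 ... | yes p = p
 ... | no ¬p with collision (≰⇒> ¬p) T
 ... | α , β , (i , ne) , e = ⊥-elim (ne (inj α β e i))

 ext : ∀ {n} -> (Fin n -> F) -> ℕ -> F
 ext {n} f k with k N.<? n
 ... | yes k< = f (fromℕ< k<)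
 ... | no _ = 0#

 ext-toℕ : ∀ {n} (f : Fin n -> F) i -> ext f (toℕ i) ≡ f i
 ext-toℕ {n} f i with toℕ i N.<? n
 ... | yes k< = cong f (Finₚ.fromℕ<-toℕ i k<)
 ... | no ¬k< = ⊥-elim (¬k< (Finₚ.toℕ<n i))

 ext-cong : ∀ {n} {f g : Fin n -> F} -> (∀ i -> f i ≡ g i) -> ∀ k -> ext f k ≡ ext g k
 ext-cong {n} e k with k N.<? n
 ... | yes k< = e _
 ... | no _ = refl

-- Powers and indexed sums in a commutative ring.

module RSum {a ℓ} (R : CommutativeRing a ℓ) where
 open RingZ
 open CommutativeRing R renaming (Carrier to C; zero to zero-*)
 open IntegerCoefficients R using (solve; _:=_; _:+_; _:*_; _:-_; :-_; con)

 pow : C -> ℕ -> C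
 pow x zero = 1#
 pow x (suc n) = x * pow x n

 pow-+ : ∀ x m n -> pow x (m N.+ n) ≈ pow x m * pow x n
 pow-+ x zero n = sym (*-identityˡ _)
 pow-+ x (suc m) n = trans (*-congˡ (pow-+ x m n)) (sym (*-assoc _ _ _))

 ∑ : ℕ -> (ℕ -> C) -> C
 ∑ zero f = 0#
 ∑ (suc n) f = ∑ n f + f n

 ∑-cong : ∀ n {f g} -> (∀ t -> t N.< n -> f t ≈ g t) -> ∑ n f ≈ ∑ n g
 ∑-cong zero e = refl
 ∑-cong (suc n) e = +-cong (∑-cong n (\ t t< -> e t (m<n⇒m<1+n t<))) (e n (n<1+n n))

 ∑-+ : ∀ n f g -> ∑ n (\ t -> f t + g t) ≈ ∑ n f + ∑ n g
 ∑-+ zero f g = sym (+-identityʳ _)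
 ∑-+ (suc n) f g = trans (+-congʳ (∑-+ n f g)) (solve 4 (\ a b e f -> (a :+ b) :+ (e :+ f) := (a :+ e) :+ (b :+ f)) refl _ _ _ _)

 ∑-*ˡ : ∀ n k f -> ∑ n (\ t -> k * f t) ≈ k * ∑ n f
 ∑-*ˡ zero k f = sym (zeroʳ k)
 ∑-*ˡ (suc n) k f = trans (+-congʳ (∑-*ˡ n k f)) (sym (distribˡ k _ _))

 ∑-*ʳ : ∀ n k f -> ∑ n (\ t -> f t * k) ≈ ∑ n f * k
 ∑-*ʳ zero k f = sym (zeroˡ k)
 ∑-*ʳ (suc n) k f = trans (+-congʳ (∑-*ʳ n k f)) (sym (distribʳ k _ _))

 ∑-zero : ∀ n f -> (∀ t -> t N.< n -> f t ≈ 0#) -> ∑ n f ≈ 0#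
 ∑-zero zero f e = refl
 ∑-zero (suc n) f e = trans (+-cong (∑-zero n f (\ t t< -> e t (m<n⇒m<1+n t<))) (e n (n<1+n n))) (+-identityʳ _)

 ∑-head : ∀ n f -> ∑ (suc n) f ≈ f 0 + ∑ n (\ t -> f (suc t))
 ∑-head zero f = +-comm _ _
 ∑-head (suc n) f = trans (+-congʳ (∑-head n f)) (+-assoc _ _ _)

 ∑-swap : ∀ m n (f : ℕ -> ℕ -> C) -> ∑ m (\ i -> ∑ n (\ j -> f i j)) ≈ ∑ n (\ j -> ∑ m (\ i -> f i j))
 ∑-swap zero n f = sym (∑-zero n _ (\ _ _ -> refl))
 ∑-swap (suc m) n f = trans (+-congʳ (∑-swap m n f)) (sym (∑-+ n _ _))

 ∑-reverse : ∀ n f -> ∑ (suc n) (\ i -> f (n N.∸ i)) ≈ ∑ (suc n) f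
 ∑-reverse zero f = refl
 ∑-reverse (suc n) f = trans (∑-head (suc n) _) (trans (+-congˡ (∑-reverse n f)) (+-comm _ _))

 pow-* : ∀ x y n -> pow (x * y) n ≈ pow x n * pow y n
 pow-* x y zero = sym (*-identityˡ _)
 pow-* x y (suc n) = trans (*-congˡ (pow-* x y n)) (solve 4 (\ x y a b -> (x :* y) :* (a :* b) := (x :* a) :* (y :* b)) refl x y (pow x n) (pow y n))

module PolySum (𝔽 : FiniteField) (A : PolyEval.FAlgebra 𝔽) where
 open RingZ
 open PolyEval 𝔽
 open Eval A
 open FAlgebra A renaming (Carrier to C; zero to zero-*)
 open IntegerCoefficients alg using (solve; _:=_; _:+_; _:*_; _:-_; :-_; con)
 open RSum alg public

 hev-∑ : ∀ I p x -> length p N.≤ I -> ∑ I (\ i -> ι (coef p i) * pow x i) ≈ hev p x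
 hev-∑ I [] x _ = ∑-zero I _ (\ t _ -> trans (*-congʳ ι-0) (zeroˡ _))
 hev-∑ (suc I) (a ∷ p) x (s≤s h) = trans (∑-head I _) (+-cong (*-identityʳ _)
  (trans (∑-cong I (\ t _ -> solve 3 (\ a x p -> a :* (x :* p) := x :* (a :* p)) refl (ι (coef p t)) x (pow x t))) (trans (∑-*ˡ I x _) (*-congˡ (hev-∑ I p x h)))))

-- Filtered function spaces and algebraic dependence.

module Tower (𝔽 : FiniteField) (A : PolyEval.FAlgebra 𝔽) where
 open ≡ using (_≡_)
 open RingZ
 private module K = Fld 𝔽
 open K using (F)
 open Pigeon 𝔽 using (collision) renaming (ext to extF; ext-toℕ to extF-toℕ)
 open Poly 𝔽 using (coef-≥length; all-zero?; NonzeroPol; coef-⊞; coef-scale; length-⊞; lst; length-lst; coef-lst)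
 open PolyEval 𝔽
 open Eval A
 open FAlgebra A renaming (Carrier to C; zero to zero-*)
 open IntegerCoefficients alg using (solve; _:=_; _:+_; _:*_; _:-_; :-_; con)
 open PolySum 𝔽 A
 open import Relation.Binary.Reasoning.Setoid setoid

 lin : (ℕ -> F) -> List C -> C
 lin k [] = 0#
 lin k (e ∷ es) = ι (k 0) * e + lin (\ i -> k (suc i)) es

 lin-cong : ∀ {k l} es -> (∀ i -> i N.< length es -> k i ≡ l i) -> lin k es ≈ lin l es
 lin-cong [] h = refl
 lin-cong (e ∷ es) h = +-cong (*-congʳ (reflexive (≡.cong ι (h 0 (s≤s z≤n))))) (lin-cong es (\ i i< -> h (suc i) (s≤s i<)))

 lin-zero : ∀ es -> lin (\ _ -> K.0#) es ≈ 0#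
 lin-zero [] = refl
 lin-zero (e ∷ es) = trans (+-cong (trans (*-congʳ ι-0) (zeroˡ e)) (lin-zero es)) (+-identityʳ 0#)

 glue : List C -> (ℕ -> F) -> (ℕ -> F) -> ℕ -> F
 glue [] k l i = l i
 glue (e ∷ es) k l zero = k 0
 glue (e ∷ es) k l (suc i) = glue es (\ i -> k (suc i)) l i

 lin-glue : ∀ es fs k l -> lin (glue es k l) (es ++ fs) ≈ lin k es + lin l fs
 lin-glue [] fs k l = sym (+-identityˡ _)
 lin-glue (e ∷ es) fs k l = trans (+-congˡ (lin-glue es fs (\ i -> k (suc i)) l)) (sym (+-assoc _ _ _))

 lin-map : ∀ k es x -> lin k (map (_* x) es) ≈ lin k es * x
 lin-map k [] x = sym (zeroˡ x)
 lin-map k (e ∷ es) x = trans (+-cong (sym (*-assoc _ _ _)) (lin-map _ es x)) (sym (distribʳ x _ _))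

 -- An increasing family of subspaces whose n-th member is spanned by at most `rank` · (n + 1)
 -- elements, like the functions of bounded pole order on a curve. Only spanning sets are recorded,
 -- since an upper bound on dimension is what the pigeonhole argument consumes. `Op c ψ` expresses
 -- that ψ has pole order at most c.
 record Level : Set1 where
  field
   Mem : ℕ -> C -> Set
   ext : ∀ {n φ ψ} -> ψ ≈ φ -> Mem n φ -> Mem n ψ
   mono : ∀ {m n φ} -> m N.≤ n -> Mem m φ -> Mem n φ
   zer : ∀ {n} -> Mem n 0#
   one : Mem 0 1#
   add : ∀ {n φ ψ} -> Mem n φ -> Mem n ψ -> Mem n (φ + ψ)
   scl : ∀ {n φ} k -> Mem n φ -> Mem n (ι k * φ)
   rank : ℕ
   cover : ∀ n -> ∃ \ es -> length es N.≤ rank N.* suc n × (∀ {φ} -> Mem n φ -> ∃ \ k -> φ ≈ lin k es)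

  Op : ℕ -> C -> Set
  Op c ψ = ∀ {n φ} -> Mem n φ -> Mem (n N.+ c) (ψ * φ)

  Op-ext : ∀ {c ψ χ} -> χ ≈ ψ -> Op c ψ -> Op c χ
  Op-ext e o m = ext (*-congʳ e) (o m)

  Op-mono : ∀ {c d ψ} -> c N.≤ d -> Op c ψ -> Op d ψ
  Op-mono le o {n} m = mono (+-monoʳ-≤ n le) (o m)

  Op-const : ∀ k -> Op 0 (ι k)
  Op-const k {n} m = mono (m≤m+n n 0) (scl k m)

  Op-+ : ∀ {c ψ χ} -> Op c ψ -> Op c χ -> Op c (ψ + χ)
  Op-+ o p m = ext (distribʳ _ _ _) (add (o m) (p m))

  Op-* : ∀ {c d ψ χ} -> Op c ψ -> Op d χ -> Op (d N.+ c) (ψ * χ)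
  Op-* {c} {d} o p {n} m = ext (*-assoc _ _ _) (mono (≡⇒≤ (NP.+-assoc n d c)) (o (p m)))

  Op-neg : ∀ {c ψ} -> Op c ψ -> Op c (- ψ)
  Op-neg {c} {ψ} o m = ext (trans (solve 2 (\ a b -> (:- a) :* b := :- (a :* b)) refl ψ _) (trans (-‿cong (sym (*-identityˡ _))) (trans (solve 2 (\ a b -> :- (a :* b) := (:- a) :* b) refl 1# _) (*-congʳ (sym (trans (ι-neg K.1#) (-‿cong ι-1))))))) (scl (K.- K.1#) (o m))

  Op-hev : ∀ {c v} p -> Op c v -> Op (length p N.* c) (hev p v)
  Op-hev [] o m = ext (zeroˡ _) zer
  Op-hev {c} {v} (a ∷ p) o = Op-+ (Op-mono z≤n (Op-const a)) (Op-mono (≡⇒≤ (NP.+-comm (length p N.* c) c)) (Op-* o (Op-hev p o)))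

 abstract
  baseLevel : C -> Level
  baseLevel y = record
   { Mem = \ n φ -> ∃ \ p -> length p N.≤ suc n × φ ≈ hev p y
   ; ext = \ { e (p , l , h) -> p , l , trans e h }
   ; mono = \ { le (p , l , h) -> p , ≤∙ l (s≤s le) , h }
   ; zer = [] , z≤n , refl
   ; one = K.1# ∷ [] , s≤s z≤n , sym (trans (+-cong ι-1 (zeroʳ y)) (+-identityʳ 1#))
   ; add = \ { (p , l , h) (r , l' , h') -> p ⊞ r , length-⊞ p r l l' , trans (+-cong h h') (sym (hev-⊞ p r y)) }
   ; scl = \ { k (p , l , h) -> scale k p , ≤∙ (≡⇒≤ (Listₚ.length-map _ p)) l , trans (*-congˡ h) (sym (hev-scale k p y)) }
   ; rank = 1
   ; cover = \ n -> powers (suc n) 1# , ≡⇒≤ (≡.trans (length-powers (suc n) 1#) (≡.sym (NP.*-identityˡ (suc n)))) ,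
     \ { (p , l , h) -> coef p , trans h (sym (trans (lin-powers (suc n) p 1# l) (*-identityʳ _))) } }
   where
   powers : ℕ -> C -> List C
   powers zero e = []
   powers (suc m) e = e ∷ powers m (y * e)
   length-powers : ∀ m e -> length (powers m e) ≡ m
   length-powers zero e = ≡.refl
   length-powers (suc m) e = ≡.cong suc (length-powers m _)
   lin-powers : ∀ m p e -> length p N.≤ m -> lin (coef p) (powers m e) ≈ hev p y * e
   lin-powers m [] e _ = trans (lin-zero (powers m e)) (sym (zeroˡ e))
   lin-powers (suc m) (a ∷ p) e (s≤s l) = trans (+-congˡ (lin-powers m p (y * e) l)) (solve 4 (\ a e h y -> a :* e :+ h :* (y :* e) := (a :+ y :* h) :* e) refl (ι a) e (hev p y) y)

  base-Op : ∀ y -> Level.Op (baseLevel y) 1 y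
  base-Op y {n} (p , l , h) = (K.0# ∷ p) , ≤∙ (s≤s l) (≡⇒≤ (≡.cong suc (NP.+-comm 1 n))) , trans (*-congˡ h) (sym (hev-shift p y))

  rank-base : ∀ y -> Level.rank (baseLevel y) ≡ 1
  rank-base y = ≡.refl

 -- A monic relation of degree d for w lets every element be written with powers of w below d: the
 -- rank is multiplied by d, and multiplication by w costs no more than the coefficients of the
 -- relation do.
 module Extend (L : Level) (w : C) (d0 c : ℕ) (r : ℕ -> C) (r-Op : ∀ j -> Level.Op L c (r j))
  (rel : pow w (suc d0) ≈ ∑ (suc d0) (\ j -> r j * pow w j)) where
  open Level L using (Mem; ext; mono; zer; one; add; scl; rank; cover; Op)

  private
   d : ℕ
   d = suc d0

   Sum : (ℕ -> C) -> C
   Sum a = ∑ d (\ j -> a j * pow w j)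

   blocks : ℕ -> List C -> List C
   blocks zero es = []
   blocks (suc k) es = blocks k es ++ map (_* pow w k) es

   length-blocks : ∀ k es -> length (blocks k es) ≡ k N.* length es
   length-blocks zero es = ≡.refl
   length-blocks (suc k) es = ≡.trans (Listₚ.length-++ (blocks k es)) (≡.trans (≡.cong₂ N._+_ (length-blocks k es) (Listₚ.length-map _ es)) (NP.+-comm _ (length es)))

   cover-blocks : ∀ k es (a : ℕ -> C) -> (∀ j -> j N.< k -> ∃ \ l -> a j ≈ lin l es) -> ∃ \ l -> ∑ k (\ j -> a j * pow w j) ≈ lin l (blocks k es)
   cover-blocks zero es a h = (\ _ -> K.0#) , refl
   cover-blocks (suc k) es a h with cover-blocks k es a (\ j j< -> h j (m<n⇒m<1+n j<)) | h k (n<1+n k)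
   ... | l , e | l' , e' = glue (blocks k es) l l' , trans (+-cong e (trans (*-congʳ e') (sym (lin-map l' es (pow w k))))) (sym (lin-glue (blocks k es) (map (_* pow w k) es) l l'))

  abstract
   level : Level
   level = record
    { Mem = \ n φ -> ∃ \ a -> (∀ j -> Mem n (a j)) × φ ≈ Sum a
    ; ext = \ { e (a , m , h) -> a , m , trans e h }
    ; mono = \ { le (a , m , h) -> a , (\ j -> mono le (m j)) , h }
    ; zer = (\ _ -> 0#) , (\ _ -> zer) , sym (∑-zero d _ (\ j _ -> zeroˡ _))
    ; one = (\ { zero -> 1# ; (suc j) -> 0# }) , (\ { zero -> one ; (suc j) -> zer }) , sym (trans (∑-head d0 _) (trans (+-cong (*-identityˡ _) (∑-zero d0 _ (\ j _ -> zeroˡ _))) (+-identityʳ 1#)))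
    ; add = \ { (a , m , h) (b , m' , h') -> (\ j -> a j + b j) , (\ j -> add (m j) (m' j)) , trans (+-cong h h') (sym (trans (∑-cong d (\ j _ -> distribʳ _ _ _)) (∑-+ d _ _))) }
    ; scl = \ { k (a , m , h) -> (\ j -> ι k * a j) , (\ j -> scl k (m j)) , trans (*-congˡ h) (sym (trans (∑-cong d (\ j _ -> *-assoc _ _ _)) (∑-*ˡ d _ _))) }
    ; rank = d N.* rank
    ; cover = \ n -> blocks d (proj₁ (cover n)) , ≤∙ (≡⇒≤ (length-blocks d (proj₁ (cover n)))) (≤∙ (*-monoʳ-≤ d (proj₁ (proj₂ (cover n)))) (≡⇒≤ (≡.sym (NP.*-assoc d rank (suc n))))) ,
      \ { (a , m , h) -> let (l , e) = cover-blocks d (proj₁ (cover n)) a (\ j _ -> proj₂ (proj₂ (cover n)) (m j)) in l , trans h e } }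

   lift-Op : ∀ {b ψ} -> Op b ψ -> Level.Op level b ψ
   lift-Op o (a , m , h) = (\ j -> _ * a j) , (\ j -> o (m j)) , trans (*-congˡ h) (sym (trans (∑-cong d (\ j _ -> *-assoc _ _ _)) (∑-*ˡ d _ _)))

   var-Op : Level.Op level c w
   var-Op {n} (a , m , h) = (\ j -> shifted j + r j * a d0) , (\ j -> add (mono (m≤m+n n c) (shifted-Mem j)) (r-Op j (m d0))) ,
    trans (*-congˡ h) (sym (begin
     ∑ d (\ j -> (shifted j + r j * a d0) * pow w j) ≈⟨ ∑-cong d (\ j _ -> solve 4 (\ s r a p -> (s :+ r :* a) :* p := s :* p :+ a :* (r :* p)) refl (shifted j) (r j) (a d0) (pow w j)) ⟩
     ∑ d (\ j -> shifted j * pow w j + a d0 * (r j * pow w j)) ≈⟨ trans (∑-+ d _ _) (+-cong (∑-head d0 _) (trans (∑-*ˡ d _ _) (*-congˡ (sym rel)))) ⟩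
     (0# * 1# + ∑ d0 (\ j -> a j * (w * pow w j))) + a d0 * (w * pow w d0) ≈⟨ +-congʳ (trans (+-cong (zeroˡ _) (trans (∑-cong d0 (\ j _ -> solve 3 (\ a w p -> a :* (w :* p) := w :* (a :* p)) refl (a j) w (pow w j))) (∑-*ˡ d0 w _))) (+-identityˡ _)) ⟩
     w * ∑ d0 (\ j -> a j * pow w j) + a d0 * (w * pow w d0) ≈⟨ solve 4 (\ w s a p -> w :* s :+ a :* (w :* p) := w :* (s :+ a :* p)) refl w (∑ d0 (\ j -> a j * pow w j)) (a d0) (pow w d0) ⟩
     w * ∑ d (\ j -> a j * pow w j) ∎))
    where
    shifted : ℕ -> C
    shifted zero = 0#
    shifted (suc j) = a j
    shifted-Mem : ∀ j -> Mem n (shifted j)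
    shifted-Mem zero = zer
    shifted-Mem (suc j) = m j

   rank-level : Level.rank level ≡ suc d0 N.* rank
   rank-level = ≡.refl

 -- Dividing g(w) = H by the leading coefficient of g gives a monic relation in which only the
 -- constant coefficient involves H.
 module Adjoin (L : Level) (w H : C) (d0 c : ℕ) (H-Op : Level.Op L c H) (g : Pol) (deg : length g ≡ suc (suc d0))
  (lead : ¬ coef g (suc d0) ≡ K.0#) (root : hev g w ≈ H) where
  open Level L using (Op; Op-mono; Op-+; Op-*; Op-const)
  private
   i : F
   i = K.inv (coef g (suc d0))

   r : ℕ -> C
   r zero = ι (K.- (i K.* coef g 0)) + ι i * H
   r (suc j) = ι (K.- (i K.* coef g (suc j)))

   r-Op : ∀ j -> Op c (r j)
   r-Op zero = Op-+ (Op-mono z≤n (Op-const _)) (Op-mono (≡⇒≤ (NP.+-identityʳ c)) (Op-* (Op-const i) H-Op))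
   r-Op (suc j) = Op-mono z≤n (Op-const _)

   ι-neg* : ∀ a b -> ι (K.- (a K.* b)) ≈ - (ι a * ι b)
   ι-neg* a b = trans (ι-neg _) (-‿cong (ι-* a b))

   rel : pow w (suc d0) ≈ ∑ (suc d0) (\ j -> r j * pow w j)
   rel = sym (begin
    ∑ (suc d0) (\ j -> r j * pow w j) ≈⟨ ∑-head d0 _ ⟩
    (ι (K.- (i K.* coef g 0)) + ι i * H) * 1# + ∑ d0 (\ j -> ι (K.- (i K.* coef g (suc j))) * pow w (suc j))
     ≈⟨ +-cong (trans (*-congʳ (+-congʳ (ι-neg* i (coef g 0)))) (*-identityʳ _)) (trans (∑-cong d0 (\ j _ -> trans (*-congʳ (ι-neg* i (coef g (suc j)))) (solve 3 (\ i g p -> (:- (i :* g)) :* p := (:- i) :* (g :* p)) refl (ι i) (ι (coef g (suc j))) (pow w (suc j))))) (∑-*ˡ d0 _ _)) ⟩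
    (- (ι i * ι (coef g 0)) + ι i * H) + - ι i * R ≈⟨ +-congʳ (+-congˡ (*-congˡ hev-split)) ⟩
    (- (ι i * ι (coef g 0)) + ι i * ((ι (coef g 0) + R) + ι (coef g (suc d0)) * pow w (suc d0))) + - ι i * R
     ≈⟨ solve 5 (\ i g R l p -> (:- (i :* g) :+ i :* ((g :+ R) :+ l :* p)) :+ (:- i) :* R := (i :* l) :* p) refl (ι i) (ι (coef g 0)) R (ι (coef g (suc d0))) (pow w (suc d0)) ⟩
    (ι i * ι (coef g (suc d0))) * pow w (suc d0) ≈⟨ *-congʳ (trans (sym (ι-* _ _)) (trans (reflexive (≡.cong ι (K.inv-l lead))) ι-1)) ⟩
    1# * pow w (suc d0) ≈⟨ *-identityˡ _ ⟩
    pow w (suc d0) ∎)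
    where
    R : C
    R = ∑ d0 (\ j -> ι (coef g (suc j)) * pow w (suc j))
    hev-split : H ≈ (ι (coef g 0) + R) + ι (coef g (suc d0)) * pow w (suc d0)
    hev-split = trans (sym root) (trans (sym (hev-∑ (suc (suc d0)) g w (≡⇒≤ deg))) (+-congʳ (trans (∑-head d0 _) (+-congʳ (*-identityʳ _)))))

  open Extend L w d0 c r r-Op rel public

 horner : C -> C -> List Pol -> C
 horner y t [] = 0#
 horner y t (ψ ∷ ψs) = hev ψ y + t * horner y t ψs

 -- More monomials y^a t^b than the dimension of the space containing them.
 module Dependence (L : Level) (y t : C) (τ : ℕ) (y-Op : Level.Op L 1 y) (t-Op : Level.Op L τ t)
  (a b : ℕ) (many : Level.rank L N.* suc (a N.+ τ N.* b) N.< a N.* b) where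
  open Level L

  private
   Mem-hev : ∀ p -> Mem (length p) (hev p y)
   Mem-hev p = ext (sym (*-identityʳ _)) (mono (≡⇒≤ (NP.*-identityʳ (length p))) (Op-hev p y-Op one))

   Mem-horner : ∀ ψs -> All (\ ψ -> length ψ N.≤ a) ψs -> Mem (a N.+ τ N.* length ψs) (horner y t ψs)
   Mem-horner [] [] = zer
   Mem-horner (ψ ∷ ψs) (l ∷ ls) = add (mono (≤∙ l (m≤m+n a _)) (Mem-hev ψ)) (mono (≡⇒≤ (eq a τ (length ψs))) (t-Op (Mem-horner ψs ls)))
    where
    eq : ∀ a τ m -> a N.+ τ N.* m N.+ τ ≡ a N.+ τ N.* suc m
    eq = solve-∀

   row : (Fin (a N.* b) -> F) -> Fin b -> Pol
   row α j = lst a (extF (\ i -> α (combine {a} {b} i j)))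

   rows : (Fin (a N.* b) -> F) -> List Pol
   rows α = Data.List.tabulate (row α)

   G : (Fin (a N.* b) -> F) -> C
   G α = horner y t (rows α)

   G-Mem : ∀ α -> Mem (a N.+ τ N.* b) (G α)
   G-Mem α = ≡.subst (\ m -> Mem (a N.+ τ N.* m) (G α)) (Listₚ.length-tabulate (row α)) (Mem-horner (rows α) (Allₚ.tabulate⁺ (\ j -> ≡⇒≤ (length-lst a _))))

   es : List C
   es = proj₁ (cover (a N.+ τ N.* b))

   few : length es N.< a N.* b
   few = ≤-<-trans (proj₁ (proj₂ (cover (a N.+ τ N.* b)))) many

   k : (Fin (a N.* b) -> F) -> ℕ -> F
   k α = proj₁ (proj₂ (proj₂ (cover (a N.+ τ N.* b))) (G-Mem α))

   G≈lin : ∀ α -> G α ≈ lin (k α) es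
   G≈lin α = proj₂ (proj₂ (proj₂ (cover (a N.+ τ N.* b))) (G-Mem α))

   hit : ∃₂ \ (α β : Fin (a N.* b) -> F) -> (∃ \ i -> ¬ α i ≡ β i) × (∀ j -> k α (toℕ j) ≡ k β (toℕ j))
   hit = collision few (\ α j -> k α (toℕ j))

   minus : List Pol -> List Pol -> List Pol
   minus [] _ = []
   minus (p ∷ ps) [] = []
   minus (p ∷ ps) (r ∷ rs) = (p ⊞ scale (K.- K.1#) r) ∷ minus ps rs

   horner-minus : ∀ ps rs -> length ps ≡ length rs -> horner y t (minus ps rs) ≈ horner y t ps - horner y t rs
   horner-minus [] [] _ = solve 0 (con (ℤ.+ 0) := con (ℤ.+ 0) :- con (ℤ.+ 0)) refl
   horner-minus (p ∷ ps) (r ∷ rs) e = trans (+-cong (trans (hev-⊞ p _ y) (+-congˡ (trans (hev-scale _ r y) (trans (*-congʳ (trans (ι-neg _) (-‿cong ι-1))) (trans (solve 2 (\ o x -> (:- o) :* x := :- (o :* x)) refl 1# (hev r y)) (-‿cong (*-identityˡ _))))))) (*-congˡ (horner-minus ps rs (suc-injective e))))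
    (solve 5 (\ p r t a b -> (p :- r) :+ t :* (a :- b) := (p :+ t :* a) :- (r :+ t :* b)) refl (hev p y) (hev r y) t (horner y t ps) (horner y t rs))

   tab : (Fin (a N.* b) -> F) -> ∀ {m} -> (Fin m -> Fin b) -> List Pol
   tab α e = Data.List.tabulate (\ j -> row α (e j))

   minus-short : ∀ α β {m} (e : Fin m -> Fin b) -> All (\ ψ -> length ψ N.≤ a) (minus (tab α e) (tab β e))
   minus-short α β {zero} e = []
   minus-short α β {suc m} e = length-⊞ (row α (e Fin.zero)) _ (≡⇒≤ (length-lst a _)) (≡⇒≤ (≡.trans (Listₚ.length-map _ (row β (e Fin.zero))) (length-lst a _))) ∷ minus-short α β (\ j -> e (Fin.suc j))

   minus-nonzero : ∀ α β {m} (e : Fin m -> Fin b) j i -> ¬ α (combine {a} {b} i (e j)) ≡ β (combine {a} {b} i (e j)) -> Any NonzeroPol (minus (tab α e) (tab β e))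
   minus-nonzero α β e (Fin.suc j) i ne = there (minus-nonzero α β (\ j -> e (Fin.suc j)) j i ne)
   minus-nonzero α β e Fin.zero i ne = here (toℕ i , \ z -> ne (K.sub-≡ (≡.trans (≡.sym eq) z)))
    where
    at : ∀ α -> coef (row α (e Fin.zero)) (toℕ i) ≡ α (combine {a} {b} i (e Fin.zero))
    at α = ≡.trans (coef-lst a _ (toℕ i) (Finₚ.toℕ<n i)) (extF-toℕ (\ i -> α (combine {a} {b} i (e Fin.zero))) i)
    eq : coef (row α (e Fin.zero) ⊞ scale (K.- K.1#) (row β (e Fin.zero))) (toℕ i) ≡ α (combine {a} {b} i (e Fin.zero)) K.- β (combine {a} {b} i (e Fin.zero))
    eq = ≡.trans (coef-⊞ (row α (e Fin.zero)) _ (toℕ i)) (≡.cong₂ K._+_ (at α) (≡.trans (coef-scale _ (row β (e Fin.zero)) (toℕ i)) (≡.trans (≡.cong (K.- K.1# K.*_) (at β))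
      (≡.trans (K.solve 2 (\ o x -> (K.:- o) K.:* x K.:= K.:- (o K.:* x)) ≡.refl K.1# _) (≡.cong K.-_ (K.*-identityˡ _))))))

  abstract
   dependence : ∃ \ ψs -> All (\ ψ -> length ψ N.≤ a) ψs × Any NonzeroPol ψs × horner y t ψs ≈ 0#
   dependence = minus (rows α) (rows β) , minus-short α β (\ j -> j) , nonz , trans (horner-minus (rows α) (rows β) (≡.trans (Listₚ.length-tabulate (row α)) (≡.sym (Listₚ.length-tabulate (row β)))))
     (trans (+-congʳ (trans (G≈lin α) (trans (lin-cong es (\ i i< -> ≡.subst (\ z -> k α z ≡ k β z) (Finₚ.toℕ-fromℕ< i<) (proj₂ (proj₂ (proj₂ hit)) (fromℕ< i<)))) (sym (G≈lin β))))) (-‿inverseʳ _))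
    where
    α β : Fin (a N.* b) -> F
    α = proj₁ hit
    β = proj₁ (proj₂ hit)
    ij : Fin a × Fin b
    ij = remQuot {a} b (proj₁ (proj₁ (proj₂ (proj₂ hit))))
    nonz : Any NonzeroPol (minus (rows α) (rows β))
    nonz = minus-nonzero α β (\ j -> j) (proj₂ ij) (proj₁ ij) (≡.subst (\ z -> ¬ α z ≡ β z) (≡.sym (Finₚ.combine-remQuot {a} b _)) (proj₂ (proj₁ (proj₂ (proj₂ hit)))))

-- Boundedness of nonsingular fibres.

module Fibre (𝔽 : FiniteField) where
 open ≡
 open Fld 𝔽
 open Ser 𝔽
 open Poly 𝔽
 open Hensel 𝔽
 open StepConst

 -- Families of power series indexed by all arcs through points of the fibre. A relation found in
 -- this algebra holds at every point simultaneously, so a single polynomial vanishes at the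
 -- y-coordinates of the whole fibre.
 pointwise : Set -> FAlgebra
 pointwise Ctx = record
  { alg = record
   { Carrier = Ctx -> Ser ; _≈_ = \ a b -> ∀ γ -> a γ ≈ b γ ; _+_ = \ a b γ -> a γ +ˢ b γ ; _*_ = \ a b γ -> a γ *ˢ b γ ; -_ = \ a γ -> -ˢ a γ
   ; 0# = \ _ -> const 0# ; 1# = \ _ -> const 1#
   ; isCommutativeRing = record
    { isRing = record
     { +-isAbelianGroup = record
      { isGroup = record
       { isMonoid = record
        { isSemigroup = record
         { isMagma = record
          { isEquivalence = record { refl = \ γ n -> refl ; sym = \ e γ n -> sym (e γ n) ; trans = \ e f γ n -> trans (e γ n) (f γ n) }
          ; ∙-cong = \ e f γ n -> cong₂ _+_ (e γ n) (f γ n) }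
         ; assoc = \ a b c γ -> R.+-assoc (a γ) (b γ) (c γ) }
        ; identity = (\ a γ -> R.+-identityˡ (a γ)) , (\ a γ -> R.+-identityʳ (a γ)) }
       ; inverse = (\ a γ -> R.-‿inverseˡ (a γ)) , (\ a γ -> R.-‿inverseʳ (a γ))
       ; ⁻¹-cong = \ e γ n -> cong -_ (e γ n) }
      ; comm = \ a b γ -> R.+-comm (a γ) (b γ) }
     ; *-cong = \ e f γ -> *ˢ-cong (e γ) (f γ)
     ; *-assoc = \ a b c γ -> R.*-assoc (a γ) (b γ) (c γ)
     ; *-identity = (\ a γ -> R.*-identityˡ (a γ)) , (\ a γ -> R.*-identityʳ (a γ))
     ; distrib = (\ a b c γ -> R.distribˡ (a γ) (b γ) (c γ)) , (\ a b c γ -> R.distribʳ (a γ) (b γ) (c γ)) }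
    ; *-comm = \ a b γ -> R.*-comm (a γ) (b γ) } }
  ; ι = \ x _ -> const x ; ι-+ = \ x y γ -> const-+ x y ; ι-* = \ x y γ -> const-* x y ; ι-0 = \ γ _ -> refl ; ι-neg = \ x γ -> const-neg x ; ι-1 = \ γ _ -> refl }

 record Exact (E : ℕ) (p : Pol) : Set where
  field
   d0 : ℕ
   deg : length p ≡ suc (suc d0)
   lead : ¬ coef p (suc d0) ≡ 0#
   short : length p N.≤ E

 module Points (Ctx : Set) where
  A : FAlgebra
  A = pointwise Ctx
  open Tower 𝔽 A public
  module Ec = Eval A

  hev-pointwise : ∀ p (w : Ctx -> Ser) γ -> Ec.hev p w γ ≈ Es.hev p (w γ)
  hev-pointwise [] w γ n = refl
  hev-pointwise (a ∷ p) w γ = R.+-congˡ {x = const a} (R.*-congˡ {x = w γ} (hev-pointwise p w γ))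

  hev-Op : ∀ (L : Level) {E} p {c} (w : Ctx -> Ser) -> length p N.≤ E -> Level.Op L c w -> Level.Op L (E N.* c) (\ γ -> Es.hev p (w γ))
  hev-Op L {E} p {c} w l o = Level.Op-ext L {E N.* c} {Ec.hev p w} (\ γ n -> sym (hev-pointwise p w γ n)) (Level.Op-mono L {ψ = Ec.hev p w} (*-monoˡ-≤ c l) (Level.Op-hev L p o))

  hev-Op-1 : ∀ (L : Level) {E} p (w : Ctx -> Ser) -> length p N.≤ E -> Level.Op L 1 w -> Level.Op L E (\ γ -> Es.hev p (w γ))
  hev-Op-1 L {E} p w l o = Level.Op-mono L {ψ = \ γ -> Es.hev p (w γ)} (≡⇒≤ (NP.*-identityʳ E)) (hev-Op L p w l o)

  plus-const-Op : ∀ (L : Level) {c} (w : Ctx -> Ser) k -> Level.Op L c w -> Level.Op L c (\ γ -> w γ +ˢ const k)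
  plus-const-Op L {c} w k o = Level.Op-+ L {c} {w} {\ _ -> const k} o (Level.Op-mono L {ψ = \ _ -> const k} z≤n (Level.Op-const L k))

  module _ (L : Level) (y t : Ctx -> Ser) (τ : ℕ) (y-Op : Level.Op L 1 y) (t-Op : Level.Op L τ t) (E : ℕ)
   (rank≤ : Level.rank L N.≤ size E) (τ≤ : τ N.≤ size E) (t₀ : ∀ γ -> t γ 0 ≡ 0#) (t₁ : ∀ γ -> ¬ t γ 1 ≡ 0#) where
   private
    M : ℕ
    M = size E

    many : Level.rank L N.* suc (cap E N.+ τ N.* suc M) N.< cap E N.* suc M
    -- When the rank and the weight of t both equal M, the two sides differ by exactly one; this is
    -- the origin of `cap`.
    many = ≤-<-trans (*-mono-≤ rank≤ (s≤s (+-monoʳ-≤ (cap E) (*-monoˡ-≤ (suc M) τ≤)))) (≡⇒≤ (eq M (M N.* suc M)))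
     where
     eq : ∀ M X -> suc (M N.* suc (suc (M N.* suc X) N.+ X)) ≡ suc (M N.* suc X) N.* suc M
     eq = solve-∀

    first : ∀ ψs -> All (\ ψ -> length ψ N.≤ cap E) ψs -> Any NonzeroPol ψs -> (∀ γ n -> horner y t ψs γ n ≡ 0#) ->
     ∃ \ φ -> NonzeroPol φ × length φ N.≤ cap E × (∀ γ -> ev φ (y γ 0) ≡ 0#)
    first (ψ ∷ ψs) (l ∷ ls) nz z with all-zero? ψ
    ... | inj₂ nzψ = ψ , nzψ , l , \ γ -> trans (sym (trans (cong₂ _+_ (trans (hev-pointwise ψ y γ 0) (coef0-hev ψ (y γ))) (trans (cong (_* horner y t ψs γ 0) (t₀ γ)) (zeroˡ _))) (+-identityʳ _))) (z γ 0)
    first (ψ ∷ ψs) (l ∷ ls) (here (k , ne)) z | inj₁ zψ = ⊥-elim (ne (zψ k))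
    first (ψ ∷ ψs) (l ∷ ls) (there nz) z | inj₁ zψ = first ψs ls nz (\ γ -> simple-zero-cancel (t γ) (horner y t ψs γ) (t₀ γ) (t₁ γ)
      (\ n -> trans (sym (+-identityˡ _)) (trans (cong (_+ (t γ *ˢ horner y t ψs γ) n) (sym (trans (Ec.hev-zero ψ y zψ γ n) (const0≡0 n)))) (z γ n))))

   root-polynomial : ∃ \ φ -> NonzeroPol φ × length φ N.≤ cap E × (∀ γ -> ev φ (y γ 0) ≡ 0#)
   root-polynomial = first (proj₁ dep) (proj₁ (proj₂ dep)) (proj₁ (proj₂ (proj₂ dep))) (\ γ n -> trans (proj₂ (proj₂ (proj₂ dep)) γ n) (const0≡0 n))
    where
    dep : ∃ \ ψs -> All (\ ψ -> length ψ N.≤ cap E) ψs × Any NonzeroPol ψs × (∀ γ n -> horner y t ψs γ n ≡ const 0# n)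
    dep = Dependence.dependence L y t τ y-Op t-Op (cap E) (suc M) many

 size-≥1 : ∀ E -> E N.≤ size E
 size-≥1 E = m≤n+m E (E N.* E N.* E N.+ E N.* E)

 size-≥2 : ∀ E -> E N.* E N.≤ size E
 size-≥2 E = ≤∙ (m≤n+m (E N.* E) (E N.* E N.* E)) (m≤m+n _ E)

 size-≥3 : ∀ E -> E N.* E N.* E N.≤ size E
 size-≥3 E = ≤∙ (m≤m+n (E N.* E N.* E) (E N.* E)) (m≤m+n _ E)

 size-≥12 : ∀ E -> E N.* E N.+ E N.≤ size E
 size-≥12 E = +-monoˡ-≤ E (m≤n+m (E N.* E) (E N.* E N.* E))

 exact-rank : ∀ {E p} (x : Exact E p) -> suc (Exact.d0 x) N.≤ E
 exact-rank x = <⇒≤ (≤∙ (≡⇒≤ (sym (Exact.deg x))) (Exact.short x))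

 -- The coordinate y itself serves as local parameter on all curves below.
 Y : F -> Ser
 Y y0 = const y0 +ˢ uˢ

 Y-0 : ∀ y0 -> Y y0 0 ≡ y0
 Y-0 y0 = +-identityʳ y0

 Y-1 : ∀ y0 -> Y y0 1 ≡ 1#
 Y-1 y0 = +-identityˡ 1#

 hev-Y0 : ∀ p y0 -> Es.hev p (Y y0) 0 ≡ ev p y0
 hev-Y0 p y0 = trans (coef0-hev p (Y y0)) (cong (ev p) (Y-0 y0))

 hev-Y1 : ∀ p y0 -> Es.hev p (Y y0) 1 ≡ Ev.der p y0
 hev-Y1 p y0 = trans (coef1-hev p (Y y0)) (trans (cong₂ (\ a b -> Ev.der p a * b) (Y-0 y0) (Y-1 y0)) (*-identityʳ _))

 module DifferencePair (E : ℕ) (P R : Pol) (xP : Exact E P) (R-short : length R N.≤ E) (α β : F) where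

  -- P'(z) ≠ 0 makes y a local parameter on the curve P(z) - P(y) = α; the second condition is that
  -- the Jacobian determinant of (P(z) - P(y), R(z) - R(y)) does not vanish.
  Smooth : F -> F -> Set
  Smooth y z = ¬ Ev.der P z ≡ 0# × ¬ Ev.der P z * Ev.der R y ≡ Ev.der P y * Ev.der R z

  private
   -- Arcs on the curve P(z) = P(y) + α along which the remaining equation t has a simple zero.
   -- `context` produces such an arc through each smooth point of the fibre.
   record Ctx : Set where
    field
     y z : Ser
     rel : Es.hev P z ≈ Es.hev P y +ˢ const α
    t : Ser
    t = (Es.hev R z +ˢ (-ˢ Es.hev R y)) +ˢ const (- β)
    field
     t₀ : t 0 ≡ 0#
     t₁ : ¬ t 1 ≡ 0#

   open Points Ctx
   open Exact xP using (d0; deg; lead)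

   L0 : Level
   L0 = baseLevel Ctx.y

   H : Ctx -> Ser
   H γ = Es.hev P (Ctx.y γ) +ˢ const α

   H-Op : Level.Op L0 E H
   H-Op = plus-const-Op L0 (\ γ -> Es.hev P (Ctx.y γ)) α (hev-Op-1 L0 P Ctx.y (Exact.short xP) (base-Op Ctx.y))

   module Z = Adjoin L0 Ctx.z H d0 E H-Op P deg lead (\ γ n -> trans (hev-pointwise P Ctx.z γ n) (Ctx.rel γ n))

   L1 : Level
   L1 = Z.level

   y-Op : Level.Op L1 1 Ctx.y
   y-Op = Z.lift-Op {1} {Ctx.y} (base-Op Ctx.y)

   t-Op : Level.Op L1 (size E) Ctx.t
   t-Op = plus-const-Op L1 (\ γ -> Es.hev R (Ctx.z γ) +ˢ (-ˢ Es.hev R (Ctx.y γ))) (- β)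
    (Level.Op-+ L1 {ψ = \ γ -> Es.hev R (Ctx.z γ)} {\ γ -> -ˢ Es.hev R (Ctx.y γ)}
     (Level.Op-mono L1 {ψ = \ γ -> Es.hev R (Ctx.z γ)} (size-≥2 E) (hev-Op L1 R Ctx.z R-short Z.var-Op))
     (Level.Op-neg L1 {ψ = \ γ -> Es.hev R (Ctx.y γ)} (Level.Op-mono L1 {ψ = \ γ -> Es.hev R (Ctx.y γ)} (size-≥1 E) (hev-Op-1 L1 R Ctx.y R-short y-Op))))

   roots : ∃ \ φ -> NonzeroPol φ × length φ N.≤ cap E × (∀ γ -> ev φ (Ctx.y γ 0) ≡ 0#)
   roots = root-polynomial L1 Ctx.y Ctx.t (size E) y-Op t-Op E (≤∙ (≡⇒≤ (trans Z.rank-level (trans (cong (suc d0 N.*_) (rank-base Ctx.y)) (NP.*-identityʳ (suc d0))))) (≤∙ (exact-rank xP) (size-≥1 E))) NP.≤-refl Ctx.t₀ Ctx.t₁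

   context : ∀ y0 zo -> ev P zo ≡ ev P y0 + α -> ev R zo - ev R y0 ≡ β -> Smooth y0 zo -> ∃ \ γ -> Ctx.y γ 0 ≡ y0
   context y0 zo e1 e2 (s1 , s2) = record { y = Y y0 ; z = z ; rel = proj₁ (proj₂ (proj₂ h)) ; t₀ = t₀ ; t₁ = t₁ } , Y-0 y0
    where
    h : ∃ \ w -> (w 0 ≡ zo) × (Es.hev P w ≈ Es.hev P (Y y0) +ˢ const α) × (Ev.der P zo * w 1 ≡ Es.hev P (Y y0) 1 + 0#)
    h = hensel P (Es.hev P (Y y0) +ˢ const α) zo (trans e1 (cong (_+ α) (sym (hev-Y0 P y0)))) s1
    z : Ser
    z = proj₁ h
    z0 : z 0 ≡ zo
    z0 = proj₁ (proj₂ h)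
    z1 : Ev.der P zo * z 1 ≡ Ev.der P y0
    z1 = trans (proj₂ (proj₂ (proj₂ h))) (trans (+-identityʳ _) (hev-Y1 P y0))
    t₀ : (Es.hev R z 0 - Es.hev R (Y y0) 0) - β ≡ 0#
    t₀ = ≡-sub (trans (cong₂ _-_ (trans (coef0-hev R z) (cong (ev R) z0)) (hev-Y0 R y0)) e2)
    t₁ : ¬ (Es.hev R z 1 - Es.hev R (Y y0) 1) + 0# ≡ 0#
    t₁ e = s2 (begin
     Ev.der P zo * Ev.der R y0 ≡⟨ cong (Ev.der P zo *_) (sym same) ⟩
     Ev.der P zo * (Ev.der R zo * z 1) ≡⟨ solve 3 (\ p r z -> p :* (r :* z) := (p :* z) :* r) refl (Ev.der P zo) (Ev.der R zo) (z 1) ⟩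
     (Ev.der P zo * z 1) * Ev.der R zo ≡⟨ cong (_* Ev.der R zo) z1 ⟩
     Ev.der P y0 * Ev.der R zo ∎)
     where
     open ≡-Reasoning
     same : Ev.der R zo * z 1 ≡ Ev.der R y0
     same = trans (sym (trans (coef1-hev R z) (cong (\ t -> Ev.der R t * z 1) z0))) (trans (sub-≡ (trans (sym (+-identityʳ _)) e)) (hev-Y1 R y0))

  abstract
   fibre-roots : ∃ \ φ -> NonzeroPol φ × length φ N.≤ cap E ×
    (∀ y0 zo -> ev P zo ≡ ev P y0 + α -> ev R zo - ev R y0 ≡ β -> Smooth y0 zo -> ev φ y0 ≡ 0#)
   fibre-roots = proj₁ roots , proj₁ (proj₂ roots) , proj₁ (proj₂ (proj₂ roots)) , \ y0 zo e1 e2 s -> let (γ , e) = context y0 zo e1 e2 s in trans (cong (ev (proj₁ roots)) (sym e)) (proj₂ (proj₂ (proj₂ roots)) γ)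

 -- This system describes the locus where the Jacobian of the four-point map vanishes, with two of
 -- the four points held fixed: U and V are then derivatives of the given polynomials and b is a
 -- ratio determined by the fixed points.
 module ProductPair (E : ℕ) (P U V : Pol) (xP : Exact E P) (U-short : length U N.≤ E) (V-short : length V N.≤ E) (a b : F) where

  wronskian : F -> F
  wronskian y = Ev.der U y * ev V y - ev U y * Ev.der V y

  triple : F -> F
  triple y = Ev.der P y * (ev U y * ev V y)

  -- The Jacobian of P(y) + P(w) and the logarithm of U(y) U(w) / (V(y) V(w)), with denominators
  -- cleared: the logarithmic derivative of U / V is the Wronskian divided by U V.
  Smooth : F -> F -> Set
  Smooth y w = ¬ Ev.der P w ≡ 0# × ¬ triple w * wronskian y ≡ triple y * wronskian w

  private
   record Ctx : Set where
    field
     y w : Ser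
     rel : Es.hev P w ≈ (-ˢ Es.hev P y) +ˢ const a
    t : Ser
    t = Es.hev U y *ˢ Es.hev U w +ˢ const (- b) *ˢ (Es.hev V y *ˢ Es.hev V w)
    field
     t₀ : t 0 ≡ 0#
     t₁ : ¬ t 1 ≡ 0#

   open Points Ctx
   open Exact xP using (d0; deg; lead)

   L0 : Level
   L0 = baseLevel Ctx.y

   H : Ctx -> Ser
   H γ = (-ˢ Es.hev P (Ctx.y γ)) +ˢ const a

   H-Op : Level.Op L0 E H
   H-Op = plus-const-Op L0 (\ γ -> -ˢ Es.hev P (Ctx.y γ)) a (Level.Op-neg L0 {ψ = \ γ -> Es.hev P (Ctx.y γ)} (hev-Op-1 L0 P Ctx.y (Exact.short xP) (base-Op Ctx.y)))

   module W = Adjoin L0 Ctx.w H d0 E H-Op P deg lead (\ γ n -> trans (hev-pointwise P Ctx.w γ n) (Ctx.rel γ n))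

   L1 : Level
   L1 = W.level

   y-Op : Level.Op L1 1 Ctx.y
   y-Op = W.lift-Op {1} {Ctx.y} (base-Op Ctx.y)

   pair-Op : ∀ p -> length p N.≤ E -> Level.Op L1 (size E) (\ γ -> Es.hev p (Ctx.y γ) *ˢ Es.hev p (Ctx.w γ))
   pair-Op p l = Level.Op-mono L1 {ψ = \ γ -> Es.hev p (Ctx.y γ) *ˢ Es.hev p (Ctx.w γ)} (size-≥12 E)
    (Level.Op-* L1 {ψ = \ γ -> Es.hev p (Ctx.y γ)} {\ γ -> Es.hev p (Ctx.w γ)} (hev-Op-1 L1 p Ctx.y l y-Op) (hev-Op L1 p Ctx.w l W.var-Op))

   t-Op : Level.Op L1 (size E) Ctx.t
   t-Op = Level.Op-+ L1 {ψ = \ γ -> Es.hev U (Ctx.y γ) *ˢ Es.hev U (Ctx.w γ)} {\ γ -> const (- b) *ˢ (Es.hev V (Ctx.y γ) *ˢ Es.hev V (Ctx.w γ))} (pair-Op U U-short)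
    (Level.Op-mono L1 {ψ = \ γ -> const (- b) *ˢ (Es.hev V (Ctx.y γ) *ˢ Es.hev V (Ctx.w γ))} (≡⇒≤ (NP.+-identityʳ (size E)))
     (Level.Op-* L1 {ψ = \ _ -> const (- b)} {\ γ -> Es.hev V (Ctx.y γ) *ˢ Es.hev V (Ctx.w γ)} (Level.Op-const L1 (- b)) (pair-Op V V-short)))

   roots : ∃ \ φ -> NonzeroPol φ × length φ N.≤ cap E × (∀ γ -> ev φ (Ctx.y γ 0) ≡ 0#)
   roots = root-polynomial L1 Ctx.y Ctx.t (size E) y-Op t-Op E (≤∙ (≡⇒≤ (trans W.rank-level (trans (cong (suc d0 N.*_) (rank-base Ctx.y)) (NP.*-identityʳ (suc d0))))) (≤∙ (exact-rank xP) (size-≥1 E))) NP.≤-refl Ctx.t₀ Ctx.t₁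

   context : ∀ y0 wo -> ev P y0 + ev P wo ≡ a -> ev U y0 * ev U wo ≡ b * (ev V y0 * ev V wo) -> Smooth y0 wo -> ∃ \ γ -> Ctx.y γ 0 ≡ y0
   context y0 wo e1 e2 (s1 , s2) = record { y = Y y0 ; w = w ; rel = proj₁ (proj₂ (proj₂ h)) ; t₀ = t₀ ; t₁ = t₁ } , Y-0 y0
    where
    open ≡-Reasoning
    h : ∃ \ w -> (w 0 ≡ wo) × (Es.hev P w ≈ (-ˢ Es.hev P (Y y0)) +ˢ const a) × (Ev.der P wo * w 1 ≡ - Es.hev P (Y y0) 1 + 0#)
    h = hensel P ((-ˢ Es.hev P (Y y0)) +ˢ const a) wo (trans (solve 2 (\ x y -> x := (:- y) :+ (y :+ x)) refl (ev P wo) (ev P y0)) (cong₂ (\ s t -> - s + t) (sym (hev-Y0 P y0)) e1)) s1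
    w : Ser
    w = proj₁ h
    w0 : w 0 ≡ wo
    w0 = proj₁ (proj₂ h)
    w1 : Ev.der P wo * w 1 ≡ - Ev.der P y0
    w1 = trans (proj₂ (proj₂ (proj₂ h))) (trans (+-identityʳ _) (cong -_ (hev-Y1 P y0)))
    w-ev : ∀ p -> Es.hev p w 0 ≡ ev p wo
    w-ev p = trans (coef0-hev p w) (cong (ev p) w0)
    w-der : ∀ p -> Es.hev p w 1 ≡ Ev.der p wo * w 1
    w-der p = trans (coef1-hev p w) (cong (\ t -> Ev.der p t * w 1) w0)
    t₀ : Es.hev U (Y y0) 0 * Es.hev U w 0 + - b * (Es.hev V (Y y0) 0 * Es.hev V w 0) ≡ 0#
    t₀ = trans (cong₂ (\ s t -> s + - b * t) (cong₂ _*_ (hev-Y0 U y0) (w-ev U)) (cong₂ _*_ (hev-Y0 V y0) (w-ev V)))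
     (trans (cong (_+ - b * (ev V y0 * ev V wo)) e2) (solve 2 (\ b x -> b :* x :+ (:- b) :* x := con (ℤ.+ 0)) refl b (ev V y0 * ev V wo)))
    T : F
    T = (ev U y0 * (Ev.der U wo * w 1) + Ev.der U y0 * ev U wo) + - b * (ev V y0 * (Ev.der V wo * w 1) + Ev.der V y0 * ev V wo)
    t1≡ : (Es.hev U (Y y0) *ˢ Es.hev U w +ˢ const (- b) *ˢ (Es.hev V (Y y0) *ˢ Es.hev V w)) 1 ≡ T
    t1≡ = cong₂ _+_ (cong₂ _+_ (cong₂ _*_ (hev-Y0 U y0) (w-der U)) (cong₂ _*_ (hev-Y1 U y0) (w-ev U)))
     (trans (const-*ˡ (- b) (Es.hev V (Y y0) *ˢ Es.hev V w) 1) (cong (- b *_) (cong₂ _+_ (cong₂ _*_ (hev-Y0 V y0) (w-der V)) (cong₂ _*_ (hev-Y1 V y0) (w-ev V)))))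
    t₁ : ¬ (Es.hev U (Y y0) *ˢ Es.hev U w +ˢ const (- b) *ˢ (Es.hev V (Y y0) *ˢ Es.hev V w)) 1 ≡ 0#
    t₁ e = s2 (sub-≡ (begin
     triple wo * wronskian y0 - triple y0 * wronskian wo
      ≡⟨ expand ⟩
     Ev.der P wo * ((ev V y0 * ev V wo) * T) ≡⟨ cong (\ t -> Ev.der P wo * ((ev V y0 * ev V wo) * t)) (trans (sym t1≡) e) ⟩
     Ev.der P wo * ((ev V y0 * ev V wo) * 0#) ≡⟨ solve 2 (\ p x -> p :* (x :* con (ℤ.+ 0)) := con (ℤ.+ 0)) refl (Ev.der P wo) (ev V y0 * ev V wo) ⟩
     0# ∎))
     where
     p : F
     p = Ev.der P wo
         -- Uses U(y)U(w) = b V(y)V(w) and P'(w) w₁ = - P'(y).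
     expand : triple wo * wronskian y0 - triple y0 * wronskian wo ≡ Ev.der P wo * ((ev V y0 * ev V wo) * T)
     expand = sym (begin
      p * ((vy * vw) * T) ≡⟨ solve 11 (\ p vy vw uy uw uy' uw' vy' vw' b w ->
         p :* ((vy :* vw) :* ((uy :* (uw' :* w) :+ uy' :* uw) :+ (:- b) :* (vy :* (vw' :* w) :+ vy' :* vw))) :=
         (p :* w) :* ((uy :* vy) :* (uw' :* vw) :- (b :* (vy :* vw)) :* (vy :* vw')) :+ p :* ((uw :* vw) :* (uy' :* vy) :- (b :* (vy :* vw)) :* (vy' :* vw))) refl
         p vy vw uy uw uy' uw' vy' vw' b (w 1) ⟩
      (p * w 1) * ((uy * vy) * (uw' * vw) - (b * (vy * vw)) * (vy * vw')) + p * ((uw * vw) * (uy' * vy) - (b * (vy * vw)) * (vy' * vw))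
        ≡⟨ cong₂ (\ s t -> s * ((uy * vy) * (uw' * vw) - t * (vy * vw')) + p * ((uw * vw) * (uy' * vy) - t * (vy' * vw))) w1 (sym e2) ⟩
      (- py) * ((uy * vy) * (uw' * vw) - (uy * uw) * (vy * vw')) + p * ((uw * vw) * (uy' * vy) - (uy * uw) * (vy' * vw))
        ≡⟨ solve 10 (\ p py vy vw uy uw uy' uw' vy' vw' ->
         (:- py) :* ((uy :* vy) :* (uw' :* vw) :- (uy :* uw) :* (vy :* vw')) :+ p :* ((uw :* vw) :* (uy' :* vy) :- (uy :* uw) :* (vy' :* vw)) :=
         (p :* (uw :* vw)) :* (uy' :* vy :- uy :* vy') :- (py :* (uy :* vy)) :* (uw' :* vw :- uw :* vw')) refl p py vy vw uy uw uy' uw' vy' vw' ⟩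
      triple wo * wronskian y0 - triple y0 * wronskian wo ∎)
      where
      py vy vw uy uw uy' uw' vy' vw' : F
      py = Ev.der P y0
      vy = ev V y0
      vw = ev V wo
      uy = ev U y0
      uw = ev U wo
      uy' = Ev.der U y0
      uw' = Ev.der U wo
      vy' = Ev.der V y0
      vw' = Ev.der V wo

  abstract
   fibre-roots : ∃ \ φ -> NonzeroPol φ × length φ N.≤ cap E ×
    (∀ y0 wo -> ev P y0 + ev P wo ≡ a -> ev U y0 * ev U wo ≡ b * (ev V y0 * ev V wo) -> Smooth y0 wo -> ev φ y0 ≡ 0#)
   fibre-roots = proj₁ roots , proj₁ (proj₂ roots) , proj₁ (proj₂ (proj₂ roots)) , \ y0 wo e1 e2 s -> let (γ , e) = context y0 wo e1 e2 s in trans (cong (ev (proj₁ roots)) (sym e)) (proj₂ (proj₂ (proj₂ roots)) γ)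

 -- The four points form a cycle y, z, z', y'. Three of its sides determine z, z' and y' as
 -- algebraic functions of y, adjoined one after another with z' lying over z; the fourth side is
 -- the equation t.
 module Cycle (E : ℕ) (P Q : Pol) (xP : Exact E P) (xQ : Exact E Q) (β τ τ' ε : F) where

  -- Following the derivative around the cycle in both directions gives two first-order values for
  -- the fourth side. The last condition says that they differ, with the denominators P'(z), Q'(z'),
  -- Q'(y') cleared.
  Smooth : (y z y' z' : F) -> Set
  Smooth y z y' z' = ¬ Ev.der P z ≡ 0# × ¬ Ev.der Q z' ≡ 0# × ¬ Ev.der Q y' ≡ 0# ×
   ¬ (Ev.der P z' * Ev.der P y) * (Ev.der Q z * Ev.der Q y') ≡ (Ev.der P y' * Ev.der P z) * (Ev.der Q y * Ev.der Q z')

  private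
   record Ctx : Set where
    field
     y z y' z' : Ser
     rel-z : Es.hev P z ≈ Es.hev P y +ˢ const β
     rel-z' : Es.hev Q z' ≈ Es.hev Q z +ˢ const τ
     rel-y' : Es.hev Q y' ≈ Es.hev Q y +ˢ const τ'
    t : Ser
    t = (Es.hev P z' +ˢ (-ˢ Es.hev P y')) +ˢ const (- ε)
    field
     t₀ : t 0 ≡ 0#
     t₁ : ¬ t 1 ≡ 0#

   open Points Ctx
   module xP = Exact xP
   module xQ = Exact xQ

   L0 : Level
   L0 = baseLevel Ctx.y

   H1 : Ctx -> Ser
   H1 γ = Es.hev P (Ctx.y γ) +ˢ const β

   H1-Op : Level.Op L0 E H1
   H1-Op = plus-const-Op L0 (\ γ -> Es.hev P (Ctx.y γ)) β (hev-Op-1 L0 P Ctx.y xP.short (base-Op Ctx.y))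

   module Z = Adjoin L0 Ctx.z H1 xP.d0 E H1-Op P xP.deg xP.lead (\ γ n -> trans (hev-pointwise P Ctx.z γ n) (Ctx.rel-z γ n))

   L1 : Level
   L1 = Z.level

   H2 : Ctx -> Ser
   H2 γ = Es.hev Q (Ctx.z γ) +ˢ const τ

   H2-Op : Level.Op L1 (E N.* E) H2
   H2-Op = plus-const-Op L1 (\ γ -> Es.hev Q (Ctx.z γ)) τ (hev-Op L1 Q Ctx.z xQ.short Z.var-Op)

   module Z' = Adjoin L1 Ctx.z' H2 xQ.d0 (E N.* E) H2-Op Q xQ.deg xQ.lead (\ γ n -> trans (hev-pointwise Q Ctx.z' γ n) (Ctx.rel-z' γ n))

   L2 : Level
   L2 = Z'.level

   y-Op2 : Level.Op L2 1 Ctx.y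
   y-Op2 = Z'.lift-Op {1} {Ctx.y} (Z.lift-Op {1} {Ctx.y} (base-Op Ctx.y))

   H3 : Ctx -> Ser
   H3 γ = Es.hev Q (Ctx.y γ) +ˢ const τ'

   H3-Op : Level.Op L2 E H3
   H3-Op = plus-const-Op L2 (\ γ -> Es.hev Q (Ctx.y γ)) τ' (hev-Op-1 L2 Q Ctx.y xQ.short y-Op2)

   module Y' = Adjoin L2 Ctx.y' H3 xQ.d0 E H3-Op Q xQ.deg xQ.lead (\ γ n -> trans (hev-pointwise Q Ctx.y' γ n) (Ctx.rel-y' γ n))

   L3 : Level
   L3 = Y'.level

   y-Op : Level.Op L3 1 Ctx.y
   y-Op = Y'.lift-Op {1} {Ctx.y} y-Op2

   t-Op : Level.Op L3 (size E) Ctx.t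
   t-Op = plus-const-Op L3 (\ γ -> Es.hev P (Ctx.z' γ) +ˢ (-ˢ Es.hev P (Ctx.y' γ))) (- ε)
    (Level.Op-+ L3 {ψ = \ γ -> Es.hev P (Ctx.z' γ)} {\ γ -> -ˢ Es.hev P (Ctx.y' γ)}
     (Level.Op-mono L3 {ψ = \ γ -> Es.hev P (Ctx.z' γ)} (≤∙ (≡⇒≤ (sym (NP.*-assoc E E E))) (size-≥3 E)) (hev-Op L3 P Ctx.z' xP.short (Y'.lift-Op {E N.* E} {Ctx.z'} Z'.var-Op)))
     (Level.Op-neg L3 {ψ = \ γ -> Es.hev P (Ctx.y' γ)} (Level.Op-mono L3 {ψ = \ γ -> Es.hev P (Ctx.y' γ)} (size-≥2 E) (hev-Op L3 P Ctx.y' xP.short Y'.var-Op))))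

   rank≤ : Level.rank L3 N.≤ size E
   rank≤ = ≤∙ (≡⇒≤ (trans Y'.rank-level (cong (suc xQ.d0 N.*_) (trans Z'.rank-level (cong (suc xQ.d0 N.*_) (trans Z.rank-level (trans (cong (suc xP.d0 N.*_) (rank-base Ctx.y)) (NP.*-identityʳ _))))))))
    (≤∙ (*-mono-≤ (exact-rank xQ) (*-mono-≤ (exact-rank xQ) (exact-rank xP)))
    (≤∙ (≡⇒≤ (sym (NP.*-assoc E E E))) (size-≥3 E)))

   roots : ∃ \ φ -> NonzeroPol φ × length φ N.≤ cap E × (∀ γ -> ev φ (Ctx.y γ 0) ≡ 0#)
   roots = root-polynomial L3 Ctx.y Ctx.t (size E) y-Op t-Op E rank≤ NP.≤-refl Ctx.t₀ Ctx.t₁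

   context : ∀ y0 zo y0' z0' -> ev P zo ≡ ev P y0 + β -> ev Q z0' ≡ ev Q zo + τ -> ev Q y0' ≡ ev Q y0 + τ' -> ev P z0' - ev P y0' ≡ ε ->
    Smooth y0 zo y0' z0' -> ∃ \ γ -> Ctx.y γ 0 ≡ y0
   context y0 zo y0' z0' e1 e2 e3 e4 (s1 , s2 , s3 , s4) = record
     { y = Y y0 ; z = z ; y' = y' ; z' = z' ; rel-z = proj₁ (proj₂ (proj₂ hz)) ; rel-z' = proj₁ (proj₂ (proj₂ hz')) ; rel-y' = proj₁ (proj₂ (proj₂ hy')) ; t₀ = t₀ ; t₁ = t₁ } , Y-0 y0
    where
    open ≡-Reasoning
    hz = hensel-chain P (Y y0) y0 β zo (Y-0 y0) e1 s1
    z = proj₁ hz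
    hz' = hensel-chain Q z zo τ z0' (proj₁ (proj₂ hz)) e2 s2
    z' = proj₁ hz'
    hy' = hensel-chain Q (Y y0) y0 τ' y0' (Y-0 y0) e3 s3
    y' = proj₁ hy'
    z'0 : z' 0 ≡ z0'
    z'0 = proj₁ (proj₂ hz')
    y'0 : y' 0 ≡ y0'
    y'0 = proj₁ (proj₂ hy')
    t₀ : (Es.hev P z' 0 - Es.hev P y' 0) - ε ≡ 0#
    t₀ = ≡-sub (trans (cong₂ _-_ (trans (coef0-hev P z') (cong (ev P) z'0)) (trans (coef0-hev P y') (cong (ev P) y'0))) e4)
    y1 : ∀ p -> Ev.der p y0 * Y y0 1 ≡ Ev.der p y0
    y1 p = trans (cong (Ev.der p y0 *_) (Y-1 y0)) (*-identityʳ _)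
    t₁ : ¬ (Es.hev P z' 1 - Es.hev P y' 1) + 0# ≡ 0#
    t₁ e = s4 (begin
     (pz' * Ev.der P y0) * (qz * qy') ≡⟨ cong (\ t -> (pz' * t) * (qz * qy')) (sym (trans (proj₂ (proj₂ (proj₂ hz))) (y1 P))) ⟩
     (pz' * (pz * z 1)) * (qz * qy') ≡⟨ solve 5 (\ a b z c d -> (a :* (b :* z)) :* (c :* d) := (a :* (c :* z)) :* (b :* d)) refl pz' pz (z 1) qz qy' ⟩
     (pz' * (qz * z 1)) * (pz * qy') ≡⟨ cong (\ t -> (pz' * t) * (pz * qy')) (sym (proj₂ (proj₂ (proj₂ hz')))) ⟩
     (pz' * (qz' * z' 1)) * (pz * qy') ≡⟨ solve 5 (\ a c z b d -> (a :* (c :* z)) :* (b :* d) := (a :* z) :* (b :* (d :* c))) refl pz' qz' (z' 1) pz qy' ⟩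
     (pz' * z' 1) * (pz * (qy' * qz')) ≡⟨ cong (_* (pz * (qy' * qz'))) same ⟩
     (py' * y' 1) * (pz * (qy' * qz')) ≡⟨ solve 5 (\ a y b c d -> (a :* y) :* (b :* (c :* d)) := (a :* b) :* ((c :* y) :* d)) refl py' (y' 1) pz qy' qz' ⟩
     (py' * pz) * ((qy' * y' 1) * qz') ≡⟨ cong (\ t -> (py' * pz) * (t * qz')) (trans (proj₂ (proj₂ (proj₂ hy'))) (y1 Q)) ⟩
     (py' * pz) * (Ev.der Q y0 * qz') ∎)
     where
     pz' pz py' qz qy' qz' : F
     pz' = Ev.der P z0'
     pz = Ev.der P zo
     py' = Ev.der P y0'
     qz = Ev.der Q zo
     qy' = Ev.der Q y0'
     qz' = Ev.der Q z0'
     same : pz' * z' 1 ≡ py' * y' 1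
     same = trans (sym (trans (coef1-hev P z') (cong (\ t -> Ev.der P t * z' 1) z'0))) (trans (sub-≡ (trans (sym (+-identityʳ _)) e)) (trans (coef1-hev P y') (cong (\ t -> Ev.der P t * y' 1) y'0)))

  abstract
   fibre-roots : ∃ \ φ -> NonzeroPol φ × length φ N.≤ cap E ×
    (∀ y0 zo y0' z0' -> ev P zo ≡ ev P y0 + β -> ev Q z0' ≡ ev Q zo + τ -> ev Q y0' ≡ ev Q y0 + τ' -> ev P z0' - ev P y0' ≡ ε ->
     Smooth y0 zo y0' z0' -> ev φ y0 ≡ 0#)
   fibre-roots = proj₁ roots , proj₁ (proj₂ roots) , proj₁ (proj₂ (proj₂ roots)) ,
    \ y0 zo y0' z0' e1 e2 e3 e4 s -> let (γ , e) = context y0 zo y0' z0' e1 e2 e3 e4 s in trans (cong (ev (proj₁ roots)) (sym e)) (proj₂ (proj₂ (proj₂ roots)) γ)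

-- Degrees, linear independence and Wronskians.

module PolyFacts (𝔽 : FiniteField) where
 open ≡
 open Fld 𝔽
 open Ser 𝔽
 open Poly 𝔽
 open PolySum 𝔽 selfAlgebra
 open Fibre 𝔽 using (Exact)

 ev-ext : ∀ p r x -> (∀ k -> coef p k ≡ coef r k) -> ev p x ≡ ev r x
 ev-ext p r x e = trans (sym (hev-∑ (length p N.+ length r) p x (m≤m+n _ _))) (trans (∑-cong (length p N.+ length r) (\ k _ -> cong (_* pow x k) (e k))) (hev-∑ (length p N.+ length r) r x (m≤n+m _ _)))

 NonConst : Pol -> Set
 NonConst p = ∃ \ k -> ¬ coef p (suc k) ≡ 0#

 top-degree : ∀ f -> NonConst f -> ∀ n -> (∀ k -> n N.< k -> coef f k ≡ 0#) ->
  ∃ \ d -> suc d N.≤ n × ¬ coef f (suc d) ≡ 0# × (∀ k -> suc d N.< k -> coef f k ≡ 0#)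
 top-degree f (k , ne) zero z = ⊥-elim (ne (z (suc k) (s≤s z≤n)))
 top-degree f nc (suc n) z with coef f (suc n) ≟ 0#
 ... | no ne = n , NP.≤-refl , ne , z
 ... | yes e with top-degree f nc n (\ k n<k -> above k n<k)
  where
  above : ∀ k -> n N.< k -> coef f k ≡ 0#
  above k n<k with k N.≟ suc n
  ... | yes refl = e
  ... | no k≢ = z k (≤∧≢⇒< n<k (\ e -> k≢ (sym e)))
 ... | d , le , ne , z' = d , m≤n⇒m≤1+n le , ne , z'

 trim : ∀ f -> NonConst f -> ∀ n -> length f N.≤ suc n ->
  ∃₂ \ g d -> suc d N.≤ n × length g ≡ suc (suc d) × ¬ coef g (suc d) ≡ 0# × (∀ k -> coef g k ≡ coef f k)
 trim f nc n len with top-degree f nc n (\ k n<k -> coef-≥length f k (≤∙ len n<k))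
 ... | d , le , ne , above = lst (suc (suc d)) (coef f) , d , le , length-lst (suc (suc d)) (coef f) , (\ h -> ne (trans (sym (same (suc d))) h)) , same
  where
  same : ∀ k -> coef (lst (suc (suc d)) (coef f)) k ≡ coef f k
  same k with k N.<? suc (suc d)
  ... | yes k< = coef-lst (suc (suc d)) (coef f) k k<
  ... | no k≥ = trans (coef-lst-≥ (suc (suc d)) (coef f) k (≮⇒≥ k≥)) (sym (above k (≮⇒≥ k≥)))

 exact : ∀ {E} f -> NonConst f -> length f N.≤ E -> ∃ \ g -> Exact E g × (∀ k -> coef g k ≡ coef f k)
 exact {zero} [] (k , ne) _ = ⊥-elim (ne refl)
 exact {suc E} f nc len with trim f nc E len
 ... | g , d , le , deg , lead , same = g , record { d0 = d ; deg = deg ; lead = lead ; short = ≤∙ (≡⇒≤ deg) (s≤s le) } , same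

 leading : ∀ f -> NonzeroPol f -> ∃ \ m -> ¬ coef f m ≡ 0# × (∀ k -> m N.< k -> coef f k ≡ 0#)
 leading [] (k , ne) = ⊥-elim (ne refl)
 leading (a ∷ f) nz with all-zero? f
 ... | inj₂ nz' with leading f nz'
 ... | m , ne , above = suc m , ne , \ { (suc k) (s≤s h) -> above k h }
 leading (a ∷ f) (zero , ne) | inj₁ z = 0 , ne , \ { (suc k) _ -> z k }
 leading (a ∷ f) (suc k , ne) | inj₁ z = ⊥-elim (ne (z k))

 length-⊠ : ∀ p r -> length (p ⊠ r) N.≤ length p N.+ length r
 length-⊠ [] r = z≤n
 length-⊠ (a ∷ p) r = length-⊞ (scale a r) (0# ∷ (p ⊠ r)) (≤∙ (≡⇒≤ (Listₚ.length-map _ r)) (≤∙ (m≤n+m (length r) (length p)) (n≤1+n _))) (s≤s (length-⊠ p r))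

 -- The Euler derivation x d/dx, convenient because it acts on coefficients without shifting them.
 θ : Ser -> Ser
 θ a n = natF n * a n

 coef-θ : ∀ p n -> coef (0# ∷ deriv p) n ≡ θ (coef p) n
 coef-θ p zero = sym (zeroˡ _)
 coef-θ p (suc n) = coef-deriv p n

 comb : F -> F -> Pol -> Pol -> Pol
 comb a b p r = scale a p ⊞ scale b r

 coef-comb : ∀ a b p r k -> coef (comb a b p r) k ≡ a * coef p k + b * coef r k
 coef-comb a b p r k = trans (coef-⊞ (scale a p) (scale b r) k) (cong₂ _+_ (coef-scale a p k) (coef-scale b r k))

 ev-comb : ∀ a b p r x -> ev (comb a b p r) x ≡ a * ev p x + b * ev r x
 ev-comb a b p r x = trans (Ev.hev-⊞ (scale a p) (scale b r) x) (cong₂ _+_ (Ev.hev-scale a p x) (Ev.hev-scale b r x))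

 length-comb : ∀ {n} a b p r -> length p N.≤ n -> length r N.≤ n -> length (comb a b p r) N.≤ n
 length-comb a b p r l l' = length-⊞ (scale a p) (scale b r) (≤∙ (≡⇒≤ (Listₚ.length-map _ p)) l) (≤∙ (≡⇒≤ (Listₚ.length-map _ r)) l')

 minorF : Pol -> Pol -> ℕ -> ℕ -> F
 minorF p r i j = coef p i * coef r j - coef p j * coef r i

 module Independent (p r : Pol) (p0 : coef p 0 ≡ 0#) (r0 : coef r 0 ≡ 0#) (i j : ℕ) (minor : ¬ minorF p r i j ≡ 0#) where

  -- Cramer's rule: if the combination vanished at the indices i and j, both a and b would be
  -- annihilated by the nonzero minor. A nonzero constant is excluded because both constant terms
  -- vanish.
  comb-nonconst : ∀ a b -> ¬ a ≡ 0# ⊎ ¬ b ≡ 0# -> NonConst (comb a b p r)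
  comb-nonconst a b ne with all-zero? (comb a b p r)
  ... | inj₂ (suc k , h) = k , h
  ... | inj₂ (zero , h) = ⊥-elim (h (trans (coef-comb a b p r 0) (trans (cong₂ (\ s t -> a * s + b * t) p0 r0) (solve 2 (\ a b -> a :* con (ℤ.+ 0) :+ b :* con (ℤ.+ 0) := con (ℤ.+ 0)) refl a b))))
  ... | inj₁ z = ⊥-elim (case ne)
   where
   zi : ∀ k -> a * coef p k + b * coef r k ≡ 0#
   zi k = trans (sym (coef-comb a b p r k)) (z k)
   vanish : ∀ {x y s t} -> x ≡ 0# -> y ≡ 0# -> s * x - t * y ≡ 0#
   vanish {s = s} {t} refl refl = solve 2 (\ s t -> s :* con (ℤ.+ 0) :- t :* con (ℤ.+ 0) := con (ℤ.+ 0)) refl s t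
   case : ¬ (¬ a ≡ 0# ⊎ ¬ b ≡ 0#)
   case (inj₁ na) = minor (*-cancelˡ-0 na (trans (solve 6 (\ a b pi pj ri rj -> a :* (pi :* rj :- pj :* ri) := rj :* (a :* pi :+ b :* ri) :- ri :* (a :* pj :+ b :* rj)) refl a b (coef p i) (coef p j) (coef r i) (coef r j)) (vanish (zi i) (zi j))))
   case (inj₂ nb) = minor (*-cancelˡ-0 nb (trans (solve 6 (\ a b pi pj ri rj -> b :* (pi :* rj :- pj :* ri) := pi :* (a :* pj :+ b :* rj) :- pj :* (a :* pi :+ b :* ri)) refl a b (coef p i) (coef p j) (coef r i) (coef r j)) (vanish (zi j) (zi i))))

 module Char (E : ℕ) (char : ∀ k -> suc k N.≤ E -> ¬ natF (suc k) ≡ 0#) where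

  deriv-nonzero : ∀ f -> NonConst f -> length f N.≤ E -> NonzeroPol (deriv f)
  deriv-nonzero f (k , ne) len = k , \ h -> *-≢0 (char k (≰⇒≥ (\ le -> ne (coef-≥length f (suc k) (≤∙ len (≤∙ le (NP.≤-refl))))))) ne (trans (sym (coef-deriv f k)) h)

  natF-+ : ∀ m n -> natF (m N.+ n) ≡ natF m + natF n
  natF-+ zero n = sym (+-identityˡ _)
  natF-+ (suc m) n = trans (cong (1# +_) (natF-+ m n)) (sym (+-assoc _ _ _))

  private
   natF-< : ∀ k m -> k N.< m -> m N.≤ E -> ¬ natF k ≡ natF m
   natF-< k m k<m m≤ e with m≤n⇒∃[o]m+o≡n k<m
   ... | o , refl = char o (≤∙ (s≤s (m≤n+m o k)) m≤) (trans (solve 2 (\ a b -> b := (a :+ b) :- a) refl (natF k) (natF (suc o))) (≡-sub (trans (sym (natF-+ k (suc o))) (trans (cong natF (+-suc k o)) (sym e)))))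

  natF-differ : ∀ k m -> k N.≤ E -> m N.≤ E -> ¬ k ≡ m -> ¬ natF k - natF m ≡ 0#
  natF-differ k m k≤ m≤ ne e with <-cmp k m
  ... | tri≈ _ eq _ = ne eq
  ... | tri< k<m _ _ = natF-< k m k<m m≤ (sub-≡ e)
  ... | tri> _ _ m<k = natF-< m k m<k k≤ (sym (sub-≡ e))

   -- x (U'V - UV')
  wronskianPol : Pol -> Pol -> Pol
  wronskianPol U V = ((0# ∷ deriv U) ⊠ V) ⊞ scale (- 1#) (U ⊠ (0# ∷ deriv V))

  coef-wronskian : ∀ U V n -> coef (wronskianPol U V) n ≡ (θ (coef U) *ˢ coef V) n - (coef U *ˢ θ (coef V)) n
  coef-wronskian U V n = trans (coef-⊞ ((0# ∷ deriv U) ⊠ V) _ n) (cong₂ _+_ (trans (coef-⊠ (0# ∷ deriv U) V n) (*ˢ-cong {coef (0# ∷ deriv U)} {θ (coef U)} {coef V} {coef V} (coef-θ U) (\ _ -> refl) n))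
   (trans (coef-scale (- 1#) (U ⊠ (0# ∷ deriv V)) n) (trans (solve 2 (\ o x -> (:- o) :* x := :- (o :* x)) refl 1# (coef (U ⊠ (0# ∷ deriv V)) n)) (cong -_ (trans (*-identityˡ _) (trans (coef-⊠ U (0# ∷ deriv V) n) (*ˢ-cong {coef U} {coef U} {coef (0# ∷ deriv V)} {θ (coef V)} (\ _ -> refl) (coef-θ V) n)))))))

  ev-wronskian : ∀ U V x -> ev (wronskianPol U V) x ≡ x * (Ev.der U x * ev V x - ev U x * Ev.der V x)
  ev-wronskian U V x = trans (Ev.hev-⊞ ((0# ∷ deriv U) ⊠ V) _ x) (trans (cong₂ _+_ (trans (Ev.hev-⊠ (0# ∷ deriv U) V x) (cong (_* ev V x) (trans (Ev.hev-shift (deriv U) x) (cong (x *_) (Ev.hev-deriv U x)))))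
    (trans (Ev.hev-scale (- 1#) (U ⊠ (0# ∷ deriv V)) x) (trans (cong (- 1# *_) (trans (Ev.hev-⊠ U (0# ∷ deriv V) x) (cong (ev U x *_) (trans (Ev.hev-shift (deriv V) x) (cong (x *_) (Ev.hev-deriv V x)))))) (trans (solve 2 (\ o x -> (:- o) :* x := :- (o :* x)) refl 1# _) (cong -_ (*-identityˡ _))))))
   (solve 5 (\ x a b c d -> (x :* a) :* b :+ :- (c :* (x :* d)) := x :* (a :* b :- c :* d)) refl x (Ev.der U x) (ev V x) (ev U x) (Ev.der V x)))

  wronskian-above : ∀ U V m n -> (∀ k -> m N.< k -> coef U k ≡ 0#) -> (∀ k -> n N.< k -> coef V k ≡ 0#) -> ∀ N -> m N.+ n N.< N -> coef (wronskianPol U V) N ≡ 0#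
  wronskian-above U V m n uz vz N h = trans (coef-wronskian U V N) (trans (cong₂ _-_ (conv-vanish (θ (coef U)) (coef V) N (\ i k e -> one i k e (\ z -> trans (cong (natF i *_) z) (zeroʳ _)) (\ z -> z)))
    (conv-vanish (coef U) (θ (coef V)) N (\ i k e -> one i k e (\ z -> z) (\ z -> trans (cong (natF k *_) z) (zeroʳ _))))) (-‿inverseʳ 0#))
   where
   one : ∀ {X Y : Set} i k -> i N.+ k ≡ N -> (coef U i ≡ 0# -> X) -> (coef V k ≡ 0# -> Y) -> X ⊎ Y
   one i k e f g with i N.≤? m
   ... | no i> = inj₁ (f (uz i (≰⇒> i>)))
   ... | yes i≤ = inj₂ (g (vz k (≰⇒> (\ k≤ -> <⇒≱ h (≤∙ (≡⇒≤ (sym e)) (+-mono-≤ i≤ k≤))))))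

  -- Replacing U by g = U - λ V does not change the Wronskian. Choose λ so that g has no term in the
  -- top degree m of V; then the top degree k of g differs from m, and x times the Wronskian has the
  -- coefficient (k - m) g_k V_m at k + m, nonzero because k and m are at most E.
  wronskian-nonzero : ∀ U V -> length U N.≤ E -> length V N.≤ E -> NonzeroPol V -> (∀ a -> NonzeroPol (comb 1# a U V)) -> NonzeroPol (wronskianPol U V)
  wronskian-nonzero U V lU lV nzV indep with leading V nzV
  ... | m , Vm , aboveV with leading (comb 1# (- (coef U m * inv (coef V m))) U V) (indep (- (coef U m * inv (coef V m))))
  ... | k , gk , aboveg = k N.+ m , \ h -> *-≢0 (natF-differ k m k≤ m≤ k≢m) (*-≢0 gk Vm) (trans (sym value) h)
   where
   λ' : F
   λ' = coef U m * inv (coef V m)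
   a b g : Ser
   a = coef U
   b = coef V
   g = coef (comb 1# (- λ') U V)
   m≤ : m N.≤ E
   m≤ = ≮⇒≥ (\ h -> Vm (coef-≥length V m (≤∙ lV (<⇒≤ h))))
   k≤ : k N.≤ E
   k≤ = ≮⇒≥ (\ h -> gk (coef-≥length (comb 1# (- λ') U V) k (≤∙ (length-comb 1# (- λ') U V lU lV) (<⇒≤ h))))
   g≡ : ∀ n -> g n ≡ a n - λ' * b n
   g≡ n = trans (coef-comb 1# (- λ') U V n) (trans (cong (_+ (- λ') * b n) (*-identityˡ _)) (solve 3 (\ a l b -> a :+ (:- l) :* b := a :- l :* b) refl (a n) λ' (b n)))
   k≢m : ¬ k ≡ m
   k≢m refl = gk (trans (g≡ m) (≡-sub (sym (trans (*-assoc _ _ _) (trans (cong (a m *_) (inv-l Vm)) (*-identityʳ _))))))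
   a≡ : ∀ n -> a n ≡ g n + λ' * b n
   a≡ n = trans (solve 2 (\ a l -> a := (a :- l) :+ l) refl (a n) (λ' * b n)) (cong (_+ λ' * b n) (sym (g≡ n)))
   reduce : ∀ n -> (θ a *ˢ b) n - (a *ˢ θ b) n ≡ (θ g *ˢ b) n - (g *ˢ θ b) n
   reduce n = trans (cong₂ _-_ (trans (*ˢ-cong {θ a} {θ g +ˢ (\ n -> λ' * θ b n)} {b} {b} (\ n -> trans (cong (natF n *_) (a≡ n)) (solve 4 (\ t g l b -> t :* (g :+ l :* b) := t :* g :+ l :* (t :* b)) refl (natF n) (g n) λ' (b n))) (\ _ -> refl) n)
       (trans (*ˢ-distribʳ b (θ g) (\ n -> λ' * θ b n) n) (cong ((θ g *ˢ b) n +_) (trans (*ˢ-scale λ' (θ b) b n) (cong (λ' *_) (*ˢ-comm (θ b) b n))))))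
      (trans (*ˢ-cong {a} {g +ˢ (\ n -> λ' * b n)} {θ b} {θ b} a≡ (\ _ -> refl) n) (trans (*ˢ-distribʳ (θ b) g (\ n -> λ' * b n) n) (cong ((g *ˢ θ b) n +_) (*ˢ-scale λ' b (θ b) n)))))
    (solve 3 (\ x y z -> (x :+ z) :- (y :+ z) := x :- y) refl ((θ g *ˢ b) n) ((g *ˢ θ b) n) (λ' * (b *ˢ θ b) n))
   off : ∀ {X Y : Set} i k' -> i N.+ k' ≡ k N.+ m -> ¬ i ≡ k -> (g i ≡ 0# -> X) -> (b k' ≡ 0# -> Y) -> X ⊎ Y
   off i k' e ne f h with i N.≤? k
   ... | no i> = inj₁ (f (aboveg i (≰⇒> i>)))
   ... | yes i≤ = inj₂ (h (aboveV k' (≰⇒> (\ k'≤ -> <⇒≢ (+-mono-<-≤ (≤∧≢⇒< i≤ ne) k'≤) e))))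
   value : coef (wronskianPol U V) (k N.+ m) ≡ (natF k - natF m) * (g k * b m)
   value = trans (coef-wronskian U V (k N.+ m)) (trans (reduce (k N.+ m)) (trans (cong₂ _-_
     (conv-top (θ g) b k m (\ i k' e ne -> off i k' e ne (\ z -> trans (cong (natF i *_) z) (zeroʳ _)) (\ z -> z)))
     (conv-top g (θ b) k m (\ i k' e ne -> off i k' e ne (\ z -> z) (\ z -> trans (cong (natF k' *_) z) (zeroʳ _)))))
    (solve 4 (\ k m g b -> (k :* g) :* b :- g :* (m :* b) := (k :- m) :* (g :* b)) refl (natF k) (natF m) (g k) (b m))))

-- Degenerate pairs and the multiplicity of generic ones.

module Counts (𝔽 : FiniteField) (𝕆 : OrderedRing) where
 open ≡ hiding (J)
 open FSum 𝔽 𝕆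
 open Analysis 𝔽 𝕆 using (D)
 open Analysis2 𝔽 𝕆
 open Count 𝔽 𝕆
 open Poly 𝔽
 open PolyFacts 𝔽
 open Ser 𝔽 using (conv-top; _*ˢ_)
 open Fibre 𝔽
 open StepConst
 private module K = Fld 𝔽

 ∑4 : (F -> F -> F -> F -> Z) -> Z
 ∑4 f = S (\ a -> S (\ b -> S (\ c -> S (\ d -> f a b c d))))

 ∑4-mono : ∀ {f g} -> (∀ a b c d -> f a b c d ≤ g a b c d) -> ∑4 f ≤ ∑4 g
 ∑4-mono h = Σ-mono els (\ a -> Σ-mono els (\ b -> Σ-mono els (\ c -> Σ-mono els (\ d -> h a b c d))))

 ∑4-+ : ∀ f g -> ∑4 (\ a b c d -> f a b c d + g a b c d) ≡ ∑4 f + ∑4 g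
 ∑4-+ f g = trans (Σ-cong els (\ a -> trans (Σ-cong els (\ b -> trans (Σ-cong els (\ c -> Σ-+ els _ _)) (Σ-+ els _ _))) (Σ-+ els _ _))) (Σ-+ els _ _)

 ∑4-els⁴ : ∀ f -> Σ els⁴ f ≡ ∑4 (\ y z y' z' -> f ((y , z) , (y' , z')))
 ∑4-els⁴ f = trans (Σ-× els² els² f) (trans (Σ-× els els _) (Σ-cong els (\ y -> Σ-cong els (\ z -> Σ-× els els _))))

 ∑4-swap12 : ∀ f -> ∑4 f ≡ ∑4 (\ b a c d -> f a b c d)
 ∑4-swap12 f = Σ-swap els els _

 ∑4-swap23 : ∀ f -> ∑4 f ≡ ∑4 (\ a c b d -> f a b c d)
 ∑4-swap23 f = Σ-cong els (\ a -> Σ-swap els els _)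

 ∑4-swap34 : ∀ f -> ∑4 f ≡ ∑4 (\ a b d c -> f a b c d)
 ∑4-swap34 f = Σ-cong els (\ a -> Σ-cong els (\ b -> Σ-swap els els _))

 nest : ∀ (f : F -> Z) (G : F -> Z) k -> (∀ x -> 0z ≤ f x) -> 0z ≤ k -> (∀ x -> G x ≤ k) -> ∀ {m} -> S f ≤ m -> S (\ x -> f x * G x) ≤ m * k
 nest f G k 0≤f 0≤k h le = ≤-trans (Σ-mono els (\ x -> *-monoˡ (0≤f x) (h x))) (≤-trans (≤-reflexive (Σ-*ʳ els k f)) (*-monoʳ 0≤k le))

 ∑4-bound : ∀ (f1 : F -> Z) (f2 : F -> F -> Z) (f3 : F -> F -> F -> Z) (f4 : F -> F -> F -> F -> Z) k1 k2 k3 k4 -> 0z ≤ k2 -> 0z ≤ k3 -> 0z ≤ k4 ->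
  (∀ a -> 0z ≤ f1 a) -> (∀ a b -> 0z ≤ f2 a b) -> (∀ a b c -> 0z ≤ f3 a b c) ->
  S f1 ≤ k1 -> (∀ a -> S (f2 a) ≤ k2) -> (∀ a b -> S (f3 a b) ≤ k3) -> (∀ a b c -> S (f4 a b c) ≤ k4) ->
  ∑4 (\ a b c d -> f1 a * (f2 a b * (f3 a b c * f4 a b c d))) ≤ k1 * (k2 * (k3 * k4))
 ∑4-bound f1 f2 f3 f4 k1 k2 k3 k4 0≤k2 0≤k3 0≤k4 p1 p2 p3 h1 h2 h3 h4 = ≤-trans (≤-reflexive pull)
   (nest f1 _ _ p1 (*-nonneg 0≤k2 (*-nonneg 0≤k3 0≤k4)) (\ a -> nest (f2 a) _ _ (p2 a) (*-nonneg 0≤k3 0≤k4) (\ b -> nest (f3 a b) _ _ (p3 a b) 0≤k4 (\ c -> h4 a b c) (h3 a b)) (h2 a)) h1)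
  where
  pull : ∑4 (\ a b c d -> f1 a * (f2 a b * (f3 a b c * f4 a b c d))) ≡ S (\ a -> f1 a * S (\ b -> f2 a b * S (\ c -> f3 a b c * S (f4 a b c))))
  pull = Σ-cong els (\ a -> trans (Σ-cong els (\ b -> trans (Σ-cong els (\ c -> trans (Σ-*ˡ els _ _) (cong (f1 a *_) (trans (Σ-*ˡ els _ _) (cong (f2 a b *_) (Σ-*ˡ els _ _)))))) (trans (Σ-*ˡ els _ _) (cong (f1 a *_) (Σ-*ˡ els _ _))))) (Σ-*ˡ els _ _))

 ind-⊎ : ∀ {A B : Set} (a : Dec A) (b : Dec B) -> ind (a ⊎-dec b) ≤ ind a + ind b
 ind-⊎ (yes _) b = ≤-trans (≤-reflexive (sym (+-identityʳ _))) (+-mono ≤-refl (ind-nonneg b))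
 ind-⊎ (no _) (yes _) = ≤-reflexive (sym (+-identityˡ _))
 ind-⊎ (no _) (no _) = ≤-reflexive (sym (+-identityˡ _))

 ind-and : ∀ {A B : Set} (a : Dec A) (b : Dec B) -> ind a * ind b ≡ ind (a ×-dec b)
 ind-and a b = sym (ind-∧ (a ×-dec b) a b proj₁ proj₂ _,_)

 1-ind : ∀ {A : Set} (a : Dec A) -> 1z - ind a ≡ ind (¬? a)
 1-ind (yes _) = -‿inverseʳ 1z
 1-ind (no _) = solve 1 (\ o -> o :- con (ℤ.+ 0) := o) refl 1z

 S-one : S (\ _ -> 1z) ≡ nat q
 S-one = trans (S-const 1z) (*-identityʳ _)

 S-ind-≤q : ∀ {P : F -> Set} (P? : ∀ x -> Dec (P x)) -> S (\ x -> ind (P? x)) ≤ nat q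
 S-ind-≤q P? = ≤-trans (Σ-mono els (\ x -> ind-≤1 (P? x))) (≤-reflexive S-one)

 roots-S : ∀ p {m} -> NonzeroPol p -> length p N.≤ m -> S (\ x -> ind (ev p x ≟ 𝟘)) ≤ nat m
 roots-S p nz l = ≤-trans (roots-≤ p nz) (nat-mono (≤∙ pred[n]≤n l))

 fibre-S : ∀ {E} P -> Exact E P -> ∀ a -> S (\ x -> ind (ev P x ≟ a)) ≤ nat E
 fibre-S P x a = ≤-trans (fibre-≤ P (Exact.d0 x , Exact.lead x) a) (nat-mono (≤∙ pred[n]≤n (Exact.short x)))

 -- At most E exceptional rows may be full; in every other row the points counted are roots of a
 -- nonzero polynomial of length at most m.
 zeros-S : ∀ {E m} (g : F -> F) {X : F -> F -> Set} (X? : ∀ a b -> Dec (X a b)) (p : F -> Pol) ->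
  S (\ a -> ind (g a ≟ 𝟘)) ≤ nat E -> (∀ a -> ¬ g a ≡ 𝟘 -> NonzeroPol (p a)) -> (∀ a -> length (p a) N.≤ m) -> (∀ a b -> X a b -> ev (p a) b ≡ 𝟘) ->
  S (\ a -> S (\ b -> ind (X? a b))) ≤ nat (q N.* (E N.+ m))
 zeros-S {E} {m} g X? p few nz len imp = ≤-trans (Σ-mono els (\ a -> row a (g a ≟ 𝟘))) (≤-trans (≤-reflexive (trans (Σ-+ els _ _) (cong₂ _+_ (Σ-*ʳ els (nat q) _) (S-const (nat m)))))
   (≤-trans (+-mono (*-monoʳ (nat-nonneg q) few) ≤-refl) (≤-reflexive (trans (cong (_+ nat q * nat m) (*-comm _ _)) (trans (sym (distribˡ _ _ _)) (trans (cong (nat q *_) (sym (nat-+ E m))) (sym (nat-* q (E N.+ m)))))))))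
  where
  row : ∀ a (d : Dec (g a ≡ 𝟘)) -> S (\ b -> ind (X? a b)) ≤ ind d * nat q + nat m
  row a (yes _) = ≤-trans (S-ind-≤q (X? a)) (≤-trans (≤-reflexive (sym (trans (cong (_+ 0z) (*-identityˡ _)) (+-identityʳ _)))) (+-mono ≤-refl (nat-nonneg m)))
  row a (no ne) = ≤-trans (Σ-mono els (\ b -> ind-mono (X? a b) (ev (p a) b ≟ 𝟘) (imp a b))) (≤-trans (roots-S (p a) (nz a ne) (len a)) (≤-reflexive (sym (trans (cong (_+ nat m) (zeroˡ _)) (+-identityˡ _)))))

 move : ∀ {a b x} -> a ⊝ b ≡ x -> a ≡ x ⊕ b
 move {a} {b} e = trans (K.solve 2 (\ a b -> a K.:= (a K.:- b) K.:+ b) refl a b) (cong (_⊕ b) e)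

 module Pairs (E : ℕ) (P R : Pol) (xP : Exact E P) (R-short : length R N.≤ E) (char : ∀ k -> suc k N.≤ E -> ¬ K.natF (suc k) ≡ 𝟘)
  (indep : ∀ a b -> ¬ b ≡ 𝟘 -> NonzeroPol (comb a b (deriv P) (deriv R))) where
  open Char E char

  Bad : F -> F -> Set
  Bad y z = (Ev.der P z ≡ 𝟘) ⊎ (Ev.der P z ⊗ Ev.der R y ≡ Ev.der P y ⊗ Ev.der R z)

  bad? : ∀ y z -> Dec (Bad y z)
  bad? y z = (Ev.der P z ≟ 𝟘) ⊎-dec (Ev.der P z ⊗ Ev.der R y ≟ Ev.der P y ⊗ Ev.der R z)

  der-roots : S (\ z -> ind (Ev.der P z ≟ 𝟘)) ≤ nat E
  der-roots = ≤-trans (≤-reflexive (Σ-cong els (\ z -> ind-cong (Ev.der P z ≟ 𝟘) (ev (deriv P) z ≟ 𝟘) (trans (Ev.hev-deriv P z)) (trans (sym (Ev.hev-deriv P z))))))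
   (roots-S (deriv P) (deriv-nonzero P (Exact.d0 xP , Exact.lead xP) (Exact.short xP)) (≤∙ (length-deriv P) (Exact.short xP)))

  few : S (\ y -> S (\ z -> ind (bad? y z))) ≤ nat (q N.* (3 N.* E))
  few = ≤-trans (Σ-mono els (\ y -> Σ-mono els (\ z -> ind-⊎ (Ev.der P z ≟ 𝟘) (Ev.der P z ⊗ Ev.der R y ≟ Ev.der P y ⊗ Ev.der R z))))
   (≤-trans (≤-reflexive (trans (Σ-cong els (\ y -> Σ-+ els _ _)) (Σ-+ els _ _)))
   (≤-trans (+-mono (≤-trans (Σ-mono els (\ y -> der-roots)) (≤-reflexive (S-const (nat E))))
     -- For fixed y with P'(y) ≠ 0 the degenerate z are roots of R'(y) P' - P'(y) R', which is
     -- nonzero by independence of the derivatives.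
     (zeros-S {E} {E} (Ev.der P) (\ y z -> Ev.der P z ⊗ Ev.der R y ≟ Ev.der P y ⊗ Ev.der R z) (\ y -> comb (Ev.der R y) (⊖ Ev.der P y) (deriv P) (deriv R)) der-roots
      (\ y ne -> indep (Ev.der R y) (⊖ Ev.der P y) (K.neg-≢0 ne)) (\ y -> length-comb (Ev.der R y) (⊖ Ev.der P y) (deriv P) (deriv R) (≤∙ (length-deriv P) (Exact.short xP)) (≤∙ (length-deriv R) R-short))
      (\ y z e -> trans (ev-comb (Ev.der R y) (⊖ Ev.der P y) (deriv P) (deriv R) z) (trans (cong₂ (\ s t -> Ev.der R y ⊗ s ⊕ (⊖ Ev.der P y) ⊗ t) (Ev.hev-deriv P z) (Ev.hev-deriv R z))
       (trans (K.solve 4 (\ a b c d -> a K.:* b K.:+ (K.:- c) K.:* d K.:= b K.:* a K.:- c K.:* d) refl (Ev.der R y) (Ev.der P z) (Ev.der P y) (Ev.der R z)) (K.≡-sub e))))))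
    (≤-reflexive (trans (cong (_+ nat (q N.* (E N.+ E))) (sym (nat-* q E))) (trans (sym (nat-+ (q N.* E) (q N.* (E N.+ E)))) (cong nat (trans (sym (*-distribˡ-+ q E (E N.+ E))) (cong (\ t -> q N.* (E N.+ t)) (cong (E N.+_) (sym (NP.+-identityʳ E)))))))))))

  good : ∀ a b -> S (\ y -> S (\ z -> (1z - ind (bad? y z)) * (ind (D (ev P) y z ≟ a) * ind (D (ev R) y z ≟ b)))) ≤ nat (cap E N.* E)
  good a b = ≤-trans (Σ-mono els (\ y -> Σ-mono els (\ z -> pt y z))) (≤-trans (≤-reflexive (Σ-cong els (\ y -> Σ-*ˡ els _ _)))
    (≤-trans (nest (\ y -> ind (ev φ y ≟ 𝟘)) _ (nat E) (\ y -> ind-nonneg (ev φ y ≟ 𝟘)) (nat-nonneg E) (\ y -> fibre-S P xP (a ⊕ ev P y)) (roots-S φ (proj₁ (proj₂ fibre-roots)) (proj₁ (proj₂ (proj₂ fibre-roots))))) (≤-reflexive (sym (nat-* (cap E) E)))))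
   where
   open DifferencePair E P R xP R-short a b
   φ : Pol
   φ = proj₁ fibre-roots
   pt : ∀ y z -> (1z - ind (bad? y z)) * (ind (D (ev P) y z ≟ a) * ind (D (ev R) y z ≟ b)) ≤ ind (ev φ y ≟ 𝟘) * ind (ev P z ≟ a ⊕ ev P y)
   pt y z = ≤-trans (≤-reflexive (trans (cong₂ _*_ (1-ind (bad? y z)) (ind-and (D (ev P) y z ≟ a) (D (ev R) y z ≟ b))) (ind-and (¬? (bad? y z)) ((D (ev P) y z ≟ a) ×-dec (D (ev R) y z ≟ b)))))
    (≤-trans (ind-mono (¬? (bad? y z) ×-dec ((D (ev P) y z ≟ a) ×-dec (D (ev R) y z ≟ b))) ((ev φ y ≟ 𝟘) ×-dec (ev P z ≟ a ⊕ ev P y))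
      (\ { (nb , e1 , e2) -> proj₂ (proj₂ (proj₂ fibre-roots)) y z (trans (move e1) (K.+-comm _ _)) e2 ((\ h -> nb (inj₁ h)) , (\ h -> nb (inj₂ h))) , move e1 }))
     (≤-reflexive (sym (ind-and (ev φ y ≟ 𝟘) (ev P z ≟ a ⊕ ev P y)))))

-- The plane curve attached to f(y) - f(z) = c.

module Curve (𝔽 : FiniteField) where
 open ≡
 open Fld 𝔽
 open Ser 𝔽 using (Ser; _≈_)
 open Poly 𝔽
 open PolySum 𝔽 selfAlgebra

 mono : ℕ -> F -> Pol
 mono zero k = k ∷ []
 mono (suc n) k = 0# ∷ mono n k

 length-mono : ∀ n k -> length (mono n k) ≡ suc n
 length-mono zero k = refl
 length-mono (suc n) k = cong suc (length-mono n k)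

 coef-mono : ∀ n k -> coef (mono n k) n ≡ k
 coef-mono zero k = refl
 coef-mono (suc n) k = coef-mono n k

 coef-mono-≢ : ∀ n k i -> ¬ i ≡ n -> coef (mono n k) i ≡ 0#
 coef-mono-≢ zero k zero ne = ⊥-elim (ne refl)
 coef-mono-≢ zero k (suc i) ne = refl
 coef-mono-≢ (suc n) k zero ne = refl
 coef-mono-≢ (suc n) k (suc i) ne = coef-mono-≢ n k i (\ e -> ne (cong suc e))

 ev-mono : ∀ n k x -> ev (mono n k) x ≡ k * pow x n
 ev-mono zero k x = trans (cong (k +_) (zeroʳ x)) (trans (+-identityʳ k) (sym (*-identityʳ k)))
 ev-mono (suc n) k x = trans (+-identityˡ _) (trans (cong (x *_) (ev-mono n k x)) (solve 3 (\ x k p -> x :* (k :* p) := k :* (x :* p)) refl x k (pow x n)))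

 -- (1 + v)^k - v^k
 T : ℕ -> Pol
 T zero = []
 T (suc k) = (T k ⊞ (0# ∷ T k)) ⊞ mono k 1#

 length-T : ∀ k -> length (T k) N.≤ k
 length-T zero = z≤n
 length-T (suc k) = length-⊞ (T k ⊞ (0# ∷ T k)) (mono k 1#) (length-⊞ (T k) (0# ∷ T k) (m≤n⇒m≤1+n (length-T k)) (s≤s (length-T k))) (≡⇒≤ (length-mono k 1#))

 ev-T : ∀ k v -> ev (T k) v ≡ pow (1# + v) k - pow v k
 ev-T zero v = sym (-‿inverseʳ 1#)
 ev-T (suc k) v = trans (Ev.hev-⊞ (T k ⊞ (0# ∷ T k)) (mono k 1#) v) (trans (cong₂ _+_ (trans (Ev.hev-⊞ (T k) (0# ∷ T k) v)
   (cong₂ _+_ (ev-T k v) (trans (Ev.hev-shift (T k) v) (cong (v *_) (ev-T k v))))) (ev-mono k 1# v))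
  (trans (cong (\ t -> ((t + v * (pow (1# + v) k - pow v k)) + 1# * pow v k)) (sym (*-identityˡ _)))
   (solve 4 (\ o v p r -> (o :* (p :- r) :+ v :* (p :- r)) :+ o :* r := (o :+ v) :* p :- v :* r) refl 1# v (pow (1# + v) k) (pow v k))))

 coef-T-top : ∀ k -> coef (T (suc k)) k ≡ natF (suc k)
 coef-T-top k = trans (coef-⊞ (T k ⊞ (0# ∷ T k)) (mono k 1#) k) (trans (cong₂ _+_ (trans (coef-⊞ (T k) (0# ∷ T k) k) (trans (cong (_+ coef (0# ∷ T k) k) (coef-≥length (T k) k (length-T k))) (trans (+-identityˡ _) (below k)))) (coef-mono k 1#)) (+-comm _ _))
  where
  below : ∀ k -> coef (0# ∷ T k) k ≡ natF k
  below zero = refl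
  below (suc k) = coef-T-top k

 -- With x y = 1 + v and x z = v, multiplying f(y) - f(z) = c by x^d gives Σ_k f_k x^(d-k) ((1 +
 -- v)^k - v^k) = c x^d. The coefficient of v^s, where s = d - 1, is the constant d f_d; dividing by
 -- it through `w` yields an equation monic in v. `base j i` is the resulting coefficient of x^i v^j
 -- on the other side.
 module Rational (s0 : ℕ) (f : Pol) (deg : length f N.≤ suc (suc (suc s0)))
  (lead : ¬ coef f (suc (suc s0)) ≡ 0#) (d≢0 : ¬ natF (suc (suc s0)) ≡ 0#) where

  s d : ℕ
  s = suc s0
  d = suc s

  w : F
  w = inv (natF d * coef f d)

  w-inv : w * (natF d * coef f d) ≡ 1#
  w-inv = inv-l (*-≢0 d≢0 lead)

  base : ℕ -> ℕ -> F
  base j i = - (w * (coef f (d N.∸ i) * coef (T (d N.∸ i)) j))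

  Row : ℕ -> Pol
  Row j = lst (suc d) (base j)

  ρ : F -> ℕ -> Pol
  ρ c zero = Row 0 ⊞ mono d (w * c)
  ρ c (suc j) = Row (suc j)

  base-0 : ∀ j i -> d N.∸ i N.≤ j -> base j i ≡ 0#
  base-0 j i h = trans (cong (\ t -> - (w * (coef f (d N.∸ i) * t))) (coef-≥length (T (d N.∸ i)) j (≤∙ (length-T _) h)))
   (solve 2 (\ w a -> :- (w :* (a :* con (ℤ.+ 0))) := con (ℤ.+ 0)) refl w (coef f (d N.∸ i)))

  private
   -- The monomial x^i v^j arises from (1 + v)^(d-i) - v^(d-i) and so requires i + j + 1 ≤ d; then s
   -- i + (s + 1) j is at most s d, the weight of v^s.
   Row-Bd : ∀ j i -> j N.< s -> suc (s N.* suc s) N.≤ s N.* i N.+ suc s N.* j -> coef (Row j) i ≡ 0#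
   Row-Bd j i j< h with i N.<? suc d
   ... | no i≥ = coef-lst-≥ (suc d) (base j) i (≮⇒≥ i≥)
   ... | yes i< = trans (coef-lst (suc d) (base j) i i<) (base-0 j i (≮⇒≥ \ j<k -> <⇒≱ h (le j<k)))
    where
    le : j N.< d N.∸ i -> s N.* i N.+ suc s N.* j N.≤ s N.* suc s
    le j<k = +-cancelˡ-≤ s _ _ (begin
     s N.+ (s N.* i N.+ suc s N.* j) ≡⟨ e1 s i j ⟩
     s N.* (i N.+ suc j) N.+ j ≤⟨ +-mono-≤ (*-monoʳ-≤ s (≤∙ (+-monoʳ-≤ i j<k) (≡⇒≤ (m+[n∸m]≡n (≤-pred i<))))) (<⇒≤ j<) ⟩
     s N.* d N.+ s ≡⟨ NP.+-comm (s N.* d) s ⟩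
     s N.+ s N.* suc s ∎)
     where
     open NP.≤-Reasoning
     e1 : ∀ s i j -> s N.+ (s N.* i N.+ suc s N.* j) ≡ s N.* (i N.+ suc j) N.+ j
     e1 = solve-∀

  ρ-Bd : ∀ c j i -> j N.< s -> suc (s N.* suc s) N.≤ s N.* i N.+ suc s N.* j -> coef (ρ c j) i ≡ 0#
  ρ-Bd c (suc j) i j< h = Row-Bd (suc j) i j< h
  ρ-Bd c zero i j< h = trans (coef-⊞ (Row 0) (mono d (w * c)) i) (trans (cong₂ _+_ (Row-Bd 0 i j< h) (coef-mono-≢ d (w * c) i
   (\ { refl -> <⇒≱ h (≡⇒≤ (trans (cong (s N.* d N.+_) (*-zeroʳ d)) (NP.+-identityʳ _))) }))) (+-identityʳ 0#))

  κ≢0 : ∀ c -> ¬ c ≡ 0# -> ¬ coef (ρ c 0) d ≡ 0#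
  κ≢0 c c≢0 e = *-≢0 (\ w0 -> 0≢1 (trans (sym (zeroˡ _)) (trans (cong (_* (natF d * coef f d)) (sym w0)) w-inv))) c≢0
   (trans (sym (+-identityˡ _)) (trans (cong₂ _+_ (sym (trans (coef-lst (suc d) (base 0) d (n<1+n d)) (base-0 0 d (≡⇒≤ (n∸n≡0 d))))) (sym (coef-mono d (w * c)))) (trans (sym (coef-⊞ (Row 0) (mono d (w * c)) d)) e)))

  length-ρ : ∀ c j -> length (ρ c j) N.≤ suc d
  length-ρ c zero = length-⊞ (Row 0) (mono d (w * c)) (≡⇒≤ (length-lst (suc d) (base 0))) (≡⇒≤ (length-mono d (w * c)))
  length-ρ c (suc j) = ≡⇒≤ (length-lst (suc d) (base (suc j)))

  ev-Row : ∀ j x -> ev (Row j) x ≡ ∑ (suc d) (\ i -> base j i * pow x i)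
  ev-Row j x = trans (sym (hev-∑ (suc d) (Row j) x (≡⇒≤ (length-lst (suc d) (base j))))) (∑-cong (suc d) (\ i i< -> cong (_* pow x i) (coef-lst (suc d) (base j) i i<)))

  ev-Row-top : ∀ x -> ev (Row s) x ≡ - 1#
  ev-Row-top x = trans (ev-Row s x) (trans (∑-head d _) (trans (cong₂ _+_ (trans (*-identityʳ _) (cong -_ (trans (cong (\ t -> w * (coef f d * t)) (coef-T-top s)) (trans (cong (w *_) (*-comm _ _)) w-inv))))
    (∑-zero d _ (\ i _ -> trans (cong (_* pow x (suc i)) (base-0 s (suc i) (m∸n≤m s i))) (zeroˡ _)))) (+-identityʳ _)))

  module _ (c y z x v : F) (eqn : ev f y - ev f z ≡ c) (yx : x * y ≡ 1# + v) (zx : x * z ≡ v) where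
   private
    X : F
    X = pow x d

    split : ∀ i u -> i N.≤ d -> pow x i * pow (x * u) (d N.∸ i) ≡ X * pow u (d N.∸ i)
    split i u h = trans (cong (pow x i *_) (pow-* x u (d N.∸ i))) (trans (sym (*-assoc _ _ _)) (cong (_* pow u (d N.∸ i)) (trans (sym (pow-+ x i (d N.∸ i))) (cong (pow x) (m+[n∸m]≡n h)))))

    inner : ∀ i -> i N.≤ d -> ∑ d (\ j -> (base j i * pow x i) * pow v j) ≡ - (w * X) * (coef f (d N.∸ i) * pow y (d N.∸ i) - coef f (d N.∸ i) * pow z (d N.∸ i))
    inner i h = begin
     ∑ d (\ j -> (base j i * pow x i) * pow v j) ≡⟨ ∑-cong d (\ j _ -> solve 5 (\ w a t x v -> ((:- (w :* (a :* t))) :* x) :* v := (:- (w :* a :* x)) :* (t :* v)) refl w a (coef (T k) j) (pow x i) (pow v j)) ⟩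
     ∑ d (\ j -> - (w * a * pow x i) * (coef (T k) j * pow v j)) ≡⟨ ∑-*ˡ d _ _ ⟩
     - (w * a * pow x i) * ∑ d (\ j -> coef (T k) j * pow v j) ≡⟨ cong (- (w * a * pow x i) *_) (trans (hev-∑ d (T k) v (≤∙ (length-T k) (m∸n≤m d i))) (ev-T k v)) ⟩
     - (w * a * pow x i) * (pow (1# + v) k - pow v k) ≡⟨ solve 5 (\ w a x p r -> (:- (w :* a :* x)) :* (p :- r) := (:- (w :* a)) :* (x :* p :- x :* r)) refl w a (pow x i) (pow (1# + v) k) (pow v k) ⟩
     - (w * a) * (pow x i * pow (1# + v) k - pow x i * pow v k) ≡⟨ cong (\ t -> - (w * a) * t) (cong₂ _-_ (trans (cong (\ t -> pow x i * pow t k) (sym yx)) (split i y h)) (trans (cong (\ t -> pow x i * pow t k) (sym zx)) (split i z h))) ⟩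
     - (w * a) * (X * pow y k - X * pow z k) ≡⟨ solve 5 (\ w a X p r -> (:- (w :* a)) :* (X :* p :- X :* r) := (:- (w :* X)) :* (a :* p :- a :* r)) refl w a X (pow y k) (pow z k) ⟩
     - (w * X) * (a * pow y k - a * pow z k) ∎
     where
     open ≡-Reasoning
     k : ℕ
     k = d N.∸ i
     a : F
     a = coef f k

    sub-∑ : ∀ n (g h : ℕ -> F) -> ∑ n (\ t -> g t - h t) ≡ ∑ n g - ∑ n h
    sub-∑ zero g h = sym (-‿inverseʳ 0#)
    sub-∑ (suc n) g h = trans (cong (_+ (g n - h n)) (sub-∑ n g h)) (solve 4 (\ a b c d -> (a :- b) :+ (c :- d) := (a :+ c) :- (b :+ d)) refl (∑ n g) (∑ n h) (g n) (h n))

    all-rows : ∑ d (\ j -> ev (Row j) x * pow v j) ≡ - (w * X) * c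
    all-rows = begin
     ∑ d (\ j -> ev (Row j) x * pow v j) ≡⟨ ∑-cong d (\ j _ -> trans (cong (_* pow v j) (ev-Row j x)) (sym (∑-*ʳ (suc d) (pow v j) _))) ⟩
     ∑ d (\ j -> ∑ (suc d) (\ i -> (base j i * pow x i) * pow v j)) ≡⟨ ∑-swap d (suc d) _ ⟩
     ∑ (suc d) (\ i -> ∑ d (\ j -> (base j i * pow x i) * pow v j)) ≡⟨ ∑-cong (suc d) (\ i i< -> inner i (≤-pred i<)) ⟩
     ∑ (suc d) (\ i -> - (w * X) * (coef f (d N.∸ i) * pow y (d N.∸ i) - coef f (d N.∸ i) * pow z (d N.∸ i))) ≡⟨ ∑-*ˡ (suc d) _ _ ⟩
     - (w * X) * ∑ (suc d) (\ i -> coef f (d N.∸ i) * pow y (d N.∸ i) - coef f (d N.∸ i) * pow z (d N.∸ i)) ≡⟨ cong (- (w * X) *_) (trans (∑-reverse d (\ k -> coef f k * pow y k - coef f k * pow z k)) (trans (sub-∑ (suc d) _ _) (trans (cong₂ _-_ (hev-∑ (suc d) f y deg) (hev-∑ (suc d) f z deg)) eqn))) ⟩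
     - (w * X) * c ∎
     where open ≡-Reasoning

   relation-holds : pow v s ≡ ∑ s (\ j -> ev (ρ c j) x * pow v j)
   relation-holds = sym (begin
    ∑ s (\ j -> ev (ρ c j) x * pow v j) ≡⟨ ∑-head s0 _ ⟩
    ev (ρ c 0) x * 1# + R ≡⟨ cong (\ t -> t * 1# + R) (trans (Ev.hev-⊞ (Row 0) (mono d (w * c)) x) (cong (ev (Row 0) x +_) (ev-mono d (w * c) x))) ⟩
    (ev (Row 0) x + (w * c) * X) * 1# + R ≡⟨ cong (_+ R) (*-identityʳ _) ⟩
    (ev (Row 0) x + (w * c) * X) + R ≡⟨ cong (\ t -> (t + (w * c) * X) + R) (sym (*-identityʳ _)) ⟩
    (ev (Row 0) x * 1# + (w * c) * X) + R ≡⟨ solve 3 (\ r m R -> (r :+ m) :+ R := (r :+ R) :+ m) refl (ev (Row 0) x * 1#) ((w * c) * X) R ⟩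
    (ev (Row 0) x * 1# + R) + (w * c) * X ≡⟨ cong (_+ (w * c) * X) (sym (∑-head s0 _)) ⟩
    ∑ s (\ j -> ev (Row j) x * pow v j) + (w * c) * X ≡⟨ cong (_+ (w * c) * X) (trans (solve 2 (\ a b -> a := (a :+ b) :- b) refl (∑ s (\ j -> ev (Row j) x * pow v j)) (ev (Row s) x * pow v s)) (cong₂ _-_ all-rows (cong (_* pow v s) (ev-Row-top x)))) ⟩
    (- (w * X) * c - (- 1# * pow v s)) + (w * c) * X ≡⟨ solve 5 (\ w X c o p -> ((:- (w :* X)) :* c :- ((:- o) :* p)) :+ (w :* c) :* X := o :* p) refl w X c 1# (pow v s) ⟩
    1# * pow v s ≡⟨ *-identityˡ _ ⟩
    pow v s ∎)
    where
    open ≡-Reasoning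
    R : F
    R = ∑ s0 (\ j -> ev (Row (suc j)) x * pow v (suc j))

-- The coordinate ring of the curve and its weight.

module Rows (𝔽 : FiniteField) (s0 : ℕ) (ρ : ℕ -> List (FiniteField.F 𝔽)) where
 import Data.Nat.DivMod as DM
 open ≡
 open Fld 𝔽
 open Ser 𝔽
 open Poly 𝔽

 s : ℕ
 s = suc s0

 -- Elements Σ a_j(x) v^j with j < s, modulo the relation for v^s. Rows with index s or more carry
 -- no meaning, which is why `Zero` and `Bd` inspect only j < s. `V̂` shifts the rows and folds the
 -- overflow from the last one back with the relation.
 E : Set
 E = ℕ -> Pol

 infix 4 _≃_
 _≃_ : E -> E -> Set
 a ≃ b = ∀ j i -> coef (a j) i ≡ coef (b j) i

 Zero : E -> Set
 Zero a = ∀ j i -> j N.< s -> coef (a j) i ≡ 0#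

 X̂ V̂ : E -> E
 X̂ a j = 0# ∷ a j
 V̂ a zero = a s0 ⊠ ρ 0
 V̂ a (suc j) = a j ⊞ (a s0 ⊠ ρ (suc j))

 infixl 6 _∔_
 _∔_ : E -> E -> E
 (a ∔ b) j = a j ⊞ b j

 smul : F -> E -> E
 smul k a j = scale k (a j)

 zeroE oneE : E
 zeroE _ = []
 oneE zero = 1# ∷ []
 oneE (suc _) = []

 sumE : ℕ -> (ℕ -> E) -> E
 sumE zero f = zeroE
 sumE (suc n) f = sumE n f ∔ f n

 X^ V^ : ℕ -> E -> E
 X^ zero a = a
 X^ (suc k) a = X̂ (X^ k a)
 V^ zero a = a
 V^ (suc k) a = V̂ (V^ k a)

 coef-∔ : ∀ a b j i -> coef ((a ∔ b) j) i ≡ coef (a j) i + coef (b j) i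
 coef-∔ a b j i = coef-⊞ (a j) (b j) i

 coef-smul : ∀ k a j i -> coef (smul k a j) i ≡ k * coef (a j) i
 coef-smul k a j i = coef-scale k (a j) i

 prev : E -> ℕ -> Ser
 prev a zero = \ _ -> 0#
 prev a (suc j) = coef (a j)

 coef-V̂ : ∀ a j i -> coef (V̂ a j) i ≡ prev a j i + (coef (a s0) *ˢ coef (ρ j)) i
 coef-V̂ a zero i = trans (coef-⊠ (a s0) (ρ 0) i) (sym (+-identityˡ _))
 coef-V̂ a (suc j) i = trans (coef-⊞ (a j) _ i) (cong (coef (a j) i +_) (coef-⊠ (a s0) (ρ (suc j)) i))

 V̂-cong : ∀ {a b} -> a ≃ b -> V̂ a ≃ V̂ b
 V̂-cong {a} {b} e j i = trans (coef-V̂ a j i) (trans (cong₂ _+_ (p j) (*ˢ-cong (e s0) (\ _ -> refl) i)) (sym (coef-V̂ b j i)))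
  where
  p : ∀ j -> prev a j i ≡ prev b j i
  p zero = refl
  p (suc j) = e j i

 X̂-cong : ∀ {a b} -> a ≃ b -> X̂ a ≃ X̂ b
 X̂-cong e j zero = refl
 X̂-cong e j (suc i) = e j i

 V̂-∔ : ∀ a b -> V̂ (a ∔ b) ≃ V̂ a ∔ V̂ b
 V̂-∔ a b j i = trans (coef-V̂ (a ∔ b) j i) (trans (cong₂ _+_ (p j) (trans (*ˢ-cong (coef-∔ a b s0) (\ _ -> refl) i) (*ˢ-distribʳ (coef (ρ j)) (coef (a s0)) (coef (b s0)) i)))
   (trans (solve 4 (\ a b e f -> (a :+ b) :+ (e :+ f) := (a :+ e) :+ (b :+ f)) refl _ _ _ _) (sym (trans (coef-∔ (V̂ a) (V̂ b) j i) (cong₂ _+_ (coef-V̂ a j i) (coef-V̂ b j i))))))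
  where
  p : ∀ j -> prev (a ∔ b) j i ≡ prev a j i + prev b j i
  p zero = sym (+-identityʳ 0#)
  p (suc j) = coef-∔ a b j i

 V̂-smul : ∀ k a -> V̂ (smul k a) ≃ smul k (V̂ a)
 V̂-smul k a j i = trans (coef-V̂ (smul k a) j i) (trans (cong₂ _+_ (p j) (trans (*ˢ-cong (coef-smul k a s0) (\ _ -> refl) i) (*ˢ-scale k (coef (a s0)) (coef (ρ j)) i)))
   (trans (sym (distribˡ k _ _)) (sym (trans (coef-smul k (V̂ a) j i) (cong (k *_) (coef-V̂ a j i))))))
  where
  p : ∀ j -> prev (smul k a) j i ≡ k * prev a j i
  p zero = sym (zeroʳ k)
  p (suc j) = coef-smul k a j i

 X̂-∔ : ∀ a b -> X̂ (a ∔ b) ≃ X̂ a ∔ X̂ b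
 X̂-∔ a b j zero = sym (+-identityʳ 0#)
 X̂-∔ a b j (suc i) = refl

 X̂-smul : ∀ k a -> X̂ (smul k a) ≃ smul k (X̂ a)
 X̂-smul k a j zero = sym (zeroʳ k)
 X̂-smul k a j (suc i) = refl

 V^-smul : ∀ n k a -> V^ n (smul k a) ≃ smul k (V^ n a)
 V^-smul zero k a j i = refl
 V^-smul (suc n) k a j i = trans (V̂-cong (V^-smul n k a) j i) (V̂-smul k (V^ n a) j i)

 V^-cong : ∀ n {a b} -> a ≃ b -> V^ n a ≃ V^ n b
 V^-cong zero e = e
 V^-cong (suc n) e = V̂-cong (V^-cong n e)

 X^-smul : ∀ n k a -> X^ n (smul k a) ≃ smul k (X^ n a)
 X^-smul zero k a j i = refl
 X^-smul (suc n) k a j i = trans (X̂-cong {X^ n (smul k a)} {smul k (X^ n a)} (X^-smul n k a) j i) (X̂-smul k (X^ n a) j i)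

 -- Weights: x has weight s and v has weight s + 1.
 wt : ℕ -> ℕ -> ℕ
 wt j i = s N.* i N.+ suc s N.* j

 -- Modulo s the weight equals j, because s + 1 is 1 modulo s. Distinct basis monomials thus have
 -- distinct weights, and a leading monomial is determined by its weight.
 wt-inj : ∀ {j i j' i'} -> j N.< s -> j' N.< s -> wt j i ≡ wt j' i' -> j ≡ j' × i ≡ i'
 wt-inj {j} {i} {j'} {i'} j< j'< e = j≡ , *-cancelˡ-≡ i i' s (+-cancelʳ-≡ (suc s N.* j) (s N.* i) (s N.* i') (trans e (cong (\ t -> s N.* i' N.+ suc s N.* t) (sym j≡))))
  where
  form : ∀ s i j -> s N.* i N.+ suc s N.* j ≡ j N.+ (i N.+ j) N.* s
  form = solve-∀
  md : ∀ {j} i -> j N.< s -> wt j i DM.% s ≡ j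
  md {j} i j< = trans (cong (DM._% s) (form s i j)) (trans (DM.[m+kn]%n≡m%n j (i N.+ j) s) (DM.m<n⇒m%n≡m j<))
  j≡ : j ≡ j'
  j≡ = trans (sym (md i j<)) (trans (cong (DM._% s) e) (md i' j'<))

 Bd : ℕ -> E -> Set
 Bd N a = ∀ j i -> j N.< s -> N N.≤ wt j i -> coef (a j) i ≡ 0#

 -- Here n behaves like the pole order at the single point at infinity.
 Lead : ℕ -> E -> Set
 Lead n a = Bd (suc n) a × ∃₂ \ j i -> j N.< s × wt j i ≡ n × ¬ coef (a j) i ≡ 0#

 Bd-mono : ∀ {N M a} -> N N.≤ M -> Bd N a -> Bd M a
 Bd-mono le b j i j< h = b j i j< (≤∙ le h)

 Zero⇒Bd : ∀ {N a} -> Zero a -> Bd N a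
 Zero⇒Bd z j i j< _ = z j i j<

 Bd-∔ : ∀ {N a b} -> Bd N a -> Bd N b -> Bd N (a ∔ b)
 Bd-∔ {N} {a} {b} p r j i j< h = trans (coef-∔ a b j i) (trans (cong₂ _+_ (p j i j< h) (r j i j< h)) (+-identityʳ 0#))

 Bd-smul : ∀ {N} k {a} -> Bd N a -> Bd N (smul k a)
 Bd-smul k {a} p j i j< h = trans (coef-smul k a j i) (trans (cong (k *_) (p j i j< h)) (zeroʳ k))

 Bd-sum : ∀ {N} n f -> (∀ t -> t N.< n -> Bd N (f t)) -> Bd N (sumE n f)
 Bd-sum zero f h j i _ _ = refl
 Bd-sum (suc n) f h = Bd-∔ {a = sumE n f} {f n} (Bd-sum n f (\ t t< -> h t (m<n⇒m<1+n t<))) (h n (n<1+n n))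

 Bd-X : ∀ {N a} -> Bd N a -> Bd (s N.+ N) (X̂ a)
 Bd-X p j zero j< h = refl
 Bd-X {N} p j (suc i) j< h = p j i j< (+-cancelˡ-≤ s N (wt j i) (≤∙ h (≡⇒≤ (eq s i j))))
  where
  eq : ∀ s i j -> s N.* suc i N.+ suc s N.* j ≡ s N.+ (s N.* i N.+ suc s N.* j)
  eq = solve-∀

 Zero-X : ∀ {a} -> Zero a -> Zero (X̂ a)
 Zero-X z j zero j< = refl
 Zero-X z j (suc i) j< = z j i j<

 Zero-V : ∀ {a} -> Zero a -> Zero (V̂ a)
 Zero-V {a} z j i j< = trans (coef-V̂ a j i) (trans (cong₂ _+_ (p j j<) (conv-vanish (coef (a s0)) (coef (ρ j)) i (\ i' k _ -> inj₁ (z s0 i' (n<1+n s0))))) (+-identityʳ 0#))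
  where
  p : ∀ j -> j N.< s -> prev a j i ≡ 0#
  p zero _ = refl
  p (suc j) j< = z j i (<-trans (n<1+n j) j<)

 Zero-X^ : ∀ n {a} -> Zero a -> Zero (X^ n a)
 Zero-X^ zero z = z
 Zero-X^ (suc n) {a} z = Zero-X {X^ n a} (Zero-X^ n {a} z)

 Zero-V^ : ∀ n {a} -> Zero a -> Zero (V^ n a)
 Zero-V^ zero z = z
 Zero-V^ (suc n) {a} z = Zero-V {V^ n a} (Zero-V^ n {a} z)

 Bd-X^ : ∀ n {N a} -> Bd N a -> Bd (n N.* s N.+ N) (X^ n a)
 Bd-X^ zero p = p
 Bd-X^ (suc n) {N} {a} p = Bd-mono {a = X^ (suc n) a} (≡⇒≤ (sym (NP.+-assoc s (n N.* s) N))) (Bd-X {a = X^ n a} (Bd-X^ n {N} {a} p))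

 Lead-X : ∀ {n a} -> Lead n a -> Lead (s N.+ n) (X̂ a)
 Lead-X {n} {a} (b , j , i , j< , e , ne) = Bd-mono {a = X̂ a} (≡⇒≤ (+-suc s n)) (Bd-X {a = a} b) , j , suc i , j< , trans (eq s i j) (cong (s N.+_) e) , ne
  where
  eq : ∀ s i j -> s N.* suc i N.+ suc s N.* j ≡ s N.+ (s N.* i N.+ suc s N.* j)
  eq = solve-∀

 Lead-X^ : ∀ k {n a} -> Lead n a -> Lead (k N.* s N.+ n) (X^ k a)
 Lead-X^ zero l = l
 Lead-X^ (suc k) {n} {a} l = subst (\ t -> Lead t (X^ (suc k) a)) (sym (NP.+-assoc s (k N.* s) n)) (Lead-X {a = X^ k a} (Lead-X^ k {n} {a} l))

 -- The relation v^s = Σ_j ρ_j(x) v^j has a single monomial κ x^{s+1} of top weight s(s+1) on the right.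
 module Relation (ρ-Bd : Bd (suc (s N.* suc s)) ρ) (κ≢0 : ¬ coef (ρ 0) (suc s) ≡ 0#) where

  private
   vv : ∀ s i' i″ j -> s N.* (i' N.+ i″) N.+ suc s N.* j N.+ (suc s) N.* s ≡ (s N.* i' N.+ suc s N.* s) N.+ (s N.* i″ N.+ suc s N.* j)
   vv = solve-∀

   top-shift : ∀ s0 i -> suc s0 N.* i N.+ suc (suc s0) N.* s0 N.+ suc (suc s0) ≡ suc s0 N.* i N.+ suc (suc s0) N.* suc s0
   top-shift = solve-∀

     -- a term a_{s0,i'} ρ_{j,i″} can only be nonzero in weight ≤ (wt s0 i') + (s+1)
   split : ∀ {N} i i' i″ j -> i' N.+ i″ ≡ i -> suc s N.+ N N.≤ wt j i -> N N.≤ wt s0 i' ⊎ (suc (wt s0 i') N.≤ N × suc (s N.* suc s) N.≤ wt j i″)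
   split {N} .(i' N.+ i″) i' i″ j refl h with N N.≤? wt s0 i'
   ... | yes p = inj₁ p
   ... | no ¬p = inj₂ (≰⇒> ¬p , ≰⇒> (\ small -> <⇒≱ (≰⇒> ¬p) (+-cancelˡ-≤ (suc s) N (wt s0 i')
     (+-cancelʳ-≤ (suc s N.* s) (suc s N.+ N) (suc s N.+ wt s0 i') (≤∙ (+-monoˡ-≤ (suc s N.* s) h)
      (≤∙ (≡⇒≤ (vv s i' i″ j)) (≤∙ (+-mono-≤ (≡⇒≤ (trans (sym (top-shift s0 i')) (NP.+-comm (wt s0 i') (suc s)))) small)
        (≡⇒≤ (cong (suc s N.+ wt s0 i' N.+_) (NP.*-comm s (suc s)))))))))))

  Bd-V : ∀ {N a} -> Bd N a -> Bd (suc s N.+ N) (V̂ a)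
  Bd-V {N} {a} p j i j< h = trans (coef-V̂ a j i) (trans (cong₂ _+_ (pr j j< h) (conv-vanish (coef (a s0)) (coef (ρ j)) i term)) (+-identityʳ 0#))
   where
   pr : ∀ j -> j N.< s -> suc s N.+ N N.≤ wt j i -> prev a j i ≡ 0#
   pr zero _ _ = refl
   pr (suc j) j< h = p j i (<-trans (n<1+n j) j<) (+-cancelˡ-≤ (suc s) N (wt j i) (≤∙ h (≡⇒≤ (eq s i j))))
    where
    eq : ∀ s i j -> s N.* i N.+ suc s N.* suc j ≡ suc s N.+ (s N.* i N.+ suc s N.* j)
    eq = solve-∀
   term : ∀ i' k -> i' N.+ k ≡ i -> coef (a s0) i' ≡ 0# ⊎ coef (ρ j) k ≡ 0#
   term i' k e with split i i' k j e h
   ... | inj₁ b = inj₁ (p s0 i' (n<1+n s0) b)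
   ... | inj₂ (_ , b) = inj₂ (ρ-Bd j k j< b)

  -- If the leading monomial has j + 1 < s, it simply moves to the next row. If it lies in the last
  -- row, v^s is replaced by the relation and the monomial κ x^(s+1) takes over, with the same
  -- weight and a nonzero coefficient. No other contribution reaches that monomial.
  Lead-V : ∀ {n a} -> Lead n a -> Lead (suc s N.+ n) (V̂ a)
  Lead-V {n} {a} (b , j , i , j< , e , ne) = Bd-mono {a = V̂ a} (≡⇒≤ (+-suc (suc s) n)) (Bd-V {a = a} b) , pos
   where
   pos : ∃₂ \ j i -> j N.< s × wt j i ≡ suc s N.+ n × ¬ coef (V̂ a j) i ≡ 0#
   pos with suc j N.<? s
   ... | yes j<' = suc j , i , j<' , trans (eq s i j) (cong (suc s N.+_) e) , \ z -> ne (trans (sym (trans (cong (coef (a j) i +_) (conv-vanish (coef (a s0)) (coef (ρ (suc j))) i term)) (+-identityʳ _))) (trans (sym (coef-V̂ a (suc j) i)) z))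
    where
    eq : ∀ s i j -> s N.* i N.+ suc s N.* suc j ≡ suc s N.+ (s N.* i N.+ suc s N.* j)
    eq = solve-∀
    term : ∀ i' k -> i' N.+ k ≡ i -> coef (a s0) i' ≡ 0# ⊎ coef (ρ (suc j)) k ≡ 0#
    term i' k e' with split {n} i i' k (suc j) e' (≡⇒≤ (sym (trans (eq s i j) (cong (suc s N.+_) e))))
    ... | inj₂ (_ , big) = inj₂ (ρ-Bd (suc j) k j<' big)
    ... | inj₁ big with suc n N.≤? wt s0 i'
    ... | yes big' = inj₁ (b s0 i' (n<1+n s0) big')
    ... | no _ with suc (s N.* suc s) N.≤? wt (suc j) k
    ... | yes big″ = inj₂ (ρ-Bd (suc j) k j<' big″)
    ... | no small with s N.* suc s N.≟ wt (suc j) k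
    ... | yes same = ⊥-elim (absurd (proj₁ (wt-inj {suc j} {k} {0} {suc s} j<' (s≤s z≤n) (trans (sym same) (zz s)))))
     where
     absurd : ¬ suc j ≡ 0
     absurd ()
     zz : ∀ s -> s N.* suc s ≡ s N.* suc s N.+ suc s N.* 0
     zz = solve-∀
    ... | no diff = inj₁ (b s0 i' (n<1+n s0) contra)
     where
     lt : wt (suc j) k N.< s N.* suc s
     lt = ≤∧≢⇒< (≤-pred (≰⇒> small)) (\ z -> diff (sym z))
     tot : suc s N.+ n N.+ suc s N.* s ≡ (suc s N.+ wt s0 i') N.+ wt (suc j) k
     tot = trans (cong (N._+ suc s N.* s) (sym (trans (eq s i j) (cong (suc s N.+_) e)))) (trans (cong (\ t -> s N.* t N.+ suc s N.* suc j N.+ suc s N.* s) (sym e'))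
       (trans (vv s i' k (suc j)) (cong (N._+ wt (suc j) k) (trans (sym (top-shift s0 i')) (NP.+-comm (wt s0 i') (suc s))))))
     contra : suc n N.≤ wt s0 i'
     contra = ≰⇒> (\ le -> <-irrefl (sym tot) (<-≤-trans (+-monoʳ-< (suc s N.+ wt s0 i') lt) (≤∙ (+-monoˡ-≤ (s N.* suc s) (+-monoʳ-≤ (suc s) le)) (≡⇒≤ (cong (suc s N.+ n N.+_) (NP.*-comm s (suc s)))))))
   ... | no ¬j<' with ≤-antisym (≤-pred j<) (≤-pred (≮⇒≥ ¬j<'))
   ... | refl = 0 , i N.+ suc s , s≤s z≤n , trans (eq s0 i) (cong (suc s N.+_) e) , \ z -> *-≢0 ne κ≢0 (trans (sym topc) (trans (sym (trans (coef-V̂ a 0 _) (+-identityˡ _))) z))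
    where
    eq : ∀ s0 i -> suc s0 N.* (i N.+ suc (suc s0)) N.+ suc (suc s0) N.* 0 ≡ suc (suc s0) N.+ (suc s0 N.* i N.+ suc (suc s0) N.* s0)
    eq = solve-∀
    topc : (coef (a s0) *ˢ coef (ρ 0)) (i N.+ suc s) ≡ coef (a s0) i * coef (ρ 0) (suc s)
    topc = conv-top (coef (a s0)) (coef (ρ 0)) i (suc s) term
     where
     term : ∀ i' k -> i' N.+ k ≡ i N.+ suc s -> ¬ i' ≡ i -> coef (a s0) i' ≡ 0# ⊎ coef (ρ 0) k ≡ 0#
     term i' k e' ne' with <-cmp i' i
     ... | tri< lt _ _ = inj₂ (ρ-Bd 0 k (s≤s z≤n) (≤∙ (<-≤-trans (n<1+n _) (+-monoˡ-≤ (s N.* suc s) (s≤s z≤n))) (≤∙ (≡⇒≤ (sym (*-suc s (suc s)))) (≤∙ (*-monoʳ-≤ s k>) (m≤m+n (s N.* k) _)))))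
      where
      k> : suc (suc s) N.≤ k
      k> = ≰⇒> (\ le -> <-irrefl e' (+-mono-<-≤ lt le))
     ... | tri≈ _ z _ = ⊥-elim (ne' z)
     ... | tri> _ _ gt = inj₁ (b s0 i' (n<1+n s0) (subst (N._< wt s0 i') e (+-monoˡ-< (suc s N.* s0) (*-monoʳ-< s gt))))

  Bd-V^ : ∀ n {N a} -> Bd N a -> Bd (n N.* suc s N.+ N) (V^ n a)
  Bd-V^ zero p = p
  Bd-V^ (suc n) {N} {a} p = Bd-mono {a = V^ (suc n) a} (≡⇒≤ (sym (NP.+-assoc (suc s) (n N.* suc s) N))) (Bd-V {a = V^ n a} (Bd-V^ n {N} {a} p))

  Lead-V^ : ∀ k {n a} -> Lead n a -> Lead (k N.* suc s N.+ n) (V^ k a)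
  Lead-V^ zero l = l
  Lead-V^ (suc k) {n} {a} l = subst (\ t -> Lead t (V^ (suc k) a)) (sym (NP.+-assoc (suc s) (k N.* suc s) n)) (Lead-V {a = V^ k a} (Lead-V^ k {n} {a} l))

-- Products and additivity of leading weights.

module RowsProd (𝔽 : FiniteField) (s0 : ℕ) (ρ : ℕ -> List (FiniteField.F 𝔽))
  (ρ-Bd : Rows.Bd 𝔽 s0 ρ (suc (suc s0 N.* suc (suc s0))) ρ)
  (κ≢0 : ¬ PolyEval.coef 𝔽 (ρ 0) (suc (suc s0)) ≡ FiniteField.0# 𝔽) where
 open ≡
 open Fld 𝔽
 open Ser 𝔽
 open Poly 𝔽
 open Rows 𝔽 s0 ρ public
 open Relation ρ-Bd κ≢0 public

 Lead-∔ˡ : ∀ {n a b} -> Lead n a -> Bd n b -> Lead n (a ∔ b)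
 Lead-∔ˡ {n} {a} {b} (p , j , i , j< , e , ne) r = Bd-∔ {a = a} {b} p (Bd-mono {a = b} (n≤1+n n) r) , j , i , j< , e ,
  \ z -> ne (trans (sym (trans (coef-∔ a b j i) (trans (cong (coef (a j) i +_) (r j i j< (≡⇒≤ (sym e)))) (+-identityʳ _)))) z)

 Lead-∔ʳ : ∀ {n a b} -> Bd n a -> Lead n b -> Lead n (a ∔ b)
 Lead-∔ʳ {n} {a} {b} r (p , j , i , j< , e , ne) = Bd-∔ {a = a} {b} (Bd-mono {a = a} (n≤1+n n) r) p , j , i , j< , e ,
  \ z -> ne (trans (sym (trans (coef-∔ a b j i) (trans (cong (_+ coef (b j) i) (r j i j< (≡⇒≤ (sym e)))) (+-identityˡ _)))) z)

 Lead-sum : ∀ {L} n f t₀ -> t₀ N.< n -> Lead L (f t₀) -> (∀ t -> t N.< n -> ¬ t ≡ t₀ -> Bd L (f t)) -> Lead L (sumE n f)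
 Lead-sum (suc n) f t₀ t0< l h with t₀ N.≟ n
 ... | yes refl = Lead-∔ʳ {a = sumE n f} {f n} (Bd-sum n f (\ t t< -> h t (m<n⇒m<1+n t<) (<⇒≢ t<))) l
 ... | no ne = Lead-∔ˡ {a = sumE n f} {f n} (Lead-sum n f t₀ (≤∧≢⇒< (≤-pred t0<) ne) l (\ t t< -> h t (m<n⇒m<1+n t<))) (h n (n<1+n n) (\ e -> ne (sym e)))

 gterm : ℕ -> (ℕ -> ℕ -> E) -> ℕ -> ℕ -> E
 gterm k A j i = V^ (k N.* j) (X^ (k N.* i) (A j i))

 -- The sum of v^(k j) x^(k i) A_{j,i}. With k = 1 and scalar multiples of one element it is
 -- multiplication; with k = q it is Stepanov's auxiliary function.
 gsum : ℕ -> ℕ -> (ℕ -> ℕ -> E) -> E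
 gsum k I A = sumE s (\ j -> sumE I (gterm k A j))

 private
  weight-eq : ∀ k j i s N -> (k N.* j) N.* suc s N.+ ((k N.* i) N.* s N.+ N) ≡ N N.+ k N.* (s N.* i N.+ suc s N.* j)
  weight-eq = solve-∀

 Small : ℕ -> ℕ -> (ℕ -> ℕ -> E) -> ℕ -> ℕ -> Set
 Small L k A j i = Zero (A j i) ⊎ ∃ \ N -> Bd N (A j i) × N N.+ k N.* wt j i N.≤ L

 Bd-gterm : ∀ {L} k A j i -> Small L k A j i -> Bd L (gterm k A j i)
 Bd-gterm k A j i (inj₁ z) = Zero⇒Bd {a = gterm k A j i} (Zero-V^ (k N.* j) {X^ (k N.* i) (A j i)} (Zero-X^ (k N.* i) {A j i} z))
 Bd-gterm k A j i (inj₂ (N , b , le)) = Bd-mono {a = gterm k A j i} (≤∙ (≡⇒≤ (weight-eq k j i s N)) le)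
  (Bd-V^ (k N.* j) {a = X^ (k N.* i) (A j i)} (Bd-X^ (k N.* i) {a = A j i} b))

 Bd-gsum : ∀ {L} k I A -> (∀ j i -> j N.< s -> i N.< I -> Small L k A j i) -> Bd L (gsum k I A)
 Bd-gsum k I A h = Bd-sum s _ (\ j j< -> Bd-sum I _ (\ i i< -> Bd-gterm k A j i (h j i j< i<)))

 Lead-gsum : ∀ k I A j0 i0 ℓ -> j0 N.< s -> i0 N.< I -> Lead ℓ (A j0 i0) ->
  (∀ j i -> j N.< s -> i N.< I -> ¬ (j ≡ j0 × i ≡ i0) -> Small (ℓ N.+ k N.* wt j0 i0) k A j i) ->
  Lead (ℓ N.+ k N.* wt j0 i0) (gsum k I A)
 Lead-gsum k I A j0 i0 ℓ j0< i0< l h = Lead-sum s _ j0 j0<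
   (Lead-sum I _ i0 i0< (subst (\ t -> Lead t (gterm k A j0 i0)) (weight-eq k j0 i0 s ℓ) (Lead-V^ (k N.* j0) {a = X^ (k N.* i0) (A j0 i0)} (Lead-X^ (k N.* i0) {a = A j0 i0} l)))
    (\ i i< ne -> Bd-gterm k A j0 i (h j0 i j0< i< (\ z -> ne (proj₂ z)))))
   (\ j j< ne -> Bd-sum I _ (\ i i< -> Bd-gterm k A j i (h j i j< i< (\ z -> ne (proj₁ z)))))

 sumℕ : ℕ -> (ℕ -> ℕ) -> ℕ
 sumℕ zero f = 0
 sumℕ (suc n) f = sumℕ n f N.+ f n

 sumℕ-≥ : ∀ n f t -> t N.< n -> f t N.≤ sumℕ n f
 sumℕ-≥ (suc n) f t t< with t N.≟ n
 ... | yes refl = m≤n+m (f n) (sumℕ n f)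
 ... | no ne = ≤∙ (sumℕ-≥ n f t (≤∧≢⇒< (≤-pred t<) ne)) (m≤m+n _ (f n))

 len : E -> ℕ
 len b = sumℕ s (\ j -> length (b j))

 coef-≥len : ∀ b j i -> j N.< s -> len b N.≤ i -> coef (b j) i ≡ 0#
 coef-≥len b j i j< h = coef-≥length (b j) i (≤∙ (sumℕ-≥ s (\ j -> length (b j)) j j<) h)

 infixl 7 _⋆_
 _⋆_ : E -> E -> E
 a ⋆ b = gsum 1 (len b) (\ j i -> smul (coef (b j) i) a)

 Bd-⋆ : ∀ {N M a b} -> Bd (suc N) a -> Bd (suc M) b -> Bd (suc (N N.+ M)) (a ⋆ b)
 Bd-⋆ {N} {M} {a} {b} p r = Bd-gsum 1 (len b) _ small
  where
  small : ∀ j i -> j N.< s -> i N.< len b -> Small (suc (N N.+ M)) 1 (\ j i -> smul (coef (b j) i) a) j i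
  small j i j< i< with suc M N.≤? wt j i
  ... | yes big = inj₁ (\ j' i' j'< -> trans (coef-smul _ a j' i') (trans (cong (_* coef (a j') i') (r j i j< big)) (zeroˡ _)))
  ... | no ¬big = inj₂ (suc N , Bd-smul (coef (b j) i) {a} p , s≤s (+-monoʳ-≤ N (≤∙ (≡⇒≤ (NP.*-identityˡ _)) (≤-pred (≰⇒> ¬big)))))

 Lead-smul : ∀ {n} k {a} -> ¬ k ≡ 0# -> Lead n a -> Lead n (smul k a)
 Lead-smul k {a} nk (p , j , i , j< , e , ne) = Bd-smul k {a} p , j , i , j< , e , \ z -> *-≢0 nk ne (trans (sym (coef-smul k a j i)) z)

 -- Only the leading monomial of b contributes in weight n + m, since the others have different,
 -- hence smaller, weights. In particular a product of elements with leading weights is nonzero.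
 Lead-⋆ : ∀ {n m a b} -> Lead n a -> Lead m b -> Lead (n N.+ m) (a ⋆ b)
 Lead-⋆ {n} {m} {a} {b} l@(p , _) (r , j0 , i0 , j0< , e , ne) =
  subst (\ t -> Lead t (a ⋆ b)) (cong (n N.+_) (trans (NP.*-identityˡ _) e))
   (Lead-gsum 1 (len b) (\ j i -> smul (coef (b j) i) a) j0 i0 n j0< i0< (Lead-smul (coef (b j0) i0) {a} ne l) small)
  where
  i0< : i0 N.< len b
  i0< = ≰⇒> (\ h -> ne (coef-≥len b j0 i0 j0< h))
  small : ∀ j i -> j N.< s -> i N.< len b -> ¬ (j ≡ j0 × i ≡ i0) -> Small (n N.+ 1 N.* wt j0 i0) 1 (\ j i -> smul (coef (b j) i) a) j i
  small j i j< i< ne' with m N.≤? wt j i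
  ... | no ¬big = inj₂ (suc n , Bd-smul (coef (b j) i) {a} p , ≤∙ (≡⇒≤ (sym (+-suc n _))) (+-monoʳ-≤ n
     (≤∙ (s≤s (≡⇒≤ (NP.*-identityˡ _))) (≤∙ (≰⇒> ¬big) (≡⇒≤ (sym (trans (NP.*-identityˡ _) e)))))))
  ... | yes big with m N.≟ wt j i
  ... | yes same = ⊥-elim (ne' (wt-inj {j} {i} {j0} {i0} j< j0< (trans (sym same) (sym e))))
  ... | no diff = inj₁ (\ j' i' j'< -> trans (coef-smul _ a j' i') (trans (cong (_* coef (a j') i') (r j i j< (≤∧≢⇒< big diff))) (zeroˡ _)))

 has-bound : ∀ a -> ∃ \ B -> Bd B a
 has-bound a = s N.* len a N.+ suc s N.* s , \ j i j< h -> coef-≥len a j i j< (≮⇒≥ (\ lt ->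
   <⇒≱ (+-mono-<-≤ (*-monoʳ-< s lt) (*-monoʳ-≤ (suc s) (<⇒≤ j<))) h))

 zero-or-lead : ∀ N a -> Bd N a -> Zero a ⊎ ∃ \ n -> Lead n a
 zero-or-lead zero a b = inj₁ (\ j i j< -> b j i j< z≤n)
 zero-or-lead (suc N) a b with Finₚ.any? {n = s} (\ j -> Finₚ.any? {n = suc N} (\ i -> (wt (toℕ j) (toℕ i) N.≟ N) ×-dec ¬? (coef (a (toℕ j)) (toℕ i) ≟ 0#)))
 ... | yes (j , i , e , ne) = inj₂ (N , b , toℕ j , toℕ i , Finₚ.toℕ<n j , e , ne)
 ... | no none = zero-or-lead N a lower
  where
  lower : Bd N a
  lower j i j< h with N N.≟ wt j i
  ... | no ne = b j i j< (≤∧≢⇒< h ne)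
  ... | yes e with coef (a j) i ≟ 0#
  ... | yes z = z
  ... | no nz = ⊥-elim (none (fromℕ< j< , fromℕ< i< , trans (cong₂ wt (Finₚ.toℕ-fromℕ< j<) (Finₚ.toℕ-fromℕ< i<)) (sym e) ,
     \ z -> nz (trans (sym (cong₂ (\ t u -> coef (a t) u) (Finₚ.toℕ-fromℕ< j<) (Finₚ.toℕ-fromℕ< i<))) z)))
   where
   i< : i N.< suc N
   i< = s≤s (≤∙ (m≤n*m i s) (≤∙ (m≤m+n _ _) (≡⇒≤ (sym e))))

 Lead-nonzero : ∀ {n a} -> Lead n a -> ¬ Zero a
 Lead-nonzero (_ , j , i , j< , _ , ne) z = ne (z j i j<)

-- Evaluation of coordinate ring elements at points.

module RowsEval (𝔽 : FiniteField) (s0 : ℕ) (ρ : ℕ -> List (FiniteField.F 𝔽))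
  (ρ-Bd : Rows.Bd 𝔽 s0 ρ (suc (suc s0 N.* suc (suc s0))) ρ)
  (κ≢0 : ¬ PolyEval.coef 𝔽 (ρ 0) (suc (suc s0)) ≡ FiniteField.0# 𝔽)
  (A : PolyEval.FAlgebra 𝔽) where
 open RingZ
 private module K = Fld 𝔽
 open K using (F)
 open PolyEval 𝔽
 open Eval A
 open RowsProd 𝔽 s0 ρ ρ-Bd κ≢0
 open FAlgebra A renaming (Carrier to C; zero to zero-*)
 open IntegerCoefficients alg using (solve; _:=_; _:+_; _:*_; _:-_; :-_; con)
 open import Relation.Binary.Reasoning.Setoid setoid

 open PolySum 𝔽 A public

 open CEval alg using (cev)

 -- v^n - Σ_{j<n} ρ_{k+j}(x) v^j as a list of coefficients of powers of v
 hlist : ℕ -> ℕ -> List Pol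
 hlist zero k = (K.1# ∷ []) ∷ []
 hlist (suc n) k = scale (K.- K.1#) (ρ k) ∷ hlist n (suc k)

 cev-hlist : ∀ n k x v -> cev (Data.List.map (\ r -> hev r x) (hlist n k)) v ≈ pow v n - ∑ n (\ j -> hev (ρ (k N.+ j)) x * pow v j)
 cev-hlist zero k x v = trans (+-cong (+-cong ι-1 (zeroʳ x)) (zeroʳ v)) (solve 1 (\ o -> (o :+ con (ℤ.+ 0)) :+ con (ℤ.+ 0) := o :- con (ℤ.+ 0)) refl 1#)
 cev-hlist (suc n) k x v = begin
  hev (scale (K.- K.1#) (ρ k)) x + v * cev (Data.List.map (\ r -> hev r x) (hlist n (suc k))) v
   ≈⟨ +-cong (trans (hev-scale _ (ρ k) x) (*-congʳ (trans (ι-neg K.1#) (-‿cong ι-1)))) (*-congˡ (cev-hlist n (suc k) x v)) ⟩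
  - 1# * hev (ρ k) x + v * (pow v n - ∑ n (\ j -> hev (ρ (suc k N.+ j)) x * pow v j))
   ≈⟨ +-congˡ (*-congˡ (+-congˡ (-‿cong (∑-cong n (\ j _ -> *-congʳ (reflexive (≡.cong (\ t -> hev (ρ t) x) (≡.sym (+-suc k j))))))))) ⟩
  - 1# * hev (ρ k) x + v * (pow v n - ∑ n (\ j -> hev (ρ (k N.+ suc j)) x * pow v j))
   ≈⟨ solve 5 (\ o r v p m -> (:- o) :* r :+ v :* (p :- m) := v :* p :- (r :* o :+ v :* m)) refl 1# (hev (ρ k) x) v (pow v n) _ ⟩
  v * pow v n - (hev (ρ k) x * 1# + v * ∑ n (\ j -> hev (ρ (k N.+ suc j)) x * pow v j))
   ≈⟨ +-congˡ (-‿cong (sym (trans (∑-head n _) (+-cong (*-congʳ (reflexive (≡.cong (\ t -> hev (ρ t) x) (NP.+-identityʳ k))))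
      (trans (∑-cong n (\ j _ -> solve 3 (\ a v p -> a :* (v :* p) := v :* (a :* p)) refl (hev (ρ (k N.+ suc j)) x) v (pow v j))) (∑-*ˡ n v _)))))) ⟩
  pow v (suc n) - ∑ (suc n) (\ j -> hev (ρ (k N.+ j)) x * pow v j) ∎

 relation : ∀ x v -> cev (Data.List.map (\ r -> hev r x) (hlist s 0)) v ≈ 0# -> pow v s ≈ ∑ s (\ j -> hev (ρ j) x * pow v j)
 relation x v e = trans (solve 2 (\ a b -> a := (a :- b) :+ b) refl (pow v s) (∑ s (\ j -> hev (ρ j) x * pow v j))) (trans (+-congʳ (trans (sym (cev-hlist s 0 x v)) e)) (+-identityˡ _))

 module At (x v : C) (rel : pow v s ≈ ∑ s (\ j -> hev (ρ j) x * pow v j)) where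

  evE : E -> C
  evE a = ∑ s (\ j -> hev (a j) x * pow v j)

  evE-∔ : ∀ a b -> evE (a ∔ b) ≈ evE a + evE b
  evE-∔ a b = trans (∑-cong s (\ j _ -> trans (*-congʳ (hev-⊞ (a j) (b j) x)) (distribʳ _ _ _))) (∑-+ s _ _)

  evE-smul : ∀ k a -> evE (smul k a) ≈ ι k * evE a
  evE-smul k a = trans (∑-cong s (\ j _ -> trans (*-congʳ (hev-scale k (a j) x)) (*-assoc _ _ _))) (∑-*ˡ s _ _)

  evE-Zero : ∀ a -> Zero a -> evE a ≈ 0#
  evE-Zero a z = ∑-zero s _ (\ j j< -> trans (*-congʳ (hev-zero (a j) x (\ i -> z j i j<))) (zeroˡ _))

  evE-X̂ : ∀ a -> evE (X̂ a) ≈ x * evE a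
  evE-X̂ a = trans (∑-cong s (\ j _ -> trans (*-congʳ (hev-shift (a j) x)) (*-assoc _ _ _))) (∑-*ˡ s _ _)

  evE-V̂ : ∀ a -> evE (V̂ a) ≈ v * evE a
  evE-V̂ a = begin
   ∑ s (\ j -> hev (V̂ a j) x * pow v j) ≈⟨ ∑-cong s (\ j _ -> step j) ⟩
   ∑ s (\ j -> pr j * pow v j + t * (hev (ρ j) x * pow v j)) ≈⟨ ∑-+ s _ _ ⟩
   ∑ s (\ j -> pr j * pow v j) + ∑ s (\ j -> t * (hev (ρ j) x * pow v j)) ≈⟨ +-cong left (trans (∑-*ˡ s t _) (*-congˡ (sym rel))) ⟩
   v * ∑ s0 (\ j -> hev (a j) x * pow v j) + t * pow v s ≈⟨ solve 4 (\ v m t p -> v :* m :+ t :* (v :* p) := v :* (m :+ t :* p)) refl v _ t (pow v s0) ⟩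
   v * (∑ s0 (\ j -> hev (a j) x * pow v j) + t * pow v s0) ∎
   where
   t : C
   t = hev (a s0) x
   pr : ℕ -> C
   pr zero = 0#
   pr (suc j) = hev (a j) x
   step : ∀ j -> hev (V̂ a j) x * pow v j ≈ pr j * pow v j + t * (hev (ρ j) x * pow v j)
   step zero = trans (*-congʳ (hev-⊠ (a s0) (ρ 0) x)) (trans (*-assoc _ _ _) (sym (trans (+-congʳ (zeroˡ _)) (+-identityˡ _))))
   step (suc j) = trans (*-congʳ (trans (hev-⊞ (a j) _ x) (+-congˡ (hev-⊠ (a s0) (ρ (suc j)) x))))
    (solve 4 (\ a t r p -> (a :+ t :* r) :* p := a :* p :+ t :* (r :* p)) refl (hev (a j) x) t (hev (ρ (suc j)) x) (pow v (suc j)))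
   left : ∑ s (\ j -> pr j * pow v j) ≈ v * ∑ s0 (\ j -> hev (a j) x * pow v j)
   left = trans (∑-head s0 _) (trans (+-cong (zeroˡ _) (trans (∑-cong s0 (\ j _ -> solve 3 (\ a v p -> a :* (v :* p) := v :* (a :* p)) refl (hev (a j) x) v (pow v j))) (∑-*ˡ s0 v _))) (+-identityˡ _))

  evE-X^ : ∀ n a -> evE (X^ n a) ≈ pow x n * evE a
  evE-X^ zero a = sym (*-identityˡ _)
  evE-X^ (suc n) a = trans (evE-X̂ (X^ n a)) (trans (*-congˡ (evE-X^ n a)) (sym (*-assoc _ _ _)))

  evE-V^ : ∀ n a -> evE (V^ n a) ≈ pow v n * evE a
  evE-V^ zero a = sym (*-identityˡ _)
  evE-V^ (suc n) a = trans (evE-V̂ (V^ n a)) (trans (*-congˡ (evE-V^ n a)) (sym (*-assoc _ _ _)))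

  evE-sum : ∀ n f -> evE (sumE n f) ≈ ∑ n (\ t -> evE (f t))
  evE-sum zero f = evE-Zero zeroE (\ _ _ _ -> ≡.refl)
  evE-sum (suc n) f = trans (evE-∔ (sumE n f) (f n)) (+-congʳ (evE-sum n f))

  evE-gsum : ∀ k I B -> evE (gsum k I B) ≈ ∑ s (\ j -> ∑ I (\ i -> pow v (k N.* j) * (pow x (k N.* i) * evE (B j i))))
  evE-gsum k I B = trans (evE-sum s _) (∑-cong s (\ j _ -> trans (evE-sum I _) (∑-cong I (\ i _ ->
    trans (evE-V^ (k N.* j) (X^ (k N.* i) (B j i))) (*-congˡ (evE-X^ (k N.* i) (B j i)))))))

  evE-⋆ : ∀ a b -> evE (a ⋆ b) ≈ evE a * evE b
  evE-⋆ a b = begin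
   evE (a ⋆ b) ≈⟨ evE-gsum 1 (len b) _ ⟩
   ∑ s (\ j -> ∑ (len b) (\ i -> pow v (1 N.* j) * (pow x (1 N.* i) * evE (smul (coef (b j) i) a))))
    ≈⟨ ∑-cong s (\ j _ -> ∑-cong (len b) (\ i _ -> term j i)) ⟩
   ∑ s (\ j -> ∑ (len b) (\ i -> (evE a * pow v j) * (ι (coef (b j) i) * pow x i)))
    ≈⟨ ∑-cong s (\ j j< -> trans (∑-*ˡ (len b) _ _) (*-congˡ (hev-∑ (len b) (b j) x (sumℕ-≥ s (\ j -> length (b j)) j j<)))) ⟩
   ∑ s (\ j -> (evE a * pow v j) * hev (b j) x)
    ≈⟨ ∑-cong s (\ j _ -> solve 3 (\ a p h -> (a :* p) :* h := a :* (h :* p)) refl (evE a) (pow v j) (hev (b j) x)) ⟩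
   ∑ s (\ j -> evE a * (hev (b j) x * pow v j)) ≈⟨ ∑-*ˡ s (evE a) _ ⟩
   evE a * evE b ∎
   where
   term : ∀ j i -> pow v (1 N.* j) * (pow x (1 N.* i) * evE (smul (coef (b j) i) a)) ≈ (evE a * pow v j) * (ι (coef (b j) i) * pow x i)
   term j i = trans (*-cong (reflexive (≡.cong (pow v) (NP.*-identityˡ j))) (*-cong (reflexive (≡.cong (pow x) (NP.*-identityˡ i))) (evE-smul _ a)))
    (solve 4 (\ p r k e -> p :* (r :* (k :* e)) := (e :* p) :* (k :* r)) refl (pow v j) (pow x i) (ι (coef (b j) i)) (evE a))

  evE-one : evE oneE ≈ 1#
  evE-one = trans (∑-head s0 _) (trans (+-cong (trans (*-congʳ (trans (+-cong ι-1 (zeroʳ x)) (+-identityʳ _))) (*-identityˡ _)) (∑-zero s0 _ (\ t _ -> zeroˡ _))) (+-identityʳ _))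

  evE-neg : ∀ a -> evE (smul (K.- K.1#) a) ≈ - evE a
  evE-neg a = trans (evE-smul _ a) (trans (*-congʳ (trans (ι-neg K.1#) (-‿cong ι-1))) (trans (sym (-‿distribˡ-* _ _)) (-‿cong (*-identityˡ _))))
   where open import Algebra.Properties.Ring (CommutativeRing.ring alg)

  evE-ext : ∀ a b -> (∀ j i -> j N.< s -> coef (a j) i ≡ coef (b j) i) -> evE a ≈ evE b
  evE-ext a b e = trans (solve 2 (\ x y -> x := (x :- y) :+ y) refl (evE a) (evE b)) (trans (+-congʳ (trans (+-congˡ (sym (evE-neg b))) (trans (sym (evE-∔ a (smul (K.- K.1#) b))) (evE-Zero (a ∔ smul (K.- K.1#) b) z)))) (+-identityˡ _))
   where
   z : Zero (a ∔ smul (K.- K.1#) b)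
   z j i j< = ≡.trans (coef-∔ a (smul (K.- K.1#) b) j i) (≡.trans (≡.cong₂ K._+_ (e j i j<) (coef-smul (K.- K.1#) b j i))
    (≡.trans (≡.cong (\ t -> coef (b j) i K.+ t) (K.solve 2 (\ o x -> (K.:- o) K.:* x K.:= K.:- (o K.:* x)) ≡.refl K.1# (coef (b j) i))) (≡.trans (≡.cong (\ t -> coef (b j) i K.+ K.- t) (K.*-identityˡ _)) (K.-‿inverseʳ _))))

-- Taylor coefficients as polynomial functions of the point.

module Weights (𝔽 : FiniteField) (s0 : ℕ) (ρ : ℕ -> List (FiniteField.F 𝔽))
  (ρ-Bd : Rows.Bd 𝔽 s0 ρ (suc (suc s0 N.* suc (suc s0))) ρ)
  (κ≢0 : ¬ PolyEval.coef 𝔽 (ρ 0) (suc (suc s0)) ≡ FiniteField.0# 𝔽) where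
 open ≡
 open Fld 𝔽
 open Ser 𝔽
 open Poly 𝔽
 open CEval FR using () renaming (cev to cevF; cder to cderF)
 open CEval SR
 open RowsProd 𝔽 s0 ρ ρ-Bd κ≢0 public
 module RF = RowsEval 𝔽 s0 ρ ρ-Bd κ≢0 selfAlgebra
 module RS = RowsEval 𝔽 s0 ρ ρ-Bd κ≢0 seriesAlgebra
 open Expand 𝔽

 H : List Pol
 H = RF.hlist s 0

 record Pt : Set where
  field
   x0 vo : F
   on : cevF (map (\ r -> ev r x0) H) vo ≡ 0#
   smooth : ¬ cderF (map (\ r -> ev r x0) H) vo ≡ 0#

 module AtF (P : Pt) = RF.At (Pt.x0 P) (Pt.vo P) (RF.relation _ _ (Pt.on P))

 evP : E -> Pt -> F
 evP a P = AtF.evE P a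

 module Loc (P : Pt) = Local H (Pt.x0 P) (Pt.vo P)

 hlist≡ : ∀ n k -> RS.hlist n k ≡ RF.hlist n k
 hlist≡ zero k = refl
 hlist≡ (suc n) k = cong (_ ∷_) (hlist≡ n (suc k))

 module AtS (P : Pt) = RS.At (Loc.x̂ P) (Loc.v̂ P) (RS.relation (Loc.x̂ P) (Loc.v̂ P)
  (subst (\ L -> cev (map (\ r -> Es.hev r (Loc.x̂ P)) L) (Loc.v̂ P) ≈ const 0#) (sym (hlist≡ s 0)) (Loc.on-curve P (Pt.on P))))

 evS : E -> Pt -> Ser
 evS a P = AtS.evE P a

 -- V N f: the function f on points is given by a polynomial of weight at most N.
 V : ℕ -> (Pt -> F) -> Set
 V N f = ∃ \ a -> Bd (suc N) a × (∀ P -> f P ≡ evP a P)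

 V-mono : ∀ {N M f} -> N N.≤ M -> V N f -> V M f
 V-mono le (a , b , e) = a , Bd-mono {a = a} (s≤s le) b , e

 V-ext : ∀ {N f g} -> (∀ P -> g P ≡ f P) -> V N f -> V N g
 V-ext h (a , b , e) = a , b , \ P -> trans (h P) (e P)

 V-0 : ∀ {N} -> V N (\ _ -> 0#)
 V-0 = zeroE , (\ _ _ _ _ -> refl) , \ P -> sym (AtF.evE-Zero P zeroE (\ _ _ _ -> refl))

 V-+ : ∀ {N f g} -> V N f -> V N g -> V N (\ P -> f P + g P)
 V-+ (a , b , e) (a' , b' , e') = a ∔ a' , Bd-∔ {a = a} {a'} b b' , \ P -> trans (cong₂ _+_ (e P) (e' P)) (sym (AtF.evE-∔ P a a'))

 V-scale : ∀ {N f} k -> V N f -> V N (\ P -> k * f P)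
 V-scale k (a , b , e) = smul k a , Bd-smul k {a} b , \ P -> trans (cong (k *_) (e P)) (sym (AtF.evE-smul P k a))

 V-neg : ∀ {N f} -> V N f -> V N (\ P -> - f P)
 V-neg {f = f} w = V-ext (\ P -> solve 2 (\ o x -> :- x := (:- con (ℤ.+ 1)) :* x) refl 1# (f P)) (V-scale (intR ℤ.-[1+ 0 ]) w)

 V-* : ∀ {N M f g} -> V N f -> V M g -> V (N N.+ M) (\ P -> f P * g P)
 V-* (a , b , e) (a' , b' , e') = a ⋆ a' , Bd-⋆ {a = a} {a'} b b' , \ P -> trans (cong₂ _*_ (e P) (e' P)) (sym (AtF.evE-⋆ P a a'))

 Bd-one : Bd 1 oneE
 Bd-one zero zero _ h with () ← ≤∙ h (≡⇒≤ (cong₂ N._+_ (*-zeroʳ s) (*-zeroʳ (suc s))))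
 Bd-one zero (suc i) _ _ = refl
 Bd-one (suc j) i _ _ = refl

 V-one : V 0 (\ _ -> 1#)
 V-one = oneE , Bd-one , \ P -> sym (AtF.evE-one P)

 V-const : ∀ k -> V 0 (\ _ -> k)
 V-const k = V-ext (\ P -> sym (*-identityʳ k)) (V-scale k V-one)

 V-x : V s Pt.x0
 V-x = X̂ oneE , Bd-mono {a = X̂ oneE} (≡⇒≤ (NP.+-comm s 1)) (Bd-X {a = oneE} Bd-one) , \ P -> sym (trans (AtF.evE-X̂ P oneE) (trans (cong (Pt.x0 P *_) (AtF.evE-one P)) (*-identityʳ _)))

 V-v : V (suc s) Pt.vo
 V-v = V̂ oneE , Bd-mono {a = V̂ oneE} (≡⇒≤ (NP.+-comm (suc s) 1)) (Bd-V {a = oneE} Bd-one) , \ P -> sym (trans (AtF.evE-V̂ P oneE) (trans (cong (Pt.vo P *_) (AtF.evE-one P)) (*-identityʳ _)))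

 module Filtration (κ : ℕ) where

   -- Filt n φ: the k-th coefficient of the family of series φ has weight at most n + κ k.
  record Filt (n : ℕ) (φ : Pt -> Ser) : Set where
   constructor filt
   field at : ∀ k -> V (n N.+ κ N.* k) (\ P -> φ P k)
  open Filt public

  Filt-mono : ∀ {n m φ} -> n N.≤ m -> Filt n φ -> Filt m φ
  Filt-mono le w = filt \ k -> V-mono (+-monoˡ-≤ (κ N.* k) le) (at w k)

  Filt-ext : ∀ {n φ χ} -> (∀ P -> χ P ≈ φ P) -> Filt n φ -> Filt n χ
  Filt-ext e w = filt \ k -> V-ext (\ P -> e P k) (at w k)

  Filt-+ : ∀ {n φ χ} -> Filt n φ -> Filt n χ -> Filt n (\ P -> φ P +ˢ χ P)
  Filt-+ w w' = filt \ k -> V-+ (at w k) (at w' k)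

  Filt-neg : ∀ {n φ} -> Filt n φ -> Filt n (\ P -> -ˢ φ P)
  Filt-neg w = filt \ k -> V-neg (at w k)

  Filt-const : ∀ {n f} -> V n f -> Filt n (\ P -> const (f P))
  Filt-const {n} w = filt \ { zero -> V-mono (m≤m+n n _) w ; (suc k) -> V-0 }

  Filt-* : ∀ {n m φ χ} -> Filt n φ -> Filt m χ -> Filt (n N.+ m) (\ P -> φ P *ˢ χ P)
  Filt-* {n} {m} {φ} {χ} w w' = filt (go n φ w)
   where
   eq : ∀ n m κ -> n N.+ κ N.* 0 N.+ (m N.+ κ N.* 0) ≡ n N.+ m N.+ κ N.* 0
   eq = solve-∀
   eq1 : ∀ n m κ k -> n N.+ κ N.* 0 N.+ (m N.+ κ N.* suc k) ≡ n N.+ m N.+ κ N.* suc k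
   eq1 = solve-∀
   eq2 : ∀ n m κ k -> n N.+ κ N.+ m N.+ κ N.* k ≡ n N.+ m N.+ κ N.* suc k
   eq2 = solve-∀
   eq3 : ∀ n κ l -> n N.+ κ N.* suc l ≡ n N.+ κ N.+ κ N.* l
   eq3 = solve-∀
   go : ∀ n φ -> Filt n φ -> ∀ k -> V (n N.+ m N.+ κ N.* k) (\ P -> (φ P *ˢ χ P) k)
   go n φ w zero = V-mono (≡⇒≤ (eq n m κ)) (V-* (at w 0) (at w' 0))
   go n φ w (suc k) = V-+ (V-mono (≡⇒≤ (eq1 n m κ k)) (V-* (at w 0) (at w' (suc k))))
    (V-mono (≡⇒≤ (eq2 n m κ k)) (go (n N.+ κ) (\ P -> tl (φ P)) (filt \ l -> V-mono (≡⇒≤ (eq3 n κ l)) (at w (suc l))) k))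

  -- A factor u shifts coefficients by one place, so it pays for an amount κ of weight. The
  -- nonlinear terms in the fixed-point equation are absorbed in this way.
  Filt-u : ∀ {n N φ} -> N N.≤ n N.+ κ -> Filt N φ -> Filt n (\ P -> uˢ *ˢ φ P)
  Filt-u {n} {N} {φ} le w = filt go
   where
   eq : ∀ n κ k -> n N.+ κ N.+ κ N.* k ≡ n N.+ κ N.* suc k
   eq = solve-∀
   go : ∀ k -> V (n N.+ κ N.* k) (\ P -> (uˢ *ˢ φ P) k)
   go zero = V-ext (\ P -> u*-zero (φ P)) V-0
   go (suc k) = V-ext (\ P -> u*-suc (φ P) k) (V-mono (≤∙ (+-monoˡ-≤ (κ N.* k) le) (≡⇒≤ (eq n κ k))) (at w k))

  Filt-0 : ∀ {n} -> Filt n (\ P -> const 0#)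
  Filt-0 = Filt-mono z≤n (Filt-const V-0)

  Filt-pow : ∀ {n φ} m -> Filt n φ -> Filt (n N.* m) (\ P -> RS.pow (φ P) m)
  Filt-pow {n} zero w = Filt-mono z≤n (Filt-const V-one)
  Filt-pow {n} (suc m) w = Filt-mono (≡⇒≤ (sym (*-suc n m))) (Filt-* w (Filt-pow m w))

  module _ {B : ℕ} {x w : Pt -> Ser} (Fx : Filt B x) where

   private
    step : ∀ {l φ} -> Filt (B N.* l) φ -> Filt (B N.* suc l) (\ P -> x P *ˢ φ P)
    step {l} {φ} h = Filt-mono (≡⇒≤ (sym (*-suc B l))) (Filt-* Fx h)
    up : ∀ {l φ} -> Filt (B N.* l) φ -> Filt (B N.* suc l) φ
    up {l} {φ} = Filt-mono (*-monoʳ-≤ B (n≤1+n l))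

   Filt-hev : ∀ p -> Filt (B N.* length p) (\ P -> Es.hev p (x P))
   Filt-hev [] = Filt-0
   Filt-hev (a ∷ p) = Filt-+ (Filt-mono z≤n (Filt-const (V-const a))) (step {length p} {\ P -> Es.hev p (x P)} (Filt-hev p))

   Filt-der : ∀ p -> Filt (B N.* length p) (\ P -> Es.der p (x P))
   Filt-der [] = Filt-0
   Filt-der (a ∷ p) = Filt-+ (up {length p} {\ P -> Es.hev p (x P)} (Filt-hev p)) (step {length p} {\ P -> Es.der p (x P)} (Filt-der p))

   Filt-tay : Filt B (\ P -> x P +ˢ w P) -> ∀ p -> Filt (B N.* length p) (\ P -> Es.tay p (x P) (w P))
   Filt-tay Fw [] = Filt-0
   Filt-tay Fw (a ∷ p) = Filt-+ (up {length p} {\ P -> Es.der p (x P)} (Filt-der p))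
    (Filt-mono (≡⇒≤ (sym (*-suc B (length p)))) (Filt-* Fw (Filt-tay Fw p)))

   module _ {I : Set} {f : Pt -> I -> Ser} where
    Filt-cev : ∀ {L} -> All (\ r -> Filt B (\ P -> f P r)) L -> Filt (B N.* length L) (\ P -> cev (map (f P) L) (x P))
    Filt-cev {[]} [] = Filt-0
    Filt-cev {r ∷ L} (h ∷ hs) = Filt-+ (Filt-mono (m≤m*n B (suc (length L))) h) (step {length L} {\ P -> cev (map (f P) L) (x P)} (Filt-cev hs))

    Filt-cder : ∀ {L} -> All (\ r -> Filt B (\ P -> f P r)) L -> Filt (B N.* length L) (\ P -> cder (map (f P) L) (x P))
    Filt-cder {[]} [] = Filt-0
    Filt-cder {r ∷ L} (h ∷ hs) = Filt-+ (up {length L} {\ P -> cev (map (f P) L) (x P)} (Filt-cev hs)) (step {length L} {\ P -> cder (map (f P) L) (x P)} (Filt-cder hs))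

    Filt-ctay : Filt B (\ P -> x P +ˢ w P) -> ∀ {L} -> All (\ r -> Filt B (\ P -> f P r)) L -> Filt (B N.* length L) (\ P -> ctay (map (f P) L) (x P) (w P))
    Filt-ctay Fw {[]} [] = Filt-0
    Filt-ctay Fw {r ∷ L} (h ∷ hs) = Filt-+ (up {length L} {\ P -> cder (map (f P) L) (x P)} (Filt-cder hs))
     (Filt-mono (≡⇒≤ (sym (*-suc B (length L)))) (Filt-* Fw (Filt-ctay Fw hs)))

 rows≤ : ℕ
 rows≤ = suc (len ρ)

 -- `B1` bounds the weight of a coefficient series of the curve, and `e` that of η, `U`, `U'` and ψ.
 -- The parameter occurs as η² u in x and with η ψ u in v, which costs 2 `e` per order; hence `κ`.
 B1 e κ : ℕ
 B1 = suc s N.* rows≤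
 e = B1 N.* length H
 κ = e N.+ e

 open Filtration κ

 private
  H-short : ∀ n k -> n N.+ k ≡ s -> All (\ r -> length r N.≤ rows≤) (RF.hlist n k)
  H-short zero k _ = s≤s z≤n ∷ []
  H-short (suc n) k eq = ≤∙ (≡⇒≤ (Listₚ.length-map _ (ρ k))) (m≤n⇒m≤1+n (sumℕ-≥ s (\ j -> length (ρ j)) k (≤∙ (s≤s (m≤n+m k n)) (≡⇒≤ eq)))) ∷ H-short n (suc k) (trans (+-suc n k) eq)

  short : All (\ r -> length r N.≤ rows≤) H
  short = H-short s 0 (NP.+-identityʳ s)

  V-η : V e Loc.η
  V-η = V-ext (\ P -> sym (eqη P)) (V-mono (≡⇒≤ (NP.+-identityʳ e)) (F0.at Filt0 0))
   where
   module F0 = Filtration 0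
   Filt0 : F0.Filt e (\ P -> cder (map (\ r -> const (ev r (Pt.x0 P))) H) (const (Pt.vo P)))
   Filt0 = F0.Filt-cder {B = B1} {x = \ P -> const (Pt.vo P)} {w = \ P -> const 0#} (F0.Filt-mono (m≤m*n (suc s) rows≤) (F0.Filt-const V-v))
    (All.map (\ {r} le -> F0.Filt-ext (\ P n -> sym (hev-const r (Pt.x0 P) n))
     (F0.Filt-mono (*-monoʳ-≤ (suc s) le) (F0.Filt-hev {x = \ P -> const (Pt.x0 P)} {w = \ P -> const 0#} (F0.Filt-mono (n≤1+n s) (F0.Filt-const V-x)) r))) short)
   eqη : ∀ P -> cder (map (\ r -> const (ev r (Pt.x0 P))) H) (const (Pt.vo P)) 0 ≡ Loc.η P
   eqη P = cder-const (\ r -> ev r (Pt.x0 P)) H (Pt.vo P) 0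

  F-ω : Filt 0 Loc.ω
  F-ω = Filt-u NP.≤-refl (Filt-const (V-* V-η V-η))

  F-X0 : Filt (suc s) Loc.X0
  F-X0 = Filt-mono (n≤1+n s) (Filt-const V-x)

  F-V0 : Filt (suc s) Loc.V0
  F-V0 = Filt-const V-v

  F-V1 : Filt B1 Loc.V0
  F-V1 = Filt-mono (m≤m*n (suc s) rows≤) F-V0

  F-Dr : ∀ r -> length r N.≤ rows≤ -> Filt B1 (\ P -> Loc.Dr P r)
  F-Dr r le = Filt-mono (*-monoʳ-≤ (suc s) le) (Filt-+ (Filt-der {x = Loc.X0} {w = Loc.ω} F-X0 r)
   (Filt-* F-ω (Filt-tay {x = Loc.X0} {w = Loc.ω} F-X0 (Filt-+ F-X0 (Filt-mono z≤n F-ω)) r)))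

  F-ĉ : ∀ r -> length r N.≤ rows≤ -> Filt B1 (\ P -> Loc.ĉ P r)
  F-ĉ r le = Filt-+ (Filt-mono (*-monoʳ-≤ (suc s) le) (Filt-hev {x = Loc.X0} {w = Loc.ω} F-X0 r)) (Filt-* F-ω (F-Dr r le))

  F-U : Filt e Loc.U
  F-U = Filt-cev {x = Loc.V0} {w = Loc.ω} F-V1 {f = Loc.Dr} (All.map (\ {r} -> F-Dr r) short)

  F-U' : Filt e Loc.U'
  F-U' = Filt-cder {x = Loc.V0} {w = Loc.ω} F-V1 {f = Loc.Dr} (All.map (\ {r} -> F-Dr r) short)

  F-η : Filt e (\ P -> const (Loc.η P))
  F-η = Filt-const V-η

  F-ν : ∀ {ψ} -> Filt e ψ -> Filt 0 (\ P -> Loc.ν P (ψ P))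
  F-ν {ψ} h = Filt-u NP.≤-refl (Filt-* F-η h)

  F-T : ∀ {ψ} -> Filt e ψ -> Filt e (\ P -> Loc.T P (ψ P))
  F-T {ψ} h = Filt-ctay {x = Loc.V0} {w = \ P -> Loc.ν P (ψ P)} F-V1 {f = Loc.ĉ} (Filt-+ F-V1 (Filt-mono z≤n (F-ν h))) (All.map (\ {r} -> F-ĉ r) short)

  F-uΦ : ∀ {ψ} -> Filt e ψ -> Filt e (\ P -> uˢ *ˢ Loc.Φ P (ψ P))
  F-uΦ {ψ} h = Filt-u NP.≤-refl (Filt-neg 
   (Filt-mono (≡⇒≤ (eq e)) (Filt-+ 
    (Filt-* (Filt-* F-η h) F-U')
    (Filt-* (Filt-* h h) (F-T h)))))
   where
   eq : ∀ e -> e N.+ e N.+ e ≡ e N.+ (e N.+ e)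
   eq = solve-∀

  F-iter : ∀ m -> Filt e (\ P -> Loc.iter P m)
  F-iter zero = Filt-neg F-U
  F-iter (suc m) = Filt-+ (Filt-neg F-U) (F-uΦ (F-iter m))

  F-ψ : Filt e Loc.ψ
  F-ψ = filt \ k -> at (F-iter k) k

 Filt-x̂ : Filt s Loc.x̂
 Filt-x̂ = Filt-+ (Filt-const V-x) (Filt-mono z≤n F-ω)

 Filt-v̂ : Filt (suc s) Loc.v̂
 Filt-v̂ = Filt-+ F-V0 (Filt-mono z≤n (F-ν F-ψ))

-- Bounding zeros by comparison of dimensions.

module ZeroBound (𝔽 : FiniteField) (s0 : ℕ) (ρ : ℕ -> List (FiniteField.F 𝔽))
  (ρ-Bd : Rows.Bd 𝔽 s0 ρ (suc (suc s0 N.* suc (suc s0))) ρ)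
  (κ≢0 : ¬ PolyEval.coef 𝔽 (ρ 0) (suc (suc s0)) ≡ FiniteField.0# 𝔽) where
 open import Data.Nat using (pred)
 import Data.Nat.DivMod as DM
 open import Data.Fin using (_↑ˡ_; _↑ʳ_; splitAt)
 open ≡ hiding (J)
 open Fld 𝔽
 open Ser 𝔽
 open Poly 𝔽
 open Frob 𝔽
 open Pigeon 𝔽
 open Weights 𝔽 s0 ρ ρ-Bd κ≢0

 evS-0 : ∀ a P -> evS a P 0 ≡ evP a P
 evS-0 a P = sum0 s
  where
  x̂ v̂ : Ser
  x̂ = Loc.x̂ P
  v̂ = Loc.v̂ P
  hev0 : ∀ p -> Es.hev p x̂ 0 ≡ ev p (Pt.x0 P)
  hev0 [] = refl
  hev0 (c ∷ p) = cong (c +_) (cong₂ _*_ (Loc.x̂-0 P) (hev0 p))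
  pow0 : ∀ n -> RS.pow v̂ n 0 ≡ RF.pow (Pt.vo P) n
  pow0 zero = refl
  pow0 (suc n) = cong₂ _*_ (Loc.v̂-0 P) (pow0 n)
  sum0 : ∀ n -> RS.∑ n (\ j -> Es.hev (a j) x̂ *ˢ RS.pow v̂ j) 0 ≡ RF.∑ n (\ j -> ev (a j) (Pt.x0 P) * RF.pow (Pt.vo P) j)
  sum0 zero = refl
  sum0 (suc n) = cong₂ _+_ (sum0 n) (cong₂ _*_ (hev0 (a n)) (pow0 n))

 powE : E -> ℕ -> E
 powE a zero = oneE
 powE a (suc n) = powE a n ⋆ a

 evS-powE : ∀ a n P -> evS (powE a n) P ≈ RS.pow (evS a P) n
 evS-powE a zero P = AtS.evE-one P
 evS-powE a (suc n) P = R.trans (AtS.evE-⋆ P (powE a n) a) (R.trans (R.*-congʳ {x = evS a P} (evS-powE a n P)) (R.*-comm _ _))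

 evP-powE : ∀ a n P -> evP (powE a n) P ≡ evP a P ^F n
 evP-powE a zero P = AtF.evE-one P
 evP-powE a (suc n) P = trans (AtF.evE-⋆ P (powE a n) a) (trans (cong (_* evP a P) (evP-powE a n P)) (*-comm _ _))

 Bd-powE : ∀ {w} a n -> Bd (suc w) a -> Bd (suc (w N.* n)) (powE a n)
 Bd-powE {w} a zero b = Bd-mono {a = oneE} (s≤s z≤n) Bd-one
 Bd-powE {w} a (suc n) b = Bd-mono {a = powE a (suc n)} (s≤s (≡⇒≤ (trans (NP.+-comm (w N.* n) w) (sym (*-suc w n))))) (Bd-⋆ {a = powE a n} {a} (Bd-powE a n b) b)

 m1 : F
 m1 = - 1#

 xf vf : F -> E
 xf x = X̂ oneE ∔ smul (- x) oneE
 vf v = V̂ oneE ∔ smul (- v) oneE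

 Bd-xf : ∀ x -> Bd (suc s) (xf x)
 Bd-xf x = Bd-∔ {a = X̂ oneE} {smul (- x) oneE} (Bd-mono {a = X̂ oneE} (≡⇒≤ (NP.+-comm s 1)) (Bd-X {a = oneE} Bd-one)) (Bd-mono {a = smul (- x) oneE} (s≤s z≤n) (Bd-smul (- x) {oneE} Bd-one))

 Bd-vf : ∀ v -> Bd (suc (suc s)) (vf v)
 Bd-vf v = Bd-∔ {a = V̂ oneE} {smul (- v) oneE} (Bd-mono {a = V̂ oneE} (≡⇒≤ (NP.+-comm (suc s) 1)) (Bd-V {a = oneE} Bd-one)) (Bd-mono {a = smul (- v) oneE} (s≤s z≤n) (Bd-smul (- v) {oneE} Bd-one))

 evP-xf : ∀ x P -> evP (xf x) P ≡ Pt.x0 P - x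
 evP-xf x P = trans (AtF.evE-∔ P (X̂ oneE) (smul (- x) oneE)) (cong₂ _+_ (trans (AtF.evE-X̂ P oneE) (trans (cong (Pt.x0 P *_) (AtF.evE-one P)) (*-identityʳ _)))
  (trans (AtF.evE-smul P (- x) oneE) (trans (cong (- x *_) (AtF.evE-one P)) (*-identityʳ _))))

 evP-vf : ∀ v P -> evP (vf v) P ≡ Pt.vo P - v
 evP-vf v P = trans (AtF.evE-∔ P (V̂ oneE) (smul (- v) oneE)) (cong₂ _+_ (trans (AtF.evE-V̂ P oneE) (trans (cong (Pt.vo P *_) (AtF.evE-one P)) (*-identityʳ _)))
  (trans (AtF.evE-smul P (- v) oneE) (trans (cong (- v *_) (AtF.evE-one P)) (*-identityʳ _))))

 evS-xf : ∀ P -> evS (xf (Pt.x0 P)) P ≈ Loc.ω P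
 evS-xf P = R.trans (AtS.evE-∔ P (X̂ oneE) (smul (- Pt.x0 P) oneE)) (R.trans (R.+-cong (R.trans (AtS.evE-X̂ P oneE) (R.trans (R.*-congˡ {x = Loc.x̂ P} (AtS.evE-one P)) (R.*-identityʳ _)))
   (R.trans (AtS.evE-smul P (- Pt.x0 P) oneE) (R.trans (R.*-congˡ {x = const (- Pt.x0 P)} (AtS.evE-one P)) (R.trans (R.*-identityʳ _) (const-neg (Pt.x0 P))))))
  (Sol.solve 2 (\ a w -> (a Sol.:+ w) Sol.:+ Sol.:- a Sol.:= w) R.refl (Loc.X0 P) (Loc.ω P)))

 1- : E -> E
 1- a = oneE ∔ smul m1 a

 evP-1- : ∀ a P -> evP (1- a) P ≡ 1# - evP a P
 evP-1- a P = trans (AtF.evE-∔ P oneE (smul m1 a)) (cong₂ _+_ (AtF.evE-one P) (AtF.evE-neg P a))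

 Bd-1- : ∀ {w} a -> Bd (suc w) a -> Bd (suc w) (1- a)
 Bd-1- a b = Bd-∔ {a = oneE} {smul m1 a} (Bd-mono {a = oneE} (s≤s z≤n) Bd-one) (Bd-smul m1 {a} b)

 -- vanishes at (x, v) and equals 1 at all other points
 away : F -> F -> E
 away x v = 1- (1- (powE (xf x) (pred q)) ⋆ 1- (powE (vf v) (pred q)))

 wA : ℕ
 wA = s N.* pred q N.+ suc s N.* pred q

 Bd-away : ∀ x v -> Bd (suc wA) (away x v)
 Bd-away x v = Bd-1- (1- (powE (xf x) (pred q)) ⋆ 1- (powE (vf v) (pred q))) (Bd-⋆ {a = 1- (powE (xf x) (pred q))} {1- (powE (vf v) (pred q))}
   (Bd-1- (powE (xf x) (pred q)) (Bd-powE (xf x) (pred q) (Bd-xf x))) (Bd-1- (powE (vf v) (pred q)) (Bd-powE (vf v) (pred q) (Bd-vf v))))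

 pow-pred : ∀ {y} -> ¬ y ≡ 0# -> y ^F pred q ≡ 1#
 pow-pred {y} ne = sub-≡ (*-cancelˡ-0 ne (trans (solve 3 (\ y p o -> y :* (p :- o) := y :* p :- y :* o) refl y (y ^F pred q) 1#)
  (≡-sub (trans (trans (pw q>0) (frobenius y)) (sym (*-identityʳ y))))))
  where
  pw : ∀ {n} -> 0 N.< n -> y * y ^F pred n ≡ y ^F n
  pw {suc n} _ = refl

 pow-zero : 0# ^F pred q ≡ 0#
 pow-zero = ^F-zero (pred-mono-≤ q≥2)

 evP-away : ∀ x v P -> evP (away x v) P ≡ 1# - (1# - (Pt.x0 P - x) ^F pred q) * (1# - (Pt.vo P - v) ^F pred q)
 evP-away x v P = trans (evP-1- _ P) (cong (\ t -> 1# - t) (trans (AtF.evE-⋆ P (1- (powE (xf x) (pred q))) (1- (powE (vf v) (pred q))))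
  (cong₂ _*_ (trans (evP-1- _ P) (cong (\ t -> 1# - t) (trans (evP-powE (xf x) (pred q) P) (cong (_^F pred q) (evP-xf x P)))))
        (trans (evP-1- _ P) (cong (\ t -> 1# - t) (trans (evP-powE (vf v) (pred q) P) (cong (_^F pred q) (evP-vf v P))))))))

 away-self : ∀ P -> evP (away (Pt.x0 P) (Pt.vo P)) P ≡ 0#
 away-self P = trans (evP-away _ _ P) (trans (cong₂ (\ a b -> 1# - (1# - a) * (1# - b)) (trans (cong (_^F pred q) (-‿inverseʳ _)) pow-zero) (trans (cong (_^F pred q) (-‿inverseʳ _)) pow-zero))
  (trans (solve 1 (\ o -> o :- (o :- con (ℤ.+ 0)) :* (o :- con (ℤ.+ 0)) := o :- o :* o) refl 1#) (trans (cong (\ t -> 1# - t) (*-identityˡ 1#)) (-‿inverseʳ _))))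

 Differ : Pt -> Pt -> Set
 Differ P R = ¬ (Pt.x0 P ≡ Pt.x0 R × Pt.vo P ≡ Pt.vo R)

 away-other : ∀ P R -> Differ P R -> evP (away (Pt.x0 P) (Pt.vo P)) R ≡ 1#
 away-other P R d with Pt.x0 R ≟ Pt.x0 P
 ... | no ne = trans (evP-away _ _ R) (trans (cong (\ a -> 1# - (1# - a) * (1# - (Pt.vo R - Pt.vo P) ^F pred q)) (pow-pred (\ e -> ne (sub-≡ e))))
   (solve 2 (\ o b -> o :- (o :- o) :* b := o) refl 1# _))
 ... | yes e = trans (evP-away _ _ R) (trans (cong (\ a -> 1# - (1# - (Pt.x0 R - Pt.x0 P) ^F pred q) * (1# - a)) (pow-pred (\ z -> d (sym e , sym (sub-≡ z)))))
   (solve 2 (\ o b -> o :- b :* (o :- o) := o) refl 1# _))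


 ord-* : ∀ {m n a b} -> a ≡[ m ] const 0# -> b ≡[ n ] const 0# -> a *ˢ b ≡[ m N.+ n ] const 0#
 ord-* {m} {n} {a} {b} p r {k} k< = trans (conv-vanish a b k term) (sym (const0≡0 k))
  where
  term : ∀ i l -> i N.+ l ≡ k -> a i ≡ 0# ⊎ b l ≡ 0#
  term i l e with i N.<? m
  ... | yes i< = inj₁ (trans (p i<) (const0≡0 i))
  ... | no ¬i< = inj₂ (trans (r (≰⇒> (\ n≤l -> <⇒≱ k< (≤∙ (+-mono-≤ (≮⇒≥ ¬i<) n≤l) (≡⇒≤ e))))) (const0≡0 l))

 ord-pow : ∀ n {a} -> a 0 ≡ 0# -> RS.pow a n ≡[ n ] const 0#
 ord-pow zero e ()
 ord-pow (suc n) {a} e = ord-* {1} {n} {a} {RS.pow a n} (\ { {zero} _ -> e ; {suc k} (s≤s ()) }) (ord-pow n e)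

 ord-absorb : ∀ {n a} b -> a ≡[ n ] const 0# -> b *ˢ a ≡[ n ] const 0#
 ord-absorb {n} {a} b p = ord-* {0} {n} {b} {a} (\ ()) p

 unit-cancel-[] : ∀ {n} a b -> ¬ a 0 ≡ 0# -> a *ˢ b ≡[ n ] const 0# -> b ≡[ n ] const 0#
 unit-cancel-[] {n} a b ne e {k} k< = trans (go k {k} (n<1+n k) k<) (sym (const0≡0 k))
  where
  step : ∀ m -> (∀ {k} -> k N.< m -> b k ≡ 0#) -> m N.< n -> b m ≡ 0#
  step m h m< = *-cancelˡ-0 ne (trans (sym (conv-top a b 0 m (\ { zero k e ne -> ⊥-elim (ne refl) ; (suc i) k e _ -> inj₂ (h (≤∙ (s≤s (m≤n+m k i)) (≡⇒≤ e))) }))) (trans (e m<) (const0≡0 m)))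
  go : ∀ m {k} -> k N.< suc m -> k N.< n -> b k ≡ 0#
  go zero {zero} _ k< = step 0 (\ ()) k<
  go zero {suc k} (s≤s ()) _
  go (suc m) {k} k<m k< with k N.≟ suc m
  ... | yes refl = step (suc m) (\ {l} l< -> go m l< (<-trans l< k<)) k<
  ... | no ne' = go m (≤∧≢⇒< (≤-pred k<m) ne') k<

 pow-unit : ∀ n a -> ¬ a 0 ≡ 0# -> ¬ RS.pow a n 0 ≡ 0#
 pow-unit zero a ne e = 0≢1 (sym e)
 pow-unit (suc n) a ne e = *-≢0 ne (pow-unit n a ne) e

 -- At a smooth point η² is nonzero, so x - x₀ = η² u is a local parameter and a polynomial in it is
 -- determined by its first coefficients.
 hev-ω-inj : ∀ M P (d : ℕ -> F) -> Es.hev (lst M d) (Loc.ω P) ≡[ M ] const 0# -> ∀ k -> k N.< M -> d k ≡ 0#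
 hev-ω-inj (suc M) P d h zero _ = trans (sym (trans (cong (d 0 +_) (trans (cong (_* Es.hev (lst M (\ i -> d (suc i))) (Loc.ω P) 0) (u*-zero (const (Loc.η P * Loc.η P)))) (zeroˡ _))) (+-identityʳ _))) (h (s≤s z≤n))
 hev-ω-inj (suc M) P d h (suc k) (s≤s k<) = hev-ω-inj M P (\ i -> d (suc i)) tail k k<
  where
  η² : F
  η² = Loc.η P * Loc.η P
  Y : Ser
  Y = Es.hev (lst M (\ i -> d (suc i))) (Loc.ω P)
  tail : Y ≡[ M ] const 0#
  tail {l} l< = trans (*-cancelˡ-0 (*-≢0 (Pt.smooth P) (Pt.smooth P)) (trans (sym (const-*ˡ η² Y l)) (trans (sym (u*-suc (const η² *ˢ Y) l)) (trans (sym (*ˢ-assoc uˢ (const η²) Y (suc l)))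
    (trans (sym (+-identityˡ _)) (h (s≤s l<))))))) (sym (const0≡0 l))

 -- Newton interpolation data: prescribing the first M Taylor coefficients at each of the points.
 Ω : ℕ -> List Pt -> (ℕ -> ℕ -> F) -> E
 Ω M [] l = zeroE
 Ω M (P ∷ pts) l = sumE M (\ k -> smul (l 0 k) (powE (xf (Pt.x0 P)) k)) ∔ (Ω M pts (\ t -> l (suc t)) ⋆ powE (away (Pt.x0 P) (Pt.vo P)) M)

 wΩ : ℕ -> List Pt -> ℕ
 wΩ M [] = 0
 wΩ M (P ∷ pts) = s N.* M N.+ (wΩ M pts N.+ wA N.* M)

 Bd-Ω : ∀ M pts l -> Bd (suc (wΩ M pts)) (Ω M pts l)
 Bd-Ω M [] l j i _ _ = refl
 Bd-Ω M (P ∷ pts) l = Bd-∔ {a = sumE M (\ k -> smul (l 0 k) (powE (xf (Pt.x0 P)) k))} {Ω M pts (\ t -> l (suc t)) ⋆ powE (away (Pt.x0 P) (Pt.vo P)) M}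
   (Bd-sum M _ (\ k k< -> Bd-smul (l 0 k) {powE (xf (Pt.x0 P)) k} (Bd-mono {a = powE (xf (Pt.x0 P)) k} (s≤s (≤∙ (*-monoʳ-≤ s (<⇒≤ k<)) (m≤m+n _ _))) (Bd-powE (xf (Pt.x0 P)) k (Bd-xf _)))))
   (Bd-mono {a = Ω M pts (\ t -> l (suc t)) ⋆ powE (away (Pt.x0 P) (Pt.vo P)) M} (s≤s (m≤n+m _ (s N.* M)))
    (Bd-⋆ {a = Ω M pts (\ t -> l (suc t))} {powE (away (Pt.x0 P) (Pt.vo P)) M} (Bd-Ω M pts (\ t -> l (suc t))) (Bd-powE (away (Pt.x0 P) (Pt.vo P)) M (Bd-away _ _))))

 evS-Ω : ∀ M P pts l R -> evS (Ω M (P ∷ pts) l) R ≈ RS.∑ M (\ k -> const (l 0 k) *ˢ RS.pow (evS (xf (Pt.x0 P)) R) k) +ˢ evS (Ω M pts (\ t -> l (suc t))) R *ˢ RS.pow (evS (away (Pt.x0 P) (Pt.vo P)) R) M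
 evS-Ω M P pts l R = R.trans (AtS.evE-∔ R (sumE M (\ k -> smul (l 0 k) (powE (xf (Pt.x0 P)) k))) (Ω M pts (\ t -> l (suc t)) ⋆ powE (away (Pt.x0 P) (Pt.vo P)) M))
  (R.+-cong (R.trans (AtS.evE-sum R M _) (RS.∑-cong M (\ k _ -> R.trans (AtS.evE-smul R (l 0 k) (powE (xf (Pt.x0 P)) k)) (R.*-congˡ {x = const (l 0 k)} (evS-powE (xf (Pt.x0 P)) k R)))))
    (R.trans (AtS.evE-⋆ R (Ω M pts (\ t -> l (suc t))) (powE (away (Pt.x0 P) (Pt.vo P)) M)) (R.*-congˡ {x = evS (Ω M pts (\ t -> l (suc t))) R} (evS-powE (away (Pt.x0 P) (Pt.vo P)) M R))))

 sub-[] : ∀ {n a b} -> a ≡[ n ] b -> a +ˢ -ˢ b ≡[ n ] const 0#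
 sub-[] p {k} k< = trans (≡-sub (p k<)) (sym (const0≡0 k))

 []-sub : ∀ {n a b} -> a +ˢ -ˢ b ≡[ n ] const 0# -> a ≡[ n ] b
 []-sub p {k} k< = sub-≡ (trans (p k<) (const0≡0 k))

 -- At the first point the M-th power of `away` vanishes to order M, so the jet there is the
 -- polynomial in x - x₀ and its coefficients can be read off. At the remaining points that power is
 -- a unit; after subtracting the common first part it cancels, and induction applies.
 Ω-injective : ∀ M pts -> AllPairs Differ pts -> ∀ l l' -> All (\ P -> evS (Ω M pts l) P ≡[ M ] evS (Ω M pts l') P) pts ->
  ∀ t k -> t N.< length pts -> k N.< M -> l t k ≡ l' t k
 Ω-injective M (P ∷ pts) (d ∷ ds) l l' (h ∷ hs) = \ { zero k _ k< -> head k k< ; (suc t) k (s≤s t<) k< -> Ω-injective M pts ds _ _ (rest pts d hs) t k t< k< }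
  where
  J J' : Pt -> Ser
  J R = RS.∑ M (\ k -> const (l 0 k) *ˢ RS.pow (evS (xf (Pt.x0 P)) R) k)
  J' R = RS.∑ M (\ k -> const (l' 0 k) *ˢ RS.pow (evS (xf (Pt.x0 P)) R) k)
  A : Pt -> Ser
  A R = RS.pow (evS (away (Pt.x0 P) (Pt.vo P)) R) M
  O O' : Pt -> Ser
  O R = evS (Ω M pts (\ t -> l (suc t))) R
  O' R = evS (Ω M pts (\ t -> l' (suc t))) R
  J-hev : ∀ (l : ℕ -> F) -> RS.∑ M (\ k -> const (l k) *ˢ RS.pow (evS (xf (Pt.x0 P)) P) k) ≈ Es.hev (lst M l) (Loc.ω P)
  J-hev l = R.trans (RS.∑-cong M (\ k k< -> R.*-congʳ {x = RS.pow (evS (xf (Pt.x0 P)) P) k} (\ n -> cong (\ z -> const z n) (sym (coef-lst M l k k<)))))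
    (R.trans (RS.hev-∑ M (lst M l) (evS (xf (Pt.x0 P)) P) (≡⇒≤ (length-lst M l))) (Es.hev-cong (lst M l) (evS-xf P)))
  A0 : A P ≡[ M ] const 0#
  A0 = ord-pow M {evS (away (Pt.x0 P) (Pt.vo P)) P} (trans (evS-0 (away (Pt.x0 P) (Pt.vo P)) P) (away-self P))
  only-J : ∀ l -> evS (Ω M (P ∷ pts) l) P ≡[ M ] Es.hev (lst M (l 0)) (Loc.ω P)
  only-J l {k} k< = trans (evS-Ω M P pts l P k) (trans (cong₂ _+_ (J-hev (l 0) k) (trans (ord-absorb (evS (Ω M pts (\ t -> l (suc t))) P) A0 k<) (const0≡0 k))) (+-identityʳ _))
  hev-diff : ∀ n (a b : ℕ -> F) x -> Es.hev (lst n (\ k -> a k - b k)) x ≈ Es.hev (lst n a) x +ˢ -ˢ Es.hev (lst n b) x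
  hev-diff zero a b x = R.sym (R.-‿inverseʳ (const 0#))
  hev-diff (suc n) a b x = R.trans (R.+-cong (R.trans (const-+ (a 0) (- b 0)) (R.+-congˡ {x = const (a 0)} (const-neg (b 0)))) (R.*-congˡ {x = x} (hev-diff n (\ i -> a (suc i)) (\ i -> b (suc i)) x)))
   (Sol.solve 5 (\ a b x h k -> (a Sol.:+ Sol.:- b) Sol.:+ x Sol.:* (h Sol.:+ Sol.:- k) Sol.:= (a Sol.:+ x Sol.:* h) Sol.:+ Sol.:- (b Sol.:+ x Sol.:* k)) R.refl (const (a 0)) (const (b 0)) x _ _)
  head : ∀ k -> k N.< M -> l 0 k ≡ l' 0 k
  head k k< = sub-≡ (hev-ω-inj M P (\ k -> l 0 k - l' 0 k) (\ {i} i< -> trans (hev-diff M (l 0) (l' 0) (Loc.ω P) i) (sub-[] {M} {Es.hev (lst M (l 0)) (Loc.ω P)} {Es.hev (lst M (l' 0)) (Loc.ω P)} (\ {j} j< -> trans (sym (only-J l j<)) (trans (h j<) (only-J l' j<))) i<)) k k<)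
  JJ : ∀ R -> J R ≈ J' R
  JJ R = RS.∑-cong M (\ k k< -> R.*-congʳ {x = RS.pow (evS (xf (Pt.x0 P)) R) k} (\ n -> cong (\ z -> const z n) (head k k<)))
  one : ∀ {R} -> Differ P R -> evS (Ω M (P ∷ pts) l) R ≡[ M ] evS (Ω M (P ∷ pts) l') R -> O R ≡[ M ] O' R
  one {R} dR hR = []-sub {M} {O R} {O' R} (unit-cancel-[] {M} (A R) (O R +ˢ -ˢ O' R) unit (\ {k} k< -> trans (alg k) (sub-[] {M} {evS (Ω M (P ∷ pts) l) R} {evS (Ω M (P ∷ pts) l') R} hR k<)))
   where
   unit : ¬ A R 0 ≡ 0#
   unit = pow-unit M (evS (away (Pt.x0 P) (Pt.vo P)) R) (\ e -> 0≢1 (trans (sym e) (trans (evS-0 (away (Pt.x0 P) (Pt.vo P)) R) (away-other P R dR))))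
   alg : A R *ˢ (O R +ˢ -ˢ O' R) ≈ evS (Ω M (P ∷ pts) l) R +ˢ -ˢ evS (Ω M (P ∷ pts) l') R
   alg = R.trans (Sol.solve 4 (\ a o p j -> a Sol.:* (o Sol.:+ Sol.:- p) Sol.:= (j Sol.:+ o Sol.:* a) Sol.:+ Sol.:- (j Sol.:+ p Sol.:* a)) R.refl (A R) (O R) (O' R) (J R))
     (R.+-cong (R.sym (evS-Ω M P pts l R)) (R.-‿cong (R.trans (R.+-congʳ {x = O' R *ˢ A R} (JJ R)) (R.sym (evS-Ω M P pts l' R)))))
  rest : ∀ qs -> All (Differ P) qs -> All (\ R -> evS (Ω M (P ∷ pts) l) R ≡[ M ] evS (Ω M (P ∷ pts) l') R) qs -> All (\ R -> O R ≡[ M ] O' R) qs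
  rest [] [] [] = []
  rest (R ∷ qs) (d ∷ ds) (h ∷ hs) = one' d (\ {k} -> h {k}) ∷ rest qs ds hs
   where
   one' : Differ P R -> evS (Ω M (P ∷ pts) l) R ≡[ M ] evS (Ω M (P ∷ pts) l') R -> O R ≡[ M ] O' R
   one' a b = one {R} a (\ {k} -> b {k})

 ∔-cong : ∀ {a a' b b'} -> a ≃ a' -> b ≃ b' -> a ∔ b ≃ a' ∔ b'
 ∔-cong {a} {a'} {b} {b'} p r j i = trans (coef-∔ a b j i) (trans (cong₂ _+_ (p j i) (r j i)) (sym (coef-∔ a' b' j i)))

 smul-cong : ∀ {k l a} -> k ≡ l -> smul k a ≃ smul l a
 smul-cong refl j i = refl

 sum-cong : ∀ n {f g : ℕ -> E} -> (∀ t -> t N.< n -> f t ≃ g t) -> sumE n f ≃ sumE n g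
 sum-cong zero e j i = refl
 sum-cong (suc n) {f} {g} e = ∔-cong {sumE n f} {sumE n g} {f n} {g n} (sum-cong n (\ t t< -> e t (m<n⇒m<1+n t<))) (e n (n<1+n n))

 X^-cong : ∀ n {a b} -> a ≃ b -> X^ n a ≃ X^ n b
 X^-cong zero e = e
 X^-cong (suc n) {a} {b} e = X̂-cong {X^ n a} {X^ n b} (X^-cong n {a} {b} e)

 ⋆-congˡ : ∀ {a a'} b -> a ≃ a' -> a ⋆ b ≃ a' ⋆ b
 ⋆-congˡ {a} {a'} b e = sum-cong s (\ j _ -> sum-cong (len b) (\ i _ -> V^-cong (1 N.* j) (X^-cong (1 N.* i) {smul (coef (b j) i) a} {smul (coef (b j) i) a'}
   (\ j' i' -> trans (coef-smul _ a j' i') (trans (cong (coef (b j) i *_) (e j' i')) (sym (coef-smul _ a' j' i')))))))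

 Ω-cong : ∀ M pts l l' -> (∀ t k -> t N.< length pts -> k N.< M -> l t k ≡ l' t k) -> Ω M pts l ≃ Ω M pts l'
 Ω-cong M [] l l' e j i = refl
 Ω-cong M (P ∷ pts) l l' e = ∔-cong {sumE M (\ k -> smul (l 0 k) (powE (xf (Pt.x0 P)) k))} {sumE M (\ k -> smul (l' 0 k) (powE (xf (Pt.x0 P)) k))}
   {Ω M pts (\ t -> l (suc t)) ⋆ powE (away (Pt.x0 P) (Pt.vo P)) M} {Ω M pts (\ t -> l' (suc t)) ⋆ powE (away (Pt.x0 P) (Pt.vo P)) M}
   (sum-cong M (\ k k< -> smul-cong {a = powE (xf (Pt.x0 P)) k} (e 0 k (s≤s z≤n) k<)))
   (⋆-congˡ {Ω M pts (\ t -> l (suc t))} {Ω M pts (\ t -> l' (suc t))} (powE (away (Pt.x0 P) (Pt.vo P)) M) (Ω-cong M pts _ _ (\ t k t< -> e (suc t) k (s≤s t<))))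

 ⋆-sub : ∀ a a' b -> (a ∔ smul m1 a') ⋆ b ≃ (a ⋆ b) ∔ smul m1 (a' ⋆ b)
 ⋆-sub a a' b = sums s (\ j -> sumE (len b) (gterm 1 (c (a ∔ smul m1 a')) j)) (\ j -> sumE (len b) (gterm 1 (c a) j)) (\ j -> sumE (len b) (gterm 1 (c a') j))
    (\ j -> sums (len b) _ (gterm 1 (c a) j) (gterm 1 (c a') j) (\ i -> term j i))
  where
  c : E -> ℕ -> ℕ -> E
  c a j i = smul (coef (b j) i) a
  sums : ∀ n (f g h : ℕ -> E) -> (∀ t -> f t ≃ g t ∔ smul m1 (h t)) -> sumE n f ≃ sumE n g ∔ smul m1 (sumE n h)
  sums zero f g h e j i = refl
  sums (suc n) f g h e j i = trans (coef-∔ (sumE n f) (f n) j i) (trans (cong₂ _+_ (trans (sums n f g h e j i) (trans (coef-∔ (sumE n g) (smul m1 (sumE n h)) j i) (cong (coef (sumE n g j) i +_) (coef-smul m1 (sumE n h) j i))))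
     (trans (e n j i) (trans (coef-∔ (g n) (smul m1 (h n)) j i) (cong (coef (g n j) i +_) (coef-smul m1 (h n) j i)))))
    (trans (solve 5 (\ a b k x y -> (a :+ k :* x) :+ (b :+ k :* y) := (a :+ b) :+ k :* (x :+ y)) refl (coef (sumE n g j) i) (coef (g n j) i) m1 (coef (sumE n h j) i) (coef (h n j) i))
     (sym (trans (coef-∔ (sumE (suc n) g) (smul m1 (sumE (suc n) h)) j i) (cong₂ _+_ (coef-∔ (sumE n g) (g n) j i) (trans (coef-smul m1 (sumE (suc n) h) j i) (cong (m1 *_) (coef-∔ (sumE n h) (h n) j i))))))))
  opLin : (T : E -> E) -> (∀ {a b} -> a ≃ b -> T a ≃ T b) -> (∀ a b -> T (a ∔ b) ≃ T a ∔ T b) -> (∀ k a -> T (smul k a) ≃ smul k (T a)) -> ∀ {x y z} -> x ≃ y ∔ smul m1 z -> T x ≃ T y ∔ smul m1 (T z)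
  opLin T cg ad sc {x} {y} {z} e j i = trans (cg {x} {y ∔ smul m1 z} e j i) (trans (ad y (smul m1 z) j i) (∔-cong {T y} {T y} {T (smul m1 z)} {smul m1 (T z)} (\ _ _ -> refl) (sc m1 z) j i))
  X^L : ∀ n {x y z} -> x ≃ y ∔ smul m1 z -> X^ n x ≃ X^ n y ∔ smul m1 (X^ n z)
  X^L zero e = e
  X^L (suc n) {x} {y} {z} e = opLin X̂ (\ {a} {b} -> X̂-cong {a} {b}) X̂-∔ X̂-smul {X^ n x} {X^ n y} {X^ n z} (X^L n {x} {y} {z} e)
  V^L : ∀ n {x y z} -> x ≃ y ∔ smul m1 z -> V^ n x ≃ V^ n y ∔ smul m1 (V^ n z)
  V^L zero e = e
  V^L (suc n) {x} {y} {z} e = opLin V̂ (\ {a} {b} -> V̂-cong {a} {b}) V̂-∔ V̂-smul {V^ n x} {V^ n y} {V^ n z} (V^L n {x} {y} {z} e)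
  term : ∀ j i -> gterm 1 (c (a ∔ smul m1 a')) j i ≃ gterm 1 (c a) j i ∔ smul m1 (gterm 1 (c a') j i)
  term j i = V^L (1 N.* j) {X^ (1 N.* i) (c (a ∔ smul m1 a') j i)} {X^ (1 N.* i) (c a j i)} {X^ (1 N.* i) (c a' j i)} (X^L (1 N.* i) {c (a ∔ smul m1 a') j i} {c a j i} {c a' j i} base)
   where
   base : c (a ∔ smul m1 a') j i ≃ c a j i ∔ smul m1 (c a' j i)
   base j' i' = trans (coef-smul _ (a ∔ smul m1 a') j' i') (trans (cong (coef (b j) i *_) (trans (coef-∔ a (smul m1 a') j' i') (cong (coef (a j') i' +_) (coef-smul m1 a' j' i'))))
    (trans (solve 4 (\ k x m y -> k :* (x :+ m :* y) := k :* x :+ m :* (k :* y)) refl (coef (b j) i) (coef (a j') i') m1 (coef (a' j') i'))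
     (sym (trans (coef-∔ (c a j i) (smul m1 (c a' j i)) j' i') (cong₂ _+_ (coef-smul _ a j' i') (trans (coef-smul m1 (c a' j i) j' i') (cong (m1 *_) (coef-smul _ a' j' i'))))))))

 -- An element with leading weight g vanishing to order M at N points satisfies M N ≤ g + O(1).
 zero-bound : ∀ {g} G -> Lead g G -> ∀ M pts -> AllPairs Differ pts -> All (\ P -> evS G P ≡[ M ] const 0#) pts ->
  length pts N.* M N.≤ g N.+ (s N.+ suc s N.* s)
 zero-bound {g} G lead M pts dist van = +-cancelʳ-≤ (s N.* Ir) (length pts N.* M) _ (≤∙ (injection-≤ T T-inj) fin)
  where
  Ir Iw : ℕ
  Ir = wΩ M pts
  Iw = Ir N.+ suc ((g N.+ suc s N.* s) DM./ s)
  NM : ℕ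
  NM = length pts N.* M
  fin : s N.* Iw N.≤ g N.+ (s N.+ suc s N.* s) N.+ s N.* Ir
  fin = ≤∙ (≡⇒≤ (ar s Ir ((g N.+ suc s N.* s) DM./ s))) (≤∙ (+-monoˡ-≤ (s N.+ s N.* Ir) (DM.m/n*n≤m (g N.+ suc s N.* s) s)) (≡⇒≤ (br g (suc s N.* s) s (s N.* Ir))))
   where
   ar : ∀ s a b -> s N.* (a N.+ suc b) ≡ b N.* s N.+ (s N.+ s N.* a)
   ar = solve-∀
   br : ∀ g a s b -> g N.+ a N.+ (s N.+ b) ≡ g N.+ (s N.+ a) N.+ b
   br = solve-∀
  module _ (α : Fin (NM N.+ s N.* Ir) -> F) where
   lα : ℕ -> ℕ -> F
   lα t k = ext {length pts} (\ t -> ext {M} (\ k -> α (combine t k ↑ˡ (s N.* Ir))) k) t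
   rα : E
   rα j = lst Ir (\ i -> ext {s} (\ j -> ext {Ir} (\ i -> α (NM ↑ʳ combine j i)) i) j)
   elt : E
   -- Since G vanishes to order M at every point, the jets of Ω + r G are those of Ω and determine
   -- its data; what is left determines r, because multiplication by G is injective. The data number
   -- |pts| M + s `Ir`, while the sum lies in a space of dimension s `Iw`, where `Iw` exceeds `Ir`
   -- just enough to hold r G.
   elt = Ω M pts lα ∔ (rα ⋆ G)
   Bd-r : Bd (s N.* Ir N.+ suc s N.* s) rα
   Bd-r j i j< h = coef-lst-≥ Ir _ i (≮⇒≥ (\ i< -> <⇒≱ (+-mono-<-≤ (*-monoʳ-< s i<) (*-monoʳ-≤ (suc s) (<⇒≤ j<))) h))
   Bd-elt : Bd (s N.* Iw) elt
   Bd-elt = Bd-∔ {a = Ω M pts lα} {rα ⋆ G} (Bd-mono {a = Ω M pts lα} le1 (Bd-Ω M pts lα)) (Bd-mono {a = rα ⋆ G} le2 (Bd-⋆ {a = rα} {G} (Bd-mono {a = rα} (n≤1+n _) Bd-r) (proj₁ lead)))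
    where
    le1 : suc (wΩ M pts) N.≤ s N.* Iw
    le1 = ≤∙ (≤∙ (≡⇒≤ (NP.+-comm 1 Ir)) (+-monoʳ-≤ Ir (s≤s z≤n))) (m≤n*m Iw s)
    le2 : suc (s N.* Ir N.+ suc s N.* s N.+ g) N.≤ s N.* Iw
    le2 = ≤∙ (≡⇒≤ (ar (s N.* Ir) (suc s N.* s) g)) (≤∙ (+-monoʳ-≤ (s N.* Ir) (≤∙ (s≤s (≡⇒≤ (DM.m≡m%n+[m/n]*n (g N.+ suc s N.* s) s)))
      (+-monoˡ-≤ _ (DM.m%n<n (g N.+ suc s N.* s) s)))) (≡⇒≤ (br s Ir ((g N.+ suc s N.* s) DM./ s))))
     where
     ar : ∀ a b g -> suc (a N.+ b N.+ g) ≡ a N.+ suc (g N.+ b)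
     ar = solve-∀
     br : ∀ s a b -> s N.* a N.+ (s N.+ b N.* s) ≡ s N.* (a N.+ suc b)
     br = solve-∀
  T : (Fin (NM N.+ s N.* Ir) -> F) -> Fin (s N.* Iw) -> F
  T α t = coef (elt α (toℕ (proj₁ (remQuot {s} Iw t)))) (toℕ (proj₂ (remQuot {s} Iw t)))
  module _ (α β : Fin (NM N.+ s N.* Ir) -> F) (eq : ∀ t -> T α t ≡ T β t) where
   same : ∀ j i -> j N.< s -> coef (elt α j) i ≡ coef (elt β j) i
   same j i j< with i N.<? Iw
   ... | no ¬i< = trans (Bd-elt α j i j< big) (sym (Bd-elt β j i j< big))
    where
    big : s N.* Iw N.≤ wt j i
    big = ≤∙ (*-monoʳ-≤ s (≮⇒≥ ¬i<)) (m≤m+n _ _)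
   ... | yes i< = trans (sym (at α)) (trans (eq (combine (fromℕ< j<) (fromℕ< i<))) (at β))
    where
    at : ∀ α -> T α (combine (fromℕ< j<) (fromℕ< i<)) ≡ coef (elt α j) i
    at α = trans (cong (\ z -> coef (elt α (toℕ (proj₁ z))) (toℕ (proj₂ z))) (Finₚ.remQuot-combine {s} {Iw} (fromℕ< j<) (fromℕ< i<)))
     (cong₂ (\ a b -> coef (elt α a) b) (Finₚ.toℕ-fromℕ< j<) (Finₚ.toℕ-fromℕ< i<))
   jets : All (\ P -> evS (Ω M pts (lα α)) P ≡[ M ] evS (Ω M pts (lα β)) P) pts
   jets = All.map {P = \ P -> evS G P ≡[ M ] const 0#} {Q = \ P -> evS (Ω M pts (lα α)) P ≡[ M ] evS (Ω M pts (lα β)) P}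
    (\ {P} v {k} k< -> trans (sym (drop α P (\ {l} -> v {l}) k<)) (trans (AtS.evE-ext P (elt α) (elt β) same k) (drop β P (\ {l} -> v {l}) k<))) van
    where
    drop : ∀ α P -> evS G P ≡[ M ] const 0# -> evS (elt α) P ≡[ M ] evS (Ω M pts (lα α)) P
    drop α P v {k} k< = trans (AtS.evE-∔ P (Ω M pts (lα α)) (rα α ⋆ G) k) (trans (cong (evS (Ω M pts (lα α)) P k +_) (trans (AtS.evE-⋆ P (rα α) G k) (trans (ord-absorb (evS (rα α) P) v k<) (const0≡0 k)))) (+-identityʳ _))
   l≡ : ∀ t k -> t N.< length pts -> k N.< M -> lα α t k ≡ lα β t k
   l≡ = Ω-injective M pts dist (lα α) (lα β) jets
   diff : E
   diff = rα α ∔ smul m1 (rα β)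
   diff-zero : Zero (diff ⋆ G)
   diff-zero j i j< = trans (⋆-sub (rα α) (rα β) G j i) (trans (coef-∔ (rα α ⋆ G) (smul m1 (rα β ⋆ G)) j i) (trans (cong (coef ((rα α ⋆ G) j) i +_) (coef-smul m1 (rα β ⋆ G) j i))
     (trans (cong (\ z -> z + m1 * coef ((rα β ⋆ G) j) i) r≡) (trans (solve 2 (\ o x -> x :+ (:- o) :* x := x :- o :* x) refl 1# (coef ((rα β ⋆ G) j) i)) (≡-sub (sym (*-identityˡ _)))))))
    where
    r≡ : coef ((rα α ⋆ G) j) i ≡ coef ((rα β ⋆ G) j) i
    r≡ = trans (solve 2 (\ a b -> b := (a :+ b) :- a) refl (coef (Ω M pts (lα α) j) i) (coef ((rα α ⋆ G) j) i))
     (trans (cong₂ _-_ (trans (sym (coef-∔ (Ω M pts (lα α)) (rα α ⋆ G) j i)) (trans (same j i j<) (coef-∔ (Ω M pts (lα β)) (rα β ⋆ G) j i))) (Ω-cong M pts (lα α) (lα β) l≡ j i))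
      (solve 2 (\ a b -> (a :+ b) :- a := b) refl (coef (Ω M pts (lα β) j) i) (coef ((rα β ⋆ G) j) i)))
   diff≡0 : Zero diff
   diff≡0 with has-bound diff
   ... | B , b with zero-or-lead B diff b
   ... | inj₁ z = z
   ... | inj₂ (n , ld) = ⊥-elim (Lead-nonzero {a = diff ⋆ G} (Lead-⋆ {a = diff} {G} ld lead) diff-zero)
   T-inj : ∀ i -> α i ≡ β i
   T-inj i with splitAt NM i in e
   ... | inj₁ tk = trans (cong α (sym i≡)) (trans (trans (sym (at α)) (trans (l≡ (toℕ t) (toℕ k) (Finₚ.toℕ<n t) (Finₚ.toℕ<n k)) (at β))) (cong β i≡))
    where
    t = proj₁ (remQuot {length pts} M tk)
    k = proj₂ (remQuot {length pts} M tk)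
    i≡ : combine t k ↑ˡ (s N.* Ir) ≡ i
    i≡ = trans (cong (_↑ˡ (s N.* Ir)) (Finₚ.combine-remQuot {length pts} M tk)) (Finₚ.splitAt⁻¹-↑ˡ e)
    at : ∀ α -> lα α (toℕ t) (toℕ k) ≡ α (combine t k ↑ˡ (s N.* Ir))
    at α = trans (ext-toℕ _ t) (ext-toℕ _ k)
   ... | inj₂ ji = trans (cong α (sym i≡)) (trans (trans (sym (at α)) (trans req (at β))) (cong β i≡))
    where
    j = proj₁ (remQuot {s} Ir ji)
    k = proj₂ (remQuot {s} Ir ji)
    i≡ : NM ↑ʳ combine j k ≡ i
    i≡ = trans (cong (NM ↑ʳ_) (Finₚ.combine-remQuot {s} Ir ji)) (Finₚ.splitAt⁻¹-↑ʳ e)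
    at : ∀ α -> coef (rα α (toℕ j)) (toℕ k) ≡ α (NM ↑ʳ combine j k)
    at α = trans (coef-lst Ir _ (toℕ k) (Finₚ.toℕ<n k)) (trans (ext-toℕ _ j) (ext-toℕ _ k))
    req : coef (rα α (toℕ j)) (toℕ k) ≡ coef (rα β (toℕ j)) (toℕ k)
    req = sub-≡ (trans (sym (trans (coef-∔ (rα α) (smul m1 (rα β)) (toℕ j) (toℕ k)) (cong (coef (rα α (toℕ j)) (toℕ k) +_) (trans (coef-smul m1 (rα β) (toℕ j) (toℕ k)) (trans (solve 2 (\ o x -> (:- o) :* x := :- (o :* x)) refl 1# _) (cong -_ (*-identityˡ _))))))) (diff≡0 (toℕ j) (toℕ k) (Finₚ.toℕ<n j)))

-- Stepanov's auxiliary function.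

module Stepanov (𝔽 : FiniteField) (s0 : ℕ) (ρ : ℕ -> List (FiniteField.F 𝔽))
  (ρ-Bd : Rows.Bd 𝔽 s0 ρ (suc (suc s0 N.* suc (suc s0))) ρ)
  (κ≢0 : ¬ PolyEval.coef 𝔽 (ρ 0) (suc (suc s0)) ≡ FiniteField.0# 𝔽) where
 open import Data.Nat using (pred)
 open ≡
 open Fld 𝔽
 open Ser 𝔽
 open Poly 𝔽
 open Frob 𝔽
 open Pigeon 𝔽
 open Weights 𝔽 s0 ρ ρ-Bd κ≢0 public
 open ZeroBound 𝔽 s0 ρ ρ-Bd κ≢0 public
 open Filtration κ

 Filt-∑ : ∀ {w} n {f : ℕ -> Pt -> Ser} -> (∀ t -> t N.< n -> Filt w (f t)) -> Filt w (\ P -> RS.∑ n (\ t -> f t P))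
 Filt-∑ zero h = Filt-0
 Filt-∑ (suc n) h = Filt-+ (Filt-∑ n (\ t t< -> h t (m<n⇒m<1+n t<))) (h n (n<1+n n))

 V-∑ : ∀ {w} n {f : ℕ -> Pt -> F} -> (∀ t -> t N.< n -> V w (f t)) -> V w (\ P -> RF.∑ n (\ t -> f t P))
 V-∑ zero h = V-0
 V-∑ (suc n) {f} h = V-+ {f = \ P -> RF.∑ n (\ t -> f t P)} {f n} (V-∑ n (\ t t< -> h t (m<n⇒m<1+n t<))) (h n (n<1+n n))

 V-pow : ∀ {w f} n -> V w f -> V (w N.* n) (\ P -> RF.pow (f P) n)
 V-pow {w} {f} zero h = V-mono {f = \ _ -> 1#} z≤n V-one
 V-pow {w} {f} (suc n) h = V-mono {f = \ P -> f P * RF.pow (f P) n} (≡⇒≤ (sym (*-suc w n))) (V-* {f = f} {\ P -> RF.pow (f P) n} h (V-pow n h))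

 ext-sub : ∀ {n} (f g : Fin n -> F) k -> ext (\ i -> f i - g i) k ≡ ext f k - ext g k
 ext-sub {n} f g k with k N.<? n
 ... | yes _ = refl
 ... | no _ = sym (-‿inverseʳ 0#)

 pow≈^ˢ : ∀ x n -> RS.pow x n ≈ x ^ˢ n
 pow≈^ˢ x zero = \ _ -> refl
 pow≈^ˢ x (suc n) = R.*-congˡ {x = x} (pow≈^ˢ x n)

 pow-mul : ∀ x m n -> RS.pow x (m N.* n) ≈ RS.pow (RS.pow x m) n
 pow-mul x m zero = \ k -> cong (\ t -> RS.pow x t k) (*-zeroʳ m)
 pow-mul x m (suc n) = R.trans (\ k -> cong (\ t -> RS.pow x t k) (*-suc m n)) (R.trans (RS.pow-+ x m (m N.* n)) (R.*-congˡ {x = RS.pow x m} (pow-mul x m n)))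

 pow-[] : ∀ {n a b} k -> a ≡[ n ] b -> RS.pow a k ≡[ n ] RS.pow b k
 pow-[] zero p = \ _ -> refl
 pow-[] {n} {a} {b} (suc k) p = ≡[]-* {n} {a} {b} {RS.pow a k} {RS.pow b k} p (pow-[] {n} {a} {b} k p)

 pow-const : ∀ x n -> RS.pow (const x) n ≈ const (RF.pow x n)
 pow-const x zero = \ _ -> refl
 pow-const x (suc n) = R.trans (R.*-congˡ {x = const x} (pow-const x n)) (R.sym (const-* x (RF.pow x n)))

 -- X^q begins at u^q, so modulo u^q the q-th power of c + X is the constant c. Taylor coefficients
 -- of order below q thus treat x^q and v^q as constants.
 frob-trunc : ∀ X c -> X 0 ≡ 0# -> RS.pow (const c +ˢ X) q ≡[ q ] const c
 frob-trunc X c e {k} k< = trans (R.trans (pow≈^ˢ (const c +ˢ X) q) (R.trans (^-cong q (R.+-comm (const c) X)) (frobenius-series X c)) k)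
   (trans (cong (_+ const c k) (trans (sym (pow≈^ˢ X q k)) (trans (ord-pow q e k<) (const0≡0 k)))) (+-identityˡ _))
  where
  ^-cong : ∀ n {x y} -> x ≈ y -> x ^ˢ n ≈ y ^ˢ n
  ^-cong zero e = \ _ -> refl
  ^-cong (suc n) {x} {y} e = R.*-cong {x} {y} e (^-cong n e)

 x̂-frob : ∀ P i -> RS.pow (Loc.x̂ P) (q N.* i) ≡[ q ] const (RF.pow (Pt.x0 P) i)
 x̂-frob P i {k} k< = trans (pow-mul (Loc.x̂ P) q i k) (trans (pow-[] {q} {RS.pow (Loc.x̂ P) q} {const (Pt.x0 P)} i (frob-trunc (Loc.ω P) (Pt.x0 P) (u*-zero (const (Loc.η P * Loc.η P)))) k<) (pow-const (Pt.x0 P) i k))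

 v̂-frob : ∀ P j -> RS.pow (Loc.v̂ P) (q N.* j) ≡[ q ] const (RF.pow (Pt.vo P) j)
 v̂-frob P j {k} k< = trans (pow-mul (Loc.v̂ P) q j k) (trans (pow-[] {q} {RS.pow (Loc.v̂ P) q} {const (Pt.vo P)} j (frob-trunc (Loc.ν P (Loc.ψ P)) (Pt.vo P) (u*-zero (const (Loc.η P) *ˢ Loc.ψ P))) k<) (pow-const (Pt.vo P) j k))

 ∑-[] : ∀ {n} N {f g : ℕ -> Ser} -> (∀ t -> t N.< N -> f t ≡[ n ] g t) -> RS.∑ N f ≡[ n ] RS.∑ N g
 ∑-[] zero e k< = refl
 ∑-[] (suc N) e k< = cong₂ _+_ (∑-[] N (\ t t< -> e t (m<n⇒m<1+n t<)) k<) (e N (n<1+n N) k<)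

 ∑-coef : ∀ N (f : ℕ -> Ser) k -> RS.∑ N f k ≡ RF.∑ N (\ t -> f t k)
 ∑-coef zero f k = const0≡0 k
 ∑-coef (suc N) f k = cong (_+ f N k) (∑-coef N f k)

 -- M is the order of vanishing, ℓ the x-length of the coefficients A, m the number of exponents i
 -- in x^(q i), and I the x-length of the space containing the vanishing conditions. `small` keeps
 -- the weights of the A below q, so that different blocks cannot cancel; `room` makes the
 -- conditions fit; `many` leaves more unknowns than conditions.
 module Construct (M ℓ m I : ℕ) (M≤q : M N.≤ q) (small : s N.* ℓ N.+ suc s N.* s N.≤ q)
  (room : suc ((s N.* ℓ N.+ suc s N.* s N.+ κ N.* M) N.+ (suc s N.* s N.+ s N.* m)) N.≤ s N.* I)
  (many : M N.* (s N.* I) N.< (s N.* ℓ) N.* (s N.* m)) where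

  U N : ℕ
  U = (s N.* ℓ) N.* (s N.* m)
  N = (s N.* ℓ N.+ suc s N.* s N.+ κ N.* M) N.+ (suc s N.* s N.+ s N.* m)

  cf : (Fin U -> F) -> ℕ -> ℕ -> ℕ -> ℕ -> F
  cf α j i j' i' = ext {s} (\ j -> ext {ℓ} (\ i -> ext {s} (\ j' -> ext {m} (\ i' -> α (combine {s N.* ℓ} {s N.* m} (combine j i) (combine j' i'))) i') j') i) j

  A : (Fin U -> F) -> ℕ -> ℕ -> E
  A α j' i' j = lst ℓ (\ i -> cf α j i j' i')

  -- The k-th Taylor coefficient at P of the auxiliary function for k < q, after the q-th powers
  -- have been replaced by the coordinates of P. It is a polynomial function of P of bounded weight,
  -- so its vanishing at all points follows from finitely many equations independent of P.
  b : (Fin U -> F) -> ℕ -> Pt -> F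
  b α k P = RF.∑ s (\ j' -> RF.∑ m (\ i' -> RF.pow (Pt.vo P) j' * (RF.pow (Pt.x0 P) i' * evS (A α j' i') P k)))

  abstract
   Filt-A : ∀ α j' i' -> Filt (s N.* ℓ N.+ suc s N.* s) (evS (A α j' i'))
   Filt-A α j' i' = Filt-∑ s (\ j j< -> Filt-mono (+-mono-≤ (≡⇒≤ (cong (s N.*_) (length-lst ℓ _))) (*-monoʳ-≤ (suc s) (<⇒≤ j<)))
    (Filt-* (Filt-hev {x = Loc.x̂} {w = Loc.ω} Filt-x̂ (A α j' i' j)) (Filt-pow j Filt-v̂)))

  abstract
   V-b : ∀ α k -> k N.< M -> V N (b α k)
   V-b α k k< = V-∑ s {\ j' P -> RF.∑ m (\ i' -> RF.pow (Pt.vo P) j' * (RF.pow (Pt.x0 P) i' * evS (A α j' i') P k))} (\ j' j'< -> V-∑ m {\ i' P -> RF.pow (Pt.vo P) j' * (RF.pow (Pt.x0 P) i' * evS (A α j' i') P k)} (\ i' i'< ->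
     V-mono {f = \ P -> RF.pow (Pt.vo P) j' * (RF.pow (Pt.x0 P) i' * evS (A α j' i') P k)} (le j' i' j'< i'<) (V-* {f = \ P -> RF.pow (Pt.vo P) j'} {\ P -> RF.pow (Pt.x0 P) i' * evS (A α j' i') P k} (V-pow j' V-v)
      (V-* {f = \ P -> RF.pow (Pt.x0 P) i'} {\ P -> evS (A α j' i') P k} (V-pow i' V-x) (at (Filt-A α j' i') k)))))
    where
    le : ∀ j' i' -> j' N.< s -> i' N.< m -> suc s N.* j' N.+ (s N.* i' N.+ (s N.* ℓ N.+ suc s N.* s N.+ κ N.* k)) N.≤ N
    le j' i' j'< i'< = ≤∙ (+-mono-≤ (*-monoʳ-≤ (suc s) (<⇒≤ j'<)) (+-mono-≤ (*-monoʳ-≤ s (<⇒≤ i'<)) (+-monoʳ-≤ (s N.* ℓ N.+ suc s N.* s) (*-monoʳ-≤ κ (<⇒≤ k<)))))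
     (≡⇒≤ (eq (suc s N.* s) (s N.* m) (s N.* ℓ N.+ suc s N.* s N.+ κ N.* M)))
     where
     eq : ∀ a b c -> a N.+ (b N.+ c) ≡ c N.+ (a N.+ b)
     eq = solve-∀

  T : (Fin U -> F) -> Fin (M N.* (s N.* I)) -> F
  T α t = coef (proj₁ (V-b α (toℕ k) (Finₚ.toℕ<n k)) (toℕ (proj₁ ji))) (toℕ (proj₂ ji))
   where
   k : Fin M
   k = proj₁ (remQuot {M} (s N.* I) t)
   ji : Fin s × Fin I
   ji = remQuot {s} I (proj₂ (remQuot {M} (s N.* I) t))

  T-b : ∀ α β -> (∀ t -> T α t ≡ T β t) -> ∀ (k : Fin M) P -> b α (toℕ k) P ≡ b β (toℕ k) P
  T-b α β eq k P = trans (proj₂ (proj₂ (Vα α)) P) (trans (AtF.evE-ext P (proj₁ (Vα α)) (proj₁ (Vα β)) same) (sym (proj₂ (proj₂ (Vα β)) P)))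
   where
   Vα : ∀ α -> V N (b α (toℕ k))
   Vα α = V-b α (toℕ k) (Finₚ.toℕ<n k)
   same : ∀ j i -> j N.< s -> coef (proj₁ (Vα α) j) i ≡ coef (proj₁ (Vα β) j) i
   same j i j< with i N.<? I
   ... | no ¬i< = trans (proj₁ (proj₂ (Vα α)) j i j< big) (sym (proj₁ (proj₂ (Vα β)) j i j< big))
    where
    big : suc N N.≤ wt j i
    big = ≤∙ room (≤∙ (*-monoʳ-≤ s (≮⇒≥ ¬i<)) (m≤m+n _ _))
   ... | yes i< = trans (sym (pos α)) (trans (eq t) (pos β))
    where
    t : Fin (M N.* (s N.* I))
    t = combine k (combine (fromℕ< j<) (fromℕ< i<))
    r1 : remQuot {M} (s N.* I) t ≡ (k , combine (fromℕ< j<) (fromℕ< i<))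
    r1 = Finₚ.remQuot-combine {M} {s N.* I} k (combine (fromℕ< j<) (fromℕ< i<))
    pos : ∀ α -> T α t ≡ coef (proj₁ (Vα α) j) i
    pos α = trans (cong (\ z -> coef (proj₁ (V-b α (toℕ (proj₁ z)) (Finₚ.toℕ<n (proj₁ z))) (toℕ (proj₁ (remQuot {s} I (proj₂ z))))) (toℕ (proj₂ (remQuot {s} I (proj₂ z))))) r1)
     (trans (cong (\ z -> coef (proj₁ (Vα α) (toℕ (proj₁ z))) (toℕ (proj₂ z))) (Finₚ.remQuot-combine {s} {I} (fromℕ< j<) (fromℕ< i<)))
      (cong₂ (\ x y -> coef (proj₁ (Vα α) x) y) (Finₚ.toℕ-fromℕ< j<) (Finₚ.toℕ-fromℕ< i<)))

  cf-sub : ∀ α β j i j' i' -> cf (\ t -> α t - β t) j i j' i' ≡ cf α j i j' i' - cf β j i j' i'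
  cf-sub α β j i j' i' = trans (ext-cong {s} (\ jf -> trans (ext-cong {ℓ} (\ if -> trans (ext-cong {s} (\ jf' -> ext-sub {m} _ _ i') j') (ext-sub {s} _ _ j')) i) (ext-sub {ℓ} _ _ i)) j) (ext-sub {s} _ _ j)

  b-sub : ∀ α β k P -> b (\ t -> α t - β t) k P ≡ b α k P - b β k P
  b-sub α β k P = trans (RF.∑-cong s (\ j' _ -> trans (RF.∑-cong m (\ i' _ -> trans (cong (\ t -> RF.pow (Pt.vo P) j' * (RF.pow (Pt.x0 P) i' * t)) (ev-sub j' i'))
     (solve 4 (\ v x a c -> v :* (x :* (a :- c)) := v :* (x :* a) :+ :- (v :* (x :* c))) refl (RF.pow (Pt.vo P) j') (RF.pow (Pt.x0 P) i') (evS (A α j' i') P k) (evS (A β j' i') P k)))) (sub-∑ m _ _))) (sub-∑ s _ _)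
   where
   sub-∑ : ∀ n (f g : ℕ -> F) -> RF.∑ n (\ t -> f t - g t) ≡ RF.∑ n f - RF.∑ n g
   sub-∑ zero f g = sym (-‿inverseʳ 0#)
   sub-∑ (suc n) f g = trans (cong (_+ (f n - g n)) (sub-∑ n f g)) (solve 4 (\ a b c d -> (a :- b) :+ (c :- d) := (a :+ c) :- (b :+ d)) refl _ _ _ _)
   ev-sub : ∀ j' i' -> evS (A (\ t -> α t - β t) j' i') P k ≡ evS (A α j' i') P k - evS (A β j' i') P k
   ev-sub j' i' = trans (AtS.evE-ext P (A (\ t -> α t - β t) j' i') (A α j' i' ∔ smul m1 (A β j' i')) coefs k)
    (trans (AtS.evE-∔ P (A α j' i') (smul m1 (A β j' i')) k) (cong (evS (A α j' i') P k +_) (AtS.evE-neg P (A β j' i') k)))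
    where
    coefs : ∀ j i -> j N.< s -> coef (A (\ t -> α t - β t) j' i' j) i ≡ coef ((A α j' i' ∔ smul m1 (A β j' i')) j) i
    coefs j i j< = trans (lhs i) (sym (trans (coef-∔ (A α j' i') (smul m1 (A β j' i')) j i) (cong (coef (A α j' i' j) i +_) (trans (coef-smul m1 (A β j' i') j i) (trans (solve 2 (\ o x -> (:- o) :* x := :- (o :* x)) refl 1# _) (cong -_ (*-identityˡ _)))))))
     where
     lhs : ∀ i -> coef (A (\ t -> α t - β t) j' i' j) i ≡ coef (A α j' i' j) i - coef (A β j' i' j) i
     lhs i with i N.<? ℓ
     ... | yes i< = trans (coef-lst ℓ _ i i<) (trans (cf-sub α β j i j' i') (cong₂ _-_ (sym (coef-lst ℓ _ i i<)) (sym (coef-lst ℓ _ i i<))))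
     ... | no ¬i< = trans (coef-lst-≥ ℓ _ i (≮⇒≥ ¬i<)) (trans (sym (-‿inverseʳ 0#)) (cong₂ _-_ (sym (coef-lst-≥ ℓ _ i (≮⇒≥ ¬i<))) (sym (coef-lst-≥ ℓ _ i (≮⇒≥ ¬i<)))))

  abstract
   hit : ∃₂ \ (α β : Fin U -> F) -> (∃ \ t -> ¬ α t ≡ β t) × (∀ t -> T α t ≡ T β t)
   hit = collision many T

   solution : ∃ \ (δ : Fin U -> F) -> (∃ \ t -> ¬ δ t ≡ 0#) × (∀ k P -> k N.< M -> b δ k P ≡ 0#)
   solution = δ0 , (proj₁ (proj₁ (proj₂ (proj₂ hit))) , \ e -> proj₂ (proj₁ (proj₂ (proj₂ hit))) (sub-≡ e)) , \ k P k< -> trans (b-sub (proj₁ hit) (proj₁ (proj₂ hit)) k P)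
     (≡-sub (subst (\ z -> b (proj₁ hit) z P ≡ b (proj₁ (proj₂ hit)) z P) (Finₚ.toℕ-fromℕ< k<) (T-b (proj₁ hit) (proj₁ (proj₂ hit)) (proj₂ (proj₂ (proj₂ hit))) (fromℕ< k<) P)))
    where
    δ0 : Fin U -> F
    δ0 t = proj₁ hit t - proj₁ (proj₂ hit) t

  δ : Fin U -> F
  δ = proj₁ solution

  abstract
   Bd-A : ∀ j' i' -> Bd q (A δ j' i')
   Bd-A j' i' j i j< h = coef-lst-≥ ℓ _ i (≮⇒≥ (\ i< -> <⇒≱ (<-≤-trans (+-mono-<-≤ (*-monoʳ-< s i<) (*-monoʳ-≤ (suc s) (<⇒≤ j<))) small) h))

  abstract
   lead? : ∀ j' i' -> Zero (A δ j' i') ⊎ ∃ \ n -> Lead n (A δ j' i')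
   lead? j' i' = zero-or-lead q (A δ j' i') (Bd-A j' i')

  toFlag : ∀ {X Y : Set} -> X ⊎ Y -> F
  toFlag (inj₁ _) = 0#
  toFlag (inj₂ _) = 1#

  flag : ℕ -> ℕ -> F
  flag j' i' = toFlag (lead? j' i')

  toFlag-0 : ∀ {X Y : Set} (d : X ⊎ Y) -> toFlag d ≡ 0# -> X
  toFlag-0 (inj₁ z) _ = z
  toFlag-0 (inj₂ _) e = ⊥-elim (0≢1 (sym e))

  toFlag-1 : ∀ {X Y : Set} (d : X ⊎ Y) -> ¬ toFlag d ≡ 0# -> Y
  toFlag-1 (inj₁ _) ne = ⊥-elim (ne refl)
  toFlag-1 (inj₂ l) _ = l

  flag-0 : ∀ j' i' -> flag j' i' ≡ 0# -> Zero (A δ j' i')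
  flag-0 j' i' = toFlag-0 (lead? j' i')

  flag-1 : ∀ j' i' -> ¬ flag j' i' ≡ 0# -> ∃ \ n -> Lead n (A δ j' i')
  flag-1 j' i' = toFlag-1 (lead? j' i')

  -- Marks which blocks A are nonzero, encoded as an element of the coordinate ring so that
  -- `zero-or-lead` selects the nonzero block whose monomial has the largest weight.
  flags : E
  flags j' = lst m (flag j')

  flags-nonzero : ¬ Zero flags
  flags-nonzero z with proj₁ (proj₂ solution)
  ... | t , ne = ne (trans (sym (trans (at1 j) (trans (at1 i) (trans (at1 j') (trans (at1 i') (cong δ t≡)))))) (trans (sym (coef-lst ℓ _ (toℕ i) (Finₚ.toℕ<n i))) (flag-0 (toℕ j') (toℕ i') (trans (sym (coef-lst m (flag (toℕ j')) (toℕ i') (Finₚ.toℕ<n i'))) (z (toℕ j') (toℕ i') (Finₚ.toℕ<n j'))) (toℕ j) (toℕ i) (Finₚ.toℕ<n j))))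
   where
   at1 : ∀ {n} {f : Fin n -> F} i -> ext f (toℕ i) ≡ f i
   at1 {f = f} i = ext-toℕ f i
   p = remQuot {s N.* ℓ} (s N.* m) t
   j = proj₁ (remQuot {s} ℓ (proj₁ p))
   i = proj₂ (remQuot {s} ℓ (proj₁ p))
   j' = proj₁ (remQuot {s} m (proj₂ p))
   i' = proj₂ (remQuot {s} m (proj₂ p))
   t≡ : combine {s N.* ℓ} {s N.* m} (combine j i) (combine j' i') ≡ t
   t≡ = trans (cong₂ combine (Finₚ.combine-remQuot {s} ℓ (proj₁ p)) (Finₚ.combine-remQuot {s} m (proj₂ p))) (Finₚ.combine-remQuot {s N.* ℓ} (s N.* m) t)

  G : E
  G = gsum q m (A δ)

  -- The monomials v^(q j) x^(q i) have weights that are distinct multiples of q, while each A has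
  -- weight below q. The block selected by `flags` therefore dominates all others, and G is not
  -- zero.
  G-lead : ∃ \ g -> Lead g G × g N.≤ q N.* (s N.* m N.+ suc s N.* s)
  G-lead with has-bound flags
  ... | B , bd with zero-or-lead B flags bd
  ... | inj₁ z = ⊥-elim (flags-nonzero z)
  ... | inj₂ (μ , fb , j0 , i0 , j0< , e , ne) = ℓ0 N.+ q N.* wt j0 i0 , Lead-gsum q m (A δ) j0 i0 ℓ0 j0< i0< (proj₂ ld) others , bound
   where
   i0< : i0 N.< m
   i0< = ≰⇒> (\ h -> ne (coef-lst-≥ m (flag j0) i0 h))
   ld : ∃ \ n -> Lead n (A δ j0 i0)
   ld = flag-1 j0 i0 (\ z -> ne (trans (coef-lst m (flag j0) i0 i0<) z))
   ℓ0 : ℕ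
   ℓ0 = proj₁ ld
   ℓ0<q : ℓ0 N.< q
   ℓ0<q with proj₂ (proj₂ ld)
   ... | j , i , j< , e' , ne' = ≰⇒> (\ h -> ne' (Bd-A j0 i0 j i j< (≤∙ h (≡⇒≤ (sym e')))))
   others : ∀ j i -> j N.< s -> i N.< m -> ¬ (j ≡ j0 × i ≡ i0) -> Small (ℓ0 N.+ q N.* wt j0 i0) q (A δ) j i
   others j i j< i< d with flag j i ≟ 0#
   ... | yes z = inj₁ (flag-0 j i z)
   ... | no nz = inj₂ (q , Bd-A j i , ≤∙ (≡⇒≤ (sym (*-suc q (wt j i)))) (≤∙ (*-monoʳ-≤ q lt) (m≤n+m _ ℓ0)))
    where
    lt : wt j i N.< wt j0 i0
    lt = ≤∧≢⇒< (≮⇒≥ (\ h -> nz (trans (sym (coef-lst m (flag j) i i<)) (fb j i j< (subst (N._< wt j i) e h))))) (\ same -> d (wt-inj {j} {i} {j0} {i0} j< j0< same))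
   bound : ℓ0 N.+ q N.* wt j0 i0 N.≤ q N.* (s N.* m N.+ suc s N.* s)
   bound = ≤∙ (+-monoˡ-≤ _ (<⇒≤ ℓ0<q)) (≤∙ (≡⇒≤ (sym (*-suc q (wt j0 i0)))) (*-monoʳ-≤ q (+-mono-<-≤ (*-monoʳ-< s i0<) (*-monoʳ-≤ (suc s) (<⇒≤ j0<)))))

  G-vanishes : ∀ P -> evS G P ≡[ M ] const 0#
  G-vanishes P {k} k< = trans (AtS.evE-gsum P q m (A δ) k) (trans (trunc (<-≤-trans k< M≤q)) (trans (trans (∑-coef s _ k) (RF.∑-cong s (\ j _ -> trans (∑-coef m _ k) (RF.∑-cong m (\ i _ -> cf-eq j i)))))
    (trans (proj₂ (proj₂ solution) k P k<) (sym (const0≡0 k)))))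
   where
   trunc : RS.∑ s (\ j -> RS.∑ m (\ i -> RS.pow (Loc.v̂ P) (q N.* j) *ˢ (RS.pow (Loc.x̂ P) (q N.* i) *ˢ evS (A δ j i) P)))
       ≡[ q ] RS.∑ s (\ j -> RS.∑ m (\ i -> const (RF.pow (Pt.vo P) j) *ˢ (const (RF.pow (Pt.x0 P) i) *ˢ evS (A δ j i) P)))
   trunc = ∑-[] s {\ j -> RS.∑ m (\ i -> RS.pow (Loc.v̂ P) (q N.* j) *ˢ (RS.pow (Loc.x̂ P) (q N.* i) *ˢ evS (A δ j i) P))} {\ j -> RS.∑ m (\ i -> const (RF.pow (Pt.vo P) j) *ˢ (const (RF.pow (Pt.x0 P) i) *ˢ evS (A δ j i) P))}
    (\ j _ -> ∑-[] m {\ i -> RS.pow (Loc.v̂ P) (q N.* j) *ˢ (RS.pow (Loc.x̂ P) (q N.* i) *ˢ evS (A δ j i) P)} {\ i -> const (RF.pow (Pt.vo P) j) *ˢ (const (RF.pow (Pt.x0 P) i) *ˢ evS (A δ j i) P)}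
     (\ i _ -> ≡[]-* {q} {RS.pow (Loc.v̂ P) (q N.* j)} {const (RF.pow (Pt.vo P) j)} {RS.pow (Loc.x̂ P) (q N.* i) *ˢ evS (A δ j i) P} {const (RF.pow (Pt.x0 P) i) *ˢ evS (A δ j i) P} (v̂-frob P j)
      (≡[]-* {q} {RS.pow (Loc.x̂ P) (q N.* i)} {const (RF.pow (Pt.x0 P) i)} {evS (A δ j i) P} {evS (A δ j i) P} (x̂-frob P i) (\ _ -> refl))))
   cf-eq : ∀ j i -> (const (RF.pow (Pt.vo P) j) *ˢ (const (RF.pow (Pt.x0 P) i) *ˢ evS (A δ j i) P)) k ≡ RF.pow (Pt.vo P) j * (RF.pow (Pt.x0 P) i * evS (A δ j i) P k)
   cf-eq j i = trans (const-*ˡ _ (const (RF.pow (Pt.x0 P) i) *ˢ evS (A δ j i) P) k) (cong (RF.pow (Pt.vo P) j *_) (const-*ˡ _ (evS (A δ j i) P) k))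

  points-bound : ∀ pts -> AllPairs Differ pts -> length pts N.* M N.≤ q N.* (s N.* m N.+ suc s N.* s) N.+ (s N.+ suc s N.* s)
  points-bound pts d = ≤∙ (zero-bound G (proj₁ (proj₂ G-lead)) M pts d (All.universal {P = \ P -> evS G P ≡[ M ] const 0#} (\ P {k} -> G-vanishes P {k}) pts))
   (+-monoˡ-≤ _ (proj₂ (proj₂ G-lead)))

-- Choice of parameters.

module Params (𝔽 : FiniteField) (s0 : ℕ) (ρ : ℕ -> List (FiniteField.F 𝔽))
  (ρ-Bd : Rows.Bd 𝔽 s0 ρ (suc (suc s0 N.* suc (suc s0))) ρ)
  (κ≢0 : ¬ PolyEval.coef 𝔽 (ρ 0) (suc (suc s0)) ≡ FiniteField.0# 𝔽) where
 open import Data.Nat.DivMod using (_/_; m/n*n≤m; m≡m%n+[m/n]*n; m%n<n)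
 open ≡
 open Fld 𝔽
 open StepConst
 open Stepanov 𝔽 s0 ρ ρ-Bd κ≢0 public

 private
  module Choice (K r Q : ℕ) (κ≤ : κ N.≤ K) (r²≤ : r N.* r N.≤ Q) (large : radius s K N.≤ r) where
   -- ℓ is about half of q / s, which keeps weights below q. M = s r and m = r + B almost balance
   -- unknowns against conditions, the surplus B tipping the balance. The number of points is then
   -- at most about q m s / M = q + O(q / r).
   B ℓ m I M Y : ℕ
   B = slack s K
   ℓ = Q / (2 N.* s)
   m = r N.+ B
   M = s N.* r
   Y = (r N.+ B) N.+ (2 N.* suc s N.+ 1 N.+ κ N.* M)
   I = ℓ N.+ Y

   1≤r : 1 N.≤ r
   1≤r = ≤∙ (m≤n+m 1 (s N.* slack s K N.+ s N.* (2 N.* suc s N.+ 1) N.+ 4 N.* s)) large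

   4s≤r : 4 N.* s N.≤ r
   4s≤r = ≤∙ (≤∙ (m≤n+m (4 N.* s) (s N.* slack s K N.+ s N.* (2 N.* suc s N.+ 1))) (m≤m+n _ 1)) large

   r*≤Q : ∀ {k} -> k N.≤ r -> k N.* r N.≤ Q
   r*≤Q k≤ = ≤∙ (*-monoˡ-≤ r k≤) r²≤

   r≤Q : r N.≤ Q
   r≤Q = ≤∙ (≡⇒≤ (sym (NP.*-identityˡ r))) (r*≤Q 1≤r)

   2sℓ≤Q : 2 N.* (s N.* ℓ) N.≤ Q
   2sℓ≤Q = ≤∙ (≡⇒≤ (eq s ℓ)) (m/n*n≤m Q (2 N.* s))
    where
    eq : ∀ s ℓ -> 2 N.* (s N.* ℓ) ≡ ℓ N.* (2 N.* s)
    eq = solve-∀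

   Q≤4sℓ : Q N.≤ 4 N.* (s N.* ℓ)
   Q≤4sℓ = +-cancelˡ-≤ Q _ _ (begin
    Q N.+ Q ≡⟨ cong₂ N._+_ div div ⟩
    (ρ' N.+ ℓ N.* (2 N.* s)) N.+ (ρ' N.+ ℓ N.* (2 N.* s)) ≡⟨ eq ρ' ℓ s ⟩
    2 N.* ρ' N.+ 4 N.* (s N.* ℓ) ≤⟨ +-monoˡ-≤ (4 N.* (s N.* ℓ)) (*-monoʳ-≤ 2 (<⇒≤ (m%n<n Q (2 N.* s)))) ⟩
    2 N.* (2 N.* s) N.+ 4 N.* (s N.* ℓ) ≡⟨ cong (N._+ 4 N.* (s N.* ℓ)) (sym (NP.*-assoc 2 2 s)) ⟩
    4 N.* s N.+ 4 N.* (s N.* ℓ) ≤⟨ +-monoˡ-≤ (4 N.* (s N.* ℓ)) (≤∙ 4s≤r r≤Q) ⟩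
    Q N.+ 4 N.* (s N.* ℓ) ∎)
    where
    open NP.≤-Reasoning
    ρ' : ℕ
    ρ' = Q N.% (2 N.* s)
    div : Q ≡ ρ' N.+ ℓ N.* (2 N.* s)
    div = m≡m%n+[m/n]*n Q (2 N.* s)
    eq : ∀ p l s -> (p N.+ l N.* (2 N.* s)) N.+ (p N.+ l N.* (2 N.* s)) ≡ 2 N.* p N.+ 4 N.* (s N.* l)
    eq = solve-∀

   M≤Q : M N.≤ Q
   M≤Q = r*≤Q (≤∙ (m≤n*m s 4) 4s≤r)

   small : s N.* ℓ N.+ suc s N.* s N.≤ Q
   small = *-cancelˡ-≤ 2 (begin
    2 N.* (s N.* ℓ N.+ suc s N.* s) ≡⟨ eq s (s N.* ℓ) ⟩
    2 N.* (s N.* ℓ) N.+ (2 N.* suc s) N.* s ≤⟨ +-mono-≤ 2sℓ≤Q (≤∙ (*-mono-≤ 2+2s≤r s≤r) r²≤) ⟩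
    Q N.+ Q ≡⟨ cong (Q N.+_) (sym (NP.+-identityʳ Q)) ⟩
    2 N.* Q ∎)
    where
    open NP.≤-Reasoning
    eq : ∀ s x -> 2 N.* (x N.+ suc s N.* s) ≡ 2 N.* x N.+ (2 N.* suc s) N.* s
    eq = solve-∀
    s≤r : s N.≤ r
    s≤r = ≤∙ (m≤n*m s 4) 4s≤r
    2+2s≤r : 2 N.* suc s N.≤ r
    2+2s≤r = ≤∙ (*-monoʳ-≤ 2 (≤∙ (s≤s (m≤n+m s s0)) (≡⇒≤ (cong (s N.+_) (sym (NP.+-identityʳ s))))))
     (≤∙ (≡⇒≤ (sym (NP.*-assoc 2 2 s))) 4s≤r)

   room : suc ((s N.* ℓ N.+ suc s N.* s N.+ κ N.* M) N.+ (suc s N.* s N.+ s N.* m)) N.≤ s N.* I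
   room = ≤∙ (+-mono-≤ (s≤s (z≤n {s0})) (+-monoˡ-≤ _ (+-monoʳ-≤ (s N.* ℓ N.+ suc s N.* s) (m≤n*m (κ N.* M) s))))
    (≡⇒≤ (eq s ℓ (κ N.* M) m))
    where
    eq : ∀ s ℓ k m -> s N.+ ((s N.* ℓ N.+ suc s N.* s N.+ s N.* k) N.+ (suc s N.* s N.+ s N.* m)) ≡ s N.* (ℓ N.+ (m N.+ (2 N.* suc s N.+ 1 N.+ k)))
    eq = solve-∀

   4sY<rB : 4 N.* (s N.* Y) N.< r N.* B
   4sY<rB = begin-strict
    4 N.* (s N.* Y) ≡⟨ cong (4 N.*_) (eq s r B κ) ⟩
    4 N.* (r N.* (s N.+ s N.* s N.* κ) N.+ (s N.* B N.+ s N.* (2 N.* suc s N.+ 1)))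
     ≤⟨ *-monoʳ-≤ 4 (+-mono-≤ (*-monoʳ-≤ r (+-monoʳ-≤ s (*-monoʳ-≤ (s N.* s) κ≤)))
        (≤∙ (≤∙ (m≤m+n (s N.* slack s K N.+ s N.* (2 N.* suc s N.+ 1)) (4 N.* s)) (m≤m+n _ 1)) large)) ⟩
    4 N.* (r N.* (s N.+ s N.* s N.* K) N.+ r) ≡⟨ eq2 r (s N.+ s N.* s N.* K) ⟩
    r N.* (4 N.* (s N.+ s N.* s N.* K N.+ 1)) <⟨ *-monoʳ-< r {{N.>-nonZero 1≤r}} (n<1+n _) ⟩
    r N.* B ∎
    where
    open NP.≤-Reasoning
    eq : ∀ s r B κ -> s N.* ((r N.+ B) N.+ (2 N.* suc s N.+ 1 N.+ κ N.* (s N.* r))) ≡ r N.* (s N.+ s N.* s N.* κ) N.+ (s N.* B N.+ s N.* (2 N.* suc s N.+ 1))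
    eq = solve-∀
    eq2 : ∀ r x -> 4 N.* (r N.* x N.+ r) ≡ r N.* (4 N.* (x N.+ 1))
    eq2 = solve-∀

   -- The main terms on both sides agree. What remains is r s Y < s ℓ B, which follows from 4 s Y <
   -- r B together with r² ≤ q ≤ 4 s ℓ.
   many : M N.* (s N.* I) N.< (s N.* ℓ) N.* (s N.* m)
   many = begin-strict
    M N.* (s N.* I) ≡⟨ eq1 s r ℓ Y ⟩
    M N.* (s N.* ℓ) N.+ s N.* (r N.* (s N.* Y)) <⟨ +-monoʳ-< (M N.* (s N.* ℓ)) (*-monoʳ-< s (*-cancelˡ-< 4 _ _ lt)) ⟩
    M N.* (s N.* ℓ) N.+ s N.* ((s N.* ℓ) N.* B) ≡⟨ eq2 s r ℓ B ⟩
    (s N.* ℓ) N.* (s N.* m) ∎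
    where
    open NP.≤-Reasoning
    eq1 : ∀ s r ℓ Y -> (s N.* r) N.* (s N.* (ℓ N.+ Y)) ≡ (s N.* r) N.* (s N.* ℓ) N.+ s N.* (r N.* (s N.* Y))
    eq1 = solve-∀
    eq2 : ∀ s r ℓ B -> (s N.* r) N.* (s N.* ℓ) N.+ s N.* ((s N.* ℓ) N.* B) ≡ (s N.* ℓ) N.* (s N.* (r N.+ B))
    eq2 = solve-∀
    e3 : ∀ r x -> 4 N.* (r N.* x) ≡ r N.* (4 N.* x)
    e3 = solve-∀
    lt : 4 N.* (r N.* (s N.* Y)) N.< 4 N.* ((s N.* ℓ) N.* B)
    lt = begin-strict
     4 N.* (r N.* (s N.* Y)) ≡⟨ e3 r (s N.* Y) ⟩
     r N.* (4 N.* (s N.* Y)) <⟨ *-monoʳ-< r {{N.>-nonZero 1≤r}} 4sY<rB ⟩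
     r N.* (r N.* B) ≡⟨ sym (NP.*-assoc r r B) ⟩
     r N.* r N.* B ≤⟨ *-monoˡ-≤ B (≤∙ r²≤ Q≤4sℓ) ⟩
     4 N.* (s N.* ℓ) N.* B ≡⟨ NP.*-assoc 4 (s N.* ℓ) B ⟩
     4 N.* ((s N.* ℓ) N.* B) ∎

 smooth-bound : ∀ K r -> κ N.≤ K -> r N.* r N.≤ q -> radius s K N.≤ r -> ∀ pts -> AllPairs Differ pts ->
  length pts N.* r N.≤ q N.* r N.+ q N.* (slack s K N.+ 2 N.* suc s N.+ 1)
 smooth-bound K r κ≤ r²≤ large pts d = *-cancelˡ-≤ s (begin
  s N.* (length pts N.* r) ≡⟨ e1 s (length pts) r ⟩
  length pts N.* M ≤⟨ points-bound pts d ⟩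
  q N.* (s N.* m N.+ suc s N.* s) N.+ (s N.+ suc s N.* s) ≤⟨ +-monoʳ-≤ _ (m≤n*m _ q {{N.>-nonZero (≤∙ 1≤r r≤Q)}}) ⟩
  q N.* (s N.* m N.+ suc s N.* s) N.+ q N.* (s N.+ suc s N.* s) ≡⟨ e2 s q r (slack s K) ⟩
  s N.* (q N.* r N.+ q N.* (slack s K N.+ 2 N.* suc s N.+ 1)) ∎)
  where
  open NP.≤-Reasoning
  open Choice K r q κ≤ r²≤ large
  open Construct M ℓ m I M≤Q small room many
  e1 : ∀ s l r -> s N.* (l N.* r) ≡ l N.* (s N.* r)
  e1 = solve-∀
  e2 : ∀ s q r B -> q N.* (s N.* (r N.+ B) N.+ suc s N.* s) N.+ q N.* (s N.+ suc s N.* s) ≡ s N.* (q N.* r N.+ q N.* (B N.+ 2 N.* suc s N.+ 1))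
  e2 = solve-∀

-- From pairs (y, z) to smooth points of the curve.

module CurveCount (𝔽 : FiniteField) where
 open ≡
 open Fld 𝔽
 open Poly 𝔽
 open PolySum 𝔽 selfAlgebra
 open CEval FR using (cev; cder)
 open StepConst
 open Curve 𝔽

 cev≡ev : ∀ p v -> cev p v ≡ ev p v
 cev≡ev [] v = refl
 cev≡ev (a ∷ p) v = cong (\ t -> a + v * t) (cev≡ev p v)

 cder≡der : ∀ p v -> cder p v ≡ Ev.der p v
 cder≡der [] v = refl
 cder≡der (a ∷ p) v = cong₂ (\ s t -> s + v * t) (cev≡ev p v) (cder≡der p v)

 inv-injective : ∀ {x y} -> ¬ x ≡ 0# -> ¬ y ≡ 0# -> inv x ≡ inv y -> x ≡ y
 inv-injective {x} {y} nx ny e = trans (sym (*-identityʳ x)) (trans (cong (x *_) (trans (sym (inv-l ny)) (cong (_* y) (sym e)))) (trans (sym (*-assoc _ _ _)) (trans (cong (_* y) (inv-r nx)) (*-identityˡ y))))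

 module Points (s0 : ℕ) (f : Pol) (deg : length f N.≤ suc (suc (suc s0)))
  (lead : ¬ coef f (suc (suc s0)) ≡ 0#) (d≢0 : ¬ natF (suc (suc s0)) ≡ 0#) where
  open Rational s0 f deg lead d≢0

  tail : ℕ -> ℕ -> List Pol
  tail zero k = (1# ∷ []) ∷ []
  tail (suc n) k = scale (- 1#) (Row (suc k)) ∷ tail n (suc k)

  -- The v-derivative of the curve equation. The constant c occurs only in row 0, which
  -- differentiation discards, so a pair (y, z) is singular or not independently of c, and singular
  -- pairs can be counted for all c together.
  ∂ : F -> Pol
  ∂ x = deriv (0# ∷ map (\ r -> ev r x) (tail s0 0))

  slope : F -> F -> F
  slope y z = ev (∂ (inv (y - z))) (z * inv (y - z))

  length-tail : ∀ n k -> length (tail n k) ≡ suc n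
  length-tail zero k = refl
  length-tail (suc n) k = cong suc (length-tail n (suc k))

  length-∂ : ∀ x -> length (∂ x) N.≤ suc s
  length-∂ x = ≤∙ (length-deriv (0# ∷ map (\ r -> ev r x) (tail s0 0))) (s≤s (≡⇒≤ (trans (Listₚ.length-map (\ r -> ev r x) (tail s0 0)) (length-tail s0 0))))

  ∂-nonzero : ¬ natF s ≡ 0# -> ∀ x -> NonzeroPol (∂ x)
  ∂-nonzero s≢0 x = s0 , \ e -> *-≢0 s≢0 (\ e -> 0≢1 (trans (sym e) (top s0 0))) (trans (sym (coef-deriv (0# ∷ map (\ r -> ev r x) (tail s0 0)) s0)) e)
   where
   top : ∀ n k -> coef (map (\ r -> ev r x) (tail n k)) n ≡ 1#
   top zero k = trans (cong (1# +_) (zeroʳ x)) (+-identityʳ 1#)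
   top (suc n) k = top n (suc k)

  module _ (c : F) (c≢0 : ¬ c ≡ 0#) where
   private
    module St = Params 𝔽 s0 (ρ c) (ρ-Bd c) (κ≢0 c c≢0)

    hlist-tail : ∀ n k -> St.RF.hlist n (suc k) ≡ tail n k
    hlist-tail zero k = refl
    hlist-tail (suc n) k = cong (_ ∷_) (hlist-tail n (suc k))

    slope-eq : ∀ x v -> cder (map (\ r -> ev r x) St.H) v ≡ ev (∂ x) v
    slope-eq x v = trans (cong (\ L -> cev (map (\ r -> ev r x) L) v + v * cder (map (\ r -> ev r x) L) v) (hlist-tail s0 0))
     (trans (cder≡der (0# ∷ map (\ r -> ev r x) (tail s0 0)) v) (sym (Ev.hev-deriv (0# ∷ map (\ r -> ev r x) (tail s0 0)) v)))

    len-≤ : ∀ n -> RowsProd.sumℕ 𝔽 s0 (ρ c) (ρ-Bd c) (κ≢0 c c≢0) n (\ j -> length (ρ c j)) N.≤ n N.* suc d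
    len-≤ zero = z≤n
    len-≤ (suc n) = ≤∙ (+-mono-≤ (len-≤ n) (length-ρ c n)) (≡⇒≤ (NP.+-comm (n N.* suc d) (suc d)))

    e≤ : St.e N.≤ suc s N.* suc (s N.* suc (suc s)) N.* suc s
    e≤ = *-mono-≤ (*-monoʳ-≤ (suc s) (s≤s (len-≤ s))) (≡⇒≤ (trans (cong (\ L -> suc (length L)) (hlist-tail s0 0)) (cong suc (length-tail s0 0))))

    κ≤ : St.κ N.≤ weight s
    κ≤ = +-mono-≤ e≤ e≤

    Good : F × F -> Set
    Good (y , z) = (ev f y - ev f z ≡ c) × ¬ slope y z ≡ 0#

    differ : ∀ {p} -> Good p -> ¬ proj₁ p - proj₂ p ≡ 0#
    differ {y , z} (e , _) h = c≢0 (trans (sym e) (trans (cong (\ t -> ev f t - ev f z) (sub-≡ h)) (-‿inverseʳ _)))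

    point : ∀ p -> Good p -> St.Pt
    point (y , z) g@(e , sm) = record
     { x0 = x ; vo = v
     ; on = trans (St.RF.cev-hlist s 0 x v) (≡-sub (relation-holds c y z x v e xy (*-comm x z)))
     ; smooth = \ h -> sm (trans (sym (slope-eq x v)) h) }
     where
     x v : F
     x = inv (y - z)
     v = z * x
     xy : x * y ≡ 1# + v
     xy = trans (solve 3 (\ x y z -> x :* y := x :* (y :- z) :+ z :* x) refl x y z) (cong (_+ v) (inv-l (differ {y , z} g)))

    points : ∀ {ps} -> All Good ps -> List St.Pt
    points [] = []
    points (_∷_ {p} g gs) = point p g ∷ points gs

    length-points : ∀ {ps} (gs : All Good ps) -> length (points gs) ≡ length ps
    length-points [] = refl
    length-points (g ∷ gs) = cong suc (length-points gs)

    point-differ : ∀ {p p'} (g : Good p) (g' : Good p') -> ¬ p ≡ p' -> St.Differ (point p g) (point p' g')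
    point-differ {y , z} {y' , z'} g g' ne (ex , ev) = ne (cong₂ _,_ y≡ z≡)
     where
     δ≡ : y - z ≡ y' - z'
     δ≡ = inv-injective (differ {y , z} g) (differ {y' , z'} g') ex
     z≡ : z ≡ z'
     z≡ = trans (back z (y - z) (differ {y , z} g)) (trans (cong₂ _*_ ev δ≡) (sym (back z' (y' - z') (differ {y' , z'} g'))))
      where
      back : ∀ z δ -> ¬ δ ≡ 0# -> z ≡ (z * inv δ) * δ
      back z δ n = sym (trans (*-assoc _ _ _) (trans (cong (z *_) (inv-l n)) (*-identityʳ z)))
     y≡ : y ≡ y'
     y≡ = trans (solve 2 (\ y z -> y := (y :- z) :+ z) refl y z) (trans (cong₂ _+_ δ≡ z≡) (solve 2 (\ y z -> (y :- z) :+ z := y) refl y' z'))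

    points-differ : ∀ {ps} (gs : All Good ps) -> Unique ps -> AllPairs St.Differ (points gs)
    points-differ [] [] = []
    points-differ (g ∷ gs) (u ∷ us) = heads gs u ∷ points-differ gs us
     where
     heads : ∀ {ps} (gs : All Good ps) -> All (\ p' -> ¬ _ ≡ p') ps -> All (St.Differ (point _ g)) (points gs)
     heads [] [] = []
     heads (g' ∷ gs) (n ∷ ns) = point-differ g g' n ∷ heads gs ns

   smooth-pairs : ∀ r -> r N.* r N.≤ q -> radius s (weight s) N.≤ r -> ∀ ps -> Unique ps ->
    All (\ p -> (ev f (proj₁ p) - ev f (proj₂ p) ≡ c) × ¬ slope (proj₁ p) (proj₂ p) ≡ 0#) ps -> length ps N.* r N.≤ q N.* r N.+ q N.* excess s
   smooth-pairs r r² large ps u gs = ≤∙ (≡⇒≤ (cong (N._* r) (sym (length-points gs)))) (St.smooth-bound (weight s) r κ≤ r² large (points gs) (points-differ gs u))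

-- The correlation bound for a single polynomial.

module LinPoly (𝔽 : FiniteField) (𝕆 : OrderedRing) where
 open import Data.Nat.Divisibility using (n∣m*n)
 open import Data.Nat.DivMod using (_/_; m*n/n≡m; /-monoˡ-≤; +-distrib-/-∣ˡ)
 open ≡ hiding (J)
 open FSum 𝔽 𝕆
 open Analysis 𝔽 𝕆
 open Analysis2 𝔽 𝕆
 open Count 𝔽 𝕆
 open Poly 𝔽
 open PolyFacts 𝔽
 private module K = Fld 𝔽
 open StepConst
 open CurveCount 𝔽

 LinBound-mono : ∀ {f Λ Λ'} -> Λ ≤ Λ' -> LinBound f Λ -> LinBound f Λ'
 LinBound-mono le b ψ Sψ = ≤-trans (b ψ Sψ) (*-monoʳ (n-nonneg ψ) le)

 LinBound-cong : ∀ {f g Λ} -> (∀ y -> f y ≡ g y) -> LinBound f Λ -> LinBound g Λ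
 LinBound-cong {f} {g} {Λ} e b ψ Sψ = subst (_≤ Λ * n ψ) (Σ-cong els (\ y -> Σ-cong els (\ z -> cong (c ψ) (cong₂ _⊝_ (e z) (e y))))) (b ψ Sψ)

 shift-≟ : ∀ a b u -> ind (b ⊝ a ≟ u) ≡ ind (b ≟ u ⊕ a)
 shift-≟ a b u = ind-cong (b ⊝ a ≟ u) (b ≟ u ⊕ a) (\ e -> trans (K.solve 2 (\ a b -> b K.:= (b K.:- a) K.:+ a) refl a b) (cong (_⊕ a) e))
   (\ e -> trans (cong (_⊝ a) e) (K.solve 2 (\ a u -> (u K.:+ a) K.:- a K.:= u) refl a u))

 repr-≤ : ∀ f -> NonConst f -> ∀ u -> repr (ev f) u ≤ nat q * nat (N.pred (length f))
 repr-≤ f nc u = ≤-trans (Σ-mono els (\ y -> ≤-trans (≤-reflexive (Σ-cong els (\ z -> shift-≟ (ev f y) (ev f z) u))) (fibre-≤ f nc (u ⊕ ev f y)))) (≤-reflexive (S-const _))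

 -- Λ-bound D C r is about 2 C q²/r, that is, of order q^{3/2} once r ≈ √q.
 Λ-bound : ℕ -> ℕ -> (r : ℕ) -> .{{N.NonZero r}} -> ℕ
 Λ-bound D C r = 2 N.* ((D N.* q N.+ q N.* (q N.* C / r)) N.+ q N.* suc D)

 module _ (D C r : ℕ) .{{_ : N.NonZero r}} (r²≤q : r N.* r N.≤ q)
  (char : ∀ k -> suc k N.≤ D -> ¬ K.natF (suc k) ≡ 𝟘)
  (excess≤ : ∀ s -> s N.≤ D -> excess s N.≤ C) (radius≤ : ∀ s -> s N.≤ D -> radius s (weight s) N.≤ r) where

  private
   e : ℕ
   e = q N.* C / r

   module Deg (f : Pol) (d0 : ℕ) (d≤D : suc d0 N.≤ D) (deg : length f ≡ suc (suc d0)) (lead : ¬ coef f (suc d0) ≡ 𝟘)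
    (bad : F -> Z) (0≤bad : ∀ u -> 0z ≤ bad u) (few : S bad ≤ nat (q N.* suc D)) (main : ∀ u -> ¬ u ≡ 𝟘 -> repr (ev f) u ≤ nat (q N.+ e) + bad u) where

    -- At u = 0 the monomial of top weight in the curve equation disappears, so the trivial bound D
    -- q is used there; elsewhere the curve bound, with `e` for the smooth pairs and `bad` for the
    -- singular ones.
    t : F -> Z
    t u = (ind (𝟘 ≟ u) * nat (D N.* q) + nat e) + bad u

    0≤t : ∀ u -> 0z ≤ t u
    0≤t u = +-nonneg (+-nonneg (*-nonneg (ind-nonneg (𝟘 ≟ u)) (nat-nonneg (D N.* q))) (nat-nonneg e)) (0≤bad u)

    up : ∀ u -> repr (ev f) u ≤ nat q + t u
    up u = go (𝟘 ≟ u)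
     where
     go : (dec : Dec (𝟘 ≡ u)) -> repr (ev f) u ≤ nat q + ((ind dec * nat (D N.* q) + nat e) + bad u)
     go (no ne) = ≤-trans (main u (\ h -> ne (sym h))) (≤-reflexive (trans (cong (_+ bad u) (nat-+ q e)) (trans (+-assoc _ _ _) (cong (\ t -> nat q + (t + bad u)) (sym (trans (cong (_+ nat e) (zeroˡ _)) (+-identityˡ _)))))))
     go (yes refl) = ≤-trans (repr-≤ f (d0 , lead) u) (≤-trans (≤-trans (≤-reflexive (trans (cong (\ l -> nat q * nat (N.pred l)) deg) (*-comm _ _))) (*-monoʳ (nat-nonneg q) (nat-mono d≤D)))
      (≤-by ((nat q + nat e) + bad u) (trans (cong (\ a -> (nat q + ((1z * a + nat e) + bad u)) - nat D * nat q) (nat-* D q))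
        (trans (cong (\ a -> (nat q + ((a + nat e) + bad u)) - nat D * nat q) (*-identityˡ _)) (solve 4 (\ a p e b -> (a :+ ((p :+ e) :+ b)) :- p := (a :+ e) :+ b) refl (nat q) (nat D * nat q) (nat e) (bad u)))) (+-nonneg (+-nonneg (nat-nonneg q) (nat-nonneg e)) (0≤bad u))))

    St≤ : S t ≤ nat ((D N.* q N.+ q N.* e) N.+ q N.* suc D)
    St≤ = ≤-trans (≤-reflexive (trans (Σ-+ els _ bad) (cong (_+ S bad) (trans (Σ-+ els _ _) (cong₂ _+_ (S-δ 𝟘 (\ _ -> nat (D N.* q))) (trans (S-const _) (sym (nat-* q e))))))))
     (≤-trans (+-mono ≤-refl few) (≤-reflexive (trans (cong (_+ nat (q N.* suc D)) (sym (nat-+ (D N.* q) (q N.* e)))) (sym (nat-+ (D N.* q N.+ q N.* e) (q N.* suc D))))))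

    result : LinBound (ev f) (nat (Λ-bound D C r))
    result = LinBound-mono (≤-trans (+-mono St≤ St≤) (≤-reflexive (trans (sym (nat-+ X X)) (cong nat (cong (X N.+_) (sym (NP.+-identityʳ X))))))) (linBound (ev f) t 0≤t up)
     where
     X : ℕ
     X = (D N.* q N.+ q N.* e) N.+ q N.* suc D

   linear : ∀ f -> 1 N.≤ D -> length f ≡ 2 -> ¬ coef f 1 ≡ 𝟘 -> LinBound (ev f) (nat (Λ-bound D C r))
   linear f 1≤D deg lead = Deg.result f 0 1≤D deg lead (\ _ -> 0z) (\ _ -> ≤-refl) (≤-trans (≤-reflexive (Σ-zero els)) (nat-nonneg (q N.* suc D)))
    (\ u _ -> ≤-trans (repr-≤ f (0 , lead) u) (≤-trans (≤-reflexive (trans (cong (\ l -> nat q * nat (N.pred l)) deg) (trans (sym (nat-* q 1)) (cong nat (NP.*-identityʳ q))))) (≤-trans (nat-mono (m≤m+n q e)) (≤-reflexive (sym (+-identityʳ _))))))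

   module Curved (f : Pol) (s0 : ℕ) (d≤D : suc (suc s0) N.≤ D) (deg : length f ≡ suc (suc (suc s0))) (lead : ¬ coef f (suc (suc s0)) ≡ 𝟘) where
    open Points s0 f (≡⇒≤ deg) lead (char (suc s0) d≤D)
    s≤D : suc s0 N.≤ D
    s≤D = <⇒≤ d≤D

    bad : F -> Z
    bad u = S (\ y -> S (\ z -> ind (ev f z ⊝ ev f y ≟ u) * ind (slope z y ≟ 𝟘)))

    0≤bad : ∀ u -> 0z ≤ bad u
    0≤bad u = Σ-nonneg els (\ y -> Σ-nonneg els (\ z -> *-nonneg (ind-nonneg (ev f z ⊝ ev f y ≟ u)) (ind-nonneg (slope z y ≟ 𝟘))))

    -- Sum over u first: each singular pair is counted once. For a fixed difference δ ≠ 0 the value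
    -- v = y / δ runs through F and must be a root of a nonzero polynomial, giving at most D pairs;
    -- δ = 0 gives at most q.
    few : S bad ≤ nat (q N.* suc D)
    few = ≤-trans (≤-reflexive total) (≤-trans (Σ-mono els col) (≤-reflexive (trans (Σ-+ els _ _) (trans (cong₂ _+_ (S-δ 𝟘 (\ _ -> nat q)) (S-const (nat D)))
      (trans (cong (nat q +_) (sym (nat-* q D))) (trans (sym (nat-+ q (q N.* D))) (cong nat (sym (*-suc q D)))))))))
     where
     g : F -> F -> Z
     g δ y = ind (ev (∂ (K.inv δ)) (y ⊗ K.inv δ) ≟ 𝟘)
     total : S bad ≡ S (\ δ -> S (g δ))
     total = trans (Σ-swap els els _) (trans (Σ-cong els (\ y -> trans (Σ-swap els els _) (trans (Σ-cong els (\ z -> S-δ (ev f z ⊝ ev f y) (\ _ -> ind (slope z y ≟ 𝟘))))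
       (trans (sym (S-shiftˡ y _)) (Σ-cong els (\ δ -> cong (\ t -> g t y) (K.solve 2 (\ y d -> (y K.:+ d) K.:- y K.:= d) refl y δ)))))))
       (Σ-swap els els _))
     col : ∀ δ -> S (g δ) ≤ ind (𝟘 ≟ δ) * nat q + nat D
     col δ = go (𝟘 ≟ δ)
      where
      go : (dec : Dec (𝟘 ≡ δ)) -> S (g δ) ≤ ind dec * nat q + nat D
      go (yes _) = ≤-trans (Σ-mono els (\ y -> ind-≤1 (ev (∂ (K.inv δ)) (y ⊗ K.inv δ) ≟ 𝟘))) (≤-trans (≤-reflexive (trans (S-const 1z) (*-comm _ _))) (≤-trans (≤-reflexive (sym (+-identityʳ _))) (+-mono ≤-refl (nat-nonneg D))))
      go (no ne) = ≤-trans (≤-reflexive (S-perm (_⊗ K.inv δ) (_⊗ δ) (\ x -> trans (K.*-assoc _ _ _) (trans (cong (x ⊗_) (K.inv-r ne')) (K.*-identityʳ x)))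
         (\ x -> trans (K.*-assoc _ _ _) (trans (cong (x ⊗_) (K.inv-l ne')) (K.*-identityʳ x))) (\ v -> ind (ev (∂ (K.inv δ)) v ≟ 𝟘))))
        (≤-trans (roots-≤ (∂ (K.inv δ)) (∂-nonzero (char s0 s≤D) (K.inv δ))) (≤-trans (nat-mono (≤∙ (pred-mono-≤ (length-∂ (K.inv δ))) s≤D)) (≤-reflexive (sym (trans (cong (_+ nat D) (zeroˡ _)) (+-identityˡ _))))))
       where
       ne' : ¬ δ ≡ 𝟘
       ne' h = ne (sym h)

    main : ∀ u -> ¬ u ≡ 𝟘 -> repr (ev f) u ≤ nat (q N.+ e) + bad u
    main u u≢0 = ≤-trans (≤-reflexive split) (+-mono (≤-trans (≤-reflexive (sym (Σ-× els els _))) (count-≤ P? els² els²-unique (q N.+ e) bnd)) ≤-refl)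
     where
     P : F × F -> Set
     P (y , z) = (ev f z ⊝ ev f y ≡ u) × ¬ slope z y ≡ 𝟘
     P? : ∀ p -> Dec (P p)
     P? (y , z) = (ev f z ⊝ ev f y ≟ u) ×-dec ¬? (slope z y ≟ 𝟘)
     ind-split : ∀ {A B : Set} (a : Dec A) (b : Dec B) -> ind a ≡ ind (a ×-dec ¬? b) + ind a * ind b
     ind-split (yes _) (yes _) = sym (trans (+-identityˡ _) (*-identityˡ _))
     ind-split (yes _) (no _) = sym (trans (cong (1z +_) (zeroʳ _)) (+-identityʳ _))
     ind-split (no _) b = sym (trans (+-identityˡ _) (zeroˡ _))
     split : repr (ev f) u ≡ S (\ y -> S (\ z -> ind (P? (y , z)))) + bad u
     split = trans (Σ-cong els (\ y -> trans (Σ-cong els (\ z -> ind-split (ev f z ⊝ ev f y ≟ u) (slope z y ≟ 𝟘))) (Σ-+ els _ _))) (Σ-+ els _ _)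
     swap : F × F -> F × F
     swap (y , z) = z , y
     bnd : ∀ ps -> Unique ps -> All P ps -> length ps N.≤ q N.+ e
     bnd ps uq al = ≤∙ (≡⇒≤ (sym (m*n/n≡m (length ps) r))) (≤∙ (/-monoˡ-≤ r le)
       (≡⇒≤ (trans (+-distrib-/-∣ˡ (q N.* C) (n∣m*n q)) (cong (N._+ e) (m*n/n≡m q r)))))
      where
      le : length ps N.* r N.≤ q N.* r N.+ q N.* C
      le = ≤∙ (≡⇒≤ (cong (N._* r) (sym (Listₚ.length-map swap ps))))
       (≤∙ (smooth-pairs u u≢0 r r²≤q (radius≤ (suc s0) s≤D) (map swap ps) (Uniqueₚ.map⁺ (\ { {_ , _} {_ , _} refl -> refl }) uq) (Allₚ.map⁺ (All.map (\ { {_ , _} g -> g }) al)))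
        (+-monoʳ-≤ (q N.* r) (*-monoʳ-≤ q (excess≤ (suc s0) s≤D))))

    result : LinBound (ev f) (nat (Λ-bound D C r))
    result = Deg.result f (suc s0) d≤D deg lead bad 0≤bad few main

   exactly : ∀ f d0 -> suc d0 N.≤ D -> length f ≡ suc (suc d0) -> ¬ coef f (suc d0) ≡ 𝟘 -> LinBound (ev f) (nat (Λ-bound D C r))
   exactly f zero = linear f
   exactly f (suc s0) = Curved.result f s0

  polynomial-linBound : ∀ f -> length f N.≤ suc D -> NonConst f -> LinBound (ev f) (nat (Λ-bound D C r))
  polynomial-linBound f len nc with trim f nc D len
  ... | g , d0 , d≤D , deg , lead , same = LinBound-cong (\ y -> ev-ext g f y same) (exactly g d0 d≤D deg lead)

-- Translation of the given counts into sums.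

module Link (𝔽 : FiniteField) where
 open ≡
 open IntRing
 open FSum 𝔽 integers
 open Count 𝔽 integers using (nat-+)

 private
  total : ∀ {n} -> (Fin n -> ℕ) -> ℕ
  total {zero} f = 0
  total {suc n} f = f Fin.zero N.+ total (\ i -> f (Fin.suc i))

   -- The summation function inside sumF is private; the underscore is solved to it by unification.
  mutual
   sumF≡total : ∀ f -> FiniteField.sumF 𝔽 f ≡ total (\ i -> f (FiniteField.element 𝔽 i))
   sumF≡total f with FiniteField.q 𝔽 | (\ i -> f (FiniteField.element 𝔽 i))
   ... | n | g = count≡total n g

   count≡total : ∀ n (g : Fin n -> ℕ) -> _ ≡ total g
   count≡total zero g = refl
   count≡total (suc n) g = cong (g Fin.zero N.+_) (count≡total n (\ i -> g (Fin.suc i)))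

  total-Σ : ∀ {n} (e : Fin n -> F) (f : F -> ℕ) -> nat (total (\ i -> f (e i))) ≡ Σ (tabulate e) (\ x -> nat (f x))
  total-Σ {zero} e f = refl
  total-Σ {suc n} e f = trans (nat-+ (f (e Fin.zero)) (total (\ i -> f (e (Fin.suc i))))) (cong (\ t -> nat (f (e Fin.zero)) + t) (total-Σ (\ i -> e (Fin.suc i)) f))

 sumF-S : ∀ f -> nat (FiniteField.sumF 𝔽 f) ≡ S (\ x -> nat (f x))
 sumF-S f = trans (cong nat (sumF≡total f)) (total-Σ element f)

 char-fun : (F -> Bool) -> F -> ℤ
 char-fun A x = nat (FiniteField.ind 𝔽 (A x))

 char-fun² : ∀ A x -> char-fun A x * char-fun A x ≡ char-fun A x
 char-fun² A x with A x
 ... | true = refl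
 ... | false = refl

 ind-∧∧ : ∀ a b c -> nat (FiniteField.ind 𝔽 (a ∧ b ∧ c)) ≡ nat (FiniteField.ind 𝔽 a) * nat (FiniteField.ind 𝔽 b) * nat (FiniteField.ind 𝔽 c)
 ind-∧∧ true true true = refl
 ind-∧∧ true true false = refl
 ind-∧∧ true false c = sym (zeroˡ (nat (FiniteField.ind 𝔽 c)))
 ind-∧∧ false b c = sym (trans (cong (_* nat (FiniteField.ind 𝔽 c)) (zeroˡ (nat (FiniteField.ind 𝔽 b)))) (zeroˡ (nat (FiniteField.ind 𝔽 c))))

-- Counting colliding quadruples.

module Quads (𝔽 : FiniteField) (𝕆 : OrderedRing) where
 open ≡ hiding (J)
 open FSum 𝔽 𝕆
 open Analysis 𝔽 𝕆 using (D)
 open Analysis2 𝔽 𝕆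
 open Count 𝔽 𝕆
 open Counts 𝔽 𝕆
 open Poly 𝔽
 open PolyFacts 𝔽
 open Ser 𝔽 using (conv-top; _*ˢ_)
 open Fibre 𝔽
 open StepConst
 private module K = Fld 𝔽

 nat4 : ∀ a b c d -> nat a * (nat b * (nat c * nat d)) ≡ nat (a N.* (b N.* (c N.* d)))
 nat4 a b c d = sym (trans (nat-* a (b N.* (c N.* d))) (cong (nat a *_) (trans (nat-* b (c N.* d)) (cong (nat b *_) (nat-* c d)))))

 ∑4-dec : ∀ {A : F -> Set} {B : F -> F -> Set} {C : F -> F -> F -> Set} {D : F -> F -> F -> F -> Set}
  (A? : ∀ a -> Dec (A a)) (B? : ∀ a b -> Dec (B a b)) (C? : ∀ a b c -> Dec (C a b c)) (D? : ∀ a b c d -> Dec (D a b c d)) k1 k2 k3 k4 ->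
  S (\ a -> ind (A? a)) ≤ nat k1 -> (∀ a -> S (\ b -> ind (B? a b)) ≤ nat k2) -> (∀ a b -> S (\ c -> ind (C? a b c)) ≤ nat k3) -> (∀ a b c -> S (\ d -> ind (D? a b c d)) ≤ nat k4) ->
  ∀ {X : F -> F -> F -> F -> Set} (X? : ∀ a b c d -> Dec (X a b c d)) -> (∀ a b c d -> X a b c d -> A a × B a b × C a b c × D a b c d) ->
  ∑4 (\ a b c d -> ind (X? a b c d)) ≤ nat (k1 N.* (k2 N.* (k3 N.* k4)))
 ∑4-dec A? B? C? D? k1 k2 k3 k4 h1 h2 h3 h4 X? imp = ≤-trans (∑4-mono (\ a b c d -> ≤-trans (ind-mono (X? a b c d) (A? a ×-dec (B? a b ×-dec (C? a b c ×-dec D? a b c d))) (imp a b c d))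
    (≤-reflexive (sym (trans (cong (ind (A? a) *_) (trans (cong (ind (B? a b) *_) (ind-and (C? a b c) (D? a b c d))) (ind-and (B? a b) (C? a b c ×-dec D? a b c d)))) (ind-and (A? a) (B? a b ×-dec (C? a b c ×-dec D? a b c d))))))))
  (≤-trans (∑4-bound (\ a -> ind (A? a)) (\ a b -> ind (B? a b)) (\ a b c -> ind (C? a b c)) (\ a b c d -> ind (D? a b c d)) (nat k1) (nat k2) (nat k3) (nat k4)
    (nat-nonneg k2) (nat-nonneg k3) (nat-nonneg k4) (\ a -> ind-nonneg (A? a)) (\ a b -> ind-nonneg (B? a b)) (\ a b c -> ind-nonneg (C? a b c)) h1 h2 h3 h4)
   (≤-reflexive (nat4 k1 k2 k3 k4)))

 S-all : S (\ x -> ind {⊤} (yes tt)) ≤ nat q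
 S-all = ≤-reflexive S-one

 module Cycles (E : ℕ) (P1 P2 Q : Pol) (x1 : Exact E P1) (x2 : Exact E P2) (xQ : Exact E Q) (Q≡ : ∀ y -> ev Q y ≡ ev P2 y ⊝ ev P1 y)
  (char : ∀ k -> suc k N.≤ E -> ¬ K.natF (suc k) ≡ 𝟘) (indep : ∀ a -> NonzeroPol (comb 𝟙 a (deriv Q) (deriv P2))) where
  open Char E char
  open Quadruples (ev P1) (ev P2) using (on?; key; quadruples)

  private
   p1 p2 q' u v d1 : F -> F
   p1 = ev P1
   p2 = ev P2
   q' = ev Q
   u = Ev.der Q
   v = Ev.der P2
   d1 = Ev.der P1

   U V : Pol
   U = deriv Q
   V = deriv P2

   On : F -> F -> F -> F -> Set
   On y z y' z' = D p1 z' y' ≡ D p1 z y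

   on : ∀ y z y' z' -> Dec (On y z y' z')
   on y z y' z' = D p1 z' y' ≟ D p1 z y

   on-z' : ∀ y z y' z' -> On y z y' z' -> p1 z' ≡ p1 y' ⊝ D p1 z y
   on-z' y z y' z' e = trans (K.solve 2 (\ a b -> b K.:= a K.:- (a K.:- b)) refl (p1 y') (p1 z')) (cong (p1 y' ⊝_) e)

   on-sum : ∀ y z y' z' -> On y z y' z' -> p1 y ⊕ p1 z' ≡ p1 y' ⊕ p1 z
   on-sum y z y' z' e = trans (cong (p1 y ⊕_) (on-z' y z y' z' e)) (K.solve 3 (\ a b c -> a K.:+ (b K.:- (a K.:- c)) K.:= b K.:+ c) refl (p1 y) (p1 y') (p1 z))

   -- `X` is the vanishing of the Jacobian of the cycle map. For fixed y' and z it is a product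
   -- equation in (y, z'), and `T` is the vanishing of the Jacobian of that second system. `T`
   -- involves only y and z', so its other two arguments are placeholders.
   X T : F -> F -> F -> F -> Set
   X y z y' z' = (v z' ⊗ v y) ⊗ (u z ⊗ u y') ≡ (v y' ⊗ v z) ⊗ (u y ⊗ u z')

   triple W : F -> F
   triple y = d1 y ⊗ (ev U y ⊗ ev V y)
   W y = Ev.der U y ⊗ ev V y ⊝ ev U y ⊗ Ev.der V y
   T y z y' z' = triple z' ⊗ W y ≡ triple y ⊗ W z'

   X? : ∀ y z y' z' -> Dec (X y z y' z')
   X? y z y' z' = (v z' ⊗ v y) ⊗ (u z ⊗ u y') ≟ (v y' ⊗ v z) ⊗ (u y ⊗ u z')
   T? : ∀ y z y' z' -> Dec (T y z y' z')
   T? y z y' z' = triple z' ⊗ W y ≟ triple y ⊗ W z'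

   Bad : F -> F -> F -> F -> Set
   Bad y z y' z' = (v z ≡ 𝟘) ⊎ (u z' ≡ 𝟘) ⊎ (u y' ≡ 𝟘) ⊎ X y z y' z'

   bad? : ∀ y z y' z' -> Dec (Bad y z y' z')
   bad? y z y' z' = (v z ≟ 𝟘) ⊎-dec ((u z' ≟ 𝟘) ⊎-dec ((u y' ≟ 𝟘) ⊎-dec X? y z y' z'))

   solve-z' : ∀ y z y' -> S (\ z' -> ind (p1 z' ≟ p1 y' ⊝ D p1 z y)) ≤ nat E
   solve-z' y z y' = fibre-S P1 x1 (p1 y' ⊝ D p1 z y)

   solve-y' : ∀ y z z' -> S (\ y' -> ind (p1 y' ≟ D p1 z y ⊕ p1 z')) ≤ nat E
   solve-y' y z z' = fibre-S P1 x1 (D p1 z y ⊕ p1 z')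

   der-roots : ∀ P -> Exact E P -> S (\ z -> ind (Ev.der P z ≟ 𝟘)) ≤ nat E
   der-roots P x = ≤-trans (≤-reflexive (Σ-cong els (\ z -> ind-cong (Ev.der P z ≟ 𝟘) (ev (deriv P) z ≟ 𝟘) (trans (Ev.hev-deriv P z)) (trans (sym (Ev.hev-deriv P z))))))
    (roots-S (deriv P) (deriv-nonzero P (Exact.d0 x , Exact.lead x) (Exact.short x)) (≤∙ (length-deriv P) (Exact.short x)))

   total : ∑4 (\ y z y' z' -> ind (on y z y' z')) ≤ nat (q N.* (q N.* (q N.* E)))
   total = ∑4-dec (\ _ -> yes tt) (\ _ _ -> yes tt) (\ _ _ _ -> yes tt) (\ y z y' z' -> p1 z' ≟ p1 y' ⊝ D p1 z y) q q q E S-all (\ _ -> S-all) (\ _ _ -> S-all) solve-z'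
    on (\ y z y' z' e -> tt , tt , tt , on-z' y z y' z' e)

   at-z : ∀ P -> Exact E P -> ∑4 (\ y z y' z' -> ind (on y z y' z' ×-dec (Ev.der P z ≟ 𝟘))) ≤ nat (q N.* (E N.* (q N.* E)))
   at-z P x = ∑4-dec (\ _ -> yes tt) (\ _ z -> Ev.der P z ≟ 𝟘) (\ _ _ _ -> yes tt) (\ y z y' z' -> p1 z' ≟ p1 y' ⊝ D p1 z y) q E q E S-all (\ _ -> der-roots P x) (\ _ _ -> S-all) solve-z'
    (\ y z y' z' -> on y z y' z' ×-dec (Ev.der P z ≟ 𝟘)) (\ y z y' z' e -> tt , proj₂ e , tt , on-z' y z y' z' (proj₁ e))

   at-y' : ∀ P -> Exact E P -> ∑4 (\ y z y' z' -> ind (on y z y' z' ×-dec (Ev.der P y' ≟ 𝟘))) ≤ nat (q N.* (q N.* (E N.* E)))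
   at-y' P x = ∑4-dec (\ _ -> yes tt) (\ _ _ -> yes tt) (\ _ _ y' -> Ev.der P y' ≟ 𝟘) (\ y z y' z' -> p1 z' ≟ p1 y' ⊝ D p1 z y) q q E E S-all (\ _ -> S-all) (\ _ _ -> der-roots P x) solve-z'
    (\ y z y' z' -> on y z y' z' ×-dec (Ev.der P y' ≟ 𝟘)) (\ y z y' z' e -> tt , tt , proj₂ e , on-z' y z y' z' (proj₁ e))

   at-z' : ∀ P -> Exact E P -> ∑4 (\ y z y' z' -> ind (on y z y' z' ×-dec (Ev.der P z' ≟ 𝟘))) ≤ nat (q N.* (q N.* (E N.* E)))
   at-z' P x = ≤-trans (≤-reflexive (∑4-swap34 _)) (∑4-dec (\ _ -> yes tt) (\ _ _ -> yes tt) (\ _ _ z' -> Ev.der P z' ≟ 𝟘) (\ y z z' y' -> p1 y' ≟ D p1 z y ⊕ p1 z') q q E E S-all (\ _ -> S-all) (\ _ _ -> der-roots P x) solve-y'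
    (\ y z z' y' -> on y z y' z' ×-dec (Ev.der P z' ≟ 𝟘)) (\ y z z' y' e -> tt , tt , proj₂ e , move (proj₁ e)))

   U-short : length U N.≤ E
   U-short = ≤∙ (length-deriv Q) (Exact.short xQ)
   V-short : length V N.≤ E
   V-short = ≤∙ (length-deriv P2) (Exact.short x2)
   D1-short : length (deriv P1) N.≤ E
   D1-short = ≤∙ (length-deriv P1) (Exact.short x1)

   module Sing where
    nzD : NonzeroPol (deriv P1)
    nzD = deriv-nonzero P1 (Exact.d0 x1 , Exact.lead x1) (Exact.short x1)
    nzU : NonzeroPol U
    nzU = deriv-nonzero Q (Exact.d0 xQ , Exact.lead xQ) (Exact.short xQ)
    nzV : NonzeroPol V
    nzV = deriv-nonzero P2 (Exact.d0 x2 , Exact.lead x2) (Exact.short x2)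

    WX triplePol : Pol
    WX = wronskianPol U V
    triplePol = deriv P1 ⊠ (U ⊠ V)

    WX-short : length WX N.≤ suc (E N.+ E)
    WX-short = length-⊞ ((𝟘 ∷ U') ⊠ V) (scale (⊖ 𝟙) (U ⊠ (𝟘 ∷ V'))) (≤∙ (length-⊠ (𝟘 ∷ U') V) (s≤s (+-mono-≤ (≤∙ (length-deriv U) U-short) V-short)))
      (≤∙ (≡⇒≤ (Listₚ.length-map _ (U ⊠ (𝟘 ∷ V')))) (≤∙ (length-⊠ U (𝟘 ∷ V')) (≤∙ (+-mono-≤ U-short (s≤s (≤∙ (length-deriv V) V-short))) (≡⇒≤ (+-suc E E)))))
     where
     U' V' : Pol
     U' = deriv U
     V' = deriv V

    triple-short : length (𝟘 ∷ triplePol) N.≤ suc (E N.+ (E N.+ E))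
    triple-short = s≤s (≤∙ (length-⊠ (deriv P1) (U ⊠ V)) (+-mono-≤ D1-short (≤∙ (length-⊠ U V) (+-mono-≤ U-short V-short))))

    W-roots : S (\ y -> ind (W y ≟ 𝟘)) ≤ nat (suc (E N.+ E))
    W-roots = ≤-trans (Σ-mono els (\ y -> ind-mono (W y ≟ 𝟘) (ev WX y ≟ 𝟘) (\ e -> trans (ev-wronskian U V y) (trans (cong (y ⊗_) e) (K.zeroʳ y)))))
     (roots-S WX (wronskian-nonzero U V U-short V-short nzV indep) WX-short)

    poly : F -> Pol
    poly y = comb (W y) (⊖ triple y) (𝟘 ∷ triplePol) WX

    prod-top : ∀ p r m k -> (∀ i -> m N.< i -> coef p i ≡ 𝟘) -> (∀ i -> k N.< i -> coef r i ≡ 𝟘) -> coef (p ⊠ r) (m N.+ k) ≡ coef p m ⊗ coef r k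
    prod-top p r m k pz rz = trans (coef-⊠ p r (m N.+ k)) (conv-top (coef p) (coef r) m k off)
     where
     off : ∀ i' k' -> i' N.+ k' ≡ m N.+ k -> ¬ i' ≡ m -> coef p i' ≡ 𝟘 ⊎ coef r k' ≡ 𝟘
     off i' k' e ne with i' N.≤? m
     ... | no i> = inj₁ (pz i' (≰⇒> i>))
     ... | yes i≤ = inj₂ (rz k' (≰⇒> (\ k≤ -> <⇒≢ (+-mono-<-≤ (≤∧≢⇒< i≤ ne) k≤) e)))

    prod-above : ∀ p r m k -> (∀ i -> m N.< i -> coef p i ≡ 𝟘) -> (∀ i -> k N.< i -> coef r i ≡ 𝟘) -> ∀ i -> m N.+ k N.< i -> coef (p ⊠ r) i ≡ 𝟘
    prod-above p r m k pz rz i h = trans (coef-⊠ p r i) (conv-vanish (coef p) (coef r) i off)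
     where
     open Ser 𝔽 using (conv-vanish)
     off : ∀ i' k' -> i' N.+ k' ≡ i -> coef p i' ≡ 𝟘 ⊎ coef r k' ≡ 𝟘
     off i' k' e with i' N.≤? m
     ... | no i> = inj₁ (pz i' (≰⇒> i>))
     ... | yes i≤ = inj₂ (rz k' (≰⇒> (\ k≤ -> <⇒≱ h (≤∙ (≡⇒≤ (sym e)) (+-mono-≤ i≤ k≤)))))

       -- The triple product has larger degree than the Wronskian.
    poly-nonzero : ∀ y -> ¬ W y ≡ 𝟘 -> NonzeroPol (poly y)
    poly-nonzero y Wy with leading (deriv P1) nzD | leading U nzU | leading V nzV
    ... | m , lm , am | k , lk , ak | l , ll , al = suc (m N.+ (k N.+ l)) , \ h -> K.*-≢0 Wy (K.*-≢0 lm (K.*-≢0 lk ll)) (trans (sym value) h)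
     where
     value : coef (poly y) (suc (m N.+ (k N.+ l))) ≡ W y ⊗ (coef (deriv P1) m ⊗ (coef U k ⊗ coef V l))
     value = trans (coef-comb (W y) (⊖ triple y) (𝟘 ∷ triplePol) WX (suc (m N.+ (k N.+ l)))) (trans (cong₂ (\ s t -> W y ⊗ s ⊕ (⊖ triple y) ⊗ t)
       (trans (prod-top (deriv P1) (U ⊠ V) m (k N.+ l) am (prod-above U V k l ak al)) (cong (coef (deriv P1) m ⊗_) (prod-top U V k l ak al)))
       (wronskian-above U V k l ak al (suc (m N.+ (k N.+ l))) (s≤s (m≤n+m (k N.+ l) m))))
      (K.solve 3 (\ w c t -> w K.:* c K.:+ (K.:- t) K.:* K.con (ℤ.+ 0) K.:= w K.:* c) refl (W y) (coef (deriv P1) m ⊗ (coef U k ⊗ coef V l)) (triple y)))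

    ev-triple : ∀ w -> ev triplePol w ≡ triple w
    ev-triple w = trans (Ev.hev-⊠ (deriv P1) (U ⊠ V) w) (cong₂ _⊗_ (Ev.hev-deriv P1 w) (Ev.hev-⊠ U V w))

    pairs : S (\ y -> S (\ w -> ind (T? y y y w))) ≤ nat (q N.* (suc (E N.+ E) N.+ suc (E N.+ (E N.+ E))))
    pairs = zeros-S {suc (E N.+ E)} {suc (E N.+ (E N.+ E))} W (\ y w -> T? y y y w) poly W-roots poly-nonzero
     (\ y -> length-comb (W y) (⊖ triple y) (𝟘 ∷ triplePol) WX triple-short (≤∙ WX-short (s≤s (+-monoʳ-≤ E (m≤m+n E E)))))
     (\ y w e -> trans (ev-comb (W y) (⊖ triple y) (𝟘 ∷ triplePol) WX w) (trans (cong₂ (\ s t -> W y ⊗ s ⊕ (⊖ triple y) ⊗ t) (trans (Ev.hev-shift triplePol w) (cong (w ⊗_) (ev-triple w))) (ev-wronskian U V w))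
      (trans (K.solve 5 (\ a w t s b -> a K.:* (w K.:* t) K.:+ (K.:- s) K.:* (w K.:* b) K.:= w K.:* (t K.:* a K.:- s K.:* b)) refl (W y) w (triple w) (triple y) (W w)) (trans (cong (w ⊗_) (K.≡-sub e)) (K.zeroʳ w)))))

   -- The Wronskian argument leaves O(q) pairs (y, z') satisfying `T`; then z is free and y' lies in
   -- a fibre of P₁, giving O(q²).
   singular : ∑4 (\ y z y' z' -> ind (on y z y' z' ×-dec T? y z y' z')) ≤ nat ((q N.* (suc (E N.+ E) N.+ suc (E N.+ (E N.+ E)))) N.* (q N.* E))
   singular = ≤-trans (≤-reflexive (trans (∑4-swap34 _) (∑4-swap23 _))) (≤-trans (Σ-mono els (\ y -> Σ-mono els (\ z' -> inner y z')))
    (≤-trans (≤-reflexive (trans (Σ-cong els (\ y -> Σ-*ʳ els _ _)) (Σ-*ʳ els _ _))) (≤-trans (*-monoʳ (nat-nonneg (q N.* E)) Sing.pairs) (≤-reflexive (sym (nat-* (q N.* (suc (E N.+ E) N.+ suc (E N.+ (E N.+ E)))) (q N.* E)))))))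
    where
    inner : ∀ y z' -> S (\ z -> S (\ y' -> ind (on y z y' z' ×-dec T? y z y' z'))) ≤ ind (T? y y y z') * nat (q N.* E)
    inner y z' = ≤-trans (Σ-mono els (\ z -> ≤-trans (Σ-mono els (\ y' -> ≤-trans (ind-mono (on y z y' z' ×-dec T? y z y' z') (T? y y y z' ×-dec (p1 y' ≟ D p1 z y ⊕ p1 z')) (\ e -> proj₂ e , move (proj₁ e)))
       (≤-reflexive (sym (ind-and (T? y y y z') (p1 y' ≟ D p1 z y ⊕ p1 z'))))))
      (≤-trans (≤-reflexive (Σ-*ˡ els _ _)) (*-monoˡ (ind-nonneg (T? y y y z')) (solve-y' y z z')))))
     (≤-reflexive (trans (S-const _) (trans (solve 3 (\ a b c -> a :* (b :* c) := b :* (a :* c)) refl (nat q) (ind (T? y y y z')) (nat E)) (cong (ind (T? y y y z') *_) (sym (nat-* q E))))))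

   -- With y' and z fixed, the equation of the quadruple prescribes P₁(y) + P₁(z'), and `X`
   -- prescribes the ratio of U(y) U(z') to V(y) V(z').
   module Generic (y' z : F) = ProductPair E P1 U V x1 U-short V-short (p1 y' ⊕ p1 z) ((u z ⊗ u y') ⊗ K.inv (v y' ⊗ v z))

   Isolated : F -> F -> F -> F -> Set
   Isolated y z y' z' = ev (proj₁ (Generic.fibre-roots y' z)) y ≡ 𝟘 × p1 z' ≡ p1 y' ⊝ D p1 z y

   isolated? : ∀ y z y' z' -> Dec (Isolated y z y' z')
   isolated? y z y' z' = (ev (proj₁ (Generic.fibre-roots y' z)) y ≟ 𝟘) ×-dec (p1 z' ≟ p1 y' ⊝ D p1 z y)

   isolated : ∑4 (\ y z y' z' -> ind (isolated? y z y' z')) ≤ nat (q N.* (q N.* (cap E N.* E)))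
   isolated = ≤-trans (≤-reflexive (trans (∑4-swap12 _) (trans (∑4-swap23 _) (∑4-swap12 _))))
    (∑4-dec (\ _ -> yes tt) (\ _ _ -> yes tt) (\ y' z y -> ev (proj₁ (Generic.fibre-roots y' z)) y ≟ 𝟘) (\ y' z y z' -> p1 z' ≟ p1 y' ⊝ D p1 z y) q q (cap E) E S-all (\ _ -> S-all)
     (\ y' z -> roots-S (proj₁ (Generic.fibre-roots y' z)) (proj₁ (proj₂ (Generic.fibre-roots y' z))) (proj₁ (proj₂ (proj₂ (Generic.fibre-roots y' z))))) (\ y' z y -> solve-z' y z y')
     (\ y' z y z' -> isolated? y z y' z') (\ y' z y z' e -> tt , tt , e))

   cover : ∀ y z y' z' -> On y z y' z' × Bad y z y' z' ->
    (On y z y' z' × v z ≡ 𝟘) ⊎ (On y z y' z' × u z' ≡ 𝟘) ⊎ (On y z y' z' × u y' ≡ 𝟘) ⊎ (On y z y' z' × v y' ≡ 𝟘) ⊎ (On y z y' z' × d1 z' ≡ 𝟘) ⊎ (On y z y' z' × T y z y' z') ⊎ Isolated y z y' z'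
   cover y z y' z' (o , inj₁ e) = inj₁ (o , e)
   cover y z y' z' (o , inj₂ (inj₁ e)) = inj₂ (inj₁ (o , e))
   cover y z y' z' (o , inj₂ (inj₂ (inj₁ e))) = inj₂ (inj₂ (inj₁ (o , e)))
   cover y z y' z' (o , inj₂ (inj₂ (inj₂ x))) with v z ≟ 𝟘 | v y' ≟ 𝟘 | d1 z' ≟ 𝟘 | T? y z y' z'
   ... | yes e | _ | _ | _ = inj₁ (o , e)
   ... | no _ | yes e | _ | _ = inj₂ (inj₂ (inj₂ (inj₁ (o , e))))
   ... | no _ | no _ | yes e | _ = inj₂ (inj₂ (inj₂ (inj₂ (inj₁ (o , e)))))
   ... | no _ | no _ | no _ | yes e = inj₂ (inj₂ (inj₂ (inj₂ (inj₂ (inj₁ (o , e))))))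
   ... | no nz | no ny | no nd | no nt = inj₂ (inj₂ (inj₂ (inj₂ (inj₂ (inj₂ (proj₂ (proj₂ (proj₂ (Generic.fibre-roots y' z))) y z' (on-sum y z y' z' o) ratio (nd , nt) , on-z' y z y' z' o))))))
    where
    ne : ¬ v y' ⊗ v z ≡ 𝟘
    ne = K.*-≢0 ny nz
    ratio : ev U y ⊗ ev U z' ≡ ((u z ⊗ u y') ⊗ K.inv (v y' ⊗ v z)) ⊗ (ev V y ⊗ ev V z')
    ratio = trans (cong₂ _⊗_ (Ev.hev-deriv Q y) (Ev.hev-deriv Q z')) (trans (sym (K.*-identityˡ _)) (trans (cong (_⊗ (u y ⊗ u z')) (sym (K.inv-l ne))) (trans (K.*-assoc _ _ _) (trans (cong (K.inv (v y' ⊗ v z) ⊗_) (sym x))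
     (trans (K.solve 5 (\ i a b c d -> i K.:* ((a K.:* b) K.:* (c K.:* d)) K.:= ((c K.:* d) K.:* i) K.:* (b K.:* a)) refl (K.inv (v y' ⊗ v z)) (v z') (v y) (u z) (u y'))
      (cong (((u z ⊗ u y') ⊗ K.inv (v y' ⊗ v z)) ⊗_) (cong₂ _⊗_ (sym (Ev.hev-deriv P2 y)) (sym (Ev.hev-deriv P2 z')))))))))

   -- Quadruples form a family of size O(q³); each of the seven loci in `cover` imposes one further
   -- independent condition and so has size O(q²).
   bad-count : ∑4 (\ y z y' z' -> ind (on y z y' z' ×-dec bad? y z y' z')) ≤ nat (q N.* q N.* badConst E)
   bad-count = ≤-trans (∑4-mono pt) (≤-trans (≤-reflexive split) (≤-trans
     (+-mono (at-z P2 x2) (+-mono (at-z' Q xQ) (+-mono (at-y' Q xQ) (+-mono (at-y' P2 x2) (+-mono (at-z' P1 x1) (+-mono singular isolated))))))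
     (≤-reflexive (trans (sym sum-nat) (cong nat (ar q E G (cap E)))))))
    where
    G : ℕ
    G = suc (E N.+ E) N.+ suc (E N.+ (E N.+ E))
    A1 A2 A3 A4 A5 A6 A7 : F -> F -> F -> F -> Z
    A1 y z y' z' = ind (on y z y' z' ×-dec (v z ≟ 𝟘))
    A2 y z y' z' = ind (on y z y' z' ×-dec (u z' ≟ 𝟘))
    A3 y z y' z' = ind (on y z y' z' ×-dec (u y' ≟ 𝟘))
    A4 y z y' z' = ind (on y z y' z' ×-dec (v y' ≟ 𝟘))
    A5 y z y' z' = ind (on y z y' z' ×-dec (d1 z' ≟ 𝟘))
    A6 y z y' z' = ind (on y z y' z' ×-dec T? y z y' z')
    A7 y z y' z' = ind (isolated? y z y' z')
    ⊎-≤ : ∀ {A B : Set} (a : Dec A) (b : Dec B) {x} -> ind b ≤ x -> ind (a ⊎-dec b) ≤ ind a + x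
    ⊎-≤ a b h = ≤-trans (ind-⊎ a b) (+-mono ≤-refl h)
    pt : ∀ y z y' z' -> ind (on y z y' z' ×-dec bad? y z y' z') ≤ A1 y z y' z' + (A2 y z y' z' + (A3 y z y' z' + (A4 y z y' z' + (A5 y z y' z' + (A6 y z y' z' + A7 y z y' z')))))
    pt y z y' z' = ≤-trans (ind-mono (o ×-dec bad? y z y' z') (a1 ⊎-dec (a2 ⊎-dec (a3 ⊎-dec (a4 ⊎-dec (a5 ⊎-dec (a6 ⊎-dec a7)))))) (cover y z y' z'))
      (⊎-≤ a1 (a2 ⊎-dec (a3 ⊎-dec (a4 ⊎-dec (a5 ⊎-dec (a6 ⊎-dec a7))))) (⊎-≤ a2 (a3 ⊎-dec (a4 ⊎-dec (a5 ⊎-dec (a6 ⊎-dec a7)))) (⊎-≤ a3 (a4 ⊎-dec (a5 ⊎-dec (a6 ⊎-dec a7))) (⊎-≤ a4 (a5 ⊎-dec (a6 ⊎-dec a7)) (⊎-≤ a5 (a6 ⊎-dec a7) (ind-⊎ a6 a7))))))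
     where
     o = on y z y' z'
     a1 = o ×-dec (v z ≟ 𝟘)
     a2 = o ×-dec (u z' ≟ 𝟘)
     a3 = o ×-dec (u y' ≟ 𝟘)
     a4 = o ×-dec (v y' ≟ 𝟘)
     a5 = o ×-dec (d1 z' ≟ 𝟘)
     a6 = o ×-dec T? y z y' z'
     a7 = isolated? y z y' z'
    split : ∑4 (\ y z y' z' -> A1 y z y' z' + (A2 y z y' z' + (A3 y z y' z' + (A4 y z y' z' + (A5 y z y' z' + (A6 y z y' z' + A7 y z y' z')))))) ≡ ∑4 A1 + (∑4 A2 + (∑4 A3 + (∑4 A4 + (∑4 A5 + (∑4 A6 + ∑4 A7)))))
    split = trans (∑4-+ A1 _) (cong (∑4 A1 +_) (trans (∑4-+ A2 _) (cong (∑4 A2 +_) (trans (∑4-+ A3 _) (cong (∑4 A3 +_) (trans (∑4-+ A4 _) (cong (∑4 A4 +_) (trans (∑4-+ A5 _) (cong (∑4 A5 +_) (∑4-+ A6 A7))))))))))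
    n1 n2 n6 n7 : ℕ
    n1 = q N.* (E N.* (q N.* E))
    n2 = q N.* (q N.* (E N.* E))
    n6 = (q N.* G) N.* (q N.* E)
    n7 = q N.* (q N.* (cap E N.* E))
    sum-nat : nat (n1 N.+ (n2 N.+ (n2 N.+ (n2 N.+ (n2 N.+ (n6 N.+ n7)))))) ≡ nat n1 + (nat n2 + (nat n2 + (nat n2 + (nat n2 + (nat n6 + nat n7)))))
    sum-nat = trans (nat-+ n1 _) (cong (nat n1 +_) (trans (nat-+ n2 _) (cong (nat n2 +_) (trans (nat-+ n2 _) (cong (nat n2 +_) (trans (nat-+ n2 _) (cong (nat n2 +_) (trans (nat-+ n2 _) (cong (nat n2 +_) (nat-+ n6 n7))))))))))
    ar : ∀ q E G c -> q N.* (E N.* (q N.* E)) N.+ (q N.* (q N.* (E N.* E)) N.+ (q N.* (q N.* (E N.* E)) N.+ (q N.* (q N.* (E N.* E)) N.+ (q N.* (q N.* (E N.* E)) N.+ ((q N.* G) N.* (q N.* E) N.+ q N.* (q N.* (c N.* E)))))))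
      ≡ q N.* q N.* (5 N.* (E N.* E) N.+ G N.* E N.+ c N.* E)
    ar = solve-∀

   key-eqs : ∀ y z y' z' k1 k2 k3 -> key ((y , z) , (y' , z')) ≡ (k1 , k2 , k3) -> (p2 z ≡ p2 y ⊕ (⊖ k2)) × (q' z' ≡ q' z ⊕ k1) × (q' y' ≡ q' y ⊕ k3)
   key-eqs y z y' z' k1 k2 k3 refl = K.solve 2 (\ a b -> b K.:= a K.:+ K.:- (a K.:- b)) refl (p2 y) (p2 z) ,
    trans (Q≡ z') (trans (K.solve 2 (\ a b -> a K.:= b K.:+ (a K.:- b)) refl (p2 z' ⊝ p1 z') (p2 z ⊝ p1 z)) (cong (_⊕ _) (sym (Q≡ z)))) ,
    trans (Q≡ y') (trans (K.solve 2 (\ a b -> a K.:= b K.:+ (a K.:- b)) refl (p2 y' ⊝ p1 y') (p2 y ⊝ p1 y)) (cong (_⊕ _) (sym (Q≡ y))))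

   -- Substituting P₁ = P₂ - Q into the equation of the quadruple expresses P₂(z') - P₂(y') through
   -- the key. This supplies the fourth side of the cycle.
   closing : ∀ y z y' z' -> On y z y' z' -> p2 z' ⊝ p2 y' ≡ (D (\ t -> p2 t ⊝ p1 t) z z' ⊝ D p2 z y) ⊝ D (\ t -> p2 t ⊝ p1 t) y y'
   closing y z y' z' o = trans (K.solve 4 (\ a b c d -> a K.:- b K.:= ((a K.:- c) K.:- (b K.:- d)) K.:- (d K.:- c)) refl (p2 z') (p2 y') (p1 z') (p1 y'))
    (trans (cong (\ t -> ((p2 z' ⊝ p1 z') ⊝ (p2 y' ⊝ p1 y')) ⊝ t) o)
     (K.solve 6 (\ A B y₁ z₁ y2 z2 -> (A K.:- B) K.:- (y₁ K.:- z₁) K.:= ((A K.:- (z2 K.:- z₁)) K.:- (y2 K.:- z2)) K.:- (B K.:- (y2 K.:- y₁))) refl (p2 z' ⊝ p1 z') (p2 y' ⊝ p1 y') (p1 y) (p1 z) (p2 y) (p2 z)))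

   E³ : ℕ
   E³ = E N.* (E N.* E)

   fibre : ∀ k -> ∑4 (\ y z y' z' -> ind (on y z y' z' ×-dec (key ((y , z) , (y' , z')) ≟³ k))) ≤ nat (q N.* E³)
   fibre (k1 , k2 , k3) = ∑4-dec (\ _ -> yes tt) (\ y z -> p2 z ≟ p2 y ⊕ (⊖ k2)) (\ y z y' -> q' y' ≟ q' y ⊕ k3) (\ y z y' z' -> q' z' ≟ q' z ⊕ k1) q E E E S-all
    (\ y -> fibre-S P2 x2 _) (\ y z -> fibre-S Q xQ _) (\ y z y' -> fibre-S Q xQ _) (\ y z y' z' -> on y z y' z' ×-dec (key ((y , z) , (y' , z')) ≟³ (k1 , k2 , k3)))
    (\ y z y' z' e -> let (e1 , e2 , e3) = key-eqs y z y' z' k1 k2 k3 (proj₂ e) in tt , e1 , e3 , e2)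

   good-fibre : ∀ k -> ∑4 (\ y z y' z' -> ind (on y z y' z' ×-dec (¬? (bad? y z y' z') ×-dec (key ((y , z) , (y' , z')) ≟³ k)))) ≤ nat (cap E N.* E³)
   good-fibre (k1 , k2 , k3) = ∑4-dec (\ y -> ev φ y ≟ 𝟘) (\ y z -> p2 z ≟ p2 y ⊕ (⊖ k2)) (\ y z y' -> q' y' ≟ q' y ⊕ k3) (\ y z y' z' -> q' z' ≟ q' z ⊕ k1) (cap E) E E E
    (roots-S φ (proj₁ (proj₂ C.fibre-roots)) (proj₁ (proj₂ (proj₂ C.fibre-roots)))) (\ y -> fibre-S P2 x2 _) (\ y z -> fibre-S Q xQ _) (\ y z y' -> fibre-S Q xQ _)
    (\ y z y' z' -> on y z y' z' ×-dec (¬? (bad? y z y' z') ×-dec (key ((y , z) , (y' , z')) ≟³ (k1 , k2 , k3))))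
    (\ { y z y' z' (o , nb , ek) -> let (e1 , e2 , e3) = key-eqs y z y' z' k1 k2 k3 ek in
      proj₂ (proj₂ (proj₂ C.fibre-roots)) y z y' z' e1 e2 e3 (trans (closing y z y' z' o) (cong (\ k -> (proj₁ k ⊝ proj₁ (proj₂ k)) ⊝ proj₂ (proj₂ k)) ek))
       ((\ h -> nb (inj₁ h)) , (\ h -> nb (inj₂ (inj₁ h))) , (\ h -> nb (inj₂ (inj₂ (inj₁ h)))) , (\ h -> nb (inj₂ (inj₂ (inj₂ h))))) , e1 , e3 , e2 })
    where
    module C = Cycle E P2 Q x2 xQ (⊖ k2) k1 k3 ((k1 ⊝ k2) ⊝ k3)
    φ : Pol
    φ = proj₁ C.fibre-roots

  -- Split the colliding pairs (p, p') by whether p' is singular. There are O(q³) choices of p with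
  -- boundedly many nonsingular p' of the same key, and O(q²) singular p' with O(q) partners p each.
  quadruples-≤ : quadruples ≤ nat (q N.* q N.* q N.* quadConst E)
  quadruples-≤ = ≤-trans (≤-reflexive (trans (Σ-cong els⁴ (\ p -> trans (Σ-cong els⁴ (\ p' -> split p p')) (Σ-+ els⁴ _ _))) (Σ-+ els⁴ _ _))) (≤-trans (+-mono T1 T2) (≤-reflexive fin))
   where
   Pt = (F × F) × (F × F)
   w b : Pt -> Z
   w p = ind (on? p)
   bd? : ∀ (p : Pt) -> Dec (Bad (proj₁ (proj₁ p)) (proj₂ (proj₁ p)) (proj₁ (proj₂ p)) (proj₂ (proj₂ p)))
   bd? ((y , z) , (y' , z')) = bad? y z y' z'
   b p = ind (bd? p)
   I : Pt -> Pt -> Z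
   I p' p = ind (key p' ≟³ key p)
   split : ∀ p p' -> w p * w p' * I p' p ≡ w p * (w p' * (ind (¬? (bd? p')) * I p' p)) + (w p' * b p') * (w p * I p' p)
   split p p' = trans (trans (sym (*-identityˡ _)) (solve 5 (\ o a c i e -> o :* (a :* c :* i) := a :* (c :* ((o :- e) :* i)) :+ (c :* e) :* (a :* i)) refl 1z (w p) (w p') (I p' p) (b p')))
    (cong (\ t -> w p * (w p' * (t * I p' p)) + (w p' * b p') * (w p * I p' p)) (1-ind (bd? p')))
   T1 : Σ els⁴ (\ p -> Σ els⁴ (\ p' -> w p * (w p' * (ind (¬? (bd? p')) * I p' p)))) ≤ nat (q N.* (q N.* (q N.* E))) * nat (cap E N.* E³)
   T1 = ≤-trans (≤-reflexive (Σ-cong els⁴ (\ p -> Σ-*ˡ els⁴ (w p) _))) (≤-trans (Σ-mono els⁴ (\ p -> *-monoˡ (ind-nonneg (on? p)) (≤-trans (≤-reflexive (trans (Σ-cong els⁴ (\ p' ->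
      trans (cong (w p' *_) (ind-and (¬? (bd? p')) (key p' ≟³ key p))) (ind-and (on? p') (¬? (bd? p') ×-dec (key p' ≟³ key p))))) (∑4-els⁴ _))) (good-fibre (key p)))))
     (≤-trans (≤-reflexive (Σ-*ʳ els⁴ _ w)) (*-monoʳ (nat-nonneg (cap E N.* E³)) (≤-trans (≤-reflexive (∑4-els⁴ w)) total))))
   T2 : Σ els⁴ (\ p -> Σ els⁴ (\ p' -> (w p' * b p') * (w p * I p' p))) ≤ nat (q N.* q N.* badConst E) * nat (q N.* E³)
   T2 = ≤-trans (≤-reflexive (trans (Σ-swap els⁴ els⁴ _) (Σ-cong els⁴ (\ p' -> Σ-*ˡ els⁴ (w p' * b p') _)))) (≤-trans (Σ-mono els⁴ (\ p' -> *-monoˡ (*-nonneg (ind-nonneg (on? p')) (ind-nonneg (bd? p')))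
      (≤-trans (≤-reflexive (trans (Σ-cong els⁴ (\ p -> trans (cong (w p *_) (ind-cong (key p' ≟³ key p) (key p ≟³ key p') sym sym)) (ind-and (on? p) (key p ≟³ key p')))) (∑4-els⁴ _))) (fibre (key p')))))
     (≤-trans (≤-reflexive (Σ-*ʳ els⁴ _ _)) (*-monoʳ (nat-nonneg (q N.* E³)) (≤-trans (≤-reflexive (trans (Σ-cong els⁴ (\ p -> ind-and (on? p) (bd? p))) (∑4-els⁴ _))) bad-count))))
   fin : nat (q N.* (q N.* (q N.* E))) * nat (cap E N.* E³) + nat (q N.* q N.* badConst E) * nat (q N.* E³) ≡ nat (q N.* q N.* q N.* quadConst E)
   fin = trans (cong₂ _+_ (sym (nat-* (q N.* (q N.* (q N.* E))) (cap E N.* E³))) (sym (nat-* (q N.* q N.* badConst E) (q N.* E³)))) (trans (sym (nat-+ ((q N.* (q N.* (q N.* E))) N.* (cap E N.* E³)) ((q N.* q N.* badConst E) N.* (q N.* E³)))) (cong nat (ar q E (cap E) (badConst E) E³)))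
    where
    ar : ∀ q E c B e -> (q N.* (q N.* (q N.* E))) N.* (c N.* e) N.+ (q N.* q N.* B) N.* (q N.* e) ≡ q N.* q N.* q N.* ((c N.* e) N.* E N.+ B N.* e)
    ar = solve-∀

-- Separating the mean from each weight.

module Decompose (𝔽 : FiniteField) (𝕆 : OrderedRing) where
 open ≡ hiding (J)
 open FSum 𝔽 𝕆
 open Analysis 𝔽 𝕆
 private module K = Fld 𝔽

 module _ (P1 P2 : F -> F) (α β γ : F -> Z) (a b e : Z) (SA : S α ≡ a) (SB : S β ≡ b) (SC : S γ ≡ e) where

  T1 T2 T3 : Z
  T1 = S (\ x -> S (\ y -> proj β (x ⊕ P1 y) * proj γ (x ⊕ P2 y)))
  T2 = S (\ x -> S (\ y -> proj α x * proj γ (x ⊕ P2 y)))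
  T3 = S (\ x -> S (\ y -> proj α x * proj β (x ⊕ P1 y)))

  T1-rotate : T1 ≡ S (\ x -> S (\ y -> proj β x * proj γ (x ⊕ (P2 y ⊝ P1 y))))
  T1-rotate = trans (Σ-swap els els _) (trans (Σ-cong els (\ y -> trans (sym (S-shift (⊖ P1 y) _)) (Σ-cong els (\ x -> cong₂ (\ s t -> proj β s * proj γ t)
    (K.solve 2 (\ x p -> (x K.:+ K.:- p) K.:+ p K.:= x) refl x (P1 y)) (K.solve 3 (\ x p r -> (x K.:+ K.:- p) K.:+ r K.:= x K.:+ (r K.:- p)) refl x (P1 y) (P2 y)))))) (Σ-swap els els _))

  private
   f g h : F -> Z
   f = proj α
   g = proj β
   h = proj γ

   ∑² : (F -> F -> Z) -> Z
   ∑² φ = S (\ x -> S (φ x))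

   ∑²-+ : ∀ φ ψ -> ∑² (\ x y -> φ x y + ψ x y) ≡ ∑² φ + ∑² ψ
   ∑²-+ φ ψ = trans (Σ-cong els (\ x -> Σ-+ els _ _)) (Σ-+ els _ _)

   ∑²-* : ∀ k φ -> ∑² (\ x y -> k * φ x y) ≡ k * ∑² φ
   ∑²-* k φ = trans (Σ-cong els (\ x -> Σ-*ˡ els _ _)) (Σ-*ˡ els _ _)

   ∑²-shift : ∀ (P : F -> F) φ -> S φ ≡ 0z -> ∑² (\ x y -> φ (x ⊕ P y)) ≡ 0z
   ∑²-shift P φ Sφ = trans (Σ-swap els els _) (trans (Σ-cong els (\ y -> trans (S-shift (P y) φ) Sφ)) (Σ-zero els))

   ∑²-left : ∀ φ -> S φ ≡ 0z -> ∑² (\ x y -> φ x) ≡ 0z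
   ∑²-left φ Sφ = trans (Σ-cong els (\ x -> S-const (φ x))) (trans (Σ-*ˡ els _ _) (trans (cong (nat q *_) Sφ) (zeroʳ (nat q))))

  -- Expand the product after writing q α = `proj α` + a, and likewise for β and γ. Terms with
  -- exactly one mean-zero factor sum to zero, the term without any is the main term, and the terms
  -- with two become the two-weight sums `T1`, `T2`, `T3`.
  decomposition : nat q * (nat q * (nat q * N P1 P2 α β γ - a * b * e)) ≡ (N P1 P2 (proj α) (proj β) (proj γ) + a * T1) + (b * T2 + e * T3)
  decomposition = trans (solve 4 (\ q n t k -> q :* (q :* (q :* n :- t)) := (q :* (q :* (q :* n))) :- (q :* q) :* t) refl (nat q) (N P1 P2 α β γ) (a * b * e) 0z)
   (trans (cong (_- (nat q * nat q) * (a * b * e)) total)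
    (solve 3 (\ x k t -> (x :+ k :* t) :- k :* t := x) refl ((N P1 P2 (proj α) (proj β) (proj γ) + a * T1) + (b * T2 + e * T3)) (nat q * nat q) (a * b * e)))
   where
   m₁ m2 m3 m4 m5 m6 m7 : F -> F -> Z
   m₁ x y = f x * g (x ⊕ P1 y) * h (x ⊕ P2 y)
   m2 x y = g (x ⊕ P1 y) * h (x ⊕ P2 y)
   m3 x y = f x * h (x ⊕ P2 y)
   m4 x y = f x * g (x ⊕ P1 y)
   m5 x y = h (x ⊕ P2 y)
   m6 x y = g (x ⊕ P1 y)
   m7 x y = f x
   proj≡ : ∀ φ X -> S φ ≡ X -> ∀ x -> nat q * φ x ≡ proj φ x + X
   proj≡ φ X Sφ x = trans (solve 2 (\ u s -> u := (u :- s) :+ s) refl (nat q * φ x) (S φ)) (cong (\ t -> proj φ x + t) Sφ)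
   pt : ∀ x y -> nat q * (nat q * (nat q * (α x * β (x ⊕ P1 y) * γ (x ⊕ P2 y)))) ≡
    ((m₁ x y + a * m2 x y) + (b * m3 x y + e * m4 x y)) + (((a * b) * m5 x y + (a * e) * m6 x y) + ((b * e) * m7 x y + a * b * e))
   pt x y = trans (solve 4 (\ q u v w -> q :* (q :* (q :* (u :* v :* w))) := (q :* u) :* (q :* v) :* (q :* w)) refl (nat q) (α x) (β (x ⊕ P1 y)) (γ (x ⊕ P2 y)))
    (trans (cong₂ _*_ (cong₂ _*_ (proj≡ α a SA x) (proj≡ β b SB (x ⊕ P1 y))) (proj≡ γ e SC (x ⊕ P2 y)))
     (solve 6 (\ f g h a b e -> (f :+ a) :* (g :+ b) :* (h :+ e) := ((f :* g :* h :+ a :* (g :* h)) :+ (b :* (f :* h) :+ e :* (f :* g))) :+ (((a :* b) :* h :+ (a :* e) :* g) :+ ((b :* e) :* f :+ a :* b :* e))) refl (f x) (g (x ⊕ P1 y)) (h (x ⊕ P2 y)) a b e))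
   total : nat q * (nat q * (nat q * N P1 P2 α β γ)) ≡ ((N P1 P2 (proj α) (proj β) (proj γ) + a * T1) + (b * T2 + e * T3)) + (nat q * nat q) * (a * b * e)
   total = trans (sym (trans (∑²-* (nat q) _) (cong (nat q *_) (trans (∑²-* (nat q) _) (cong (nat q *_) (∑²-* (nat q) _))))))
    (trans (Σ-cong els (\ x -> Σ-cong els (\ y -> pt x y)))
    (trans (∑²-+ _ _) (cong₂ _+_ (trans (∑²-+ _ _) (cong₂ _+_ (trans (∑²-+ m₁ _) (cong (∑² m₁ +_) (∑²-* a m2))) (trans (∑²-+ _ _) (cong₂ _+_ (∑²-* b m3) (∑²-* e m4)))))
     (trans (∑²-+ _ _) (trans (cong₂ _+_ (trans (∑²-+ _ _) (cong₂ _+_ (trans (∑²-* (a * b) m5) (trans (cong (a * b *_) (∑²-shift P2 h (S-proj γ))) (zeroʳ (a * b)))) (trans (∑²-* (a * e) m6) (trans (cong (a * e *_) (∑²-shift P1 g (S-proj β))) (zeroʳ (a * e))))))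
       (trans (∑²-+ _ _) (cong₂ _+_ (trans (∑²-* (b * e) m7) (trans (cong (b * e *_) (∑²-left f (S-proj α))) (zeroʳ (b * e)))) (trans (Σ-cong els (\ x -> S-const (a * b * e))) (trans (S-const _) (sym (*-assoc (nat q) (nat q) (a * b * e))))))))
       (trans (cong₂ _+_ (+-identityˡ 0z) (+-identityˡ _)) (+-identityˡ _)))))))

-- The estimate for indicator functions.

module Sets (𝔽 : FiniteField) where
 open import Data.Nat using (_^_)
 open import Data.Integer using (∣_∣)
 open ≡ hiding (J)
 open import Algebra.Solver.CommutativeMonoid NP.*-1-commutativeMonoid using (_⊕_; _⊜_) renaming (solve to solveM)
 open IntRing
 open NumChain using (_⋆_)
 open FSum 𝔽 integers hiding (∣_∣; _⊕_)
 private module FS = FSum 𝔽 integers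
 open Analysis 𝔽 integers
 open Analysis2 𝔽 integers
 open Count 𝔽 integers using (nat-*)
 private module DC = Decompose 𝔽 integers

 -- The factor 2 is kept symbolic so that its powers are never computed.
 two-sum : ∀ t -> t ≡ 2 -> ∀ {x y W} -> x ^ 16 N.≤ W -> y ^ 16 N.≤ W -> (x N.+ y) ^ 16 N.≤ t ^ 16 N.* W
 two-sum t t≡2 {x} {y} {W} p r = go (≤-total x y)
  where
  scaled : ∀ z {s} -> s N.≤ z N.+ z -> z ^ 16 N.≤ W -> s ^ 16 N.≤ t ^ 16 N.* W
  scaled z {s} le h = begin
   s ^ 16 ≤⟨ ^-monoˡ-≤ 16 (≤∙ le (≡⇒≤ (trans (cong (z N.+_) (sym (NP.+-identityʳ z))) (cong (N._* z) (sym t≡2))))) ⟩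
   (t N.* z) ^ 16 ≡⟨ solveM 2 (\ t y -> (t ⊕ y) ⋆ 16 ⊜ (t ⋆ 16) ⊕ (y ⋆ 16)) refl t z ⟩
   t ^ 16 N.* z ^ 16 ≤⟨ *-monoʳ-≤ (t ^ 16) h ⟩
   t ^ 16 N.* W ∎
   where open NP.≤-Reasoning
  go : x N.≤ y ⊎ y N.≤ x -> (x N.+ y) ^ 16 N.≤ t ^ 16 N.* W
  go (inj₁ x≤y) = scaled y (+-monoˡ-≤ y x≤y) r
  go (inj₂ y≤x) = scaled x (+-monoʳ-≤ x y≤x) p

 module _ (P1 P2 : F -> F) (Λ D' K₀ : ℕ) .{{_ : N.NonZero q}} .{{_ : N.NonZero K₀}}
  (linP1 : LinBound P1 (nat Λ)) (linP2 : LinBound P2 (nat Λ)) (linQ : LinBound (\ y -> P2 y ⊝ P1 y) (nat Λ))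
  (Λ² : Λ N.* Λ N.≤ D' N.* q ^ 3) (D⁴ : D' ^ 4 N.≤ K₀)
  (core : ∀ f g h -> S f ≡ 0z -> S g ≡ 0z -> S h ≡ 0z -> ∣ N P1 P2 f g h ∣ ^ 16 N.≤ K₀ N.* q ^ 7 N.* (∣ n f ∣ N.* ∣ n g ∣ N.* ∣ n h ∣) ^ 8)
  (α β γ : F -> ℤ) (α² : ∀ x -> α x * α x ≡ α x) (β² : ∀ x -> β x * β x ≡ β x) (γ² : ∀ x -> γ x * γ x ≡ γ x)
  (A B C : ℕ) (SA : S α ≡ nat A) (SB : S β ≡ nat B) (SC : S γ ≡ nat C) (A≤q : A N.≤ q) (B≤q : B N.≤ q) (C≤q : C N.≤ q) where

  private
   f g h : F -> ℤ
   f = proj α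
   g = proj β
   h = proj γ

   T1 T2 T3 : ℤ
   T1 = DC.T1 P1 P2 α β γ (nat A) (nat B) (nat C) SA SB SC
   T2 = DC.T2 P1 P2 α β γ (nat A) (nat B) (nat C) SA SB SC
   T3 = DC.T3 P1 P2 α β γ (nat A) (nat B) (nat C) SA SB SC

   δ : ℤ
   δ = nat q * N P1 P2 α β γ - nat A * nat B * nat C

   size : ∀ φ X -> (∀ x -> φ x * φ x ≡ φ x) -> S φ ≡ nat X -> ∣ n (proj φ) ∣ N.≤ q N.* q N.* X
   size φ X φ² Sφ = ∣∣-≤ (n-nonneg (proj φ)) (≤-trans (n-proj φ) (≤-reflexive (trans (cong (nat q * nat q *_) (trans (Σ-cong els φ²) Sφ)) (trans (cong (_* nat X) (sym (nat-* q q))) (sym (nat-* (q N.* q) X))))))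

   M W : ℕ
   M = A N.* B N.* C
   W = K₀ N.* q ^ 55 N.* M ^ 8

   -- Bound one factor Z' of Z'² by q, to obtain the symmetric product X Y Z'. The powers of q are
   -- 40 from Z' and the norms and 12 from Λ^8, and 52 is below the 55 coming from the term with
   -- three mean-zero weights.
   linear : ∀ (T : ℤ) (u v : F -> ℤ) (X Y Z' : ℕ) -> T * T ≤ n u * (nat Λ * n v) -> ∣ n u ∣ N.≤ q N.* q N.* X -> ∣ n v ∣ N.≤ q N.* q N.* Y -> Z' N.≤ q -> X N.* Y N.* Z' ≡ M -> ∣ nat Z' * T ∣ ^ 16 N.≤ W
   linear T u v X Y Z' hT hu hv hz eq = begin
    ∣ nat Z' * T ∣ ^ 16 ≡⟨ cong (_^ 16) (trans (ℤₚ.abs-* (nat Z') T) (cong (N._* t) (∣nat∣ Z'))) ⟩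
    (Z' N.* t) ^ 16 ≡⟨ solveM 2 (\ z t -> (z ⊕ t) ⋆ 16 ⊜ ((z ⊕ z) ⊕ (t ⊕ t)) ⋆ 8) refl Z' t ⟩
    ((Z' N.* Z') N.* (t N.* t)) ^ 8 ≤⟨ ^-monoˡ-≤ 8 (*-mono-≤ (*-monoʳ-≤ Z' hz) tt≤) ⟩
    ((Z' N.* q) N.* ((q N.* q N.* X) N.* (Λ N.* (q N.* q N.* Y)))) ^ 8 ≡⟨ solveM 5 (\ z q x l y -> ((z ⊕ q) ⊕ (((q ⊕ q) ⊕ x) ⊕ (l ⊕ ((q ⊕ q) ⊕ y)))) ⋆ 8 ⊜ ((q ⋆ 40) ⊕ ((((x ⊕ y) ⊕ z)) ⋆ 8)) ⊕ ((l ⊕ l) ⋆ 4)) refl Z' q X Λ Y ⟩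
    q ^ 40 N.* (X N.* Y N.* Z') ^ 8 N.* (Λ N.* Λ) ^ 4 ≤⟨ *-mono-≤ (≡⇒≤ (cong (\ t -> q ^ 40 N.* t ^ 8) eq)) (^-monoˡ-≤ 4 Λ²) ⟩
    q ^ 40 N.* M ^ 8 N.* (D' N.* q ^ 3) ^ 4 ≡⟨ solveM 3 (\ q m d -> ((q ⋆ 40) ⊕ (m ⋆ 8)) ⊕ ((d ⊕ (q ⋆ 3)) ⋆ 4) ⊜ ((d ⋆ 4) ⊕ (q ⋆ 52)) ⊕ (m ⋆ 8)) refl q M D' ⟩
    D' ^ 4 N.* q ^ 52 N.* M ^ 8 ≤⟨ *-monoˡ-≤ (M ^ 8) (*-mono-≤ D⁴ (^-monoʳ-≤ q (m≤n+m 52 3))) ⟩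
    W ∎
    where
    open NP.≤-Reasoning
    t : ℕ
    t = ∣ T ∣
    tt≤ : t N.* t N.≤ (q N.* q N.* X) N.* (Λ N.* (q N.* q N.* Y))
    tt≤ = ≤∙ (∣∣-sq-mono {T} hT) (≤∙ (≡⇒≤ (trans (ℤₚ.abs-* (n u) _) (cong (∣ n u ∣ N.*_) (trans (ℤₚ.abs-* (nat Λ) (n v)) (cong (N._* ∣ n v ∣) (∣nat∣ Λ))))))
     (*-mono-≤ hu (*-monoʳ-≤ Λ hv)))

   b1 : ∣ N P1 P2 f g h ∣ ^ 16 N.≤ W
   b1 = begin
    ∣ N P1 P2 f g h ∣ ^ 16 ≤⟨ core f g h (S-proj α) (S-proj β) (S-proj γ) ⟩
    K₀ N.* q ^ 7 N.* (∣ n f ∣ N.* ∣ n g ∣ N.* ∣ n h ∣) ^ 8 ≤⟨ *-monoʳ-≤ (K₀ N.* q ^ 7) (^-monoˡ-≤ 8 (*-mono-≤ (*-mono-≤ (size α A α² SA) (size β B β² SB)) (size γ C γ² SC))) ⟩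
    K₀ N.* q ^ 7 N.* ((q N.* q N.* A) N.* (q N.* q N.* B) N.* (q N.* q N.* C)) ^ 8 ≡⟨ solveM 5 (\ k q a b c -> (k ⊕ (q ⋆ 7)) ⊕ (((((q ⊕ q) ⊕ a) ⊕ ((q ⊕ q) ⊕ b)) ⊕ ((q ⊕ q) ⊕ c)) ⋆ 8) ⊜ (k ⊕ (q ⋆ 55)) ⊕ (((a ⊕ b) ⊕ c) ⋆ 8)) refl K₀ q A B C ⟩
    W ∎
    where open NP.≤-Reasoning

   b2 : ∣ nat A * T1 ∣ ^ 16 N.≤ W
   b2 = linear T1 g h B C A (subst (\ t -> t * t ≤ n g * (nat Λ * n h)) (sym (DC.T1-rotate P1 P2 α β γ (nat A) (nat B) (nat C) SA SB SC)) (N-linear (\ y -> P2 y ⊝ P1 y) (nat Λ) (nat-nonneg Λ) linQ g h (S-proj γ))) (size β B β² SB) (size γ C γ² SC) A≤q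
     (solveM 3 (\ a b c -> (b ⊕ c) ⊕ a ⊜ (a ⊕ b) ⊕ c) refl A B C)
   b3 : ∣ nat B * T2 ∣ ^ 16 N.≤ W
   b3 = linear T2 f h A C B (N-linear P2 (nat Λ) (nat-nonneg Λ) linP2 f h (S-proj γ)) (size α A α² SA) (size γ C γ² SC) B≤q
     (solveM 3 (\ a b c -> (a ⊕ c) ⊕ b ⊜ (a ⊕ b) ⊕ c) refl A B C)

   b4 : ∣ nat C * T3 ∣ ^ 16 N.≤ W
   b4 = linear T3 f g A B C (N-linear P1 (nat Λ) (nat-nonneg Λ) linP1 f g (S-proj β)) (size α A α² SA) (size β B β² SB) C≤q refl

   split : q N.* (q N.* ∣ δ ∣) N.≤ (∣ N P1 P2 f g h ∣ N.+ ∣ nat A * T1 ∣) N.+ (∣ nat B * T2 ∣ N.+ ∣ nat C * T3 ∣)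
   split = ≤∙ (≡⇒≤ (sym (trans (ℤₚ.abs-* (nat q) _) (cong₂ N._*_ (∣nat∣ q) (trans (ℤₚ.abs-* (nat q) δ) (cong (N._* ∣ δ ∣) (∣nat∣ q)))))))
    (≤∙ (≡⇒≤ (cong ∣_∣ (DC.decomposition P1 P2 α β γ (nat A) (nat B) (nat C) SA SB SC))) (≤∙ (ℤₚ.∣i+j∣≤∣i∣+∣j∣ (N P1 P2 f g h + nat A * T1) (nat B * T2 + nat C * T3)) (+-mono-≤ (ℤₚ.∣i+j∣≤∣i∣+∣j∣ (N P1 P2 f g h) (nat A * T1)) (ℤₚ.∣i+j∣≤∣i∣+∣j∣ (nat B * T2) (nat C * T3)))))

  -- The decomposition carries q² in front of δ, so q^32 is cancelled from q^55, leaving q^23.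
  indicator-bound : ∀ t -> t ≡ 2 -> ∣ nat q * N P1 P2 α β γ - nat A * nat B * nat C ∣ ^ 16 N.≤ (t N.* t N.* K₀) ^ 16 N.* (A N.* B N.* C) ^ 8 N.* q ^ 23
  indicator-bound t t≡2 = *-cancelʳ-≤ (∣ δ ∣ ^ 16) _ (q ^ 32) {{m^n≢0 q 32}} (begin
   ∣ δ ∣ ^ 16 N.* q ^ 32 ≡⟨ solveM 2 (\ d q -> (d ⋆ 16) ⊕ (q ⋆ 32) ⊜ (q ⊕ (q ⊕ d)) ⋆ 16) refl ∣ δ ∣ q ⟩
   (q N.* (q N.* ∣ δ ∣)) ^ 16 ≤⟨ ^-monoˡ-≤ 16 split ⟩
   ((∣ N P1 P2 f g h ∣ N.+ ∣ nat A * T1 ∣) N.+ (∣ nat B * T2 ∣ N.+ ∣ nat C * T3 ∣)) ^ 16 ≤⟨ two-sum t t≡2 {∣ N P1 P2 f g h ∣ N.+ ∣ nat A * T1 ∣} {∣ nat B * T2 ∣ N.+ ∣ nat C * T3 ∣} (two-sum t t≡2 {∣ N P1 P2 f g h ∣} {∣ nat A * T1 ∣} b1 b2) (two-sum t t≡2 {∣ nat B * T2 ∣} {∣ nat C * T3 ∣} b3 b4) ⟩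
   t ^ 16 N.* (t ^ 16 N.* W) ≡⟨ solveM 4 (\ t k q m -> (t ⋆ 16) ⊕ ((t ⋆ 16) ⊕ ((k ⊕ (q ⋆ 55)) ⊕ (m ⋆ 8))) ⊜ ((((t ⊕ t) ⋆ 16) ⊕ k) ⊕ (m ⋆ 8)) ⊕ (q ⋆ 55)) refl t K₀ q M ⟩
   (t N.* t) ^ 16 N.* K₀ N.* M ^ 8 N.* q ^ 55 ≤⟨ *-monoˡ-≤ (q ^ 55) (*-monoˡ-≤ (M ^ 8) (*-monoʳ-≤ ((t N.* t) ^ 16) (m≤m*n K₀ (K₀ ^ 15) {{m^n≢0 K₀ 15}}))) ⟩
   (t N.* t) ^ 16 N.* K₀ ^ 16 N.* M ^ 8 N.* q ^ 55 ≡⟨ solveM 4 (\ t k m q -> (((t ⋆ 16) ⊕ (k ⋆ 16)) ⊕ (m ⋆ 8)) ⊕ (q ⋆ 55) ⊜ ((((t ⊕ k) ⋆ 16) ⊕ (m ⋆ 8)) ⊕ (q ⋆ 23)) ⊕ (q ⋆ 32)) refl (t N.* t) K₀ M q ⟩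
   (t N.* t N.* K₀) ^ 16 N.* M ^ 8 N.* q ^ 23 N.* q ^ 32 ∎)
   where open NP.≤-Reasoning

-- Reduction from integer polynomials and assembly.

module Final where
 open import Data.Nat using (_^_)
 open import Data.Integer using (+_; -[1+_]; 0ℤ; 1ℤ)
 open ≡ hiding (J)
 open IntRing
 open StepConst
 open Numbers
 open NumChain using (constant)
 open RingZ

 coefℤ : Polyℤ -> ℕ -> ℤ
 coefℤ [] k = 0ℤ
 coefℤ (a ∷ P) zero = a
 coefℤ (a ∷ P) (suc k) = coefℤ P k

 zero-or-coef : ∀ P -> IsZeroPoly P ⊎ ∃ \ k -> ¬ coefℤ P k ≡ 0ℤ
 zero-or-coef [] = inj₁ []
 zero-or-coef (a ∷ P) with a ℤ.≟ 0ℤ | zero-or-coef P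
 ... | no ne | _ = inj₂ (0 , ne)
 ... | yes _ | inj₂ (k , h) = inj₂ (suc k , h)
 ... | yes e | inj₁ z = inj₁ (e ∷ z)

 coefℤ-· : ∀ a P k -> coefℤ (a ·P P) k ≡ a ℤ.* coefℤ P k
 coefℤ-· a [] k = sym (ℤₚ.*-zeroʳ a)
 coefℤ-· a (b ∷ P) zero = refl
 coefℤ-· a (b ∷ P) (suc k) = coefℤ-· a P k

 coefℤ-+ : ∀ P R k -> coefℤ (P +P R) k ≡ coefℤ P k ℤ.+ coefℤ R k
 coefℤ-+ [] R k = sym (ℤₚ.+-identityˡ _)
 coefℤ-+ (a ∷ P) [] k = sym (ℤₚ.+-identityʳ _)
 coefℤ-+ (a ∷ P) (b ∷ R) zero = refl
 coefℤ-+ (a ∷ P) (b ∷ R) (suc k) = coefℤ-+ P R k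

 coefℤ-zero : ∀ {P} -> IsZeroPoly P -> ∀ k -> coefℤ P k ≡ 0ℤ
 coefℤ-zero [] k = refl
 coefℤ-zero (e ∷ z) zero = e
 coefℤ-zero (e ∷ z) (suc k) = coefℤ-zero z k

 zero-coefℤ : ∀ P -> (∀ k -> coefℤ P k ≡ 0ℤ) -> IsZeroPoly P
 zero-coefℤ [] h = []
 zero-coefℤ (a ∷ P) h = h 0 ∷ zero-coefℤ P (\ k -> h (suc k))

 minor : Polyℤ -> Polyℤ -> ℕ -> ℕ -> ℤ
 minor P R i j = coefℤ P i ℤ.* coefℤ R j ℤ.- coefℤ P j ℤ.* coefℤ R i

 -- If P has a nonzero coefficient p_i and all minors involving the index i vanish, then r_i P - p_i
 -- R = 0 is a dependence whose second coefficient is nonzero. One integer minor thus records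
 -- independence in a form that survives reduction.
 minor-exists : ∀ P R -> LinIndep P R -> ∃₂ \ i j -> ¬ minor P R i j ≡ 0ℤ
 minor-exists P R indep with zero-or-coef P
 ... | inj₁ z = ⊥-elim (1≢0 (proj₁ (indep 1ℤ 0ℤ (zero-coefℤ _ (\ k -> trans (coefℤ-+ (1ℤ ·P P) (0ℤ ·P R) k) (cong₂ ℤ._+_ (trans (coefℤ-· 1ℤ P k) (trans (cong (1ℤ ℤ.*_) (coefℤ-zero z k)) (ℤₚ.*-zeroʳ 1ℤ))) (coefℤ-· 0ℤ R k)))))))
  where
  1≢0 : ¬ 1ℤ ≡ 0ℤ
  1≢0 ()
 ... | inj₂ (i , ne) with zero-or-coef ((coefℤ R i ·P P) +P ((ℤ.- coefℤ P i) ·P R))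
 ... | inj₁ z = ⊥-elim (ne (trans (sym (ℤₚ.neg-involutive (coefℤ P i))) (cong ℤ.-_ (proj₂ (indep (coefℤ R i) (ℤ.- coefℤ P i) z)))))
 ... | inj₂ (j , h) = j , i , \ e -> h (trans (coefℤ-+ (coefℤ R i ·P P) ((ℤ.- coefℤ P i) ·P R) j) (trans (cong₂ ℤ._+_ (trans (coefℤ-· (coefℤ R i) P j) (ℤₚ.*-comm (coefℤ R i) (coefℤ P j))) (trans (coefℤ-· (ℤ.- coefℤ P i) R j) (sym (ℤₚ.neg-distribˡ-* (coefℤ P i) (coefℤ R j))))) e))

 constant-term : ∀ P -> evalℤ P 0ℤ ≡ 0ℤ -> coefℤ P 0 ≡ 0ℤ
 constant-term [] e = refl
 constant-term (a ∷ P) e = trans (sym (trans (cong (\ t -> a ℤ.+ t) (ℤₚ.*-zeroˡ (evalℤ P 0ℤ))) (ℤₚ.+-identityʳ a))) e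

 ∣⊖∣ : ∀ m n -> ℤ.∣ m ℤ.⊖ n ∣ ≡ N.∣ m - n ∣
 ∣⊖∣ zero zero = refl
 ∣⊖∣ zero (suc n) = refl
 ∣⊖∣ (suc m) zero = refl
 ∣⊖∣ (suc m) (suc n) = trans (cong ℤ.∣_∣ (ℤₚ.[1+m]⊖[1+n]≡m⊖n m n)) (∣⊖∣ m n)

 module Field (𝔽 : FiniteField) (p : ℕ) (isChar : FiniteField.IsCharacteristic 𝔽 p) where
  open Fld 𝔽
  open Poly 𝔽
  open PolyFacts 𝔽

  natF≢0 : ∀ k -> suc k N.< p -> ¬ natF (suc k) ≡ 0#
  natF≢0 k h = proj₂ (proj₂ isChar) (suc k) (s≤s z≤n) h

  -- The multiples 0, 1, ..., p - 1 of the unit are distinct in F, so a large characteristic makes q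
  -- large as well.
  p≤q : p N.≤ q
  p≤q = Finₚ.injective⇒≤ {f = \ (i : Fin p) -> index (natF (toℕ i))} inj
   where
   pred< : ∀ p -> 0 N.< p -> N.pred p N.< p
   pred< (suc p) _ = n<1+n p
   open Char (N.pred p) (\ k h -> natF≢0 k (≤-<-trans h (pred< p (proj₁ isChar)))) using (natF-differ)
   inj : ∀ {i j} -> index (natF (toℕ i)) ≡ index (natF (toℕ j)) -> i ≡ j
   inj {i} {j} e with toℕ i N.≟ toℕ j
   ... | yes eq = Finₚ.toℕ-injective eq
   ... | no ne = ⊥-elim (natF-differ (toℕ i) (toℕ j) (<⇒≤pred (Finₚ.toℕ<n i)) (<⇒≤pred (Finₚ.toℕ<n j)) ne
     (≡-sub (trans (sym (element-index _)) (trans (cong element e) (element-index _)))))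

  intF≢0 : ∀ m -> ¬ m ≡ 0ℤ -> ℤ.∣ m ∣ N.< p -> ¬ intF m ≡ 0#
  intF≢0 (+ zero) ne _ = ⊥-elim (ne refl)
  intF≢0 (+ suc n) _ h = natF≢0 n h
  intF≢0 -[1+ n ] _ h = neg-≢0 (natF≢0 n h)

  coef-intF : ∀ P k -> coef (map intF P) k ≡ intF (coefℤ P k)
  coef-intF [] k = refl
  coef-intF (a ∷ P) zero = refl
  coef-intF (a ∷ P) (suc k) = coef-intF P k

  minor-intF : ∀ P R i j -> coef (map intF P) i * coef (map intF R) j - coef (map intF P) j * coef (map intF R) i ≡ intF (minor P R i j)
  minor-intF P R i j = trans (cong₂ _-_ (cong₂ _*_ (c P i) (c R j)) (cong₂ _*_ (c P j) (c R i))) (sym (trans (intF≡intR (minor P R i j)) (trans (intR-+ (coefℤ P i ℤ.* coefℤ R j) (ℤ.- (coefℤ P j ℤ.* coefℤ R i)))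
    (cong₂ _+_ (intR-* (coefℤ P i) (coefℤ R j)) (trans (intR-neg (coefℤ P j ℤ.* coefℤ R i)) (cong -_ (intR-* (coefℤ P j) (coefℤ R i))))))))
   where
   c : ∀ P k -> coef (map intF P) k ≡ intR (coefℤ P k)
   c P k = trans (coef-intF P k) (intF≡intR (coefℤ P k))

 module Bound (𝔽 : FiniteField) (E : ℕ) (p1 p2 : List (FiniteField.F 𝔽)) (len1 : length p1 N.≤ E) (len2 : length p2 N.≤ E)
  (z₁ : PolyEval.coef 𝔽 p1 0 ≡ FiniteField.0# 𝔽) (z2 : PolyEval.coef 𝔽 p2 0 ≡ FiniteField.0# 𝔽) (i j : ℕ) (minor≢0 : ¬ PolyFacts.minorF 𝔽 p1 p2 i j ≡ FiniteField.0# 𝔽)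
  (char : ∀ k -> suc k N.≤ E -> ¬ FiniteField.natF 𝔽 (suc k) ≡ FiniteField.0# 𝔽) (large : maxRadius E N.* maxRadius E N.≤ FiniteField.q 𝔽) where
  open Fld 𝔽
  open Poly 𝔽
  open PolyFacts 𝔽
  open Fibre 𝔽 using (Exact)
  open Char E char using (deriv-nonzero)
  open Independent p1 p2 z₁ z2 i j minor≢0
  private
   module A = Analysis 𝔽 integers
   module A2 = Analysis2 𝔽 integers
   module S = FSum 𝔽 integers

   1≢0 : ¬ 1# ≡ 0#
   1≢0 e = 0≢1 (sym e)

   nonconst-ext : ∀ p r -> (∀ k -> coef r k ≡ coef p k) -> NonConst p -> NonConst r
   nonconst-ext p r e (k , ne) = k , \ h -> ne (trans (sym (e (suc k))) h)

   nc1 : NonConst p1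
   nc1 = nonconst-ext (comb 1# 0# p1 p2) p1 (\ k -> sym (trans (coef-comb 1# 0# p1 p2 k) (trans (cong₂ _+_ (*-identityˡ _) (zeroˡ _)) (+-identityʳ _)))) (comb-nonconst 1# 0# (inj₁ 1≢0))

   nc2 : NonConst p2
   nc2 = nonconst-ext (comb 0# 1# p1 p2) p2 (\ k -> sym (trans (coef-comb 0# 1# p1 p2 k) (trans (cong₂ _+_ (zeroˡ _) (*-identityˡ _)) (+-identityˡ _)))) (comb-nonconst 0# 1# (inj₂ 1≢0))

   qp : Pol
   qp = comb (- 1#) 1# p1 p2

   X1 : ∃ \ g -> Exact E g × (∀ k -> coef g k ≡ coef p1 k)
   X1 = exact p1 nc1 len1
   X2 : ∃ \ g -> Exact E g × (∀ k -> coef g k ≡ coef p2 k)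
   X2 = exact p2 nc2 len2
   XQ : ∃ \ g -> Exact E g × (∀ k -> coef g k ≡ coef qp k)
   XQ = exact qp (comb-nonconst (- 1#) 1# (inj₂ 1≢0)) (length-comb (- 1#) 1# p1 p2 len1 len2)

   e1 e2 eQ : Pol
   e1 = proj₁ X1
   e2 = proj₁ X2
   eQ = proj₁ XQ

   neg-one : ∀ x -> - 1# * x ≡ - x
   neg-one x = trans (solve 2 (\ o x -> (:- o) :* x := :- (o :* x)) refl 1# x) (cong -_ (*-identityˡ x))

   Q≡ : ∀ y -> ev eQ y ≡ ev e2 y - ev e1 y
   Q≡ y = trans (ev-ext eQ qp y (proj₂ (proj₂ XQ))) (trans (ev-comb (- 1#) 1# p1 p2 y) (trans (cong₂ _+_ (neg-one _) (*-identityˡ _)) (trans (+-comm _ _)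
    (cong₂ _-_ (sym (ev-ext e2 p2 y (proj₂ (proj₂ X2)))) (sym (ev-ext e1 p1 y (proj₂ (proj₂ X1))))))))

   deriv-comb : ∀ a b k -> coef (comb a b p1 p2) (suc k) ≡ 0# ⊎ suc k N.≤ E
   deriv-comb a b k with suc k N.≤? E
   ... | yes h = inj₂ h
   ... | no ¬h = inj₁ (coef-≥length (comb a b p1 p2) (suc k) (≤∙ (length-comb a b p1 p2 len1 len2) (<⇒≤ (≰⇒> ¬h))))

   deriv-indep : ∀ a b a' b' g h -> (∀ k -> a * coef g k + b * coef h k ≡ a' * coef p1 k + b' * coef p2 k) -> ¬ a' ≡ 0# ⊎ ¬ b' ≡ 0# -> NonzeroPol (comb a b (deriv g) (deriv h))
   deriv-indep a b a' b' g h e ne with comb-nonconst a' b' ne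
   ... | k , nk with deriv-comb a' b' k
   ... | inj₁ z = ⊥-elim (nk z)
   ... | inj₂ le = k , \ z -> *-≢0 (char k le) nk (trans (cong (natF (suc k) *_) (trans (coef-comb a' b' p1 p2 (suc k)) (sym (e (suc k)))))
     (trans (solve 5 (\ n a b x y -> n :* (a :* x :+ b :* y) := a :* (n :* x) :+ b :* (n :* y)) refl (natF (suc k)) a b (coef g (suc k)) (coef h (suc k)))
      (trans (cong₂ (\ s t -> a * s + b * t) (sym (coef-deriv g k)) (sym (coef-deriv h k))) (trans (sym (coef-comb a b (deriv g) (deriv h) k)) z))))

   indep12 : ∀ a b -> ¬ b ≡ 0# -> NonzeroPol (comb a b (deriv e1) (deriv e2))
   indep12 a b ne = deriv-indep a b a b e1 e2 (\ k -> cong₂ (\ s t -> a * s + b * t) (proj₂ (proj₂ X1) k) (proj₂ (proj₂ X2) k)) (inj₂ ne)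

   indepQ2 : ∀ a -> NonzeroPol (comb 1# a (deriv eQ) (deriv e2))
   indepQ2 a = deriv-indep 1# a (- 1#) (1# + a) eQ e2 (\ k -> trans (cong₂ (\ s t -> 1# * s + a * t) (trans (proj₂ (proj₂ XQ) k) (coef-comb (- 1#) 1# p1 p2 k)) (proj₂ (proj₂ X2) k))
     (trans (cong (_+ a * coef p2 k) (*-identityˡ _)) (solve 4 (\ o a x y -> ((:- o) :* x :+ o :* y) :+ a :* y := (:- o) :* x :+ (o :+ a) :* y) refl 1# a (coef p1 k) (coef p2 k)))) (inj₁ (neg-≢0 1≢0))

   root : ∃ \ r -> r N.* r N.≤ q × q N.< suc r N.* suc r
   root = isqrt q
   r : ℕ
   r = proj₁ root

   R≤r : maxRadius E N.≤ r
   R≤r = ≮⇒≥ (\ h -> <⇒≱ (proj₂ (proj₂ root)) (≤∙ (*-mono-≤ h h) large))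

   instance
    r≢0 : N.NonZero r
    r≢0 = N.>-nonZero (≤∙ (m≤n+m 1 (0 N.* slack 0 (weight 0) N.+ 0 N.* (2 N.* 1 N.+ 1) N.+ 4 N.* 0)) (≤∙ (sumUpTo-≥ (\ s -> radius s (weight s)) {0} {E} z≤n) R≤r))
    q≢0 : N.NonZero q
    q≢0 = N.>-nonZero (≤∙ (N.>-nonZero⁻¹ r) (≤∙ (m≤m*n r r) (proj₁ (proj₂ root))))

   Λ : ℕ
   Λ = LinPoly.Λ-bound 𝔽 integers E (maxExcess E) r

   lin : ∀ f -> length f N.≤ E -> NonConst f -> A2.LinBound (ev f) (S.nat Λ)
   lin f len = LinPoly.polynomial-linBound 𝔽 integers E (maxExcess E) r (proj₁ (proj₂ root)) char (\ s -> sumUpTo-≥ excess) (\ s h -> ≤∙ (sumUpTo-≥ (\ s -> radius s (weight s)) h) R≤r) f (m≤n⇒m≤1+n len)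

   lin-comb : ∀ a b g -> ¬ a ≡ 0# ⊎ ¬ b ≡ 0# -> (∀ y -> a * ev e1 y + b * ev e2 y ≡ g y) -> A2.LinBound g (S.nat Λ)
   lin-comb a b g ne e = LinPoly.LinBound-cong 𝔽 integers {Λ = S.nat Λ} (\ y -> trans (ev-comb a b p1 p2 y) (trans (cong₂ (\ s t -> a * s + b * t) (sym (ev-ext e1 p1 y (proj₂ (proj₂ X1)))) (sym (ev-ext e2 p2 y (proj₂ (proj₂ X2))))) (e y)))
    (lin (comb a b p1 p2) (length-comb a b p1 p2 len1 len2) (comb-nonconst a b ne))

   lin1 : ∀ b -> A2.LinBound (\ y -> ev e1 y + b * ev e2 y) (S.nat Λ)
   lin1 b = lin-comb 1# b _ (inj₁ 1≢0) (\ y -> cong (_+ b * ev e2 y) (*-identityˡ _))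

   -- The rotated pair consists of P₂ - P₁ and -P₁, and its combinations are -(1 + b) P₁ + P₂; the
   -- coefficient 1 of P₂ keeps them nonconstant.
   lin2 : ∀ b -> A2.LinBound (\ y -> (ev e2 y - ev e1 y) + b * (- ev e1 y)) (S.nat Λ)
   lin2 b = lin-comb (- (1# + b)) 1# _ (inj₂ 1≢0) (\ y -> trans (solve 4 (\ o b x z -> (:- (o :+ b)) :* x :+ o :* z := (o :* z :- o :* x) :+ b :* (:- x)) refl 1# b (ev e1 y) (ev e2 y)) (cong₂ (\ s t -> (s - t) + b * (- ev e1 y)) (*-identityˡ _) (*-identityˡ _)))

   D' : ℕ
   D' = bigD E

   Λ² : Λ N.* Λ N.≤ D' N.* q ^ 3
   Λ² = ≤∙ (Λ²-bound E q r (proj₁ (proj₂ root)) (proj₂ (proj₂ root))) (*-monoˡ-≤ (q ^ 3) (bigD-≥1 E))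

   module Pr = Counts.Pairs 𝔽 integers E e1 e2 (proj₁ (proj₂ X1)) (Exact.short (proj₁ (proj₂ X2))) char indep12
   module Cy = Quads.Cycles 𝔽 integers E e1 e2 eQ (proj₁ (proj₂ X1)) (proj₁ (proj₂ X2)) (proj₁ (proj₂ XQ)) Q≡ char indepQ2

   core : ∀ f g h -> S.S f ≡ 0ℤ -> S.S g ≡ 0ℤ -> S.S h ≡ 0ℤ -> ℤ.∣ A.N (ev e1) (ev e2) f g h ∣ ^ 16 N.≤ constant D' ^ 2 N.* q ^ 7 N.* (ℤ.∣ A.n f ∣ N.* ℤ.∣ A.n g ∣ N.* ℤ.∣ A.n h ∣) ^ 8
   core = Core.mean-zero-bound 𝔽 (ev e1) (ev e2) Λ E (cap E N.* E) (3 N.* E) (quadConst E) D' lin1 lin2 (Counts.fibre-S 𝔽 integers e2 (proj₁ (proj₂ X2)))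
    Pr.bad? Pr.good Pr.few Cy.quadruples-≤ (bigD-≥2 E) (bigD-≥3 E) (bigD-≥4 E) Λ²

  field-bound : ∀ t -> t ≡ 2 -> (P1 P2 : F -> F) -> (∀ y -> P1 y ≡ ev p1 y) -> (∀ y -> P2 y ≡ ev p2 y) -> (α β γ : F -> ℤ) ->
   (∀ x -> α x ℤ.* α x ≡ α x) -> (∀ x -> β x ℤ.* β x ≡ β x) -> (∀ x -> γ x ℤ.* γ x ≡ γ x) ->
   ∀ A B C -> S.S α ≡ S.nat A -> S.S β ≡ S.nat B -> S.S γ ≡ S.nat C -> A N.≤ q -> B N.≤ q -> C N.≤ q ->
   ℤ.∣ S.nat q ℤ.* A.N P1 P2 α β γ ℤ.- S.nat A ℤ.* S.nat B ℤ.* S.nat C ∣ ^ 16 N.≤ (t N.* t N.* constant (bigD E) ^ 2) ^ 16 N.* (A N.* B N.* C) ^ 8 N.* q ^ 23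
  field-bound t t≡2 P1 P2 eq1 eq2 α β γ α² β² γ² A B C SA SB SC A≤ B≤ C≤ =
   subst (\ m -> ℤ.∣ S.nat q ℤ.* m ℤ.- S.nat A ℤ.* S.nat B ℤ.* S.nat C ∣ ^ 16 N.≤ (t N.* t N.* constant (bigD E) ^ 2) ^ 16 N.* (A N.* B N.* C) ^ 8 N.* q ^ 23) same
    (Sets.indicator-bound 𝔽 (ev e1) (ev e2) Λ D' (constant D' ^ 2) {{q≢0}} {{m^n≢0 (constant D') 2 {{constant-nonzero D'}}}}
     (lin-comb 1# 0# _ (inj₁ 1≢0) (\ y -> trans (cong₂ _+_ (*-identityˡ _) (zeroˡ _)) (+-identityʳ _)))
     (lin-comb 0# 1# _ (inj₂ 1≢0) (\ y -> trans (cong₂ _+_ (zeroˡ _) (*-identityˡ _)) (+-identityˡ _)))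
     (lin-comb (- 1#) 1# _ (inj₂ 1≢0) (\ y -> trans (cong₂ _+_ (neg-one _) (*-identityˡ _)) (+-comm _ _)))
     Λ² (D⁴≤ D') core α β γ α² β² γ² A B C SA SB SC A≤ B≤ C≤ t t≡2)
   where
   same : A.N (ev e1) (ev e2) α β γ ≡ A.N P1 P2 α β γ
   same = S.Σ-cong els (\ x -> S.Σ-cong els (\ y -> cong₂ (\ s t -> α x ℤ.* β (x + s) ℤ.* γ (x + t)) (trans (ev-ext e1 p1 y (proj₂ (proj₂ X1))) (sym (eq1 y))) (trans (ev-ext e2 p2 y (proj₂ (proj₂ X2))) (sym (eq2 y)))))

 abstract
  -- Opaque, like `two`, so that 16th powers of concrete numerals are never evaluated.
  finalK : ℕ -> ℕ
  finalK E = 2 N.* 2 N.* constant (bigD E) ^ 2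

  finalK>0 : ∀ E -> 0 N.< finalK E
  finalK>0 E = ≤∙ (N.>-nonZero⁻¹ (constant (bigD E) ^ 2) {{m^n≢0 (constant (bigD E)) 2 {{constant-nonzero (bigD E)}}}}) (m≤n*m (constant (bigD E) ^ 2) 4)

  two : ℕ
  two = 2

  two≡2 : two ≡ 2
  two≡2 = refl

  finalK≡ : ∀ E -> two N.* two N.* constant (bigD E) ^ 2 ≡ finalK E
  finalK≡ E = refl

 module Main (P1 P2 : Polyℤ) (P10 : coefℤ P1 0 ≡ 0ℤ) (P20 : coefℤ P2 0 ≡ 0ℤ) (i j : ℕ) (m≢0 : ¬ minor P1 P2 i j ≡ 0ℤ)
  (E : ℕ) (len1 : length P1 N.≤ E) (len2 : length P2 N.≤ E)
  (𝔽 : FiniteField) (p : ℕ) (isChar : FiniteField.IsCharacteristic 𝔽 p) (E< : E N.< p) (m< : ℤ.∣ minor P1 P2 i j ∣ N.< p) (R< : maxRadius E N.* maxRadius E N.< p)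
  (A B C : FiniteField.Subset 𝔽) where

  private
   open Fld 𝔽 using (F; q; els; evalF; intF; natF; _+_)
   open Poly 𝔽 using (ev; coef; evalF≡ev)
   open Field 𝔽 p isChar
   open Link 𝔽
   module S = FSum 𝔽 integers
   module An = Analysis 𝔽 integers

   α β γ : F -> ℤ
   α = char-fun A
   β = char-fun B
   γ = char-fun C

   a b e pc : ℕ
   a = FiniteField.∣_∣ₛ 𝔽 A
   b = FiniteField.∣_∣ₛ 𝔽 B
   e = FiniteField.∣_∣ₛ 𝔽 C
   pc = FiniteField.patternCount 𝔽 P1 P2 A B C

   card : ∀ X -> S.S (char-fun X) ≡ S.nat (FiniteField.∣_∣ₛ 𝔽 X)
   card X = sym (sumF-S (\ x -> FiniteField.ind 𝔽 (X x)))

   char-≤1 : ∀ X x -> char-fun X x ℤ.≤ 1ℤ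
   char-≤1 X x with X x
   ... | true = ℤₚ.≤-refl
   ... | false = ℤ.+≤+ z≤n

   card-≤ : ∀ X -> FiniteField.∣_∣ₛ 𝔽 X N.≤ q
   card-≤ X = subst (N._≤ q) (∣nat∣ (FiniteField.∣_∣ₛ 𝔽 X)) (∣∣-≤ (S.nat-nonneg (FiniteField.∣_∣ₛ 𝔽 X)) (subst (ℤ._≤ S.nat q) (card X)
    (ℤₚ.≤-trans (S.Σ-mono els (char-≤1 X)) (ℤₚ.≤-reflexive (trans (S.S-const 1ℤ) (ℤₚ.*-identityʳ (S.nat q)))))))

   pattern-N : S.nat pc ≡ An.N (evalF P1) (evalF P2) α β γ
   pattern-N = trans (sumF-S (\ x -> FiniteField.sumF 𝔽 (hits x))) (S.Σ-cong els (\ x -> trans (sumF-S (hits x)) (S.Σ-cong els (\ y -> ind-∧∧ (A x) (B (x + evalF P1 y)) (C (x + evalF P2 y))))))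
    where
    hits : F -> F -> ℕ
    hits x y = FiniteField.ind 𝔽 (A x ∧ B (x + evalF P1 y) ∧ C (x + evalF P2 y))

   difference : ℤ.∣ S.nat q ℤ.* An.N (evalF P1) (evalF P2) α β γ ℤ.- S.nat a ℤ.* S.nat b ℤ.* S.nat e ∣ ≡ N.∣ q N.* pc - a N.* b N.* e ∣
   difference = trans (cong ℤ.∣_∣ (trans (cong₂ ℤ._-_ (trans (cong (S.nat q ℤ.*_) (trans (sym pattern-N) (nat≡+ pc))) (trans (cong (ℤ._* + pc) (nat≡+ q)) (sym (ℤₚ.pos-* q pc))))
     (trans (cong₂ ℤ._*_ (trans (cong₂ ℤ._*_ (nat≡+ a) (nat≡+ b)) (sym (ℤₚ.pos-* a b))) (nat≡+ e)) (sym (ℤₚ.pos-* (a N.* b) e)))) (ℤₚ.m-n≡m⊖n (q N.* pc) (a N.* b N.* e)))) (∣⊖∣ (q N.* pc) (a N.* b N.* e))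

  set-bound : ∀ t -> t ≡ 2 -> N.∣ q N.* pc - a N.* b N.* e ∣ ^ 16 N.≤ (t N.* t N.* constant (bigD E) ^ 2) ^ 16 N.* (a N.* b N.* e) ^ 8 N.* q ^ 23
  set-bound t t≡2 = subst (\ d -> d ^ 16 N.≤ (t N.* t N.* constant (bigD E) ^ 2) ^ 16 N.* (a N.* b N.* e) ^ 8 N.* q ^ 23) difference
    (Bound.field-bound 𝔽 E (map intF P1) (map intF P2) (≤∙ (≡⇒≤ (Listₚ.length-map intF P1)) len1) (≤∙ (≡⇒≤ (Listₚ.length-map intF P2)) len2)
     (trans (coef-intF P1 0) (cong intF P10)) (trans (coef-intF P2 0) (cong intF P20)) i j
     (\ h -> intF≢0 (minor P1 P2 i j) m≢0 m< (trans (sym (minor-intF P1 P2 i j)) h))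
     (\ k h -> natF≢0 k (≤-<-trans h E<)) (≤∙ (<⇒≤ R<) p≤q) t t≡2 (evalF P1) (evalF P2) (evalF≡ev P1) (evalF≡ev P2) α β γ
     (char-fun² A) (char-fun² B) (char-fun² C) a b e (card A) (card B) (card C) (card-≤ A) (card-≤ B) (card-≤ C))

open Numbers using (maxRadius)
open Final
open import Data.Nat using (_<_; _≤_; _*_; _^_; ∣_-_∣)
open import Data.Integer using (0ℤ)

theorem1p2 :
  (P₁ P₂ : Polyℤ) → LinIndep P₁ P₂ → evalℤ P₁ 0ℤ ≡ 0ℤ → evalℤ P₂ 0ℤ ≡ 0ℤ →
    ∃₂ λ (c K : ℕ) → (0 < c) × (0 < K) ×
      ((𝔽 : FiniteField) (p : ℕ) → FiniteField.IsCharacteristic 𝔽 p → c ≤ p →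
        (A B C : FiniteField.Subset 𝔽) →
          ∣ FiniteField.q 𝔽 * FiniteField.patternCount 𝔽 P₁ P₂ A B C
              - FiniteField.∣_∣ₛ 𝔽 A * FiniteField.∣_∣ₛ 𝔽 B * FiniteField.∣_∣ₛ 𝔽 C ∣ ^ 16
            ≤ K ^ 16
              * (FiniteField.∣_∣ₛ 𝔽 A * FiniteField.∣_∣ₛ 𝔽 B * FiniteField.∣_∣ₛ 𝔽 C) ^ 8
              * FiniteField.q 𝔽 ^ 23)
theorem1p2 P1 P2 indep P10 P20 with minor-exists P1 P2 indep
... | i , j , m≢0 = suc (E N.+ m N.+ R) , finalK E , s≤s z≤n , finalK>0 E , λ 𝔽 p isChar c≤p A B C →
    ≡.subst (λ K → ∣ FiniteField.q 𝔽 * FiniteField.patternCount 𝔽 P1 P2 A B C - FiniteField.∣_∣ₛ 𝔽 A * FiniteField.∣_∣ₛ 𝔽 B * FiniteField.∣_∣ₛ 𝔽 C ∣ ^ 16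
        ≤ K ^ 16 * (FiniteField.∣_∣ₛ 𝔽 A * FiniteField.∣_∣ₛ 𝔽 B * FiniteField.∣_∣ₛ 𝔽 C) ^ 8 * FiniteField.q 𝔽 ^ 23) (finalK≡ E)
      (Main.set-bound P1 P2 (constant-term P1 P10) (constant-term P2 P20) i j m≢0 E (NP.m≤m+n _ _) (NP.m≤n+m _ (length P1)) 𝔽 p isChar
        (≤∙ (s≤s (≤∙ (NP.m≤m+n E m) (NP.m≤m+n (E N.+ m) R))) c≤p) (≤∙ (s≤s (≤∙ (NP.m≤n+m m E) (NP.m≤m+n (E N.+ m) R))) c≤p) (≤∙ (s≤s (NP.m≤n+m R (E N.+ m))) c≤p)
        A B C two two≡2)
  where
  -- A characteristic above `E` keeps derivatives and Wronskians nonzero, one above `m` keeps the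
  -- chosen minor nonzero modulo p, and q ≥ p > `R` makes √q at least the radius required by the
  -- point count.
  E m R : ℕ
  E = length P1 N.+ length P2
  m = ℤ.∣ minor P1 P2 i j ∣
  R = maxRadius E * maxRadius E
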